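{- There exists an absolute constant $n_0$ such that for all integers $n \ge n_0$ and $2 \le t \le n-2$ the following holds. If $\mathcal{F}\subset \mathcal{T}_n$ is $t$-intersecting, then $|\mathcal{F}| \le c_{n, t}\, n^{n-2-t}$. Moreover, equality holds if and only if $\mathcal{F}$ is the family of all spanning trees of $K_n$ containing a fixed forest $F$ with $t$ edges whose connected components have almost equal sizes (i.e., $F$ has $n-t$ connected components, counting isolated vertices, and any two component sizes differ by at most $1$).
   Context: $\mathcal{T}_n$ denotes the set of all labelled spanning trees of the complete graph $K_n$ on vertex set $[n]$; each tree is regarded as its set of $n-1$ edges. A family $\mathcal{F}\subset\mathcal{T}_n$ is $t$-intersecting if any two (not necessarily distinct) trees $A,B\in\mathcal{F}$ share at least $t$ edges. $c_{n,t}$ denotes the largest possible product of $n-t$ positive integers whose sum is $n$. -}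

module Defs where

open import Data.Nat using (ℕ; zero; suc; _+_; _*_; _∸_; _^_; _≤_; _<_)
open import Data.Fin as Fin using (Fin)
open import Data.Fin.Properties as FinP using ()
open import Data.Product using (Σ; ∃; ∃-syntax; _×_; _,_; proj₁; proj₂)
open import Data.Product.Properties using (≡-dec)
open import Data.Sum using (_⊎_)
open import Data.List using (List; []; _∷_; _++_; length; filter)
open import Data.Nat.ListAction using (sum; product)
open import Data.List.Relation.Unary.All using (All)
open import Data.List.Relation.Unary.Any using (Any)
open import Data.List.Relation.Unary.Unique.Propositional using (Unique)
open import Data.List.Relation.Unary.AllPairs using (AllPairs)
open import Relation.Binary.PropositionalEquality using (_≡_)
open import Relation.Binary.Definitions using (DecidableEquality)
open import Relation.Nullary using (¬_; Dec)
import Data.List.Membership.DecPropositional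
open import Function.Bundles using (_⇔_)

-- Vertices of K_n are Fin n.  An edge {i,j} is represented by the ordered
-- pair (i , j) with i < j (this ordering is imposed in `Graph`).
Edge : ℕ → Set
Edge n = Fin n × Fin n

_≟E_ : ∀ {n} → DecidableEquality (Edge n)
_≟E_ = ≡-dec FinP._≟_ FinP._≟_

module EdgeMembership (n : ℕ) = Data.List.Membership.DecPropositional (_≟E_ {n})

_∈_ : ∀ {n} → Edge n → List (Edge n) → Set
_∈_ {n} = EdgeMembership._∈_ n

_∈?_ : ∀ {n} (e : Edge n) (E : List (Edge n)) → Dec (e ∈ E)
_∈?_ {n} = EdgeMembership._∈?_ n

Graph : ∀ {n} → List (Edge n) → Set
Graph E = All (λ e → proj₁ e Fin.< proj₂ e) E × Unique E

data Reach {n} (E : List (Edge n)) (u : Fin n) : Fin n → Set where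
  here : Reach E u u
  step : ∀ {v w} → Reach E u v → ((v , w) ∈ E ⊎ (w , v) ∈ E) → Reach E u w

Connected : ∀ {n} → List (Edge n) → Set
Connected {n} E = (u v : Fin n) → Reach E u v

-- Acyclic: every edge is a bridge, i.e. removing it disconnects its endpoints.
Acyclic : ∀ {n} → List (Edge n) → Set
Acyclic {n} E = ∀ (xs ys : List (Edge n)) (e : Edge n) → E ≡ xs ++ (e ∷ ys) →
  ¬ Reach (xs ++ ys) (proj₁ e) (proj₂ e)

Forest : ∀ {n} → List (Edge n) → Set
Forest E = Graph E × Acyclic E

SpanningTree : ∀ {n} → List (Edge n) → Set
SpanningTree E = Forest E × Connected E

SameEdges : ∀ {n} → List (Edge n) → List (Edge n) → Set
SameEdges {n} A B = (e : Edge n) → (e ∈ A) ⇔ (e ∈ B)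

_⊆E_ : ∀ {n} → List (Edge n) → List (Edge n) → Set
A ⊆E B = All (λ e → e ∈ B) A

-- Number of common edges |A ∩ B| (A has no repeated edges).
common : ∀ {n} → List (Edge n) → List (Edge n) → ℕ
common A B = length (filter (λ e → e ∈? B) A)

-- A family 𝓕 ⊂ 𝓣_n, as a list of spanning trees, pairwise distinct as edge sets;
-- its cardinality is the length of the list.
TreeFamily : ∀ {n} → List (List (Edge n)) → Set
TreeFamily F = All SpanningTree F × AllPairs (λ A B → ¬ SameEdges A B) F

TIntersecting : ∀ {n} → ℕ → List (List (Edge n)) → Set
TIntersecting {n} t F = ∀ A B → Any (_≡_ A) F → Any (_≡_ B) F → t ≤ common A B

CompSize : ∀ {n} → List (Edge n) → Fin n → ℕ → Set
CompSize {n} E v s = Σ (List (Fin n)) λ ws →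
  Unique ws × length ws ≡ s × ((w : Fin n) → Any (_≡_ w) ws ⇔ Reach E v w)

AlmostEqualComponents : ∀ {n} → List (Edge n) → Set
AlmostEqualComponents {n} E = ∃[ k ] ((v : Fin n) (s : ℕ) → CompSize E v s → s ≡ k ⊎ s ≡ suc k)

-- c is the largest product of k positive integers whose sum is m  (c = c_{m, m-k} when k = m - t).
IsMaxProduct : ℕ → ℕ → ℕ → Set
IsMaxProduct m k c =
  (∃[ xs ] (length xs ≡ k × All (0 <_) xs × sum xs ≡ m × product xs ≡ c))
  × ((xs : List ℕ) → length xs ≡ k → All (0 <_) xs → sum xs ≡ m → product xs ≤ c)

{-# OPTIONS --safe #-}
module Submission where

open import Defs hiding (_∈_; _∈?_; here; step)
open import Data.Nat
open import Data.Nat.Properties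
open import Data.Nat.ListAction using (sum; product)
open import Data.Nat.Tactic.RingSolver using (solve-∀)
open import Data.Bool using (Bool; true; false; _∧_; _∨_; not; T)
open import Data.Fin as Fin using (Fin; zero; suc)
import Data.Fin.Properties as Finₚ
open import Data.Fin.Subset as Sub using (Subset; _∩_; _∪_; ∁; ∣_∣; ⁅_⁆)
import Data.Fin.Subset.Properties as Subₚ
open import Data.Vec as Vec using (Vec; []; _∷_)
open import Data.List as List using (List; []; _∷_; _++_; length)
import Data.List.Properties as Listₚ
open import Data.List.Membership.Propositional using (_∈_; lose; find)
open import Data.List.Membership.Propositional.Properties as Listₘ using (∈-++⁺ˡ; ∈-++⁺ʳ; ∈-map⁺; ∈-map⁻; ∈-++⁻; ∈-filter⁺; ∈-filter⁻)
open import Data.List.Relation.Unary.Any using (Any; here; there)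
import Data.List.Relation.Unary.All as All
import Data.List.Relation.Unary.AllPairs as AllPairs
import Data.List.Relation.Unary.AllPairs.Properties as AllPairsₚ
open import Data.List.Relation.Unary.Unique.Propositional using (Unique)
import Data.List.Relation.Unary.Unique.Propositional.Properties as Uniqueₚ
import Data.List.Relation.Unary.Unique.DecPropositional.Properties as UniqueDec
open import Data.Product using (_×_; _,_; proj₁; proj₂; ∃-syntax)
open import Data.Sum using (_⊎_; inj₁; inj₂; [_,_]′)
open import Data.Unit using (⊤; tt)
open import Data.Empty using (⊥; ⊥-elim)
open import Relation.Nullary using (¬_; Dec; yes; no)
open import Relation.Nullary.Decidable using (_×-dec_; _→-dec_; ¬?; decidable-stable)
open import Relation.Binary.PropositionalEquality
open import Relation.Binary.Definitions using (tri<; tri≈; tri>)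
open import Function using (_∘_; id)
open import Function.Bundles using (_⇔_; mk⇔; Equivalence)

-- Trees are subsets of the edge set. By Moon's formula a forest with block sizes a₁ … a_k lies in a₁ ⋯ a_k n^(k-2) trees, so a forest
-- with t edges lies in at most M = c n^(n-2-t) trees, with equality exactly when its blocks are almost equal. It remains to show that a
-- t-intersecting family F with at least M members has t common edges. The method is spread approximation: as long as many members
-- of F are left, they contain a subfamily, lying above a set S of at most t + q edges, whose links shrink by a factor r per extra edge.
-- Collect these S into 𝒮; only a negligible part of F is not above 𝒮. A random colouring of the edges would find disjoint members in
-- the links of two spread subfamilies, hence 𝒮 is again t-intersecting. Now 𝒮 is peeled level by level: the sets of size t + j either carry
-- little weight (and are discarded) or all lie in a set of size t + 2j. What survives is a single T₀ of size t, or sets of size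
-- t + 1 inside a Z of size t + 2, or a family of small weight; the last two are too small to cover F. In the first case a member B of F
-- not containing T₀ would be t-intersecting with almost all trees containing T₀, whereas a fraction n^-10 of those trees meets B
-- in fewer than t edges.

-- Since t may be as large as n - 2, no estimate may lose a factor per common element; only the
-- excess over t is affordable. Two steps are shaped by this. In `FindSpread` the set of largest
-- weighted degree is measured against the smallest intersection of two members, which recovers the
-- factor r^t. In `Cut` one set may have far more than r elements outside the other; this is paid
-- for by tolerating up to half of the missing intersection. The link parameter r = y^3, the excess
-- q and the exponent h are all of order n^(3/4). The stability of stars of trees is only
-- polynomially strong (loss L = n^10), so the part of F left uncovered must be below M / (2L);
-- hence θ is exponential in n^(1/4). Probabilities are counts over all colourings, and all
-- inequalities are cleared of denominators. Linear facts about cardinalities of Boolean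
-- combinations are left to the reflective prover `slin`.

-- A reflective prover for linear inequalities between cardinalities

data SE (k : ℕ) : Set where
  sv : Fin k → SE k
  _∩′_ _∪′_ : SE k → SE k → SE k
  ∁′ : SE k → SE k
infixr 7 _∩′_
infixr 6 _∪′_

data LE (k l : ℕ) : Set where
  ∥_∥ : SE k → LE k l
  nv  : Fin l → LE k l
  #   : ℕ → LE k l
  _⊹_ : LE k l → LE k l → LE k l
  _⋆_ : ℕ → LE k l → LE k l
infixl 5 _⊹_
infixr 6 _⋆_

data Ineq (k l : ℕ) : Set where
  _≼_ : LE k l → LE k l → Ineq k l
infix 4 _≼_

data Prob (k l : ℕ) : Set where
  ⊢_  : Ineq k l → Prob k l
  _⇒_ : Ineq k l → Prob k l → Prob k l
infixr 3 _⇒_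
infix 3 ⊢_

b2n : Bool → ℕ
b2n true = 1
b2n false = 0

module _ {k : ℕ} where
  evˢ : ∀ {m} → SE k → Vec (Subset m) k → Subset m
  evˢ (sv i) ρ = Vec.lookup ρ i
  evˢ (a ∩′ b) ρ = evˢ a ρ ∩ evˢ b ρ
  evˢ (a ∪′ b) ρ = evˢ a ρ ∪ evˢ b ρ
  evˢ (∁′ a) ρ = ∁ (evˢ a ρ)

  evᵇ : SE k → Vec Bool k → Bool
  evᵇ (sv i) v = Vec.lookup v i
  evᵇ (a ∩′ b) v = evᵇ a v ∧ evᵇ b v
  evᵇ (a ∪′ b) v = evᵇ a v ∨ evᵇ b v
  evᵇ (∁′ a) v = not (evᵇ a v)

  module _ {l : ℕ} where
    ev : ∀ {m} → LE k l → Vec (Subset m) k → Vec ℕ l → ℕ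
    ev ∥ s ∥ ρ σ = ∣ evˢ s ρ ∣
    ev (nv i) ρ σ = Vec.lookup σ i
    ev (# c) ρ σ = c
    ev (a ⊹ b) ρ σ = ev a ρ σ + ev b ρ σ
    ev (c ⋆ a) ρ σ = c * ev a ρ σ

    evC : ∀ {m} → LE k l → Vec (Subset m) k → ℕ
    evC ∥ s ∥ ρ = ∣ evˢ s ρ ∣
    evC (nv i) ρ = 0
    evC (# c) ρ = 0
    evC (a ⊹ b) ρ = evC a ρ + evC b ρ
    evC (c ⋆ a) ρ = c * evC a ρ

    evN : LE k l → Vec ℕ (suc l) → ℕ
    evN ∥ s ∥ σ = 0
    evN (nv i) σ = Vec.lookup σ (suc i)
    evN (# c) σ = c * Vec.lookup σ zero
    evN (a ⊹ b) σ = evN a σ + evN b σ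
    evN (c ⋆ a) σ = c * evN a σ

    pt : LE k l → Vec Bool k → ℕ
    pt ∥ s ∥ v = b2n (evᵇ s v)
    pt (nv i) v = 0
    pt (# c) v = 0
    pt (a ⊹ b) v = pt a v + pt b v
    pt (c ⋆ a) v = c * pt a v

interchange : ∀ a b c d → (a + b) + (c + d) ≡ (a + c) + (b + d)
interchange a b c d = trans (+-assoc a b (c + d)) (trans (cong (a +_) (trans (sym (+-assoc b c d)) (trans (cong (_+ d) (+-comm b c)) (+-assoc c b d)))) (sym (+-assoc a c (b + d))))

module _ {k : ℕ} where
  evˢ-∷ : ∀ {m} (s : SE k) (ρ : Vec (Subset (suc m)) k) → evˢ s ρ ≡ evᵇ s (Vec.map Vec.head ρ) ∷ evˢ s (Vec.map Vec.tail ρ)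
  evˢ-∷ (sv i) ρ = go ρ i
    where
    go : ∀ {m k} (ρ : Vec (Subset (suc m)) k) (i : Fin k) → Vec.lookup ρ i ≡ Vec.lookup (Vec.map Vec.head ρ) i ∷ Vec.lookup (Vec.map Vec.tail ρ) i
    go ((x ∷ xs) ∷ ρ) zero = refl
    go (_ ∷ ρ) (suc i) = go ρ i
  evˢ-∷ (a ∩′ b) ρ rewrite evˢ-∷ a ρ | evˢ-∷ b ρ = refl
  evˢ-∷ (a ∪′ b) ρ rewrite evˢ-∷ a ρ | evˢ-∷ b ρ = refl
  evˢ-∷ (∁′ a) ρ rewrite evˢ-∷ a ρ = refl

  card-∷ : ∀ {m} b (p : Subset m) → ∣ b ∷ p ∣ ≡ b2n b + ∣ p ∣
  card-∷ true p = refl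
  card-∷ false p = refl

  module _ {l : ℕ} where
    -- A constant is read as a multiple of one extra variable, which here takes the value 1. An
    -- expression thus splits into a cardinality part, additive over the points of the ground set,
    -- and a linear form in numbers; the two are compared separately.
    ev-split : ∀ {m} (e : LE k l) (ρ : Vec (Subset m) k) σ → ev e ρ σ ≡ evC e ρ + evN e (1 ∷ σ)
    ev-split ∥ s ∥ ρ σ = sym (+-identityʳ _)
    ev-split (nv i) ρ σ = refl
    ev-split (# c) ρ σ = sym (*-identityʳ c)
    ev-split (a ⊹ b) ρ σ rewrite ev-split a ρ σ | ev-split b ρ σ = interchange (evC a ρ) _ _ _
    ev-split (c ⋆ a) ρ σ rewrite ev-split a ρ σ = *-distribˡ-+ c _ _

    evC-∷ : ∀ {m} (e : LE k l) (ρ : Vec (Subset (suc m)) k) → evC e ρ ≡ pt e (Vec.map Vec.head ρ) + evC e (Vec.map Vec.tail ρ)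
    evC-∷ ∥ s ∥ ρ rewrite evˢ-∷ s ρ = card-∷ (evᵇ s (Vec.map Vec.head ρ)) (evˢ s (Vec.map Vec.tail ρ))
    evC-∷ (nv i) ρ = refl
    evC-∷ (# c) ρ = refl
    evC-∷ (a ⊹ b) ρ rewrite evC-∷ a ρ | evC-∷ b ρ = interchange (pt a _) _ _ _
    evC-∷ (c ⋆ a) ρ rewrite evC-∷ a ρ = *-distribˡ-+ c (pt a _) _

    evC-[] : (e : LE k l) (ρ : Vec (Subset 0) k) → evC e ρ ≡ 0
    evC-[] ∥ s ∥ ρ with evˢ s ρ
    ... | [] = refl
    evC-[] (nv i) ρ = refl
    evC-[] (# c) ρ = refl
    evC-[] (a ⊹ b) ρ rewrite evC-[] a ρ | evC-[] b ρ = refl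
    evC-[] (c ⋆ a) ρ rewrite evC-[] a ρ = *-zeroʳ c

    -- Each point of the ground set contributes according to its membership vector alone, so
    -- comparing the finitely many vectors settles all ground sets.
    evC-mono : ∀ {m} (e f : LE k l) → (∀ v → pt e v ≤ pt f v) → (ρ : Vec (Subset m) k) → evC e ρ ≤ evC f ρ
    evC-mono {zero} e f h ρ rewrite evC-[] e ρ = z≤n
    evC-mono {suc m} e f h ρ rewrite evC-∷ e ρ | evC-∷ f ρ = +-mono-≤ (h _) (evC-mono e f h _)

dot : ∀ {l} → Vec ℕ l → Vec ℕ l → ℕ
dot [] [] = 0
dot (a ∷ as) (b ∷ bs) = a * b + dot as bs

dot-mono : ∀ {l} (a b : Vec ℕ l) (σ : Vec ℕ l) → (∀ i → Vec.lookup a i ≤ Vec.lookup b i) → dot a σ ≤ dot b σ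
dot-mono [] [] [] h = z≤n
dot-mono (a ∷ as) (b ∷ bs) (s ∷ σ) h = +-mono-≤ (*-monoˡ-≤ s (h zero)) (dot-mono as bs σ (h ∘ suc))

unitV : ∀ {l} → Fin l → Vec ℕ l
unitV zero = 1 ∷ Vec.replicate _ 0
unitV (suc i) = 0 ∷ unitV i

dot-0 : ∀ {l} (σ : Vec ℕ l) → dot (Vec.replicate l 0) σ ≡ 0
dot-0 [] = refl
dot-0 (_ ∷ σ) = dot-0 σ

dot-unit : ∀ {l} (i : Fin l) (σ : Vec ℕ l) → dot (unitV i) σ ≡ Vec.lookup σ i
dot-unit zero (s ∷ σ) rewrite dot-0 σ = trans (+-identityʳ _) (*-identityˡ s)
dot-unit (suc i) (s ∷ σ) = dot-unit i σ

dot-+ : ∀ {l} (a b σ : Vec ℕ l) → dot (Vec.zipWith _+_ a b) σ ≡ dot a σ + dot b σ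
dot-+ [] [] [] = refl
dot-+ (a ∷ as) (b ∷ bs) (s ∷ σ) rewrite dot-+ as bs σ | *-distribʳ-+ s a b = interchange (a * s) _ _ _

dot-* : ∀ {l} c (a σ : Vec ℕ l) → dot (Vec.map (c *_) a) σ ≡ c * dot a σ
dot-* c [] [] = sym (*-zeroʳ c)
dot-* c (a ∷ as) (s ∷ σ) rewrite dot-* c as σ | *-assoc c a s = sym (*-distribˡ-+ c (a * s) _)

module _ {k l : ℕ} where
  norm : LE k l → Vec ℕ (suc l)
  norm ∥ s ∥ = Vec.replicate _ 0
  norm (nv i) = unitV (suc i)
  norm (# c) = Vec.map (c *_) (unitV zero)
  norm (a ⊹ b) = Vec.zipWith _+_ (norm a) (norm b)
  norm (c ⋆ a) = Vec.map (c *_) (norm a)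

  norm-ok : (e : LE k l) (σ : Vec ℕ (suc l)) → evN e σ ≡ dot (norm e) σ
  norm-ok ∥ s ∥ σ = sym (dot-0 σ)
  norm-ok (nv i) σ = sym (dot-unit (suc i) σ)
  norm-ok (# c) σ = trans (cong (c *_) (sym (dot-unit zero σ))) (sym (dot-* c (unitV zero) σ))
  norm-ok (a ⊹ b) σ = trans (cong₂ _+_ (norm-ok a σ) (norm-ok b σ)) (sym (dot-+ (norm a) (norm b) σ))
  norm-ok (c ⋆ a) σ = trans (cong (c *_) (norm-ok a σ)) (sym (dot-* c (norm a) σ))

  allᵇ : ∀ j → (Vec Bool j → Bool) → Bool
  allᵇ zero f = f []
  allᵇ (suc j) f = allᵇ j (λ v → f (true ∷ v)) ∧ allᵇ j (λ v → f (false ∷ v))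

  T-∧ : ∀ a b → T (a ∧ b) → T a × T b
  T-∧ true b t = tt , t

  allᵇ-ok : ∀ j (f : Vec Bool j → Bool) → T (allᵇ j f) → ∀ v → T (f v)
  allᵇ-ok zero f t [] = t
  allᵇ-ok (suc j) f t (true ∷ v) = allᵇ-ok j _ (proj₁ (T-∧ _ _ t)) v
  allᵇ-ok (suc j) f t (false ∷ v) = allᵇ-ok j _ (proj₂ (T-∧ (allᵇ j (λ v → f (true ∷ v))) _ t)) v

  leV : ∀ {j} → Vec ℕ j → Vec ℕ j → Bool
  leV [] [] = true
  leV (a ∷ as) (b ∷ bs) = (a ≤ᵇ b) ∧ leV as bs

  leV-ok : ∀ {j} (a b : Vec ℕ j) → T (leV a b) → ∀ i → Vec.lookup a i ≤ Vec.lookup b i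
  leV-ok (a ∷ as) (b ∷ bs) t zero = ≤ᵇ⇒≤ a b (proj₁ (T-∧ _ _ t))
  leV-ok (a ∷ as) (b ∷ bs) t (suc i) = leV-ok as bs (proj₂ (T-∧ (a ≤ᵇ b) _ t)) i

  checkLE : LE k l → LE k l → Bool
  checkLE a b = allᵇ k (λ v → pt a v ≤ᵇ pt b v) ∧ leV (norm a) (norm b)

  checkLE-ok : ∀ {m} a b → T (checkLE a b) → (ρ : Vec (Subset m) k) (σ : Vec ℕ l) → ev a ρ σ ≤ ev b ρ σ
  checkLE-ok a b t ρ σ rewrite ev-split a ρ σ | ev-split b ρ σ =
    +-mono-≤ (evC-mono a b (λ v → ≤ᵇ⇒≤ _ _ (allᵇ-ok k _ (proj₁ tt′) v)) ρ)
      (subst₂ _≤_ (sym (norm-ok a (1 ∷ σ))) (sym (norm-ok b (1 ∷ σ))) (dot-mono (norm a) (norm b) (1 ∷ σ) (leV-ok (norm a) (norm b) (proj₂ tt′))))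
    where
    tt′ : T (allᵇ k (λ v → pt a v ≤ᵇ pt b v)) × T (leV (norm a) (norm b))
    tt′ = T-∧ (allᵇ k (λ v → pt a v ≤ᵇ pt b v)) _ t

  ⟦_⟧ᴵ : ∀ {m} → Ineq k l → Vec (Subset m) k → Vec ℕ l → Set
  ⟦ a ≼ b ⟧ᴵ ρ σ = ev a ρ σ ≤ ev b ρ σ

  ⟦_⟧ᴾ : ∀ {m} → Prob k l → Vec (Subset m) k → Vec ℕ l → Set
  ⟦ ⊢ g ⟧ᴾ ρ σ = ⟦ g ⟧ᴵ ρ σ
  ⟦ h ⇒ p ⟧ᴾ ρ σ = ⟦ h ⟧ᴵ ρ σ → ⟦ p ⟧ᴾ ρ σ

  checkP : Prob k l → LE k l → LE k l → Bool
  checkP (⊢ (a ≼ b)) x y = checkLE (a ⊹ y) (b ⊹ x)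
  checkP ((a ≼ b) ⇒ p) x y = checkP p (a ⊹ x) (b ⊹ y)

  -- The pair `x`, `y` accumulates the two sides of the hypotheses read so far, each with
  -- coefficient one. A hypothesis that a derivation needs several times must therefore be repeated
  -- or scaled by the caller.
  checkP-ok : ∀ {m} (p : Prob k l) x y → T (checkP p x y) → (ρ : Vec (Subset m) k) (σ : Vec ℕ l) → ev x ρ σ ≤ ev y ρ σ → ⟦ p ⟧ᴾ ρ σ
  checkP-ok (⊢ (a ≼ b)) x y t ρ σ h =
    +-cancelʳ-≤ (ev y ρ σ) _ _ (≤-trans (checkLE-ok (a ⊹ y) (b ⊹ x) t ρ σ) (+-monoʳ-≤ (ev b ρ σ) h))
  checkP-ok ((a ≼ b) ⇒ p) x y t ρ σ h h′ = checkP-ok p _ _ t ρ σ (+-mono-≤ h′ h)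

Pi : ∀ k (A : Set) → (Vec A k → Set) → Set
Pi zero A B = B []
Pi (suc k) A B = (a : A) → Pi k A (λ v → B (a ∷ v))

lamPi : ∀ k {A : Set} {B : Vec A k → Set} → (∀ v → B v) → Pi k A B
lamPi zero f = f []
lamPi (suc k) f a = lamPi k (λ v → f (a ∷ v))

Fun : ℕ → Set → Set → Set
Fun zero A B = B
Fun (suc k) A B = A → Fun k A B

appV : ∀ {k} {A B : Set} → Fun k A B → Vec A k → B
appV f [] = f
appV f (x ∷ v) = appV (f x) v

body : ∀ k l → Fun k (SE k) (Fun l (LE k l) (Prob k l)) → Prob k l
body k l f = appV (appV f (Vec.map sv (Vec.allFin k))) (Vec.map nv (Vec.allFin l))

-- The goal must follow from the sum of the hypotheses: after adding it, every point of the
-- ground set and every numeric atom has to contribute at most as much on the left as on the right.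
slin : ∀ k l (f : Fun k (SE k) (Fun l (LE k l) (Prob k l))) {_ : T (checkP (body k l f) (# 0) (# 0))} {m} →
       Pi k (Subset m) (λ ρ → Pi l ℕ (λ σ → ⟦ body k l f ⟧ᴾ ρ σ))
slin k l f {t} = lamPi k (λ ρ → lamPi l (λ σ → checkP-ok (body k l f) (# 0) (# 0) t ρ σ z≤n))

lin : ∀ l (f : Fun l (LE 0 l) (Prob 0 l)) {_ : T (checkP (body 0 l f) (# 0) (# 0))} → Pi l ℕ (λ σ → ⟦_⟧ᴾ {m = 0} (body 0 l f) [] σ)
lin l f {t} = lamPi l (λ σ → checkP-ok (body 0 l f) (# 0) (# 0) t [] σ z≤n)

-- Indicators and finite sums over lists

a*bc≡b*ac : ∀ a b c → a * (b * c) ≡ b * (a * c)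
a*bc≡b*ac = solve-∀

𝟙 : {P : Set} → Dec P → ℕ
𝟙 (yes _) = 1
𝟙 (no _) = 0

𝟙-yes : {P : Set} (d : Dec P) → P → 1 ≤ 𝟙 d
𝟙-yes (yes _) p = ≤-refl
𝟙-yes (no ¬p) p = ⊥-elim (¬p p)

𝟙-no : {P : Set} (d : Dec P) → ¬ P → 𝟙 d ≡ 0
𝟙-no (yes p) ¬p = ⊥-elim (¬p p)
𝟙-no (no _) ¬p = refl

𝟙-inv : {P : Set} (d : Dec P) → 1 ≤ 𝟙 d → P
𝟙-inv (yes p) _ = p

𝟙≤1 : {P : Set} (d : Dec P) → 𝟙 d ≤ 1
𝟙≤1 (yes p) = ≤-refl
𝟙≤1 (no p) = z≤n

𝟙-if : {P : Set} (d : Dec P) {b : ℕ} → (P → 1 ≤ b) → 𝟙 d ≤ b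
𝟙-if (yes p) h = h p
𝟙-if (no _) h = z≤n

𝟙-mono : {P Q : Set} (d : Dec P) (e : Dec Q) → (P → Q) → 𝟙 d ≤ 𝟙 e
𝟙-mono d e f = 𝟙-if d (𝟙-yes e ∘ f)

𝟙-or : {P Q : Set} (d : Dec P) (e : Dec Q) → (¬ P → Q) → 1 ≤ 𝟙 d + 𝟙 e
𝟙-or (yes p) e h = s≤s z≤n
𝟙-or (no ¬p) e h = 𝟙-yes e (h ¬p)

𝟙*-≤ : {P : Set} (d : Dec P) {a b : ℕ} → (P → a ≤ b) → 𝟙 d * a ≤ b
𝟙*-≤ (yes p) {a} h = ≤-trans (≤-reflexive (*-identityˡ a)) (h p)
𝟙*-≤ (no _) h = z≤n

𝟙*-mono : {P : Set} (d : Dec P) {a b : ℕ} → (P → a ≤ b) → 𝟙 d * a ≤ 𝟙 d * b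
𝟙*-mono (yes p) h = *-monoʳ-≤ 1 (h p)
𝟙*-mono (no _) h = z≤n

-- A record, so that hypotheses with large literals stay folded under normalisation.
record Scaled (k a b : ℕ) : Set where
  constructor scaled
  field unscaled : k * a ≤ b
open Scaled public

Σ : {A : Set} → List A → (A → ℕ) → ℕ
Σ [] f = 0
Σ (x ∷ xs) f = f x + Σ xs f

module _ {A : Set} where
  Σ-mono : (xs : List A) {f g : A → ℕ} → (∀ x → x ∈ xs → f x ≤ g x) → Σ xs f ≤ Σ xs g
  Σ-mono [] h = z≤n
  Σ-mono (x ∷ xs) h = +-mono-≤ (h x (here refl)) (Σ-mono xs (λ y m → h y (there m)))

  Σ-mono′ : (xs : List A) {f g : A → ℕ} → (∀ x → f x ≤ g x) → Σ xs f ≤ Σ xs g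
  Σ-mono′ xs h = Σ-mono xs (λ x _ → h x)

  Σ-cong : (xs : List A) {f g : A → ℕ} → (∀ x → f x ≡ g x) → Σ xs f ≡ Σ xs g
  Σ-cong [] h = refl
  Σ-cong (x ∷ xs) h = cong₂ _+_ (h x) (Σ-cong xs h)

  Σ-const : (xs : List A) (c : ℕ) → Σ xs (λ _ → c) ≡ length xs * c
  Σ-const [] c = refl
  Σ-const (x ∷ xs) c = cong (c +_) (Σ-const xs c)

  Σ-0 : (xs : List A) → Σ xs (λ _ → 0) ≡ 0
  Σ-0 [] = refl
  Σ-0 (x ∷ xs) = Σ-0 xs

  Σ-1 : (xs : List A) → Σ xs (λ _ → 1) ≡ length xs
  Σ-1 xs = trans (Σ-const xs 1) (*-identityʳ _)

  Σ-≤const : (xs : List A) {f : A → ℕ} (c : ℕ) → (∀ x → x ∈ xs → f x ≤ c) → Σ xs f ≤ length xs * c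
  Σ-≤const xs c h = ≤-trans (Σ-mono xs h) (≤-reflexive (Σ-const xs c))

  Σ-+ : (xs : List A) (f g : A → ℕ) → Σ xs (λ x → f x + g x) ≡ Σ xs f + Σ xs g
  Σ-+ [] f g = refl
  Σ-+ (x ∷ xs) f g rewrite Σ-+ xs f g = interchange (f x) _ _ _

  Σ-*ˡ : (xs : List A) (c : ℕ) (f : A → ℕ) → Σ xs (λ x → c * f x) ≡ c * Σ xs f
  Σ-*ˡ [] c f = sym (*-zeroʳ c)
  Σ-*ˡ (x ∷ xs) c f rewrite Σ-*ˡ xs c f = sym (*-distribˡ-+ c (f x) _)

  Σ-*ʳ : (xs : List A) (c : ℕ) (f : A → ℕ) → Σ xs (λ x → f x * c) ≡ Σ xs f * c
  Σ-*ʳ xs c f = trans (Σ-cong xs (λ x → *-comm (f x) c)) (trans (Σ-*ˡ xs c f) (*-comm c _))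

  Σ-++ : (xs ys : List A) (f : A → ℕ) → Σ (xs ++ ys) f ≡ Σ xs f + Σ ys f
  Σ-++ [] ys f = refl
  Σ-++ (x ∷ xs) ys f rewrite Σ-++ xs ys f = sym (+-assoc (f x) _ _)

  Σ-member : {xs : List A} {x : A} (f : A → ℕ) → x ∈ xs → f x ≤ Σ xs f
  Σ-member f (here refl) = m≤m+n _ _
  Σ-member {x′ ∷ xs} f (there m) = ≤-trans (Σ-member f m) (m≤n+m _ (f x′))

  Σ-pos : (xs : List A) {f : A → ℕ} → 1 ≤ Σ xs f → ∃[ x ] (x ∈ xs × 1 ≤ f x)
  Σ-pos (x ∷ xs) {f} h with f x in eq
  ... | suc k = x , here refl , subst (1 ≤_) (sym eq) (s≤s z≤n)
  ... | zero with Σ-pos xs h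
  ...   | y , m , p = y , there m , p

  argmax : (f : A → ℕ) (x : A) (xs : List A) → ∃[ y ] (y ∈ (x ∷ xs) × (∀ z → z ∈ (x ∷ xs) → f z ≤ f y))
  argmax f x [] = x , here refl , λ { z (here refl) → ≤-refl }
  argmax f x (x′ ∷ xs) with argmax f x′ xs
  ... | y , m , h with ≤-total (f x) (f y)
  ...   | inj₁ p = y , there m , λ { z (here refl) → p ; z (there q) → h z q }
  ...   | inj₂ p = x , here refl , λ { z (here refl) → ≤-refl ; z (there q) → ≤-trans (h z q) p }

  argmin : (f : A → ℕ) (x : A) (xs : List A) → ∃[ y ] (y ∈ (x ∷ xs) × (∀ z → z ∈ (x ∷ xs) → f y ≤ f z))
  argmin f x [] = x , here refl , λ { z (here refl) → ≤-refl }
  argmin f x (x′ ∷ xs) with argmin f x′ xs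
  ... | y , m , h with ≤-total (f x) (f y)
  ...   | inj₂ p = y , there m , λ { z (here refl) → p ; z (there q) → h z q }
  ...   | inj₁ p = x , here refl , λ { z (here refl) → ≤-refl ; z (there q) → ≤-trans p (h z q) }

  dec∃ : {P : A → Set} → (∀ x → Dec (P x)) → (xs : List A) → (∃[ x ] (x ∈ xs × P x)) ⊎ (∀ x → x ∈ xs → ¬ P x)
  dec∃ d [] = inj₂ (λ x ())
  dec∃ d (x ∷ xs) with d x | dec∃ d xs
  ... | yes p | _ = inj₁ (x , here refl , p)
  ... | no ¬p | inj₁ (y , m , q) = inj₁ (y , there m , q)
  ... | no ¬p | inj₂ h = inj₂ λ { y (here refl) → ¬p ; y (there m) → h y m }

  decAll : {P : A → Set} → (∀ x → Dec (P x)) → (xs : List A) → (∀ x → x ∈ xs → P x) ⊎ (∃[ x ] (x ∈ xs × ¬ P x))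
  decAll d [] = inj₁ (λ x ())
  decAll d (x ∷ xs) with d x | decAll d xs
  ... | no ¬p | _ = inj₂ (x , here refl , ¬p)
  ... | yes p | inj₂ (y , m , q) = inj₂ (y , there m , q)
  ... | yes p | inj₁ h = inj₁ λ { y (here refl) → p ; y (there m) → h y m }

  dec∃′ : {P : A → Set} → (∀ x → Dec (P x)) → (xs : List A) → Dec (∃[ x ] (x ∈ xs × P x))
  dec∃′ d xs with dec∃ d xs
  ... | inj₁ p = yes p
  ... | inj₂ h = no (λ { (x , m , p) → h x m p })

  decAll′ : {P : A → Set} → (∀ x → Dec (P x)) → (xs : List A) → Dec (∀ x → x ∈ xs → P x)
  decAll′ d xs with decAll d xs
  ... | inj₁ p = yes p
  ... | inj₂ (x , m , q) = no (λ h → q (h x m))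

Σ-swap : {A B : Set} (xs : List A) (ys : List B) (f : A → B → ℕ) → Σ xs (λ x → Σ ys (f x)) ≡ Σ ys (λ y → Σ xs (λ x → f x y))
Σ-swap [] ys f = sym (Σ-0 ys)
Σ-swap (x ∷ xs) ys f rewrite Σ-swap xs ys f = sym (Σ-+ ys (f x) _)

Σ-map : {A B : Set} (g : A → B) (xs : List A) (f : B → ℕ) → Σ (List.map g xs) f ≡ Σ xs (f ∘ g)
Σ-map g [] f = refl
Σ-map g (x ∷ xs) f = cong (f (g x) +_) (Σ-map g xs f)

cover : {A B : Set} (xs : List A) (ys : List B) (g : A → B → ℕ) → (∀ x → x ∈ xs → ∃[ y ] (y ∈ ys × 1 ≤ g x y)) →
        length xs ≤ Σ ys (λ y → Σ xs (λ x → g x y))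
cover xs ys g h = ≤-trans (≤-reflexive (sym (Σ-1 xs)))
  (≤-trans (Σ-mono xs (λ x m → let (y , my , p) = h x m in ≤-trans p (Σ-member (g x) my))) (≤-reflexive (Σ-swap xs ys g)))

-- Enumeration of words and subsets, inclusion of subsets

words : {C : Set} → List C → ∀ m → List (Vec C m)
extend : {C : Set} → List C → ∀ {m} → List (Vec C m) → List (Vec C (suc m))
extend [] vs = []
extend (c ∷ cs) vs = List.map (c ∷_) vs ++ extend cs vs
words cs zero = [] ∷ []
words cs (suc m) = extend cs (words cs m)

Σ-words : {C : Set} (cs : List C) (m : ℕ) (f : Vec C (suc m) → ℕ) → Σ (words cs (suc m)) f ≡ Σ cs (λ c → Σ (words cs m) (λ v → f (c ∷ v)))
Σ-words {C} cs m f = go cs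
  where
  go : ∀ ds → Σ (extend ds (words cs m)) f ≡ Σ ds (λ c → Σ (words cs m) (λ v → f (c ∷ v)))
  go [] = refl
  go (d ∷ ds) = trans (Σ-++ (List.map (d ∷_) (words cs m)) _ f) (cong₂ _+_ (Σ-map (d ∷_) (words cs m) f) (go ds))

words-complete : {C : Set} (cs : List C) → (∀ c → c ∈ cs) → ∀ {m} (v : Vec C m) → v ∈ words cs m
words-complete cs h [] = here refl
words-complete {C} cs h {suc m} (c ∷ v) = go cs (h c)
  where
  go : ∀ ds → c ∈ ds → (c ∷ v) ∈ extend ds (words cs m)
  go (d ∷ ds) (here refl) = ∈-++⁺ˡ (∈-map⁺ (c ∷_) (words-complete cs h v))
  go (d ∷ ds) (there q) = ∈-++⁺ʳ (List.map (d ∷_) (words cs m)) (go ds q)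

subs : ∀ m → List (Subset m)
subs = words (true ∷ false ∷ [])

∈subs : ∀ {m} (X : Subset m) → X ∈ subs m
∈subs = words-complete _ λ { true → here refl ; false → there (here refl) }

infix 4 _⊑_ _⊑?_ _≟ˢ_

_⊑_ : ∀ {m} → Subset m → Subset m → Set
X ⊑ A = ∣ X ∩ ∁ A ∣ ≤ 0

_⊑?_ : ∀ {m} (X A : Subset m) → Dec (X ⊑ A)
X ⊑? A = ∣ X ∩ ∁ A ∣ ≤? 0

_≟ˢ_ : ∀ {m} (X A : Subset m) → Dec (X ≡ A)
_≟ˢ_ = Vecₚ.≡-dec Data.Bool._≟_
  where
  import Data.Vec.Properties as Vecₚ
  import Data.Bool

⊑-refl : ∀ {m} (X : Subset m) → X ⊑ X
⊑-refl X = slin 1 0 (λ x → ⊢ (∥ x ∩′ ∁′ x ∥ ≼ # 0)) X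

⊑-trans : ∀ {m} (p q r : Subset m) → p ⊑ q → q ⊑ r → p ⊑ r
⊑-trans = slin 3 0 (λ p q r → (∥ p ∩′ ∁′ q ∥ ≼ # 0) ⇒ (∥ q ∩′ ∁′ r ∥ ≼ # 0) ⇒ ⊢ (∥ p ∩′ ∁′ r ∥ ≼ # 0))

⊑-antisym : ∀ {m} {p q : Subset m} → p ⊑ q → q ⊑ p → p ≡ q
⊑-antisym {p = []} {[]} h k = refl
⊑-antisym {p = true ∷ p} {true ∷ q} h k = cong (true ∷_) (⊑-antisym h k)
⊑-antisym {p = true ∷ p} {false ∷ q} () k
⊑-antisym {p = false ∷ p} {true ∷ q} h ()
⊑-antisym {p = false ∷ p} {false ∷ q} h k = cong (false ∷_) (⊑-antisym h k)

point : ∀ {m} (p : Subset m) → 1 ≤ ∣ p ∣ → ∃[ x ] (⁅ x ⁆ ⊑ p)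
point (true ∷ p) h = zero , ≤-trans (≤-reflexive (go p)) z≤n
  where
  go : ∀ {m} (p : Subset m) → ∣ Sub.⊥ ∩ ∁ p ∣ ≡ 0
  go [] = refl
  go (true ∷ p) = go p
  go (false ∷ p) = go p
point (false ∷ p) h with point p h
... | x , q = suc x , q

∣⁅⁆∣ : ∀ {m} (x : Fin m) → ∣ ⁅ x ⁆ ∣ ≡ 1
∣⁅⁆∣ = Subₚ.∣⁅x⁆∣≡1

-- Every point of A independently contributes w if it is taken into X and r if not. This weighted
-- sum is what all the tail bounds reduce to.
binomial : ∀ m (A : Subset m) (r w : ℕ) → Σ (subs m) (λ X → 𝟙 (X ⊑? A) * (w ^ ∣ X ∣ * r ^ ∣ A ∩ ∁ X ∣)) ≡ (r + w) ^ ∣ A ∣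
binomial zero [] r w = refl
binomial (suc m) (a ∷ A) r w = trans (Σ-words (true ∷ false ∷ []) m _) (go a)
  where
  ih : Σ (subs m) (λ X → 𝟙 (X ⊑? A) * (w ^ ∣ X ∣ * r ^ ∣ A ∩ ∁ X ∣)) ≡ (r + w) ^ ∣ A ∣
  ih = binomial m A r w
  lem : ∀ d c e f → d * (c * e * f) ≡ c * (d * (e * f))
  lem d c e f = trans (cong (d *_) (*-assoc c e f)) (trans (sym (*-assoc d c _)) (trans (cong (_* (e * f)) (*-comm d c)) (*-assoc c d _)))
  lem′ : ∀ d c e f → d * (e * (c * f)) ≡ c * (d * (e * f))
  lem′ d c e f = trans (cong (d *_) (trans (sym (*-assoc e c f)) (cong (_* f) (*-comm e c)))) (lem d c e f)
  go : ∀ a → Σ (true ∷ false ∷ []) (λ c → Σ (subs m) (λ X → 𝟙 ((c ∷ X) ⊑? (a ∷ A)) * (w ^ ∣ c ∷ X ∣ * r ^ ∣ (a ∷ A) ∩ ∁ (c ∷ X) ∣))) ≡ (r + w) ^ ∣ a ∷ A ∣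
  go true = trans (cong₂ _+_ (trans (Σ-cong (subs m) (λ X → lem (𝟙 (X ⊑? A)) w (w ^ ∣ X ∣) (r ^ ∣ A ∩ ∁ X ∣))) (trans (Σ-*ˡ (subs m) w _) (cong (w *_) ih)))
             (trans (+-identityʳ _) (trans (Σ-cong (subs m) (λ X → lem′ (𝟙 (X ⊑? A)) r (w ^ ∣ X ∣) (r ^ ∣ A ∩ ∁ X ∣))) (trans (Σ-*ˡ (subs m) r _) (cong (r *_) ih)))))
             (trans (+-comm (w * _) _) (sym (*-distribʳ-+ ((r + w) ^ ∣ A ∣) r w)))
  go false = trans (cong₂ _+_ (trans (Σ-cong (subs m) (λ X → cong (_* (w ^ ∣ true ∷ X ∣ * r ^ ∣ (false ∷ A) ∩ ∁ (true ∷ X) ∣)) (𝟙-no ((true ∷ X) ⊑? (false ∷ A)) (λ ())))) (Σ-0 (subs m))) (+-identityʳ _)) ih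

argminP : {A : Set} {P : A → Set} → (∀ x → Dec (P x)) → (f : A → ℕ) (xs : List A) → ∀ x → x ∈ xs → P x →
          ∃[ y ] (y ∈ xs × P y × (∀ z → z ∈ xs → P z → f y ≤ f z))
argminP {A} {P} d f xs x mx px = go (suc (f x)) x mx px ≤-refl
  where
  go : ∀ fuel x → x ∈ xs → P x → f x < fuel → ∃[ y ] (y ∈ xs × P y × (∀ z → z ∈ xs → P z → f y ≤ f z))
  go (suc fuel) x mx px (s≤s h) with dec∃ (λ z → f z <? f x) xs
  ... | inj₂ no< = x , mx , px , λ z mz _ → ≮⇒≥ (no< z mz)
  ... | inj₁ (w , mw , w<) with dec∃ {P = λ z → P z × f z < f x} (λ z → Relation.Nullary.Decidable._×-dec_ (d z) (f z <? f x)) xs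
    where import Relation.Nullary.Decidable
  ...   | inj₁ (z , mz , pz , z<) = go fuel z mz pz (<-≤-trans z< h)
  ...   | inj₂ none = x , mx , px , λ z mz pz → ≮⇒≥ (λ lt → none z mz (pz , lt))

-- Division-free forms of (1 + c/r)^z ≤ 2 for 2cz ≤ r.

growth₁ : ∀ r c j d → d + j * c ≡ r → (r + c) ^ j * d ≤ r ^ j * r
growth₁ r c zero d e = ≤-trans (≤-reflexive (*-identityˡ d)) (≤-trans (≤-trans (m≤m+n d (zero * c)) (≤-reflexive e)) (≤-reflexive (sym (*-identityˡ r))))
growth₁ r c (suc j) d e = begin
    (r + c) * (r + c) ^ j * d ≡⟨ trans (cong (_* d) (*-comm (r + c) _)) (*-assoc ((r + c) ^ j) (r + c) d) ⟩
    (r + c) ^ j * ((r + c) * d) ≤⟨ *-monoʳ-≤ ((r + c) ^ j) step ⟩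
    (r + c) ^ j * ((d + c) * r) ≡⟨ sym (*-assoc ((r + c) ^ j) (d + c) r) ⟩
    (r + c) ^ j * (d + c) * r ≤⟨ *-monoˡ-≤ r (growth₁ r c j (d + c) (trans (+-assoc d c (j * c)) e)) ⟩
    r ^ j * r * r ≡⟨ cong (_* r) (*-comm (r ^ j) r) ⟩
    r * r ^ j * r ∎
  where
  open ≤-Reasoning
  d≤r : d ≤ r
  d≤r = ≤-trans (m≤m+n d _) (≤-reflexive e)
  step : (r + c) * d ≤ (d + c) * r
  step = begin
    (r + c) * d ≡⟨ *-distribʳ-+ d r c ⟩
    r * d + c * d ≤⟨ +-mono-≤ (≤-reflexive (*-comm r d)) (*-monoʳ-≤ c d≤r) ⟩
    d * r + c * r ≡⟨ sym (*-distribʳ-+ r d c) ⟩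
    (d + c) * r ∎

growth : ∀ r c z → 1 ≤ r → 2 * (z * c) ≤ r → (r + c) ^ z ≤ 2 * r ^ z
growth (suc r′) c z _ h = *-cancelʳ-≤ _ _ (suc r′) (begin
    (r + c) ^ z * r ≤⟨ *-monoʳ-≤ ((r + c) ^ z) r≤2d ⟩
    (r + c) ^ z * (2 * d) ≡⟨ a*bc≡b*ac ((r + c) ^ z) 2 d ⟩
    2 * ((r + c) ^ z * d) ≤⟨ *-monoʳ-≤ 2 (growth₁ r c z d (m∸n+n≡m zc≤r)) ⟩
    2 * (r ^ z * r) ≡⟨ sym (*-assoc 2 (r ^ z) r) ⟩
    2 * r ^ z * r ∎)
  where
  open ≤-Reasoning
  r d : ℕ
  r = suc r′
  d = r ∸ z * c
  zc≤r : z * c ≤ r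
  zc≤r = ≤-trans (m≤m+n _ _) h
  r≤2d : r ≤ 2 * d
  r≤2d = lin 3 (λ r d e → (2 ⋆ e ≼ r) ⇒ (r ≼ d ⊹ e) ⇒ (r ≼ d ⊹ e) ⇒ ⊢ (r ≼ 2 ⋆ d)) r d (z * c) h p p
    where
    p : r ≤ d + z * c
    p = ≤-reflexive (sym (m∸n+n≡m zc≤r))

-- The exponent is padded to z h and cut into h blocks of length z, each of which costs a factor 2
-- by `growth`.
growth* : ∀ r c z h x → 1 ≤ r → 2 * (z * c) ≤ r → x ≤ z * h → (r + c) ^ x ≤ 2 ^ h * r ^ x
growth* r c z h x r≥1 p x≤ = *-cancelʳ-≤ _ _ (r ^ y) {{m^n≢0 r y {{>-nonZero r≥1}}}} (begin
    (r + c) ^ x * r ^ y ≤⟨ *-monoʳ-≤ ((r + c) ^ x) (^-monoˡ-≤ y (m≤m+n r c)) ⟩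
    (r + c) ^ x * (r + c) ^ y ≡⟨ sym (^-distribˡ-+-* (r + c) x y) ⟩
    (r + c) ^ (x + y) ≡⟨ cong ((r + c) ^_) (m+[n∸m]≡n x≤) ⟩
    (r + c) ^ (z * h) ≡⟨ sym (^-*-assoc (r + c) z h) ⟩
    ((r + c) ^ z) ^ h ≤⟨ ^-monoˡ-≤ h (growth r c z r≥1 p) ⟩
    (2 * r ^ z) ^ h ≡⟨ ^-distribʳ-* h 2 (r ^ z) ⟩
    2 ^ h * (r ^ z) ^ h ≡⟨ cong (2 ^ h *_) (^-*-assoc r z h) ⟩
    2 ^ h * r ^ (z * h) ≡⟨ cong (λ e → 2 ^ h * r ^ e) (sym (m+[n∸m]≡n x≤)) ⟩
    2 ^ h * r ^ (x + y) ≡⟨ cong (2 ^ h *_) (^-distribˡ-+-* r x y) ⟩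
    2 ^ h * (r ^ x * r ^ y) ≡⟨ sym (*-assoc (2 ^ h) (r ^ x) (r ^ y)) ⟩
    2 ^ h * r ^ x * r ^ y ∎)
  where
  open ≤-Reasoning
  y = z * h ∸ x
  ^-distribʳ-* : ∀ h a b → (a * b) ^ h ≡ a ^ h * b ^ h
  ^-distribʳ-* zero a b = refl
  ^-distribʳ-* (suc h) a b rewrite ^-distribʳ-* h a b = [m*n]*[o*p]≡[m*o]*[n*p] a b (a ^ h) (b ^ h)

-- An exponential-moment bound: v^|ξ| is at least v^m₀ on the terms that count, and with this extra
-- weight the sum becomes a binomial expansion over the subsets of X.
tail : ∀ {m} (X : Subset m) (N : Subset m → ℕ) (c v r g m₀ : ℕ) → 1 ≤ v → (∀ ξ → ξ ⊑ X → N ξ * r ^ ∣ ξ ∣ ≤ g) →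
       Σ (subs m) (λ ξ → 𝟙 (ξ ⊑? X) * (𝟙 (m₀ ≤? ∣ ξ ∣) * (c ^ ∣ ξ ∣ * N ξ))) * (v ^ m₀ * r ^ ∣ X ∣) ≤ g * (r + c * v) ^ ∣ X ∣
tail {m} X N c v r g m₀ v≥1 hN = begin
    Σ (subs m) (λ ξ → 𝟙 (ξ ⊑? X) * (𝟙 (m₀ ≤? ∣ ξ ∣) * (c ^ ∣ ξ ∣ * N ξ))) * V ≡⟨ sym (Σ-*ʳ (subs m) V _) ⟩
    Σ (subs m) (λ ξ → 𝟙 (ξ ⊑? X) * (𝟙 (m₀ ≤? ∣ ξ ∣) * (c ^ ∣ ξ ∣ * N ξ)) * V) ≤⟨ Σ-mono′ (subs m) term ⟩
    Σ (subs m) (λ ξ → g * (𝟙 (ξ ⊑? X) * ((c * v) ^ ∣ ξ ∣ * r ^ ∣ X ∩ ∁ ξ ∣))) ≡⟨ Σ-*ˡ (subs m) g _ ⟩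
    g * Σ (subs m) (λ ξ → 𝟙 (ξ ⊑? X) * ((c * v) ^ ∣ ξ ∣ * r ^ ∣ X ∩ ∁ ξ ∣)) ≡⟨ cong (g *_) (binomial m X r (c * v)) ⟩
    g * (r + c * v) ^ ∣ X ∣ ∎
  where
  open ≤-Reasoning
  V = v ^ m₀ * r ^ ∣ X ∣
  size : ∀ ξ → ξ ⊑ X → ∣ X ∣ ≡ ∣ ξ ∣ + ∣ X ∩ ∁ ξ ∣
  size ξ s = ≤-antisym (slin 2 0 (λ x ξ → ⊢ (∥ x ∥ ≼ ∥ ξ ∥ ⊹ ∥ x ∩′ ∁′ ξ ∥)) X ξ)
    (slin 2 0 (λ x ξ → (∥ ξ ∩′ ∁′ x ∥ ≼ # 0) ⇒ ⊢ (∥ ξ ∥ ⊹ ∥ x ∩′ ∁′ ξ ∥ ≼ ∥ x ∥)) X ξ s)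
  ^-* : ∀ h a b → (a * b) ^ h ≡ a ^ h * b ^ h
  ^-* zero a b = refl
  ^-* (suc h) a b rewrite ^-* h a b = [m*n]*[o*p]≡[m*o]*[n*p] a b (a ^ h) (b ^ h)
  arr : ∀ a b x d e → a * b * (x * (d * e)) ≡ b * d * (a * x * e)
  arr a b x d e = trans (cong (_* (x * (d * e))) (*-comm a b)) (trans (*-assoc b a _) (trans (cong (b *_) (trans (sym (*-assoc a x (d * e))) (trans (sym (*-assoc (a * x) d e)) (trans (cong (_* e) (*-comm (a * x) d)) (*-assoc d (a * x) e))))) (sym (*-assoc b d _))))
  core : ∀ ξ → ξ ⊑ X → m₀ ≤ ∣ ξ ∣ → c ^ ∣ ξ ∣ * N ξ * V ≤ g * ((c * v) ^ ∣ ξ ∣ * r ^ ∣ X ∩ ∁ ξ ∣)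
  core ξ s l = begin
    c ^ k * N ξ * (v ^ m₀ * r ^ ∣ X ∣) ≤⟨ *-monoʳ-≤ (c ^ k * N ξ) (*-monoˡ-≤ (r ^ ∣ X ∣) (^-monoʳ-≤ v {{>-nonZero v≥1}} l)) ⟩
    c ^ k * N ξ * (v ^ k * r ^ ∣ X ∣) ≡⟨ cong (λ e → c ^ k * N ξ * (v ^ k * r ^ e)) (size ξ s) ⟩
    c ^ k * N ξ * (v ^ k * r ^ (k + d)) ≡⟨ cong (λ e → c ^ k * N ξ * (v ^ k * e)) (^-distribˡ-+-* r k d) ⟩
    c ^ k * N ξ * (v ^ k * (r ^ k * r ^ d)) ≡⟨ arr (c ^ k) (N ξ) (v ^ k) (r ^ k) (r ^ d) ⟩
    N ξ * r ^ k * (c ^ k * v ^ k * r ^ d) ≤⟨ *-monoˡ-≤ (c ^ k * v ^ k * r ^ d) (hN ξ s) ⟩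
    g * (c ^ k * v ^ k * r ^ d) ≡⟨ cong (λ e → g * (e * r ^ d)) (sym (^-* k c v)) ⟩
    g * ((c * v) ^ k * r ^ d) ∎
    where
    k = ∣ ξ ∣
    d = ∣ X ∩ ∁ ξ ∣
  term : ∀ ξ → 𝟙 (ξ ⊑? X) * (𝟙 (m₀ ≤? ∣ ξ ∣) * (c ^ ∣ ξ ∣ * N ξ)) * V ≤ g * (𝟙 (ξ ⊑? X) * ((c * v) ^ ∣ ξ ∣ * r ^ ∣ X ∩ ∁ ξ ∣))
  term ξ with ξ ⊑? X | m₀ ≤? ∣ ξ ∣
  ... | no _ | _ = z≤n
  ... | yes s | no _ = z≤n
  ... | yes s | yes l = ≤-trans (≤-reflexive (cong (_* V) (trans (*-identityˡ (1 * (c ^ ∣ ξ ∣ * N ξ))) (*-identityˡ (c ^ ∣ ξ ∣ * N ξ)))))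
          (≤-trans (core ξ s l) (≤-reflexive (cong (g *_) (sym (*-identityˡ _)))))

tailK : ∀ {m} (X : Subset m) (N : Subset m → ℕ) (c v r g m₀ K : ℕ) → 1 ≤ v → 1 ≤ r → (∀ ξ → ξ ⊑ X → N ξ * r ^ ∣ ξ ∣ ≤ g) →
        K * (r + c * v) ^ ∣ X ∣ ≤ v ^ m₀ * r ^ ∣ X ∣ →
        K * Σ (subs m) (λ ξ → 𝟙 (ξ ⊑? X) * (𝟙 (m₀ ≤? ∣ ξ ∣) * (c ^ ∣ ξ ∣ * N ξ))) ≤ g
tailK {m} X N c v r g m₀ K v≥1 r≥1 hN hK = *-cancelʳ-≤ _ _ V {{m*n≢0 _ _ {{m^n≢0 v m₀ {{>-nonZero v≥1}}}} {{m^n≢0 r ∣ X ∣ {{>-nonZero r≥1}}}}}} (begin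
    K * S * V ≡⟨ *-assoc K S V ⟩
    K * (S * V) ≤⟨ *-monoʳ-≤ K (tail X N c v r g m₀ v≥1 hN) ⟩
    K * (g * (r + c * v) ^ ∣ X ∣) ≡⟨ a*bc≡b*ac K g ((r + c * v) ^ ∣ X ∣) ⟩
    g * (K * (r + c * v) ^ ∣ X ∣) ≤⟨ *-monoʳ-≤ g hK ⟩
    g * V ∎)
  where
  open ≤-Reasoning
  V = v ^ m₀ * r ^ ∣ X ∣
  S = Σ (subs m) (λ ξ → 𝟙 (ξ ⊑? X) * (𝟙 (m₀ ≤? ∣ ξ ∣) * (c ^ ∣ ξ ∣ * N ξ)))

-- Encoding of pairs with a large minimal fragment

-- The encoding argument for spread families, stated once for two rounds of colouring. `R` is the
-- region won so far, `H` the part of a member still to be covered, and `Rel ξ ω ω′` says that ω′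
-- arises from ω by adding ξ to the region. A pair is bad if every admissible remainder inside
-- `H ω A ∪ R ω` has at least `m₀` points outside the region. Recolouring changes neither `H` nor
-- `Valid`; given (ω′ , ξ), there are at most `c` choices of ω per point of ξ, and A is one of the
-- members above ξ.
module Fragment {m : ℕ} {Ω : Set} (Ωs : List Ω) (G : List (Subset m))
  (R : Ω → Subset m) (H : Ω → Subset m → Subset m)
  {Valid : Ω → Subset m → Set} (valid? : ∀ ω A → Dec (Valid ω A))
  (Rel : Subset m → Ω → Ω → Bool)
  (recolour : ∀ ξ ω → ∣ ξ ∩ R ω ∣ ≤ 0 → ∃[ ω′ ] (ω′ ∈ Ωs × Rel ξ ω ω′ ≡ true))
  (R-rec : ∀ ξ ω ω′ → Rel ξ ω ω′ ≡ true → ξ ⊑ R ω′ × R ω ⊑ R ω′)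
  (H-rec : ∀ ξ ω ω′ → Rel ξ ω ω′ ≡ true → ∀ A → H ω′ A ≡ H ω A)
  (V-rec : ∀ ξ ω ω′ → Rel ξ ω ω′ ≡ true → ∀ A → (Valid ω A → Valid ω′ A) × (Valid ω′ A → Valid ω A))
  (R-rec′ : ∀ ξ ω ω′ → Rel ξ ω ω′ ≡ true → ∣ R ω′ ∩ ∁ (R ω ∪ ξ) ∣ ≤ 0)
  (c : ℕ) (fibre : ∀ ξ ω′ → Σ Ωs (λ ω → b2n (Rel ξ ω ω′)) ≤ c ^ ∣ ξ ∣)
  (H⊑ : ∀ ω A → Valid ω A → H ω A ⊑ A)
  (ℓ : ℕ) (Hℓ : ∀ ω A → A ∈ G → Valid ω A → ∣ H ω A ∣ ≤ ℓ)
  (v r g m₀ K : ℕ) (v≥1 : 1 ≤ v) (r≥1 : 1 ≤ r)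
  (spread : ∀ ξ → Σ G (λ A → 𝟙 (ξ ⊑? A)) * r ^ ∣ ξ ∣ ≤ g)
  (num : ∀ x → x ≤ ℓ → K * (r + c * v) ^ x ≤ v ^ m₀ * r ^ x)
  where

  Bad : Ω → Subset m → Set
  Bad ω A = Valid ω A × (∀ B → B ∈ G → Valid ω B × H ω B ⊑ H ω A ∪ R ω → m₀ ≤ ∣ H ω B ∩ ∁ (R ω) ∣)

  bad? : ∀ ω A → Dec (Bad ω A)
  bad? ω A = valid? ω A ×-dec decAll′ (λ B → (valid? ω B ×-dec (H ω B ⊑? H ω A ∪ R ω)) →-dec (m₀ ≤? ∣ H ω B ∩ ∁ (R ω) ∣)) G

  inside? : ∀ ω B → Dec (Valid ω B × H ω B ⊑ R ω)
  inside? ω B = valid? ω B ×-dec (H ω B ⊑? R ω)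

  -- It depends on ω alone. This confines ξ, once ω is the recoloured colouring, to the subsets of a
  -- single set of size at most `ℓ`. The empty default never arises from a bad pair.
  chosen : Ω → Subset m
  chosen ω with dec∃ (inside? ω) G
  ... | inj₁ (B , _) = H ω B
  ... | inj₂ _ = Sub.⊥

  chosen-size : ∀ ω → ∣ chosen ω ∣ ≤ ℓ
  chosen-size ω with dec∃ (inside? ω) G
  ... | inj₁ (B , mB , val , _) = Hℓ ω B mB val
  ... | inj₂ _ = ≤-trans (≤-reflexive (Subₚ.∣⊥∣≡0 m)) z≤n

  chosen-spec : ∀ ω {B} → B ∈ G → Valid ω B → H ω B ⊑ R ω →
                ∃[ C ] (C ∈ G × Valid ω C × H ω C ⊑ R ω × chosen ω ≡ H ω C)
  chosen-spec ω mB vB hB with dec∃ (inside? ω) G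
  ... | inj₁ (C , mC , vC , hC) = C , mC , vC , hC , refl
  ... | inj₂ none = ⊥-elim (none _ mB (vB , hB))

  -- The minimal fragment ξ of a bad pair lies in the fragment chosen after recolouring it, by minimality.
  code : ∀ ω A → A ∈ G → Bad ω A →
         ∃[ ω′ ] (ω′ ∈ Ωs × ∃[ ξ ] (Rel ξ ω ω′ ≡ true × ξ ⊑ chosen ω′ × m₀ ≤ ∣ ξ ∣ × ξ ⊑ A))
  code ω A mA (vA , bad)
    with argminP (λ B → valid? ω B ×-dec (H ω B ⊑? H ω A ∪ R ω)) (λ B → ∣ H ω B ∩ ∁ (R ω) ∣) G A mA
           (vA , slin 2 0 (λ h r → ⊢ (∥ h ∩′ ∁′ (h ∪′ r) ∥ ≼ # 0)) (H ω A) (R ω))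
  ... | B , mB , (vB , hB) , min
    with recolour (H ω B ∩ ∁ (R ω)) ω (slin 2 0 (λ h r → ⊢ (∥ (h ∩′ ∁′ r) ∩′ r ∥ ≼ # 0)) (H ω B) (R ω))
  ... | ω′ , mω′ , rel
    with chosen-spec ω′ mB (proj₁ (V-rec _ ω ω′ rel B) vB)
           (subst (_⊑ R ω′) (sym (H-rec _ ω ω′ rel B))
             (slin 3 0 (λ h r r′ → (∥ (h ∩′ ∁′ r) ∩′ ∁′ r′ ∥ ≼ # 0) ⇒ (∥ r ∩′ ∁′ r′ ∥ ≼ # 0) ⇒ ⊢ (∥ h ∩′ ∁′ r′ ∥ ≼ # 0)) (H ω B) (R ω) (R ω′)
               (proj₁ (R-rec _ ω ω′ rel)) (proj₂ (R-rec _ ω ω′ rel))))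
  ... | C , mC , vC , hC , eq = ω′ , mω′ , ξ , rel , subst (ξ ⊑_) (sym eq) (subst (ξ ⊑_) (sym (H-rec _ ω ω′ rel C)) ξ⊑C)
        , bad B mB (vB , hB)
        , slin 4 0 (λ hb ha r a → (∥ hb ∩′ ∁′ (ha ∪′ r) ∥ ≼ # 0) ⇒ (∥ ha ∩′ ∁′ a ∥ ≼ # 0) ⇒ ⊢ (∥ (hb ∩′ ∁′ r) ∩′ ∁′ a ∥ ≼ # 0)) (H ω B) (H ω A) (R ω) A hB (H⊑ ω A vA)
    where
    ξ = H ω B ∩ ∁ (R ω)
    hC′ : H ω C ⊑ R ω ∪ ξ
    hC′ = slin 3 0 (λ h r′ u → (∥ h ∩′ ∁′ r′ ∥ ≼ # 0) ⇒ (∥ r′ ∩′ ∁′ u ∥ ≼ # 0) ⇒ ⊢ (∥ h ∩′ ∁′ u ∥ ≼ # 0)) (H ω C) (R ω′) (R ω ∪ ξ)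
            (subst (_⊑ R ω′) (H-rec _ ω ω′ rel C) hC) (R-rec′ ξ ω ω′ rel)
    vC′ : Valid ω C
    vC′ = proj₂ (V-rec _ ω ω′ rel C) vC
    le : ∣ ξ ∣ ≤ ∣ H ω C ∩ ∁ (R ω) ∣
    le = min C mC (vC′ , slin 4 0 (λ hc hb ha r → (∥ hc ∩′ ∁′ (r ∪′ (hb ∩′ ∁′ r)) ∥ ≼ # 0) ⇒ (∥ hb ∩′ ∁′ (ha ∪′ r) ∥ ≼ # 0) ⇒ ⊢ (∥ hc ∩′ ∁′ (ha ∪′ r) ∥ ≼ # 0))
           (H ω C) (H ω B) (H ω A) (R ω) hC′ hB)
    ξ⊑C : ξ ⊑ H ω C
    ξ⊑C = slin 3 0 (λ hc hb r → (∥ hc ∩′ ∁′ (r ∪′ (hb ∩′ ∁′ r)) ∥ ≼ # 0) ⇒ (∥ hb ∩′ ∁′ r ∥ ≼ ∥ hc ∩′ ∁′ r ∥) ⇒ ⊢ (∥ (hb ∩′ ∁′ r) ∩′ ∁′ hc ∥ ≼ # 0))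
            (H ω C) (H ω B) (R ω) hC′ le

  private
    a : Subset m → Ω → Ω → ℕ
    a ξ ω ω′ = b2n (Rel ξ ω ω′)
    b : Ω → Subset m → Subset m → ℕ
    b ω′ ξ A = 𝟙 (ξ ⊑? chosen ω′) * (𝟙 (m₀ ≤? ∣ ξ ∣) * 𝟙 (ξ ⊑? A))

    pair≤ : ∀ ω A → A ∈ G → 𝟙 (bad? ω A) ≤ Σ Ωs (λ ω′ → Σ (subs m) (λ ξ → a ξ ω ω′ * b ω′ ξ A))
    pair≤ ω A mA = 𝟙-if (bad? ω A) λ bad → let (ω′ , mω′ , ξ , rel , p , q , s) = code ω A mA bad in
      ≤-trans (one ω′ ξ rel p q s) (≤-trans (Σ-member (λ ξ → a ξ ω ω′ * b ω′ ξ A) (∈subs ξ)) (Σ-member (λ ω′ → Σ (subs m) (λ ξ → a ξ ω ω′ * b ω′ ξ A)) mω′))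
      where
      one : ∀ ω′ ξ → Rel ξ ω ω′ ≡ true → ξ ⊑ chosen ω′ → m₀ ≤ ∣ ξ ∣ → ξ ⊑ A → 1 ≤ a ξ ω ω′ * b ω′ ξ A
      one ω′ ξ rel p q s rewrite rel = *-mono-≤ {1} {1} ≤-refl (*-mono-≤ (𝟙-yes (ξ ⊑? chosen ω′) p) (*-mono-≤ (𝟙-yes (m₀ ≤? ∣ ξ ∣) q) (𝟙-yes (ξ ⊑? A) s)))

    Σb : ∀ ω′ ξ → Σ G (b ω′ ξ) ≡ 𝟙 (ξ ⊑? chosen ω′) * (𝟙 (m₀ ≤? ∣ ξ ∣) * Σ G (λ A → 𝟙 (ξ ⊑? A)))
    Σb ω′ ξ = trans (Σ-*ˡ G (𝟙 (ξ ⊑? chosen ω′)) _) (cong (𝟙 (ξ ⊑? chosen ω′) *_) (Σ-*ˡ G (𝟙 (m₀ ≤? ∣ ξ ∣)) _))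

    reorder : Σ Ωs (λ ω → Σ G (λ A → Σ Ωs (λ ω′ → Σ (subs m) (λ ξ → a ξ ω ω′ * b ω′ ξ A))))
            ≡ Σ Ωs (λ ω′ → Σ (subs m) (λ ξ → Σ Ωs (λ ω → a ξ ω ω′) * Σ G (b ω′ ξ)))
    reorder = begin
        Σ Ωs (λ ω → Σ G (λ A → Σ Ωs (λ ω′ → Σ (subs m) (λ ξ → a ξ ω ω′ * b ω′ ξ A))))
          ≡⟨ Σ-cong Ωs (λ ω → Σ-swap G Ωs _) ⟩
        Σ Ωs (λ ω → Σ Ωs (λ ω′ → Σ G (λ A → Σ (subs m) (λ ξ → a ξ ω ω′ * b ω′ ξ A))))
          ≡⟨ Σ-swap Ωs Ωs _ ⟩
        Σ Ωs (λ ω′ → Σ Ωs (λ ω → Σ G (λ A → Σ (subs m) (λ ξ → a ξ ω ω′ * b ω′ ξ A))))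
          ≡⟨ Σ-cong Ωs (λ ω′ → Σ-cong Ωs (λ ω → trans (Σ-swap G (subs m) _) (Σ-cong (subs m) (λ ξ → Σ-*ˡ G (a ξ ω ω′) (b ω′ ξ))))) ⟩
        Σ Ωs (λ ω′ → Σ Ωs (λ ω → Σ (subs m) (λ ξ → a ξ ω ω′ * Σ G (b ω′ ξ))))
          ≡⟨ Σ-cong Ωs (λ ω′ → trans (Σ-swap Ωs (subs m) _) (Σ-cong (subs m) (λ ξ → Σ-*ʳ Ωs (Σ G (b ω′ ξ)) (λ ω → a ξ ω ω′)))) ⟩
        Σ Ωs (λ ω′ → Σ (subs m) (λ ξ → Σ Ωs (λ ω → a ξ ω ω′) * Σ G (b ω′ ξ))) ∎
      where open ≡-Reasoning

  -- The sum runs over codes instead of pairs: for fixed ω′, the number of possible ω times the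
  -- degree of ξ is exactly the quantity bounded by `tailK`.
  few-bad : K * Σ Ωs (λ ω → Σ G (λ A → 𝟙 (bad? ω A))) ≤ length Ωs * g
  few-bad = begin
      K * Σ Ωs (λ ω → Σ G (λ A → 𝟙 (bad? ω A)))
        ≤⟨ *-monoʳ-≤ K (Σ-mono′ Ωs (λ ω → Σ-mono G (λ A mA → pair≤ ω A mA))) ⟩
      K * Σ Ωs (λ ω → Σ G (λ A → Σ Ωs (λ ω′ → Σ (subs m) (λ ξ → a ξ ω ω′ * b ω′ ξ A))))
        ≡⟨ cong (K *_) reorder ⟩
      K * Σ Ωs (λ ω′ → Σ (subs m) (λ ξ → Σ Ωs (λ ω → a ξ ω ω′) * Σ G (b ω′ ξ)))
        ≤⟨ *-monoʳ-≤ K (Σ-mono′ Ωs (λ ω′ → Σ-mono′ (subs m) (λ ξ → ≤-trans (*-mono-≤ (fibre ξ ω′) (≤-reflexive (Σb ω′ ξ))) (≤-reflexive (arr (c ^ ∣ ξ ∣) (𝟙 (ξ ⊑? chosen ω′)) (𝟙 (m₀ ≤? ∣ ξ ∣)) (Σ G (λ A → 𝟙 (ξ ⊑? A)))))))) ⟩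
      K * Σ Ωs (λ ω′ → Σ (subs m) (λ ξ → 𝟙 (ξ ⊑? chosen ω′) * (𝟙 (m₀ ≤? ∣ ξ ∣) * (c ^ ∣ ξ ∣ * Σ G (λ A → 𝟙 (ξ ⊑? A))))))
        ≡⟨ sym (Σ-*ˡ Ωs K _) ⟩
      Σ Ωs (λ ω′ → K * Σ (subs m) (λ ξ → 𝟙 (ξ ⊑? chosen ω′) * (𝟙 (m₀ ≤? ∣ ξ ∣) * (c ^ ∣ ξ ∣ * Σ G (λ A → 𝟙 (ξ ⊑? A))))))
        ≤⟨ Σ-≤const Ωs g (λ ω′ _ → tailK (chosen ω′) _ c v r g m₀ K v≥1 r≥1 (λ ξ _ → spread ξ) (num _ (chosen-size ω′))) ⟩
      length Ωs * g ∎
    where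
    open ≤-Reasoning
    arr : ∀ C x y z → C * (x * (y * z)) ≡ x * (y * (C * z))
    arr = solve-∀

-- A random colouring splits the ground set. Four colours: 0 is W, {0,1} is the part given to the first family, {2,3} the part of the second.

data Col : Set where
  c₀ c₁ c₂ c₃ : Col

cols : List Col
cols = c₀ ∷ c₁ ∷ c₂ ∷ c₃ ∷ []

isW isA isB : Col → Bool
isW c₀ = true
isW _ = false
isA c₀ = true
isA c₁ = true
isA _ = false
isB c = not (isA c)

-- The arguments are membership in ξ, the old colour and the new one. `rel₁` moves ξ into W and
-- forgets which of three colours each point had. `rel₂` moves ξ into the first part through `c₁`
-- only, so that W, on which the fragments of the second round depend, stays fixed.
rel₁ rel₂ : Bool → Col → Col → Bool
rel₁ true c₀ _ = false
rel₁ true _ c₀ = true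
rel₁ true _ _ = false
rel₁ false c₀ c₀ = true
rel₁ false c₁ c₁ = true
rel₁ false c₂ c₂ = true
rel₁ false c₃ c₃ = true
rel₁ false _ _ = false
rel₂ true c₂ c₁ = true
rel₂ true c₃ c₁ = true
rel₂ true _ _ = false
rel₂ false c d = rel₁ false c d

relV : (Bool → Col → Col → Bool) → ∀ {m} → Subset m → Vec Col m → Vec Col m → Bool
relV f [] [] [] = true
relV f (x ∷ ξ) (c ∷ ω) (d ∷ ω′) = f x c d ∧ relV f ξ ω ω′

b2n-∧ : ∀ a b → b2n (a ∧ b) ≡ b2n a * b2n b
b2n-∧ true b = sym (+-identityʳ _)
b2n-∧ false b = refl

relV-fibre : (f : Bool → Col → Col → Bool) → (∀ d → Σ cols (λ c → b2n (f true c d)) ≤ 3) → (∀ d → Σ cols (λ c → b2n (f false c d)) ≤ 1) →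
             ∀ {m} (ξ : Subset m) ω′ → Σ (words cols m) (λ ω → b2n (relV f ξ ω ω′)) ≤ 3 ^ ∣ ξ ∣
relV-fibre f h1 h0 {zero} [] [] = ≤-refl
relV-fibre f h1 h0 {suc m} (x ∷ ξ) (d ∷ ω′) = begin
    Σ (words cols (suc m)) (λ ω → b2n (relV f (x ∷ ξ) ω (d ∷ ω′))) ≡⟨ Σ-words cols m _ ⟩
    Σ cols (λ c → Σ (words cols m) (λ ω → b2n (f x c d ∧ relV f ξ ω ω′))) ≡⟨ Σ-cong cols (λ c → trans (Σ-cong (words cols m) (λ ω → b2n-∧ (f x c d) (relV f ξ ω ω′))) (Σ-*ˡ (words cols m) (b2n (f x c d)) _)) ⟩
    Σ cols (λ c → b2n (f x c d) * S) ≡⟨ Σ-*ʳ cols S (λ c → b2n (f x c d)) ⟩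
    Σ cols (λ c → b2n (f x c d)) * S ≤⟨ fin x ⟩
    3 ^ ∣ x ∷ ξ ∣ ∎
  where
  open ≤-Reasoning
  S = Σ (words cols m) (λ ω → b2n (relV f ξ ω ω′))
  ih : S ≤ 3 ^ ∣ ξ ∣
  ih = relV-fibre f h1 h0 ξ ω′
  fin : ∀ x → Σ cols (λ c → b2n (f x c d)) * S ≤ 3 ^ ∣ x ∷ ξ ∣
  fin true = *-mono-≤ (h1 d) ih
  fin false = ≤-trans (*-mono-≤ (h0 d) ih) (≤-reflexive (*-identityˡ _))

rel₁-fibre : ∀ {m} (ξ : Subset m) ω′ → Σ (words cols m) (λ ω → b2n (relV rel₁ ξ ω ω′)) ≤ 3 ^ ∣ ξ ∣
rel₁-fibre = relV-fibre rel₁ (λ { c₀ → ≤ᵇ⇒≤ 3 3 tt ; c₁ → z≤n ; c₂ → z≤n ; c₃ → z≤n }) (λ { c₀ → ≤-refl ; c₁ → ≤-refl ; c₂ → ≤-refl ; c₃ → ≤-refl })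

rel₂-fibre : ∀ {m} (ξ : Subset m) ω′ → Σ (words cols m) (λ ω → b2n (relV rel₂ ξ ω ω′)) ≤ 3 ^ ∣ ξ ∣
rel₂-fibre = relV-fibre rel₂ (λ { c₀ → z≤n ; c₁ → ≤ᵇ⇒≤ 2 3 tt ; c₂ → z≤n ; c₃ → z≤n }) (λ { c₀ → ≤-refl ; c₁ → ≤-refl ; c₂ → ≤-refl ; c₃ → ≤-refl })

region : (Col → Bool) → ∀ {m} → Vec Col m → Subset m
region f = Vec.map f

∧-true : ∀ {a b} → a ∧ b ≡ true → a ≡ true × b ≡ true
∧-true {true} {true} _ = refl , refl

rel₁-false : ∀ {c d} → rel₁ false c d ≡ true → c ≡ d
rel₁-false {c₀} {c₀} _ = refl
rel₁-false {c₁} {c₁} _ = refl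
rel₁-false {c₂} {c₂} _ = refl
rel₁-false {c₃} {c₃} _ = refl

rel₁-refl : ∀ c → rel₁ false c c ≡ true
rel₁-refl c₀ = refl
rel₁-refl c₁ = refl
rel₁-refl c₂ = refl
rel₁-refl c₃ = refl

rel₁-recolour : ∀ {m} (ξ : Subset m) ω → ∣ ξ ∩ region isW ω ∣ ≤ 0 → ∃[ ω′ ] (relV rel₁ ξ ω ω′ ≡ true)
rel₁-recolour [] [] h = [] , refl
rel₁-recolour (true ∷ ξ) (c₀ ∷ ω) ()
rel₁-recolour (true ∷ ξ) (c₁ ∷ ω) h with rel₁-recolour ξ ω h
... | ω′ , e = c₀ ∷ ω′ , e
rel₁-recolour (true ∷ ξ) (c₂ ∷ ω) h with rel₁-recolour ξ ω h
... | ω′ , e = c₀ ∷ ω′ , e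
rel₁-recolour (true ∷ ξ) (c₃ ∷ ω) h with rel₁-recolour ξ ω h
... | ω′ , e = c₀ ∷ ω′ , e
rel₁-recolour (false ∷ ξ) (c ∷ ω) h with rel₁-recolour ξ ω h
... | ω′ , e = c ∷ ω′ , trans (cong (_∧ relV rel₁ ξ ω ω′) (rel₁-refl c)) e

rel₂-recolour : ∀ {m} (ξ : Subset m) ω → ∣ ξ ∩ region isA ω ∣ ≤ 0 → ∃[ ω′ ] (relV rel₂ ξ ω ω′ ≡ true)
rel₂-recolour [] [] h = [] , refl
rel₂-recolour (true ∷ ξ) (c₀ ∷ ω) ()
rel₂-recolour (true ∷ ξ) (c₁ ∷ ω) ()
rel₂-recolour (true ∷ ξ) (c₂ ∷ ω) h with rel₂-recolour ξ ω h
... | ω′ , e = c₁ ∷ ω′ , e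
rel₂-recolour (true ∷ ξ) (c₃ ∷ ω) h with rel₂-recolour ξ ω h
... | ω′ , e = c₁ ∷ ω′ , e
rel₂-recolour (false ∷ ξ) (c ∷ ω) h with rel₂-recolour ξ ω h
... | ω′ , e = c ∷ ω′ , trans (cong (_∧ relV rel₂ ξ ω ω′) (rel₁-refl c)) e

rel₁-region : ∀ {m} (ξ : Subset m) ω ω′ → relV rel₁ ξ ω ω′ ≡ true → region isW ω′ ≡ region isW ω ∪ ξ
rel₁-region [] [] [] h = refl
rel₁-region (true ∷ ξ) (c ∷ ω) (d ∷ ω′) h with ∧-true {rel₁ true c d} h
rel₁-region (true ∷ ξ) (c₁ ∷ ω) (c₀ ∷ ω′) h | p , q = cong (true ∷_) (rel₁-region ξ ω ω′ q)
rel₁-region (true ∷ ξ) (c₂ ∷ ω) (c₀ ∷ ω′) h | p , q = cong (true ∷_) (rel₁-region ξ ω ω′ q)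
rel₁-region (true ∷ ξ) (c₃ ∷ ω) (c₀ ∷ ω′) h | p , q = cong (true ∷_) (rel₁-region ξ ω ω′ q)
rel₁-region (false ∷ ξ) (c ∷ ω) (d ∷ ω′) h with ∧-true {rel₁ false c d} h
... | p , q = cong₂ _∷_ (trans (cong isW (sym (rel₁-false {c} {d} p))) (sym (Data.Bool.Properties.∨-identityʳ (isW c)))) (rel₁-region ξ ω ω′ q)
  where import Data.Bool.Properties

rel₂-region : ∀ {m} (ξ : Subset m) ω ω′ → relV rel₂ ξ ω ω′ ≡ true → region isA ω′ ≡ region isA ω ∪ ξ × region isW ω′ ≡ region isW ω
rel₂-region [] [] [] h = refl , refl
rel₂-region (true ∷ ξ) (c ∷ ω) (d ∷ ω′) h with ∧-true {rel₂ true c d} h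
rel₂-region (true ∷ ξ) (c₂ ∷ ω) (c₁ ∷ ω′) h | p , q = let (u , w) = rel₂-region ξ ω ω′ q in cong (true ∷_) u , cong (false ∷_) w
rel₂-region (true ∷ ξ) (c₃ ∷ ω) (c₁ ∷ ω′) h | p , q = let (u , w) = rel₂-region ξ ω ω′ q in cong (true ∷_) u , cong (false ∷_) w
rel₂-region (false ∷ ξ) (c ∷ ω) (d ∷ ω′) h with ∧-true {rel₁ false c d} h
... | p , q = let (u , w) = rel₂-region ξ ω ω′ q in
  cong₂ _∷_ (trans (cong isA (sym (rel₁-false {c} {d} p))) (sym (Data.Bool.Properties.∨-identityʳ (isA c)))) u , cong₂ _∷_ (cong isW (sym (rel₁-false {c} {d} p))) w
  where import Data.Bool.Properties

cols-complete : ∀ c → c ∈ cols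
cols-complete c₀ = here refl
cols-complete c₁ = there (here refl)
cols-complete c₂ = there (there (here refl))
cols-complete c₃ = there (there (there (here refl)))

W⊑A : ∀ {m} (ω : Vec Col m) → region isW ω ⊑ region isA ω
W⊑A [] = z≤n
W⊑A (c₀ ∷ ω) = W⊑A ω
W⊑A (c₁ ∷ ω) = W⊑A ω
W⊑A (c₂ ∷ ω) = W⊑A ω
W⊑A (c₃ ∷ ω) = W⊑A ω

-- An involution exchanging the two parts; it transports the estimate for the first part to the
-- second family.
swapCol : Col → Col
swapCol c₀ = c₂
swapCol c₁ = c₃
swapCol c₂ = c₀
swapCol c₃ = c₁

Σ-swapCol : ∀ m (f : Vec Col m → ℕ) → Σ (words cols m) (λ ω → f (Vec.map swapCol ω)) ≡ Σ (words cols m) f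
Σ-swapCol zero f = refl
Σ-swapCol (suc m) f = trans (Σ-words cols m _) (trans (Σ-cong cols (λ c → Σ-swapCol m (λ ω → f (swapCol c ∷ ω))))
   (trans (lem (g c₂) (g c₃) (g c₀) (g c₁)) (sym (Σ-words cols m f))))
  where
  g : Col → ℕ
  g c = Σ (words cols m) (λ ω → f (c ∷ ω))
  lem : ∀ a b c d → a + (b + (c + (d + 0))) ≡ c + (d + (a + (b + 0)))
  lem = solve-∀

region-swap : ∀ {m} (ω : Vec Col m) → region isA (Vec.map swapCol ω) ≡ region isB ω
region-swap [] = refl
region-swap (c₀ ∷ ω) = cong (_ ∷_) (region-swap ω)
region-swap (c₁ ∷ ω) = cong (_ ∷_) (region-swap ω)
region-swap (c₂ ∷ ω) = cong (_ ∷_) (region-swap ω)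
region-swap (c₃ ∷ ω) = cong (_ ∷_) (region-swap ω)

AB-disjoint : ∀ {m} (ω : Vec Col m) → ∣ region isA ω ∩ region isB ω ∣ ≤ 0
AB-disjoint [] = z≤n
AB-disjoint (c₀ ∷ ω) = AB-disjoint ω
AB-disjoint (c₁ ∷ ω) = AB-disjoint ω
AB-disjoint (c₂ ∷ ω) = AB-disjoint ω
AB-disjoint (c₃ ∷ ω) = AB-disjoint ω

-- Disjoint members of two spread families

-- One round cannot cover a member of size n completely when r is below n. The first round, inside
-- W, leaves fragments of at most h + 3 points, and for sets this small a second round leaves
-- nothing over. The factor 2 in `spread` is room for the trimming done in `Cut`.
module Half {m : ℕ} (G : List (Subset m)) (r z h n : ℕ) (nonempty : 1 ≤ length G)
  (sizes : ∀ A → A ∈ G → ∣ A ∣ ≤ n)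
  (spread : ∀ ξ → Σ G (λ A → 𝟙 (ξ ⊑? A)) * r ^ ∣ ξ ∣ ≤ 2 * length G)
  (r≥1 : 1 ≤ r) (zr : Scaled 24 z r) (n≤ : n ≤ z * h) (hr : Scaled 384 (h + 3) r) where

  private
    m₁ = h + 3
    Ω = Vec Col m
    Ωs = words cols m
    g = 2 * length G

    -- Here v = 4: `growth*` costs 2^h, and 16 * 2^h is at most 4^(h + 3). In `num₂`, v = 64: the h
    -- + 3 points form one block of growth and cost a single factor 2, and 16 * 2 ≤ 64.
    num₁ : ∀ x → x ≤ n → 16 * (r + 3 * 4) ^ x ≤ 4 ^ m₁ * r ^ x
    num₁ x x≤ = begin
      16 * (r + 12) ^ x ≤⟨ *-monoʳ-≤ 16 (growth* r 12 z h x r≥1 (≤-trans (≤-reflexive (lem z)) (unscaled zr)) (≤-trans x≤ n≤)) ⟩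
      16 * (2 ^ h * r ^ x) ≡⟨ sym (*-assoc 16 (2 ^ h) (r ^ x)) ⟩
      16 * 2 ^ h * r ^ x ≤⟨ *-monoˡ-≤ (r ^ x) (*-mono-≤ {16} {64} (≤ᵇ⇒≤ 16 64 tt) (^-monoˡ-≤ h (≤ᵇ⇒≤ 2 4 tt))) ⟩
      64 * 4 ^ h * r ^ x ≡⟨ cong (_* r ^ x) (trans (*-comm 64 (4 ^ h)) (sym (^-distribˡ-+-* 4 h 3))) ⟩
      4 ^ (h + 3) * r ^ x ∎
      where
      open ≤-Reasoning
      lem : ∀ z → 2 * (z * 12) ≡ 24 * z
      lem = solve-∀

    num₂ : ∀ x → x ≤ m₁ → 16 * (r + 3 * 64) ^ x ≤ 64 ^ 1 * r ^ x
    num₂ x x≤ = begin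
      16 * (r + 192) ^ x ≤⟨ *-monoʳ-≤ 16 (growth* r 192 m₁ 1 x r≥1 (≤-trans (≤-reflexive (lem m₁)) (unscaled hr)) (≤-trans x≤ (≤-reflexive (sym (*-identityʳ m₁))))) ⟩
      16 * (2 * r ^ x) ≡⟨ sym (*-assoc 16 2 (r ^ x)) ⟩
      32 * r ^ x ≤⟨ *-monoˡ-≤ (r ^ x) (≤ᵇ⇒≤ 32 64 tt) ⟩
      64 * r ^ x ∎
      where
      open ≤-Reasoning
      lem : ∀ z → 2 * (z * 192) ≡ 384 * z
      lem = solve-∀

    W : Ω → Subset m
    W = region isW

    recolour₁ : ∀ ξ ω → ∣ ξ ∩ W ω ∣ ≤ 0 → ∃[ ω′ ] (ω′ ∈ Ωs × relV rel₁ ξ ω ω′ ≡ true)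
    recolour₁ ξ ω d = let (ω′ , e) = rel₁-recolour ξ ω d in ω′ , words-complete cols cols-complete ω′ , e

    region₁ : ∀ ξ ω ω′ → relV rel₁ ξ ω ω′ ≡ true → ξ ⊑ W ω′ × W ω ⊑ W ω′
    region₁ ξ ω ω′ e = subst (ξ ⊑_) (sym (rel₁-region ξ ω ω′ e)) (slin 2 0 (λ x w → ⊢ (∥ x ∩′ ∁′ (w ∪′ x) ∥ ≼ # 0)) ξ (W ω))
                     , subst (W ω ⊑_) (sym (rel₁-region ξ ω ω′ e)) (slin 2 0 (λ x w → ⊢ (∥ w ∩′ ∁′ (w ∪′ x) ∥ ≼ # 0)) ξ (W ω))

    region₁′ : ∀ ξ ω ω′ → relV rel₁ ξ ω ω′ ≡ true → W ω′ ⊑ W ω ∪ ξ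
    region₁′ ξ ω ω′ e = subst (_⊑ W ω ∪ ξ) (sym (rel₁-region ξ ω ω′ e)) (⊑-refl (W ω ∪ ξ))

    module F₁ = Fragment Ωs G W (λ _ A → A) {λ _ _ → ⊤} (λ _ _ → yes tt) (relV rel₁) recolour₁ region₁
      (λ _ _ _ _ _ → refl) (λ _ _ _ _ _ → id , id) region₁′
      3 rel₁-fibre (λ _ A _ → ⊑-refl A) n (λ _ A mA _ → sizes A mA) 4 r g m₁ 16 (s≤s z≤n) r≥1 spread num₁

    Good : Subset m → Subset m → Subset m → Set
    Good w A B = B ⊑ A ∪ w × ∣ B ∩ ∁ w ∣ ≤ m₁

    good? : ∀ w A B → Dec (Good w A B)
    good? w A B = (B ⊑? A ∪ w) ×-dec (∣ B ∩ ∁ w ∣ ≤? m₁)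

    Short : Subset m → Subset m → Set
    Short w A = ∃[ B ] (B ∈ G × Good w A B)

    short? : ∀ w A → Dec (Short w A)
    short? w A = dec∃′ (good? w A) G

    -- The fragment is a function of the set w and not of the colouring, so a recolouring that
    -- leaves W alone leaves it alone.
    frag : Subset m → Subset m → Subset m
    frag w A with short? w A
    ... | yes (B , _) = B ∩ ∁ w
    ... | no _ = A

    frag-spec : ∀ w A → Short w A → ∃[ B ] (B ∈ G × Good w A B × frag w A ≡ B ∩ ∁ w)
    frag-spec w A s with short? w A
    ... | yes (B , mB , gB) = B , mB , gB , refl
    ... | no ¬s = ⊥-elim (¬s s)

    frag⊑ : ∀ w A → Short w A → frag w A ⊑ A
    frag⊑ w A s with frag-spec w A s
    ... | B , mB , (gB , _) , e = subst (_⊑ A) (sym e) (slin 3 0 (λ b a w → (∥ b ∩′ ∁′ (a ∪′ w) ∥ ≼ # 0) ⇒ ⊢ (∥ (b ∩′ ∁′ w) ∩′ ∁′ a ∥ ≼ # 0)) B A w gB)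

    frag-size : ∀ w A → Short w A → ∣ frag w A ∣ ≤ m₁
    frag-size w A s with frag-spec w A s
    ... | B , mB , (_ , gB) , e = subst (λ f → ∣ f ∣ ≤ m₁) (sym e) gB

    aR : Ω → Subset m
    aR = region isA

    recolour₂ : ∀ ξ ω → ∣ ξ ∩ aR ω ∣ ≤ 0 → ∃[ ω′ ] (ω′ ∈ Ωs × relV rel₂ ξ ω ω′ ≡ true)
    recolour₂ ξ ω d = let (ω′ , e) = rel₂-recolour ξ ω d in ω′ , words-complete cols cols-complete ω′ , e

    region₂ : ∀ ξ ω ω′ → relV rel₂ ξ ω ω′ ≡ true → ξ ⊑ aR ω′ × aR ω ⊑ aR ω′
    region₂ ξ ω ω′ e = subst (ξ ⊑_) (sym (proj₁ (rel₂-region ξ ω ω′ e))) (slin 2 0 (λ x w → ⊢ (∥ x ∩′ ∁′ (w ∪′ x) ∥ ≼ # 0)) ξ (aR ω))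
                     , subst (aR ω ⊑_) (sym (proj₁ (rel₂-region ξ ω ω′ e))) (slin 2 0 (λ x w → ⊢ (∥ w ∩′ ∁′ (w ∪′ x) ∥ ≼ # 0)) ξ (aR ω))

    region₂′ : ∀ ξ ω ω′ → relV rel₂ ξ ω ω′ ≡ true → aR ω′ ⊑ aR ω ∪ ξ
    region₂′ ξ ω ω′ e = subst (_⊑ aR ω ∪ ξ) (sym (proj₁ (rel₂-region ξ ω ω′ e))) (⊑-refl (aR ω ∪ ξ))

    same-frag : ∀ ξ ω ω′ → relV rel₂ ξ ω ω′ ≡ true → ∀ A → frag (W ω′) A ≡ frag (W ω) A
    same-frag ξ ω ω′ e A = cong (λ w → frag w A) (proj₂ (rel₂-region ξ ω ω′ e))

    same-short : ∀ ξ ω ω′ → relV rel₂ ξ ω ω′ ≡ true → ∀ A → (Short (W ω) A → Short (W ω′) A) × (Short (W ω′) A → Short (W ω) A)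
    same-short ξ ω ω′ e A = subst (λ w → Short w A) (sym (proj₂ (rel₂-region ξ ω ω′ e))) , subst (λ w → Short w A) (proj₂ (rel₂-region ξ ω ω′ e))

    module F₂ = Fragment Ωs G aR (λ ω → frag (W ω)) {λ ω → Short (W ω)} (λ ω → short? (W ω)) (relV rel₂) recolour₂ region₂
      same-frag same-short region₂′
      3 rel₂-fibre (λ ω A s → frag⊑ (W ω) A s) m₁ (λ ω A _ s → frag-size (W ω) A s) 64 r g 1 16 (s≤s z≤n) r≥1 spread num₂

  Miss : Vec Col m → Set
  Miss ω = ∀ A → A ∈ G → ¬ (A ⊑ region isA ω)

  miss? : ∀ ω → Dec (Miss ω)
  miss? ω = decAll′ (λ A → ¬? (A ⊑? aR ω)) G

  private
    -- If A is not bad in the first round, it has a short fragment. If a fragment then lay inside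
    -- the first part, so would the whole member it comes from, because the points of that member in
    -- W belong to this part anyway.
    dichotomy : ∀ ω A → A ∈ G → Miss ω → 1 ≤ 𝟙 (F₁.bad? ω A) + 𝟙 (F₂.bad? ω A)
    dichotomy ω A mA miss = 𝟙-or (F₁.bad? ω A) (F₂.bad? ω A) (λ ¬bad₁ → short ¬bad₁ , bad₂)
      where
      short : ¬ F₁.Bad ω A → Short (W ω) A
      short ¬bad₁ = [ id , (λ none → ⊥-elim (¬bad₁ (tt , λ B mB (_ , B⊑) → <⇒≤ (≰⇒> (λ le → none B mB (B⊑ , le)))))) ]′ (dec∃ (good? (W ω) A) G)
      bad₂ : ∀ C → C ∈ G → Short (W ω) C × frag (W ω) C ⊑ frag (W ω) A ∪ aR ω → 1 ≤ ∣ frag (W ω) C ∩ ∁ (aR ω) ∣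
      bad₂ C mC (sC , _) = let (B , mB , gB , e) = frag-spec (W ω) C sC in
        ≰⇒> λ le → miss B mB (slin 3 0 (λ b w a → (∥ (b ∩′ ∁′ w) ∩′ ∁′ a ∥ ≼ # 0) ⇒ (∥ w ∩′ ∁′ a ∥ ≼ # 0) ⇒ ⊢ (∥ b ∩′ ∁′ a ∥ ≼ # 0))
                B (W ω) (aR ω) (subst (λ f → ∣ f ∩ ∁ (aR ω) ∣ ≤ 0) e le) (W⊑A ω))

  -- A miss makes every member bad in one of the two rounds, and each round has at most |Ω| * 2 |G|
  -- / 16 bad pairs.
  few-miss : 4 * Σ Ωs (λ ω → 𝟙 (miss? ω)) ≤ length Ωs
  few-miss = *-cancelʳ-≤ _ _ (4 * length G) {{>-nonZero (*-mono-≤ {1} {4} (s≤s z≤n) nonempty)}} (begin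
      4 * M * (4 * length G) ≡⟨ lem M (length G) ⟩
      16 * (M * length G) ≤⟨ *-monoʳ-≤ 16 step ⟩
      16 * (B₁ + B₂) ≡⟨ *-distribˡ-+ 16 B₁ B₂ ⟩
      16 * B₁ + 16 * B₂ ≤⟨ +-mono-≤ F₁.few-bad F₂.few-bad ⟩
      length Ωs * g + length Ωs * g ≡⟨ lem₂ (length Ωs) (length G) ⟩
      length Ωs * (4 * length G) ∎)
    where
    open ≤-Reasoning
    M = Σ Ωs (λ ω → 𝟙 (miss? ω))
    B₁ = Σ Ωs (λ ω → Σ G (λ A → 𝟙 (F₁.bad? ω A)))
    B₂ = Σ Ωs (λ ω → Σ G (λ A → 𝟙 (F₂.bad? ω A)))
    lem : ∀ M l → 4 * M * (4 * l) ≡ 16 * (M * l)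
    lem = solve-∀
    lem₂ : ∀ a l → a * (2 * l) + a * (2 * l) ≡ a * (4 * l)
    lem₂ = solve-∀
    inner : ∀ ω → 𝟙 (miss? ω) * length G ≤ Σ G (λ A → 𝟙 (F₁.bad? ω A)) + Σ G (λ A → 𝟙 (F₂.bad? ω A))
    inner ω = 𝟙*-≤ (miss? ω) λ miss → ≤-trans (≤-reflexive (sym (Σ-1 G)))
      (≤-trans (Σ-mono G (λ A mA → dichotomy ω A mA miss)) (≤-reflexive (Σ-+ G (λ A → 𝟙 (F₁.bad? ω A)) (λ A → 𝟙 (F₂.bad? ω A)))))
    step : M * length G ≤ B₁ + B₂
    step = ≤-trans (≤-reflexive (sym (Σ-*ʳ Ωs (length G) (λ ω → 𝟙 (miss? ω)))))
      (≤-trans (Σ-mono′ Ωs inner) (≤-reflexive (Σ-+ Ωs (λ ω → Σ G (λ A → 𝟙 (F₁.bad? ω A))) (λ ω → Σ G (λ A → 𝟙 (F₂.bad? ω A))))))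

-- Each family misses its part for at most a quarter of the colourings, so some colouring serves
-- both, and the two parts are disjoint.
disjoint-members : ∀ {m} (G₁ G₂ : List (Subset m)) (r z h n : ℕ) → 1 ≤ length G₁ → 1 ≤ length G₂ →
  (∀ A → A ∈ G₁ → ∣ A ∣ ≤ n) → (∀ A → A ∈ G₂ → ∣ A ∣ ≤ n) →
  (∀ ξ → Σ G₁ (λ A → 𝟙 (ξ ⊑? A)) * r ^ ∣ ξ ∣ ≤ 2 * length G₁) →
  (∀ ξ → Σ G₂ (λ A → 𝟙 (ξ ⊑? A)) * r ^ ∣ ξ ∣ ≤ 2 * length G₂) →
  1 ≤ r → Scaled 24 z r → n ≤ z * h → Scaled 384 (h + 3) r →
  ∃[ A ] ∃[ B ] (A ∈ G₁ × B ∈ G₂ × ∣ A ∩ B ∣ ≤ 0)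
disjoint-members {m} G₁ G₂ r z h n ne₁ ne₂ s₁ s₂ sp₁ sp₂ r≥1 zr n≤ hr =
    [ (λ (ω , _ , ¬m₁ , ¬m₂) → get ω ¬m₁ ¬m₂ (dec∃ (λ A → A ⊑? region isA ω) G₁) (dec∃ (λ B → B ⊑? region isA (Vec.map swapCol ω)) G₂))
    , (λ none → ⊥-elim (<-irrefl refl (<-≤-trans pos (small none)))) ]′ (dec∃ (λ ω → ¬? (H₁.miss? ω) ×-dec ¬? (H₂.miss? (Vec.map swapCol ω))) (words cols m))
  where
  module H₁ = Half G₁ r z h n ne₁ s₁ sp₁ r≥1 zr n≤ hr
  module H₂ = Half G₂ r z h n ne₂ s₂ sp₂ r≥1 zr n≤ hr
  get : ∀ ω → ¬ H₁.Miss ω → ¬ H₂.Miss (Vec.map swapCol ω) → _ ⊎ _ → _ ⊎ _ → ∃[ A ] ∃[ B ] (A ∈ G₁ × B ∈ G₂ × ∣ A ∩ B ∣ ≤ 0)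
  get ω ¬m₁ ¬m₂ (inj₂ no₁) _ = ⊥-elim (¬m₁ no₁)
  get ω ¬m₁ ¬m₂ _ (inj₂ no₂) = ⊥-elim (¬m₂ no₂)
  get ω ¬m₁ ¬m₂ (inj₁ (A , mA , A⊑)) (inj₁ (B , mB , B⊑)) = A , B , mA , mB ,
    slin 4 0 (λ a b x y → (∥ a ∩′ ∁′ x ∥ ≼ # 0) ⇒ (∥ b ∩′ ∁′ y ∥ ≼ # 0) ⇒ (∥ x ∩′ y ∥ ≼ # 0) ⇒ ⊢ (∥ a ∩′ b ∥ ≼ # 0))
      A B (region isA ω) (region isB ω) A⊑ (subst (B ⊑_) (region-swap ω) B⊑) (AB-disjoint ω)
  L = length (words cols m)
  M₁ = Σ (words cols m) (λ ω → 𝟙 (H₁.miss? ω))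
  M₂ = Σ (words cols m) (λ ω → 𝟙 (H₂.miss? ω))
  pos : 0 < 4 * L
  pos = *-mono-≤ {1} {4} (s≤s z≤n) (≤-trans (Σ-member (λ _ → 1) (words-complete cols cols-complete (Vec.replicate m c₀))) (≤-reflexive (Σ-1 (words cols m))))
  module _ (none : ∀ ω → ω ∈ words cols m → ¬ (¬ H₁.Miss ω × ¬ H₂.Miss (Vec.map swapCol ω))) where
    one : ∀ ω → ω ∈ words cols m → 1 ≤ 𝟙 (H₁.miss? ω) + 𝟙 (H₂.miss? (Vec.map swapCol ω))
    one ω mω = 𝟙-or (H₁.miss? ω) (H₂.miss? (Vec.map swapCol ω)) (λ ¬m₁ → decidable-stable (H₂.miss? (Vec.map swapCol ω)) (λ ¬m₂ → none ω mω (¬m₁ , ¬m₂)))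
    all : L ≤ M₁ + M₂
    all = ≤-trans (≤-reflexive (sym (Σ-1 (words cols m)))) (≤-trans (Σ-mono (words cols m) one)
      (≤-reflexive (trans (Σ-+ (words cols m) _ _) (cong (M₁ +_) (Σ-swapCol m (λ ω → 𝟙 (H₂.miss? ω)))))))
    small : 4 * L ≤ 0
    small = lin 3 (λ l a b → (8 ⋆ l ≼ 8 ⋆ (a ⊹ b)) ⇒ (8 ⋆ a ≼ 2 ⋆ l) ⇒ (8 ⋆ b ≼ 2 ⋆ l) ⇒ ⊢ (4 ⋆ l ≼ # 0)) L M₁ M₂ (*-monoʳ-≤ 8 all) (quarter M₁ H₁.few-miss) (quarter M₂ H₂.few-miss)
      where
      quarter : ∀ a → 4 * a ≤ L → 8 * a ≤ 2 * L
      quarter a h = lin 2 (λ a l → (4 ⋆ a ≼ l) ⇒ (4 ⋆ a ≼ l) ⇒ ⊢ (8 ⋆ a ≼ 2 ⋆ l)) a L h h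

-- Sets with spread links over a t-intersecting family

module _ {A : Set} {P : A → Set} (P? : ∀ x → Dec (P x)) where
  Σ-filter : (xs : List A) (f : A → ℕ) → Σ (List.filter P? xs) f ≡ Σ xs (λ x → 𝟙 (P? x) * f x)
  Σ-filter [] f = refl
  Σ-filter (x ∷ xs) f with P? x
  ... | yes p = cong₂ _+_ (sym (+-identityʳ (f x))) (Σ-filter xs f)
  ... | no ¬p = Σ-filter xs f

  length-filter : (xs : List A) → length (List.filter P? xs) ≡ Σ xs (λ x → 𝟙 (P? x))
  length-filter xs = trans (sym (Σ-1 (List.filter P? xs))) (trans (Σ-filter xs (λ _ → 1)) (Σ-cong xs (λ x → *-identityʳ (𝟙 (P? x)))))

cnt : ∀ {m} → List (Subset m) → Subset m → ℕ
cnt G X = Σ G (λ A → 𝟙 (X ⊑? A))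

TInt : ∀ {m} → ℕ → List (Subset m) → Set
TInt t F = ∀ A B → A ∈ F → B ∈ F → t ≤ ∣ A ∩ B ∣

-- Every member of `fam` contains S, so in `links` only the points of X outside S can reduce the
-- count.
record Spread {m : ℕ} (F : List (Subset m)) (r : ℕ) (S : Subset m) : Set where
  field
    fam : List (Subset m)
    fam⊆ : ∀ A → A ∈ fam → A ∈ F
    fam≥1 : 1 ≤ length fam
    above : ∀ A → A ∈ fam → S ⊑ A
    links : ∀ X → cnt fam X * r ^ ∣ X ∩ ∁ S ∣ ≤ length fam

half : ∀ u → ∃[ h ] (u ≤ 2 * h × 2 * h ≤ u + 1)
half zero = 0 , z≤n , z≤n
half (suc zero) = 1 , s≤s z≤n , ≤-refl
half (suc (suc u)) with half u
... | h , a , b = suc h , lin 2 (λ u h → (u ≼ 2 ⋆ h) ⇒ ⊢ (# 2 ⊹ u ≼ 2 ⋆ (# 1 ⊹ h))) u h a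
                , lin 2 (λ u h → (2 ⋆ h ≼ u ⊹ # 1) ⇒ ⊢ (2 ⋆ (# 1 ⊹ h) ≼ # 2 ⊹ u ⊹ # 1)) u h b

module Meet {m : ℕ} (F : List (Subset m)) (t q n r z h : ℕ)
  (tint : TInt t F) (sizes : ∀ A → A ∈ F → ∣ A ∣ ≤ n)
  (r≥16 : 16 ≤ r) (qr : Scaled 32 q r) (zr : Scaled 24 z r) (n≤ : n ≤ z * h) (hr : Scaled 384 (h + 3) r) where

  private
    r≥1 : 1 ≤ r
    r≥1 = ≤-trans (s≤s z≤n) r≥16

    -- Here u may exceed r by far. The first q factors are controlled by `growth`; the remaining
    -- ones, at most 2k, are bounded by 2r each, and 16^k pays for their 4^k together with the
    -- constant 4.
    num : ∀ u k x → 1 ≤ k → u ≤ 2 * k → x ≤ q + u → 2 * (r + 1 * 16) ^ x ≤ 16 ^ k * r ^ x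
    num u k x k≥1 u≤ x≤ = begin
        2 * (r + 16) ^ x ≡⟨ cong (λ e → 2 * (r + 16) ^ e) (sym (m⊓n+n∸m≡n q x)) ⟩
        2 * (r + 16) ^ (x₁ + x₂) ≡⟨ cong (2 *_) (^-distribˡ-+-* (r + 16) x₁ x₂) ⟩
        2 * ((r + 16) ^ x₁ * (r + 16) ^ x₂) ≤⟨ *-monoʳ-≤ 2 (*-mono-≤ (growth r 16 x₁ r≥1 g₁) g₂) ⟩
        2 * (2 * r ^ x₁ * (4 ^ k * r ^ x₂)) ≡⟨ lem (r ^ x₁) (4 ^ k) (r ^ x₂) ⟩
        4 * 4 ^ k * (r ^ x₁ * r ^ x₂) ≤⟨ *-monoˡ-≤ (r ^ x₁ * r ^ x₂) (*-monoˡ-≤ (4 ^ k) (^-monoʳ-≤ 4 {1} {k} k≥1)) ⟩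
        4 ^ k * 4 ^ k * (r ^ x₁ * r ^ x₂) ≡⟨ cong₂ _*_ (sym (pw k)) (sym (^-distribˡ-+-* r x₁ x₂)) ⟩
        16 ^ k * r ^ (x₁ + x₂) ≡⟨ cong (λ e → 16 ^ k * r ^ e) (m⊓n+n∸m≡n q x) ⟩
        16 ^ k * r ^ x ∎
      where
      open ≤-Reasoning
      x₁ = q ⊓ x
      x₂ = x ∸ q
      lem : ∀ a b c → 2 * (2 * a * (b * c)) ≡ 4 * b * (a * c)
      lem = solve-∀
      pw : ∀ k → 16 ^ k ≡ 4 ^ k * 4 ^ k
      pw zero = refl
      pw (suc k) = trans (cong (16 *_) (pw k)) (lem₂ (4 ^ k))
        where
        lem₂ : ∀ a → 16 * (a * a) ≡ 4 * a * (4 * a)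
        lem₂ = solve-∀
      g₁ : 2 * (x₁ * 16) ≤ r
      g₁ = ≤-trans (≤-reflexive (lem₃ x₁)) (≤-trans (*-monoʳ-≤ 32 (m⊓n≤m q x)) (unscaled qr))
        where
        lem₃ : ∀ a → 2 * (a * 16) ≡ 32 * a
        lem₃ = solve-∀
      x₂≤ : x₂ ≤ 2 * k
      x₂≤ = ≤-trans (≤-trans (∸-monoˡ-≤ q x≤) (≤-reflexive (m+n∸m≡n q u))) u≤
      g₂ : (r + 16) ^ x₂ ≤ 4 ^ k * r ^ x₂
      g₂ = begin
        (r + 16) ^ x₂ ≤⟨ ^-monoˡ-≤ x₂ (+-monoʳ-≤ r (≤-trans r≥16 (m≤m+n r 0))) ⟩
        (2 * r) ^ x₂ ≡⟨ ^-* x₂ 2 r ⟩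
        2 ^ x₂ * r ^ x₂ ≤⟨ *-monoˡ-≤ (r ^ x₂) (≤-trans (^-monoʳ-≤ 2 x₂≤) (≤-reflexive (sym (^-*-assoc 2 2 k)))) ⟩
        4 ^ k * r ^ x₂ ∎
        where
        ^-* : ∀ h a b → (a * b) ^ h ≡ a ^ h * b ^ h
        ^-* zero a b = refl
        ^-* (suc h) a b rewrite ^-* h a b = [m*n]*[o*p]≡[m*o]*[n*p] a b (a ^ h) (b ^ h)

  -- Prepares a spread family for `disjoint-members`. Members with k or more points in T outside S
  -- are dropped, which are at most half of them, and the points of U are deleted from the others.
  -- Members disjoint after this can meet only inside U, where k limits them.
  module Cut {S : Subset m} (sp : Spread F r S) (T U : Subset m) (S⊑U : S ⊑ U) (u k : ℕ) (k≥1 : 1 ≤ k) (u≤ : u ≤ 2 * k) (T≤ : ∣ T ∩ ∁ S ∣ ≤ q + u) where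
    open Spread sp
    X = T ∩ ∁ S

    small? : ∀ A → Dec (¬ (k ≤ ∣ A ∩ X ∣))
    small? A = ¬? (k ≤? ∣ A ∩ X ∣)

    G′ = List.filter small? fam
    G″ = List.map (_∩ ∁ U) G′

    private
      big : ℕ
      big = Σ fam (λ A → 𝟙 (k ≤? ∣ A ∩ X ∣))

      big≤ : 2 * big ≤ length fam
      big≤ = ≤-trans (*-monoʳ-≤ 2 step) (tailK X (cnt fam) 1 16 r (length fam) k 2 (s≤s z≤n) r≥1 hyp (num u k ∣ X ∣ k≥1 u≤ T≤))
        where
        hyp : ∀ ξ → ξ ⊑ X → cnt fam ξ * r ^ ∣ ξ ∣ ≤ length fam
        hyp ξ s = ≤-trans (*-monoʳ-≤ (cnt fam ξ) (^-monoʳ-≤ r {{>-nonZero r≥1}}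
          (slin 3 0 (λ x t s → (∥ x ∩′ ∁′ (t ∩′ ∁′ s) ∥ ≼ # 0) ⇒ ⊢ (∥ x ∥ ≼ ∥ x ∩′ ∁′ s ∥)) ξ T S s))) (links ξ)
        step : big ≤ Σ (subs m) (λ ξ → 𝟙 (ξ ⊑? X) * (𝟙 (k ≤? ∣ ξ ∣) * (1 ^ ∣ ξ ∣ * cnt fam ξ)))
        step = begin
          big ≤⟨ Σ-mono′ fam (λ A → 𝟙-if (k ≤? ∣ A ∩ X ∣) (λ l → ≤-trans (one A l) (Σ-member (λ ξ → w ξ * 𝟙 (ξ ⊑? A)) (∈subs (A ∩ X))))) ⟩
          Σ fam (λ A → Σ (subs m) (λ ξ → w ξ * 𝟙 (ξ ⊑? A))) ≡⟨ Σ-swap fam (subs m) _ ⟩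
          Σ (subs m) (λ ξ → Σ fam (λ A → w ξ * 𝟙 (ξ ⊑? A))) ≡⟨ Σ-cong (subs m) (λ ξ → trans (Σ-*ˡ fam (w ξ) (λ A → 𝟙 (ξ ⊑? A))) (arr ξ)) ⟩
          Σ (subs m) (λ ξ → 𝟙 (ξ ⊑? X) * (𝟙 (k ≤? ∣ ξ ∣) * (1 ^ ∣ ξ ∣ * cnt fam ξ))) ∎
          where
          open ≤-Reasoning
          w : Subset m → ℕ
          w ξ = 𝟙 (ξ ⊑? X) * 𝟙 (k ≤? ∣ ξ ∣)
          arr : ∀ ξ → w ξ * cnt fam ξ ≡ 𝟙 (ξ ⊑? X) * (𝟙 (k ≤? ∣ ξ ∣) * (1 ^ ∣ ξ ∣ * cnt fam ξ))
          arr ξ = trans (*-assoc (𝟙 (ξ ⊑? X)) _ _) (cong (λ e → 𝟙 (ξ ⊑? X) * (𝟙 (k ≤? ∣ ξ ∣) * e)) (sym (trans (cong (_* cnt fam ξ) (^-zeroˡ ∣ ξ ∣)) (*-identityˡ (cnt fam ξ)))))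
          one : ∀ A → k ≤ ∣ A ∩ X ∣ → 1 ≤ w (A ∩ X) * 𝟙 ((A ∩ X) ⊑? A)
          one A l = *-mono-≤ (*-mono-≤ (𝟙-yes ((A ∩ X) ⊑? X) (slin 2 0 (λ a x → ⊢ (∥ (a ∩′ x) ∩′ ∁′ x ∥ ≼ # 0)) A X)) (𝟙-yes (k ≤? ∣ A ∩ X ∣) l))
                      (𝟙-yes ((A ∩ X) ⊑? A) (slin 2 0 (λ a x → ⊢ (∥ (a ∩′ x) ∩′ ∁′ a ∥ ≼ # 0)) A X))

      split : length fam ≤ big + length G′
      split = begin
          length fam ≡⟨ sym (Σ-1 fam) ⟩
          Σ fam (λ _ → 1) ≤⟨ Σ-mono′ fam one ⟩
          Σ fam (λ A → 𝟙 (k ≤? ∣ A ∩ X ∣) + 𝟙 (small? A)) ≡⟨ Σ-+ fam _ _ ⟩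
          big + Σ fam (λ A → 𝟙 (small? A)) ≡⟨ cong (big +_) (sym (length-filter small? fam)) ⟩
          big + length G′ ∎
        where
        open ≤-Reasoning
        one : ∀ A → 1 ≤ 𝟙 (k ≤? ∣ A ∩ X ∣) + 𝟙 (small? A)
        one A with k ≤? ∣ A ∩ X ∣
        ... | yes _ = s≤s z≤n
        ... | no _ = s≤s z≤n

    fam≤ : length fam ≤ 2 * length G″
    fam≤ = subst (λ e → length fam ≤ 2 * e) (sym (Listₚ.length-map _ G′))
      (lin 3 (λ f b g → (2 ⋆ b ≼ f) ⇒ (f ≼ b ⊹ g) ⇒ (f ≼ b ⊹ g) ⇒ ⊢ (f ≼ 2 ⋆ g)) (length fam) big (length G′) big≤ split split)

    G″≥1 : 1 ≤ length G″
    G″≥1 = pos (length G″) (≤-trans fam≥1 fam≤)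
      where
      pos : ∀ g → 1 ≤ 2 * g → 1 ≤ g
      pos (suc g) _ = s≤s z≤n

    members : ∀ {A″} → A″ ∈ G″ → ∃[ A ] (A ∈ F × A″ ≡ A ∩ ∁ U × suc ∣ A ∩ X ∣ ≤ k × S ⊑ A)
    members mA″ with ∈-map⁻ (_∩ ∁ U) mA″
    ... | A , mA , e with ∈-filter⁻ small? {xs = fam} mA
    ...   | mA′ , sm = A , fam⊆ A mA′ , e , ≰⇒> sm , above A mA′

    spread″ : ∀ ξ → Σ G″ (λ A → 𝟙 (ξ ⊑? A)) * r ^ ∣ ξ ∣ ≤ 2 * length G″
    spread″ ξ with dec∃ (λ A → ξ ⊑? (A ∩ ∁ U)) G′
    ... | inj₂ none = ≤-trans (≤-reflexive (cong (_* r ^ ∣ ξ ∣) zero′)) z≤n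
      where
      zero′ : Σ G″ (λ A → 𝟙 (ξ ⊑? A)) ≡ 0
      zero′ = trans (Σ-map (_∩ ∁ U) G′ _) (n≤0⇒n≡0 (≤-trans (Σ-≤const G′ 0 (λ A mA → ≤-reflexive (𝟙-no (ξ ⊑? (A ∩ ∁ U)) (none A mA)))) (≤-reflexive (*-zeroʳ (length G′)))))
    -- A set ξ inside a trimmed member avoids U and hence S, so all its points count in `links`.
    ... | inj₁ (A , mA , ξ⊑) = begin
          Σ G″ (λ A → 𝟙 (ξ ⊑? A)) * r ^ ∣ ξ ∣
            ≤⟨ *-mono-≤ (≤-trans (≤-reflexive (Σ-map (_∩ ∁ U) G′ _)) (≤-trans (≤-reflexive (Σ-filter small? fam _)) (Σ-mono′ fam le)))
                 (^-monoʳ-≤ r {{>-nonZero r≥1}} (slin 4 0 (λ x a u s → (∥ x ∩′ ∁′ (a ∩′ ∁′ u) ∥ ≼ # 0) ⇒ (∥ s ∩′ ∁′ u ∥ ≼ # 0) ⇒ ⊢ (∥ x ∥ ≼ ∥ x ∩′ ∁′ s ∥)) ξ A U S ξ⊑ S⊑U)) ⟩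
          cnt fam ξ * r ^ ∣ ξ ∩ ∁ S ∣ ≤⟨ links ξ ⟩
          length fam ≤⟨ fam≤ ⟩
          2 * length G″ ∎
      where
      open ≤-Reasoning
      le : ∀ A → 𝟙 (small? A) * 𝟙 (ξ ⊑? (A ∩ ∁ U)) ≤ 𝟙 (ξ ⊑? A)
      le A = 𝟙*-≤ (small? A) (λ _ → 𝟙-mono (ξ ⊑? (A ∩ ∁ U)) (ξ ⊑? A) (slin 3 0 (λ x a u → (∥ x ∩′ ∁′ (a ∩′ ∁′ u) ∥ ≼ # 0) ⇒ ⊢ (∥ x ∩′ ∁′ a ∥ ≼ # 0)) ξ A U))

    sizes″ : ∀ A″ → A″ ∈ G″ → ∣ A″ ∣ ≤ n
    sizes″ A″ mA″ with members mA″
    ... | A , mA , refl , _ = ≤-trans (slin 2 0 (λ a u → ⊢ (∥ a ∩′ ∁′ u ∥ ≼ ∥ a ∥)) A U) (sizes A mA)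

  -- Suppose the intersection has c points and u = t - c > 0. With k the upper half of u, members
  -- that are disjoint outside S₁ ∪ S₂ and have fewer than k points in the private part of the other
  -- set share at most c + 2(k - 1) < t points.
  spread-meet : ∀ {S₁ S₂} → Spread F r S₁ → Spread F r S₂ → ∣ S₁ ∣ ≤ t + q → ∣ S₂ ∣ ≤ t + q → t ≤ ∣ S₁ ∩ S₂ ∣
  spread-meet {S₁} {S₂} sp₁ sp₂ l₁ l₂ with t ≤? ∣ S₁ ∩ S₂ ∣
  ... | yes p = p
  ... | no ¬p = ⊥-elim impossible
    where
    c u : ℕ
    c = ∣ S₁ ∩ S₂ ∣
    c<t : c < t
    c<t = ≰⇒> ¬p
    u = t ∸ c
    u+c : u + c ≡ t
    u+c = m∸n+n≡m (<⇒≤ c<t)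
    u≥1 : 1 ≤ u
    u≥1 = m<n⇒0<n∸m c<t
    k = proj₁ (half u)
    u≤2k = proj₁ (proj₂ (half u))
    2k≤ = proj₂ (proj₂ (half u))
    k≥1 : 1 ≤ k
    k≥1 = pos k (≤-trans u≥1 u≤2k)
      where
      pos : ∀ g → 1 ≤ 2 * g → 1 ≤ g
      pos (suc g) _ = s≤s z≤n
    U = S₁ ∪ S₂
    b₁ : ∣ S₂ ∩ ∁ S₁ ∣ ≤ q + u
    b₁ = slin 2 3 (λ a b t q u → (∥ b ∥ ≼ t ⊹ q) ⇒ (t ≼ u ⊹ ∥ a ∩′ b ∥) ⇒ ⊢ (∥ b ∩′ ∁′ a ∥ ≼ q ⊹ u)) S₁ S₂ t q u l₂ (≤-reflexive (sym u+c))
    b₂ : ∣ S₁ ∩ ∁ S₂ ∣ ≤ q + u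
    b₂ = slin 2 3 (λ a b t q u → (∥ a ∥ ≼ t ⊹ q) ⇒ (t ≼ u ⊹ ∥ a ∩′ b ∥) ⇒ ⊢ (∥ a ∩′ ∁′ b ∥ ≼ q ⊹ u)) S₁ S₂ t q u l₁ (≤-reflexive (sym u+c))
    module C₁ = Cut sp₁ S₂ U (slin 2 0 (λ a b → ⊢ (∥ a ∩′ ∁′ (a ∪′ b) ∥ ≼ # 0)) S₁ S₂) u k k≥1 u≤2k b₁
    module C₂ = Cut sp₂ S₁ U (slin 2 0 (λ a b → ⊢ (∥ b ∩′ ∁′ (a ∪′ b) ∥ ≼ # 0)) S₁ S₂) u k k≥1 u≤2k b₂
    final : ∀ A B → A ∈ F → B ∈ F → suc ∣ A ∩ (S₂ ∩ ∁ S₁) ∣ ≤ k → suc ∣ B ∩ (S₁ ∩ ∁ S₂) ∣ ≤ k → ∣ (A ∩ ∁ U) ∩ (B ∩ ∁ U) ∣ ≤ 0 → ⊥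
    final A B mA mB a< b< dis = <-irrefl refl (slin 4 3 (λ a b s₁ s₂ t u k → (∥ (a ∩′ ∁′ (s₁ ∪′ s₂)) ∩′ (b ∩′ ∁′ (s₁ ∪′ s₂)) ∥ ≼ # 0)
           ⇒ (# 1 ⊹ ∥ a ∩′ (s₂ ∩′ ∁′ s₁) ∥ ≼ k) ⇒ (# 1 ⊹ ∥ b ∩′ (s₁ ∩′ ∁′ s₂) ∥ ≼ k)
           ⇒ (2 ⋆ k ≼ u ⊹ # 1) ⇒ (u ⊹ ∥ s₁ ∩′ s₂ ∥ ≼ t) ⇒ (t ≼ ∥ a ∩′ b ∥) ⇒ ⊢ (# 1 ≼ # 0))
           A B S₁ S₂ t u k dis a< b< 2k≤ (≤-reflexive u+c) (tint A B mA mB))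
    unpack : ∀ {A″ B″} → ∃[ A ] (A ∈ F × A″ ≡ A ∩ ∁ U × suc ∣ A ∩ (S₂ ∩ ∁ S₁) ∣ ≤ k × S₁ ⊑ A) →
             ∃[ B ] (B ∈ F × B″ ≡ B ∩ ∁ U × suc ∣ B ∩ (S₁ ∩ ∁ S₂) ∣ ≤ k × S₂ ⊑ B) → ∣ A″ ∩ B″ ∣ ≤ 0 → ⊥
    unpack (A , mA , refl , a< , _) (B , mB , refl , b< , _) dis = final A B mA mB a< b< dis
    impossible : ⊥
    impossible = let (A″ , B″ , mA , mB , dis) = disjoint-members C₁.G″ C₂.G″ r z h n C₁.G″≥1 C₂.G″≥1 C₁.sizes″ C₂.sizes″ C₁.spread″ C₂.spread″ r≥1 zr n≤ hr
                 in unpack (C₁.members mA) (C₂.members mB) dis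

-- Spread approximation

Σ-mono-< : {A : Set} {xs : List A} {f g : A → ℕ} → (∀ x → f x ≤ g x) → ∀ {x} → x ∈ xs → f x < g x → Σ xs f < Σ xs g
Σ-mono-< {xs = y ∷ xs} h (here refl) lt = +-mono-<-≤ lt (Σ-mono′ xs h)
Σ-mono-< {xs = y ∷ xs} h (there p) lt = +-mono-≤-< (h y) (Σ-mono-< h p lt)

∈⇒length : {A : Set} (xs : List A) → 1 ≤ length xs → ∃[ x ] (x ∈ xs)
∈⇒length (x ∷ xs) _ = x , here refl

-- A set maximising the weighted degree φ is spread by maximality. The issue is its size, for which
-- the maximum of φ has to be shown to be at least r^t |R| / 2^h.
module FindSpread {m : ℕ} (R : List (Subset m)) (t q n y z h θ M : ℕ)
  (R≥1 : 1 ≤ length R) (tint : TInt t R) (sizes : ∀ A → A ∈ R → ∣ A ∣ ≤ n)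
  (bound : ∀ S d → ∣ S ∣ ≡ t + d → cnt R S * n ^ d ≤ 2 ^ d * M)
  (M≥1 : 1 ≤ M) (M≤ : M ≤ θ * length R)
  (y≥1 : 1 ≤ y) (r≤ : 4 * y ^ 3 ≤ n) (zy : 2 * z ≤ y) (n≤ : 2 * n ≤ z * h) (θq : θ * 2 ^ h ≤ 2 ^ q) where

  private
    r = y ^ 3
    r≥1 : 1 ≤ r
    r≥1 = m^n>0 y {{>-nonZero y≥1}} 3

    φ : Subset m → ℕ
    φ X = cnt R X * r ^ ∣ X ∣

    best = argmax φ Sub.⊥ (subs m)
    S = proj₁ best

    S-max : ∀ X → φ X ≤ φ S
    S-max X = proj₂ (proj₂ best) X (there (∈subs X))

    A₀ = proj₁ (∈⇒length R R≥1)
    A₀∈ : A₀ ∈ R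
    A₀∈ = proj₂ (∈⇒length R R≥1)

    φS≥1 : 1 ≤ φ S
    φS≥1 = ≤-trans (*-mono-≤ {1} {_} {1} (≤-trans (𝟙-yes (A₀ ⊑? A₀) (⊑-refl A₀)) (Σ-member (λ A → 𝟙 (A₀ ⊑? A)) A₀∈)) (m^n>0 r {{>-nonZero r≥1}} ∣ A₀ ∣)) (S-max A₀)

    cntS≥1 : 1 ≤ cnt R S
    cntS≥1 with cnt R S | φS≥1
    ... | suc _ | _ = s≤s z≤n

  spread : Spread R r S
  spread = record
    { fam = G
    ; fam⊆ = λ A mA → proj₁ (∈-filter⁻ (S ⊑?_) {xs = R} mA)
    ; fam≥1 = subst (1 ≤_) (sym len) cntS≥1
    ; above = λ A mA → proj₂ (∈-filter⁻ (S ⊑?_) {xs = R} mA)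
    ; links = links
    }
    where
    G = List.filter (S ⊑?_) R
    len : length G ≡ cnt R S
    len = length-filter (S ⊑?_) R
    links : ∀ X → cnt G X * r ^ ∣ X ∩ ∁ S ∣ ≤ length G
    links X = *-cancelʳ-≤ _ _ (r ^ ∣ S ∣) {{m^n≢0 r ∣ S ∣ {{>-nonZero r≥1}}}} (begin
        cnt G X * r ^ d * r ^ ∣ S ∣ ≡⟨ *-assoc (cnt G X) _ _ ⟩
        cnt G X * (r ^ d * r ^ ∣ S ∣) ≡⟨ cong (cnt G X *_) (sym (^-distribˡ-+-* r d ∣ S ∣)) ⟩
        cnt G X * r ^ (d + ∣ S ∣) ≤⟨ *-mono-≤ (≤-trans (≤-reflexive (Σ-filter (S ⊑?_) R _)) (Σ-mono′ R le))
                                               (^-monoʳ-≤ r {{>-nonZero r≥1}} (slin 2 0 (λ x s → ⊢ (∥ x ∩′ ∁′ s ∥ ⊹ ∥ s ∥ ≼ ∥ x ∪′ s ∥)) X S)) ⟩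
        φ (X ∪ S) ≤⟨ S-max (X ∪ S) ⟩
        cnt R S * r ^ ∣ S ∣ ≡⟨ cong (_* r ^ ∣ S ∣) (sym len) ⟩
        length G * r ^ ∣ S ∣ ∎)
      where
      open ≤-Reasoning
      d = ∣ X ∩ ∁ S ∣
      le : ∀ A → 𝟙 (S ⊑? A) * 𝟙 (X ⊑? A) ≤ 𝟙 ((X ∪ S) ⊑? A)
      le A = 𝟙*-≤ (S ⊑? A) λ s → 𝟙-mono (X ⊑? A) ((X ∪ S) ⊑? A) λ x →
        slin 3 0 (λ x s a → (∥ s ∩′ ∁′ a ∥ ≼ # 0) ⇒ (∥ x ∩′ ∁′ a ∥ ≼ # 0) ⇒ ⊢ (∥ (x ∪′ s) ∩′ ∁′ a ∥ ≼ # 0)) X S A s x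

  private
    pairs = List.cartesianProduct R R
    -- A pair with the smallest intersection I: every B then meets A₁ and A₂ in at least |I| points
    -- each.
    minpair = argmin (λ (A , B) → ∣ A ∩ B ∣) (A₀ , A₀) pairs
    A₁ = proj₁ (proj₁ minpair)
    A₂ = proj₂ (proj₁ minpair)
    in-pairs : ∀ {p} → p ∈ ((A₀ , A₀) ∷ pairs) → proj₁ p ∈ R × proj₂ p ∈ R
    in-pairs (here refl) = A₀∈ , A₀∈
    in-pairs (there x) = Listₘ.∈-cartesianProduct⁻ R R x
      where import Data.List.Membership.Propositional.Properties as Listₘ
    A₁∈ : A₁ ∈ R
    A₁∈ = proj₁ (in-pairs (proj₁ (proj₂ minpair)))
    A₂∈ : A₂ ∈ R
    A₂∈ = proj₂ (in-pairs (proj₁ (proj₂ minpair)))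
    I U : Subset m
    I = A₁ ∩ A₂
    U = A₁ ∪ A₂
    t′ : ℕ
    t′ = ∣ I ∣
    t≤t′ : t ≤ t′
    t≤t′ = tint A₁ A₂ A₁∈ A₂∈
    I-min : ∀ {A B} → A ∈ R → B ∈ R → t′ ≤ ∣ A ∩ B ∣
    I-min {A} {B} mA mB = proj₂ (proj₂ minpair) (A , B) (there (Listₘ.∈-cartesianProduct⁺ mA mB))
      where import Data.List.Membership.Propositional.Properties as Listₘ

    U≤ : ∣ U ∣ ≤ 2 * n
    U≤ = slin 2 1 (λ a b n → (∥ a ∥ ≼ n) ⇒ (∥ b ∥ ≼ n) ⇒ ⊢ (∥ a ∪′ b ∥ ≼ 2 ⋆ n)) A₁ A₂ n (sizes A₁ A₁∈) (sizes A₂ A₂∈)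

    -- The symmetric difference of B ∩ U and I. It determines B ∩ U and measures how far B deviates
    -- from I on U.
    trace : Subset m → Subset m
    trace B = ((B ∩ U) ∩ ∁ I) ∪ (I ∩ ∁ (B ∩ U))

    V = r ^ t′ * y ^ ∣ U ∣

    -- All members with trace X contain the same Q = B ∩ U, so there are at most φ S / r^|Q| of
    -- them.
    group : ∀ X → Σ R (λ B → 𝟙 (X ≟ˢ trace B)) * V ≤ φ S * (𝟙 (X ⊑? U) * (1 ^ ∣ X ∣ * y ^ ∣ U ∩ ∁ X ∣))
    group X with dec∃ (λ B → X ≟ˢ trace B) R
    ... | inj₂ none = ≤-trans (≤-reflexive (cong (_* V) zero′)) z≤n
      where
      zero′ : Σ R (λ B → 𝟙 (X ≟ˢ trace B)) ≡ 0
      zero′ = n≤0⇒n≡0 (≤-trans (Σ-≤const R 0 (λ B mB → ≤-reflexive (𝟙-no (X ≟ˢ trace B) (none B mB)))) (≤-reflexive (*-zeroʳ (length R))))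
    ... | inj₁ (B , mB , refl) = begin
          Σ R (λ C → 𝟙 (X ≟ˢ trace C)) * V ≤⟨ *-mono-≤ (Σ-mono R λ C mC → 𝟙-mono (X ≟ˢ trace C) (Q ⊑? C) (λ e → contains C e)) V≤ ⟩
          cnt R Q * (r ^ ∣ Q ∣ * y ^ d) ≡⟨ sym (*-assoc (cnt R Q) _ _) ⟩
          φ Q * y ^ d ≤⟨ *-monoˡ-≤ (y ^ d) (S-max Q) ⟩
          φ S * y ^ d ≡⟨ cong (φ S *_) (trans (sym (*-identityˡ (y ^ d))) (cong (_* y ^ d) (sym (^-zeroˡ ∣ X ∣)))) ⟩
          φ S * (1 ^ ∣ X ∣ * y ^ d) ≤⟨ *-monoʳ-≤ (φ S) (≤-trans (≤-reflexive (sym (*-identityˡ _))) (*-monoˡ-≤ (1 ^ ∣ X ∣ * y ^ d) (𝟙-yes (X ⊑? U) X⊑U))) ⟩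
          φ S * (𝟙 (X ⊑? U) * (1 ^ ∣ X ∣ * y ^ d)) ∎
      where
      open ≤-Reasoning
      d = ∣ U ∩ ∁ X ∣
      Q = (X ∩ ∁ I) ∪ (I ∩ ∁ X)
      X⊑U : X ⊑ U
      X⊑U = slin 3 0 (λ b a₁ a₂ → ⊢ (∥ (((b ∩′ (a₁ ∪′ a₂)) ∩′ ∁′ (a₁ ∩′ a₂)) ∪′ ((a₁ ∩′ a₂) ∩′ ∁′ (b ∩′ (a₁ ∪′ a₂)))) ∩′ ∁′ (a₁ ∪′ a₂) ∥ ≼ # 0)) B A₁ A₂
      contains : ∀ C → trace B ≡ trace C → Q ⊑ C
      contains C e = subst (λ X → ((X ∩ ∁ I) ∪ (I ∩ ∁ X)) ⊑ C) (sym e)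
        (slin 3 0 (λ c i u → ⊢ (∥ ((((((c ∩′ u) ∩′ ∁′ i) ∪′ (i ∩′ ∁′ (c ∩′ u))) ∩′ ∁′ i) ∪′ (i ∩′ ∁′ (((c ∩′ u) ∩′ ∁′ i) ∪′ (i ∩′ ∁′ (c ∩′ u)))))) ∩′ ∁′ c ∥ ≼ # 0)) C I U)
      -- If B lacks p points of I, minimality forces at least p points of B into each of A₁ minus A₂
      -- and A₂ minus A₁. The factor 3 is the reason why r is a cube: r^|Q| exceeds r^t′ by a factor
      -- y for every point of the trace.
      e≤ : 3 * t′ + ∣ X ∣ ≤ 3 * ∣ Q ∣
      e≤ = slin 3 0 (λ b a₁ a₂ → let i = a₁ ∩′ a₂ ; u = a₁ ∪′ a₂ ; x = ((b ∩′ u) ∩′ ∁′ i) ∪′ (i ∩′ ∁′ (b ∩′ u)) in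
             (∥ i ∥ ≼ ∥ b ∩′ a₁ ∥) ⇒ (∥ i ∥ ≼ ∥ b ∩′ a₁ ∥) ⇒ (∥ i ∥ ≼ ∥ b ∩′ a₂ ∥) ⇒ (∥ i ∥ ≼ ∥ b ∩′ a₂ ∥) ⇒ ⊢ (3 ⋆ ∥ i ∥ ⊹ ∥ x ∥ ≼ 3 ⋆ ∥ (x ∩′ ∁′ i) ∪′ (i ∩′ ∁′ x) ∥))
             B A₁ A₂ (I-min mB A₁∈) (I-min mB A₁∈) (I-min mB A₂∈) (I-min mB A₂∈)
      V≤ : V ≤ r ^ ∣ Q ∣ * y ^ d
      V≤ = begin
        r ^ t′ * y ^ ∣ U ∣ ≡⟨ cong₂ _*_ (^-*-assoc y 3 t′) refl ⟩
        y ^ (3 * t′) * y ^ ∣ U ∣ ≤⟨ *-monoʳ-≤ (y ^ (3 * t′)) (^-monoʳ-≤ y {{>-nonZero y≥1}} (slin 2 0 (λ u x → ⊢ (∥ u ∥ ≼ ∥ x ∥ ⊹ ∥ u ∩′ ∁′ x ∥)) U X)) ⟩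
        y ^ (3 * t′) * y ^ (∣ X ∣ + d) ≡⟨ trans (sym (^-distribˡ-+-* y (3 * t′) (∣ X ∣ + d))) (cong (y ^_) (sym (+-assoc (3 * t′) ∣ X ∣ d))) ⟩
        y ^ (3 * t′ + ∣ X ∣ + d) ≤⟨ ^-monoʳ-≤ y {{>-nonZero y≥1}} (+-monoˡ-≤ d e≤) ⟩
        y ^ (3 * ∣ Q ∣ + d) ≡⟨ ^-distribˡ-+-* y (3 * ∣ Q ∣) d ⟩
        y ^ (3 * ∣ Q ∣) * y ^ d ≡⟨ cong (_* y ^ d) (sym (^-*-assoc y 3 ∣ Q ∣)) ⟩
        r ^ ∣ Q ∣ * y ^ d ∎

    -- Summing over the traces gives (1 + 1/y)^|U|, which is at most 2^h. Nothing is lost for the t′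
    -- common points.
    total : length R * V ≤ φ S * (2 ^ h * y ^ ∣ U ∣)
    total = begin
        length R * V ≤⟨ *-monoˡ-≤ V (cover R (subs m) (λ B X → 𝟙 (X ≟ˢ trace B)) (λ B mB → trace B , ∈subs _ , 𝟙-yes (trace B ≟ˢ trace B) refl)) ⟩
        Σ (subs m) (λ X → Σ R (λ B → 𝟙 (X ≟ˢ trace B))) * V ≡⟨ sym (Σ-*ʳ (subs m) V _) ⟩
        Σ (subs m) (λ X → Σ R (λ B → 𝟙 (X ≟ˢ trace B)) * V) ≤⟨ Σ-mono′ (subs m) group ⟩
        Σ (subs m) (λ X → φ S * (𝟙 (X ⊑? U) * (1 ^ ∣ X ∣ * y ^ ∣ U ∩ ∁ X ∣))) ≡⟨ trans (Σ-*ˡ (subs m) (φ S) _) (cong (φ S *_) (binomial m U y 1)) ⟩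
        φ S * (y + 1) ^ ∣ U ∣ ≤⟨ *-monoʳ-≤ (φ S) (growth* y 1 z h ∣ U ∣ y≥1 (≤-trans (≤-reflexive (cong (2 *_) (*-identityʳ z))) zy) (≤-trans U≤ n≤)) ⟩
        φ S * (2 ^ h * y ^ ∣ U ∣) ∎
      where open ≤-Reasoning

    -- If ∣S∣ = t + d then φ S ≤ (2r/n)^d M r^t, so (n/2r)^d ≤ 2^q.
    size′ : ∀ d → ∣ S ∣ ≡ t + d → d ≤ q
    size′ d e = 2^-inj (*-cancelʳ-≤ (2 ^ d) (2 ^ q) K {{>-nonZero K≥1}} (begin
        2 ^ d * K ≡⟨ arr₁ (2 ^ d) ((2 * r) ^ d) M (r ^ t) (y ^ ∣ U ∣) ⟩
        (2 ^ d * (2 * r) ^ d) * (M * (r ^ t * y ^ ∣ U ∣)) ≤⟨ *-mono-≤ (≤-trans (≤-reflexive (trans (sym (^-* d 2 (2 * r))) (cong (_^ d) (sym (*-assoc 2 2 r))))) (^-monoˡ-≤ d r≤))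
                                                          (*-mono-≤ M≤ (*-monoˡ-≤ (y ^ ∣ U ∣) (^-monoʳ-≤ r {{>-nonZero r≥1}} t≤t′))) ⟩
        n ^ d * (θ * length R * V) ≡⟨ arr₂ (n ^ d) θ (length R) V ⟩
        n ^ d * θ * (length R * V) ≤⟨ *-monoʳ-≤ (n ^ d * θ) total ⟩
        n ^ d * θ * (φ S * (2 ^ h * y ^ ∣ U ∣)) ≡⟨ cong (λ s → n ^ d * θ * (cnt R S * r ^ s * (2 ^ h * y ^ ∣ U ∣))) e ⟩
        n ^ d * θ * (cnt R S * r ^ (t + d) * (2 ^ h * y ^ ∣ U ∣)) ≡⟨ cong (λ s → n ^ d * θ * (cnt R S * s * (2 ^ h * y ^ ∣ U ∣))) (^-distribˡ-+-* r t d) ⟩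
        n ^ d * θ * (cnt R S * (r ^ t * r ^ d) * (2 ^ h * y ^ ∣ U ∣)) ≡⟨ arr₃ (n ^ d) θ (cnt R S) (r ^ t) (r ^ d) (2 ^ h) (y ^ ∣ U ∣) ⟩
        (θ * 2 ^ h) * (cnt R S * n ^ d) * (r ^ d * (r ^ t * y ^ ∣ U ∣)) ≤⟨ *-monoˡ-≤ (r ^ d * (r ^ t * y ^ ∣ U ∣)) (*-mono-≤ θq (bound S d e)) ⟩
        2 ^ q * (2 ^ d * M) * (r ^ d * (r ^ t * y ^ ∣ U ∣)) ≡⟨ arr₄ (2 ^ q) (2 ^ d) M (r ^ d) (r ^ t * y ^ ∣ U ∣) ⟩
        2 ^ q * ((2 ^ d * r ^ d) * M * (r ^ t * y ^ ∣ U ∣)) ≡⟨ cong (λ s → 2 ^ q * (s * M * (r ^ t * y ^ ∣ U ∣))) (sym (^-* d 2 r)) ⟩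
        2 ^ q * K ∎))
      where
      open ≤-Reasoning
      K = (2 * r) ^ d * M * (r ^ t * y ^ ∣ U ∣)
      2r≥1 : 1 ≤ 2 * r
      2r≥1 = *-mono-≤ {1} {2} (s≤s z≤n) r≥1
      K≥1 : 1 ≤ K
      K≥1 = *-mono-≤ {1} {_} {1} (*-mono-≤ {1} {_} {1} (m^n>0 (2 * r) {{>-nonZero 2r≥1}} d) M≥1) (*-mono-≤ {1} {_} {1} (m^n>0 r {{>-nonZero r≥1}} t) (m^n>0 y {{>-nonZero y≥1}} ∣ U ∣))
      ^-* : ∀ h a b → (a * b) ^ h ≡ a ^ h * b ^ h
      ^-* zero a b = refl
      ^-* (suc h) a b rewrite ^-* h a b = [m*n]*[o*p]≡[m*o]*[n*p] a b (a ^ h) (b ^ h)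
      arr₁ : ∀ a b c d e → a * (b * c * (d * e)) ≡ (a * b) * (c * (d * e))
      arr₁ = solve-∀
      arr₂ : ∀ a b c d → a * (b * c * d) ≡ a * b * (c * d)
      arr₂ = solve-∀
      arr₃ : ∀ a b c d e f g → a * b * (c * (d * e) * (f * g)) ≡ (b * f) * (c * a) * (e * (d * g))
      arr₃ = solve-∀
      arr₄ : ∀ a b c d e → a * (b * c) * (d * e) ≡ a * ((b * d) * c * e)
      arr₄ = solve-∀
      2^-inj : 2 ^ d ≤ 2 ^ q → d ≤ q
      2^-inj le = ≮⇒≥ (λ lt → <-irrefl refl (<-≤-trans (^-monoʳ-< 2 (s≤s (s≤s z≤n)) lt) le))

  size : ∣ S ∣ ≤ t + q
  size with ≤-total ∣ S ∣ t
  ... | inj₁ le = ≤-trans le (m≤m+n t q)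
  ... | inj₂ ge = subst (_≤ t + q) e (+-monoʳ-≤ t (size′ (∣ S ∣ ∸ t) (sym e)))
    where
    e : t + (∣ S ∣ ∸ t) ≡ ∣ S ∣
    e = m+[n∸m]≡n ge

  result : ∃[ S ] (Spread R r S × ∣ S ∣ ≤ t + q)
  result = S , spread , size

AboveL : ∀ {m} → List (Subset m) → Subset m → Set
AboveL 𝒮 A = ∃[ S ] (S ∈ 𝒮 × S ⊑ A)

above? : ∀ {m} (𝒮 : List (Subset m)) A → Dec (AboveL 𝒮 A)
above? 𝒮 A = dec∃′ (_⊑? A) 𝒮

rest# : ∀ {m} → List (Subset m) → List (Subset m) → ℕ
rest# F 𝒮 = Σ F (λ A → 𝟙 (¬? (above? 𝒮 A)))

SpreadIn : ∀ {m} → List (Subset m) → ℕ → ℕ → List (Subset m) → Set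
SpreadIn F r b 𝒮 = ∀ S → S ∈ 𝒮 → Spread F r S × ∣ S ∣ ≤ b

module Approximate {m : ℕ} (F : List (Subset m)) (t q n y z h θ M : ℕ)
  (tint : TInt t F) (sizes : ∀ A → A ∈ F → ∣ A ∣ ≤ n)
  (bound : ∀ S d → ∣ S ∣ ≡ t + d → cnt F S * n ^ d ≤ 2 ^ d * M)
  (M≥1 : 1 ≤ M)
  (y≥1 : 1 ≤ y) (r≤ : 4 * y ^ 3 ≤ n) (zy : 2 * z ≤ y) (n≤ : 2 * n ≤ z * h) (θq : θ * 2 ^ h ≤ 2 ^ q) where

  private
    rest : List (Subset m) → List (Subset m)
    rest 𝒮 = List.filter (λ A → ¬? (above? 𝒮 A)) F

    -- A greedy loop: `rest#` drops because the spread family found above the new set is nonempty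
    -- and consists of members that were not yet covered.
    loop : ∀ fuel 𝒮 → SpreadIn F (y ^ 3) (t + q) 𝒮 → rest# F 𝒮 < fuel → ∃[ 𝒮′ ] (SpreadIn F (y ^ 3) (t + q) 𝒮′ × θ * rest# F 𝒮′ < M)
    loop (suc fuel) 𝒮 good (s≤s le) with M ≤? θ * rest# F 𝒮
    ... | no ¬M≤ = 𝒮 , good , ≰⇒> ¬M≤
    ... | yes M≤ = loop fuel (S ∷ 𝒮) good′ (<-≤-trans dec le)
      where
      R = rest 𝒮
      len : length R ≡ rest# F 𝒮
      len = length-filter (λ A → ¬? (above? 𝒮 A)) F
      R⊆ : ∀ A → A ∈ R → A ∈ F × ¬ AboveL 𝒮 A
      R⊆ A mA = ∈-filter⁻ (λ A → ¬? (above? 𝒮 A)) {xs = F} mA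
      pos : ∀ a b → 1 ≤ a * b → 1 ≤ b
      pos a zero le = ⊥-elim (<-irrefl refl (≤-trans le (≤-reflexive (*-zeroʳ a))))
      pos a (suc b) _ = s≤s z≤n
      found : ∃[ S ] (Spread R (y ^ 3) S × ∣ S ∣ ≤ t + q)
      found = FindSpread.result R t q n y z h θ M (subst (1 ≤_) (sym len) (pos θ _ (≤-trans M≥1 M≤)))
        (λ A B a b → tint A B (proj₁ (R⊆ A a)) (proj₁ (R⊆ B b))) (λ A a → sizes A (proj₁ (R⊆ A a)))
        (λ S d e → ≤-trans (*-monoˡ-≤ (n ^ d) (≤-trans (≤-reflexive (Σ-filter (λ A → ¬? (above? 𝒮 A)) F _)) (Σ-mono′ F (λ A → 𝟙*-≤ (¬? (above? 𝒮 A)) (λ _ → ≤-refl))))) (bound S d e))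
        M≥1 (subst (λ e → M ≤ θ * e) (sym len) M≤) y≥1 r≤ zy n≤ θq
      S = proj₁ found
      sp : Spread R (y ^ 3) S
      sp = proj₁ (proj₂ found)
      open Spread sp
      good′ : SpreadIn F (y ^ 3) (t + q) (S ∷ 𝒮)
      good′ _ (here refl) = record { fam = fam ; fam⊆ = λ A a → proj₁ (R⊆ A (fam⊆ A a)) ; fam≥1 = fam≥1 ; above = above ; links = links } , proj₂ (proj₂ found)
      good′ T (there x) = good T x
      A = proj₁ (∈⇒length fam fam≥1)
      A∈ : A ∈ fam
      A∈ = proj₂ (∈⇒length fam fam≥1)
      dec : rest# F (S ∷ 𝒮) < rest# F 𝒮
      dec = Σ-mono-< (λ B → 𝟙-mono (¬? (above? (S ∷ 𝒮) B)) (¬? (above? 𝒮 B)) (λ no′ (T , mT , T⊑) → no′ (T , there mT , T⊑)))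
              (proj₁ (R⊆ A (fam⊆ A A∈)))
              (subst (_< 𝟙 (¬? (above? 𝒮 A))) (sym (𝟙-no (¬? (above? (S ∷ 𝒮) A)) (λ no′ → no′ (S , here refl , above A A∈))))
                (𝟙-yes (¬? (above? 𝒮 A)) (proj₂ (R⊆ A (fam⊆ A A∈)))))

  approx : ∃[ 𝒮 ] (SpreadIn F (y ^ 3) (t + q) 𝒮 × θ * rest# F 𝒮 < M)
  approx = loop (suc (rest# F [])) [] (λ S ()) ≤-refl

-- Points of subsets, counting by fibres, binomial estimates

elements : ∀ m → List (Fin m)
elements m = List.allFin m

∈elements : ∀ {m} (x : Fin m) → x ∈ elements m
∈elements = Listₘ.∈-allFin

⊥⊑ : ∀ {m} (X : Subset m) → Sub.⊥ ⊑ X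
⊥⊑ {m} X = ≤-trans (slin 2 0 (λ e x → ⊢ (∥ e ∩′ ∁′ x ∥ ≼ ∥ e ∥)) Sub.⊥ X) (≤-reflexive (Subₚ.∣⊥∣≡0 m))

infix 4 _∈ˢ_

_∈ˢ_ : ∀ {m} → Fin m → Subset m → Set
x ∈ˢ X = ⁅ x ⁆ ⊑ X

Σ-elements : ∀ {m} (X : Subset m) → Σ (elements m) (λ x → 𝟙 (⁅ x ⁆ ⊑? X)) ≡ ∣ X ∣
Σ-elements [] = refl
Σ-elements {suc m} (b ∷ X) = trans (cong₂ _+_ (first b) (trans (rest (λ i → i)) (Σ-elements X))) (sym (card b))
  where
  first : ∀ b → 𝟙 (⁅ zero ⁆ ⊑? (b ∷ X)) ≡ b2n b
  first true = ≤-antisym (𝟙≤1 (⁅ zero ⁆ ⊑? (true ∷ X))) (𝟙-yes (⁅ zero ⁆ ⊑? (true ∷ X)) (⊥⊑ X))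
  first false = 𝟙-no (⁅ zero ⁆ ⊑? (false ∷ X)) λ ()
  card : ∀ b → ∣ b ∷ X ∣ ≡ b2n b + ∣ X ∣
  card true = refl
  card false = refl
  same : ∀ b (x : Fin m) → 𝟙 (⁅ suc x ⁆ ⊑? (b ∷ X)) ≡ 𝟙 (⁅ x ⁆ ⊑? X)
  same b x = ≤-antisym (𝟙-mono (⁅ suc x ⁆ ⊑? (b ∷ X)) (⁅ x ⁆ ⊑? X) id) (𝟙-mono (⁅ x ⁆ ⊑? X) (⁅ suc x ⁆ ⊑? (b ∷ X)) id)
  rest : ∀ {k} (f : Fin k → Fin m) → Σ (List.tabulate (suc ∘ f)) (λ x → 𝟙 (⁅ x ⁆ ⊑? (b ∷ X))) ≡ Σ (List.tabulate f) (λ x → 𝟙 (⁅ x ⁆ ⊑? X))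
  rest {zero} f = refl
  rest {suc k} f = cong₂ _+_ (same b (f zero)) (rest (f ∘ suc))

point-∈ : ∀ {m} (x : Fin m) (X : Subset m) → x ∈ˢ X ⊎ ∣ ⁅ x ⁆ ∩ X ∣ ≤ 0
point-∈ x X with ⁅ x ⁆ ⊑? X
... | yes p = inj₁ p
... | no ¬p = inj₂ (slin 2 0 (λ e x → (∥ e ∥ ≼ # 1) ⇒ (# 1 ≼ ∥ e ∩′ ∁′ x ∥) ⇒ ⊢ (∥ e ∩′ x ∥ ≼ # 0)) ⁅ x ⁆ X (≤-reflexive (∣⁅⁆∣ x)) (≰⇒> ¬p))

Σ-≟ : ∀ {m} {W : List (Subset m)} → Unique W → ∀ X → Σ W (λ S → 𝟙 (S ≟ˢ X)) ≤ 1
Σ-≟ {W = []} u X = z≤n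
Σ-≟ {W = S ∷ W} (a AllPairs.∷ u) X with S ≟ˢ X
... | no _ = Σ-≟ u X
... | yes refl = s≤s (≤-trans (Σ-≤const W 0 (λ T mT → ≤-reflexive (𝟙-no (T ≟ˢ S) (λ e → All.lookup a mT (sym e))))) (≤-reflexive (*-zeroʳ (length W))))

module _ {A : Set} (W : List A) {m : ℕ} where
  group : {P : A → Set} (P? : ∀ S → Dec (P S)) (f : A → Subset m) (u : Subset m → ℕ) (c : ℕ) →
          (∀ S → S ∈ W → P S → 1 ≤ u (f S)) → (∀ D → Σ W (λ S → 𝟙 (P? S ×-dec (f S ≟ˢ D))) ≤ c) →
          Σ W (λ S → 𝟙 (P? S)) ≤ Σ (subs m) u * c
  group P? f u c hu hc = begin
      Σ W (λ S → 𝟙 (P? S)) ≤⟨ Σ-mono W (λ S mS → 𝟙-if (P? S) (λ p → ≤-trans (*-mono-≤ (hu S mS p) (𝟙-yes (P? S ×-dec (f S ≟ˢ f S)) (p , refl)))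
                                                                                 (Σ-member (λ D → u D * 𝟙 (P? S ×-dec (f S ≟ˢ D))) (∈subs (f S))))) ⟩
      Σ W (λ S → Σ (subs m) (λ D → u D * 𝟙 (P? S ×-dec (f S ≟ˢ D)))) ≡⟨ Σ-swap W (subs m) _ ⟩
      Σ (subs m) (λ D → Σ W (λ S → u D * 𝟙 (P? S ×-dec (f S ≟ˢ D)))) ≡⟨ Σ-cong (subs m) (λ D → Σ-*ˡ W (u D) _) ⟩
      Σ (subs m) (λ D → u D * Σ W (λ S → 𝟙 (P? S ×-dec (f S ≟ˢ D)))) ≤⟨ Σ-mono′ (subs m) (λ D → *-monoʳ-≤ (u D) (hc D)) ⟩
      Σ (subs m) (λ D → u D * c) ≡⟨ Σ-*ʳ (subs m) c u ⟩
      Σ (subs m) u * c ∎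
    where open ≤-Reasoning

  Σ𝟙-empty : {P : A → Set} (P? : ∀ S → Dec (P S)) → (∀ S → S ∈ W → ¬ P S) → ∀ (f : A → ℕ) → Σ W (λ S → 𝟙 (P? S) * f S) ≤ 0
  Σ𝟙-empty P? h f = ≤-trans (Σ-≤const W 0 (λ S mS → ≤-reflexive (cong (_* f S) (𝟙-no (P? S) (h S mS))))) (≤-reflexive (*-zeroʳ (length W)))

bin : ℕ → ℕ → ℕ
bin n zero = 1
bin zero (suc k) = 0
bin (suc n) (suc k) = bin n k + bin n (suc k)

subsets# : ∀ {m} (P : Subset m) x → Σ (subs m) (λ D → 𝟙 ((D ⊑? P) ×-dec (∣ D ∣ ≟ x))) ≡ bin ∣ P ∣ x
subsets# [] zero = refl
subsets# [] (suc x) = refl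
subsets# {suc m} (p ∷ P) x = trans (Σ-words (true ∷ false ∷ []) m _) (go p x)
  where
  e₁ : ∀ b x D → 𝟙 (((false ∷ D) ⊑? (b ∷ P)) ×-dec (∣ false ∷ D ∣ ≟ x)) ≡ 𝟙 ((D ⊑? P) ×-dec (∣ D ∣ ≟ x))
  e₁ b x D = ≤-antisym (𝟙-mono _ ((D ⊑? P) ×-dec (∣ D ∣ ≟ x)) id) (𝟙-mono _ (((false ∷ D) ⊑? (b ∷ P)) ×-dec (∣ false ∷ D ∣ ≟ x)) id)
  e₂ : ∀ x D → 𝟙 (((true ∷ D) ⊑? (true ∷ P)) ×-dec (∣ true ∷ D ∣ ≟ suc x)) ≡ 𝟙 ((D ⊑? P) ×-dec (∣ D ∣ ≟ x))
  e₂ x D = ≤-antisym (𝟙-mono _ ((D ⊑? P) ×-dec (∣ D ∣ ≟ x)) (λ (a , b) → a , suc-injective b)) (𝟙-mono _ (((true ∷ D) ⊑? (true ∷ P)) ×-dec (∣ true ∷ D ∣ ≟ suc x)) (λ (a , b) → a , cong suc b))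
  go : ∀ p x → Σ (true ∷ false ∷ []) (λ c → Σ (subs m) (λ D → 𝟙 (((c ∷ D) ⊑? (p ∷ P)) ×-dec (∣ c ∷ D ∣ ≟ x)))) ≡ bin ∣ p ∷ P ∣ x
  go true zero = trans (cong₂ _+_ (trans (Σ-cong (subs m) (λ D → 𝟙-no (((true ∷ D) ⊑? (true ∷ P)) ×-dec (∣ true ∷ D ∣ ≟ 0)) (λ ()))) (Σ-0 (subs m)))
                          (trans (+-identityʳ _) (trans (Σ-cong (subs m) (e₁ true 0)) (subsets# P 0)))) (go0 ∣ P ∣)
    where
    go0 : ∀ k → 0 + bin k 0 ≡ 1
    go0 zero = refl
    go0 (suc k) = refl
  go true (suc x) = cong₂ _+_ (trans (Σ-cong (subs m) (e₂ x)) (subsets# P x)) (trans (+-identityʳ _) (trans (Σ-cong (subs m) (e₁ true (suc x))) (subsets# P (suc x))))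
  go false x = trans (cong₂ _+_ (trans (Σ-cong (subs m) (λ D → 𝟙-no (((true ∷ D) ⊑? (false ∷ P)) ×-dec (∣ true ∷ D ∣ ≟ x)) (λ ()))) (Σ-0 (subs m))) (+-identityʳ _))
                 (trans (Σ-cong (subs m) (e₁ false x)) (subsets# P x))

powerset# : ∀ {m} (P : Subset m) → Σ (subs m) (λ D → 𝟙 (D ⊑? P)) ≡ 2 ^ ∣ P ∣
powerset# {m} P = trans (Σ-cong (subs m) (λ D → sym (trans (cong (𝟙 (D ⊑? P) *_) (trans (cong₂ _*_ (^-zeroˡ ∣ D ∣) (^-zeroˡ ∣ P ∩ ∁ D ∣)) refl)) (*-identityʳ _)))) (binomial m P 1 1)

pow-suc : ∀ n k → n ^ suc k + suc k * n ^ k ≤ suc n ^ suc k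
pow-suc n zero = ≤-reflexive (lem n)
  where
  lem : ∀ n → n * 1 + 1 ≡ suc n * 1
  lem = solve-∀
pow-suc n (suc k) = begin
    n ^ suc (suc k) + suc (suc k) * n ^ suc k ≤⟨ m≤m+n _ (suc k * n ^ k) ⟩
    n * (n * n ^ k) + suc (suc k) * (n * n ^ k) + suc k * n ^ k ≡⟨ lem n k (n ^ k) ⟩
    suc n * (n * n ^ k + suc k * n ^ k) ≤⟨ *-monoʳ-≤ (suc n) (pow-suc n k) ⟩
    suc n ^ suc (suc k) ∎
  where
  open ≤-Reasoning
  lem : ∀ n k p → n * (n * p) + suc (suc k) * (n * p) + suc k * p ≡ suc n * (n * p + suc k * p)
  lem = solve-∀

bin-! : ∀ n k → bin n k * k ! ≤ n ^ k
bin-! n zero = ≤-refl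
bin-! zero (suc k) = z≤n
bin-! (suc n) (suc k) = begin
    (bin n k + bin n (suc k)) * (suc k * k !) ≡⟨ lem (bin n k) (bin n (suc k)) k (k !) ⟩
    suc k * (bin n k * k !) + bin n (suc k) * (suc k * k !) ≤⟨ +-mono-≤ (*-monoʳ-≤ (suc k) (bin-! n k)) (bin-! n (suc k)) ⟩
    suc k * n ^ k + n ^ suc k ≡⟨ +-comm (suc k * n ^ k) _ ⟩
    n ^ suc k + suc k * n ^ k ≤⟨ pow-suc n k ⟩
    suc n ^ suc k ∎
  where
  open ≤-Reasoning
  lem : ∀ a b k f → (a + b) * (suc k * f) ≡ suc k * (a * f) + b * (suc k * f)
  lem = solve-∀

rising : ℕ → ℕ → ℕ
rising t zero = 1
rising t (suc x) = rising t x * (t + suc x)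

rising≥ : ∀ t x → t ^ x ≤ rising t x
rising≥ t zero = ≤-refl
rising≥ t (suc x) = ≤-trans (≤-reflexive (*-comm t (t ^ x))) (*-mono-≤ (rising≥ t x) (m≤m+n t (suc x)))

-- Peeling a t-intersecting family

Refines : ∀ {m} → List (Subset m) → List (Subset m) → Set
Refines 𝒮 𝒮′ = ∀ S → S ∈ 𝒮 → ∃[ S′ ] (S′ ∈ 𝒮′ × S′ ⊑ S)

module Peel {m : ℕ} (t j : ℕ) (j≥1 : 1 ≤ j) where

  Sized : List (Subset m) → Set
  Sized 𝒮 = ∀ S → S ∈ 𝒮 → ∣ S ∣ ≤ t + j

  -- Only the sets of top size t + j have to be critical; smaller ones are dealt with at lower
  -- levels.
  Minimal : List (Subset m) → Set
  Minimal 𝒮 = ∀ S → S ∈ 𝒮 → ∣ S ∣ ≡ t + j → ∀ x → x ∈ˢ S → ∃[ S′ ] (S′ ∈ 𝒮 × ∣ (S ∩ ∁ ⁅ x ⁆) ∩ S′ ∣ < t)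

  Shrinkable : List (Subset m) → Subset m → Fin m → Set
  Shrinkable 𝒮 S x = ∣ S ∣ ≡ t + j × x ∈ˢ S × (∀ S′ → S′ ∈ 𝒮 → t ≤ ∣ (S ∩ ∁ ⁅ x ⁆) ∩ S′ ∣)

  shrinkable? : ∀ 𝒮 S x → Dec (Shrinkable 𝒮 S x)
  shrinkable? 𝒮 S x = (∣ S ∣ ≟ t + j) ×-dec ((⁅ x ⁆ ⊑? S) ×-dec decAll′ (λ S′ → t ≤? ∣ (S ∩ ∁ ⁅ x ⁆) ∩ S′ ∣) 𝒮)

  module Replace (S T : Subset m) where
    replace : Subset m → Subset m
    replace X with X ≟ˢ S
    ... | yes _ = T
    ... | no _ = X

    replace-spec : ∀ X → (X ≡ S × replace X ≡ T) ⊎ replace X ≡ X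
    replace-spec X with X ≟ˢ S
    ... | yes e = inj₁ (e , refl)
    ... | no _ = inj₂ refl

    replace-self : replace S ≡ T
    replace-self with S ≟ˢ S
    ... | yes _ = refl
    ... | no ¬e = ⊥-elim (¬e refl)

  -- Deleting a point whose removal keeps all intersections at t lowers the total size, so the
  -- process ends. Because j ≥ 1 the shrunk set still has t points and so meets itself in t points
  -- as well.
  peel : ∀ fuel 𝒮 → TInt t 𝒮 → Sized 𝒮 → Σ 𝒮 ∣_∣ < fuel → ∃[ 𝒮′ ] (TInt t 𝒮′ × Sized 𝒮′ × Minimal 𝒮′ × Refines 𝒮 𝒮′)
  peel (suc fuel) 𝒮 tint sized (s≤s le) = go (dec∃ (λ S → dec∃′ (shrinkable? 𝒮 S) (elements m)) 𝒮)
    where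
    go : _ → _
    go (inj₂ none) = 𝒮 , tint , sized , minimal , λ S mS → S , mS , ⊑-refl S
      where
      minimal : Minimal 𝒮
      minimal S mS e x mx with decAll (λ S′ → t ≤? ∣ (S ∩ ∁ ⁅ x ⁆) ∩ S′ ∣) 𝒮
      ... | inj₂ (S′ , mS′ , ¬le) = S′ , mS′ , ≰⇒> ¬le
      ... | inj₁ all = ⊥-elim (none S mS (x , ∈elements x , e , mx , all))
    go (inj₁ (S , mS , x , _ , e , mx , all)) =
      let (𝒮′ , a , b , c , d) = peel fuel 𝒮₁ tint₁ sized₁ (<-≤-trans dec le) in 𝒮′ , a , b , c , refines 𝒮′ d
      where
      T₁ = S ∩ ∁ ⁅ x ⁆
      open Replace S T₁
      𝒮₁ = List.map replace 𝒮
      T-size : t ≤ ∣ T₁ ∣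
      T-size = slin 2 2 (λ s x t j → (∥ x ∥ ≼ # 1) ⇒ (t ⊹ j ≼ ∥ s ∥) ⇒ (# 1 ≼ j) ⇒ ⊢ (t ≼ ∥ s ∩′ ∁′ x ∥)) S ⁅ x ⁆ t j (≤-reflexive (∣⁅⁆∣ x)) (≤-reflexive (sym e)) j≥1
      T⊑S : T₁ ⊑ S
      T⊑S = slin 2 0 (λ s x → ⊢ (∥ (s ∩′ ∁′ x) ∩′ ∁′ s ∥ ≼ # 0)) S ⁅ x ⁆
      T≤S : ∣ T₁ ∣ ≤ ∣ S ∣
      T≤S = slin 2 0 (λ s x → ⊢ (∥ s ∩′ ∁′ x ∥ ≼ ∥ s ∥)) S ⁅ x ⁆
      T<S : ∣ T₁ ∣ < ∣ S ∣
      T<S = slin 2 0 (λ s x → (# 1 ≼ ∥ x ∥) ⇒ (∥ x ∩′ ∁′ s ∥ ≼ # 0) ⇒ ⊢ (# 1 ⊹ ∥ s ∩′ ∁′ x ∥ ≼ ∥ s ∥)) S ⁅ x ⁆ (≤-reflexive (sym (∣⁅⁆∣ x))) mx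
      shape : ∀ {A} → A ∈ 𝒮₁ → A ≡ T₁ ⊎ A ∈ 𝒮
      shape mA with ∈-map⁻ replace mA
      ... | A′ , mA′ , eq with replace-spec A′
      ...   | inj₁ (_ , r) = inj₁ (trans eq r)
      ...   | inj₂ r = inj₂ (subst (_∈ 𝒮) (sym (trans eq r)) mA′)
      tint₁ : TInt t 𝒮₁
      tint₁ A B mA mB with shape mA | shape mB
      ... | inj₁ refl | inj₁ refl = ≤-trans T-size (slin 1 0 (λ t → ⊢ (∥ t ∥ ≼ ∥ t ∩′ t ∥)) T₁)
      ... | inj₁ refl | inj₂ b = all B b
      ... | inj₂ a | inj₁ refl = ≤-trans (all A a) (slin 2 0 (λ a b → ⊢ (∥ b ∩′ a ∥ ≼ ∥ a ∩′ b ∥)) A T₁)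
      ... | inj₂ a | inj₂ b = tint A B a b
      sized₁ : Sized 𝒮₁
      sized₁ A mA with shape mA
      ... | inj₁ refl = ≤-trans T≤S (sized S mS)
      ... | inj₂ a = sized A a
      dec : Σ 𝒮₁ ∣_∣ < Σ 𝒮 ∣_∣
      dec = subst (_< Σ 𝒮 ∣_∣) (sym (Σ-map replace 𝒮 ∣_∣)) (Σ-mono-< le′ mS (subst (λ r → ∣ r ∣ < ∣ S ∣) (sym replace-self) T<S))
        where
        le′ : ∀ X → ∣ replace X ∣ ≤ ∣ X ∣
        le′ X with replace-spec X
        ... | inj₁ (refl , r) = ≤-trans (≤-reflexive (cong ∣_∣ r)) T≤S
        ... | inj₂ r = ≤-reflexive (cong ∣_∣ r)
      refines : ∀ 𝒮′ → Refines 𝒮₁ 𝒮′ → Refines 𝒮 𝒮′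
      refines 𝒮′ d X mX with d (replace X) (∈-map⁺ replace mX)
      ... | X′ , mX′ , le″ with replace-spec X
      ...   | inj₁ (refl , r) = X′ , mX′ , ⊑-trans X′ T₁ X (subst (X′ ⊑_) r le″) T⊑S
      ...   | inj₂ r = X′ , mX′ , subst (X′ ⊑_) r le″

-- The weight of one level of a peeled family

n<2^n : ∀ n → n < 2 ^ n
n<2^n zero = s≤s z≤n
n<2^n (suc n) = lin 2 (λ a p → (# 1 ⊹ a ≼ p) ⇒ (# 1 ≼ p) ⇒ ⊢ (# 1 ⊹ (# 1 ⊹ a) ≼ p ⊹ (p ⊹ # 0))) n (2 ^ n) (n<2^n n) (m^n>0 2 n)

^-distribʳ : ∀ h a b → (a * b) ^ h ≡ a ^ h * b ^ h
^-distribʳ zero a b = refl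
^-distribʳ (suc h) a b rewrite ^-distribʳ h a b = [m*n]*[o*p]≡[m*o]*[n*p] a b (a ^ h) (b ^ h)

-- The hypothesis `wt` may be used with any splitting j = x + y of the excess: x points are traded
-- for the factors t + 1, ..., t + x, and y points for factors n / 2. Through `hC`, exponential
-- losses are absorbed by x!.
module Weights {m : ℕ} (t q n M C K : ℕ) (w : Subset m → ℕ)
  (wt : ∀ S x y → ∣ S ∣ ≡ t + (x + y) → w S * n ^ y * rising t x ≤ 2 ^ y * M)
  (hC : ∀ x → 16 ^ x ≤ C * x !) (nbig : Scaled 128 (C * K * q) n) (C≥1 : 1 ≤ C) (K≥1 : 1 ≤ K) where

  module Level (j : ℕ) (j≥1 : 1 ≤ j) (j≤q : j ≤ q) (𝒮 : List (Subset m)) (tint : TInt t 𝒮)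
    (sized : Peel.Sized {m} t j j≥1 𝒮) (minimal : Peel.Minimal {m} t j j≥1 𝒮) (S₀ : Subset m) (S₀∈ : S₀ ∈ 𝒮) (S₀# : ∣ S₀ ∣ ≡ t + j) where

    W : List (Subset m)
    W = List.deduplicate _≟ˢ_ (List.filter (λ S → ∣ S ∣ ≟ t + j) 𝒮)

    W-unique : Unique W
    W-unique = UniqueDec.deduplicate-! _≟ˢ_ _

    W⇒ : ∀ {S} → S ∈ W → S ∈ 𝒮 × ∣ S ∣ ≡ t + j
    W⇒ mS = ∈-filter⁻ (λ S → ∣ S ∣ ≟ t + j) {xs = 𝒮} (Listₘ.∈-deduplicate⁻ _≟ˢ_ _ mS)

    ⇒W : ∀ {S} → S ∈ 𝒮 → ∣ S ∣ ≡ t + j → S ∈ W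
    ⇒W mS e = Listₘ.∈-deduplicate⁺ _≟ˢ_ (∈-filter⁺ (λ S → ∣ S ∣ ≟ t + j) mS e)

    private
      -- The witness that any one point of S₀ is critical meets S₀ in exactly t points. The pair S₀,
      -- S′ is the frame in which the level is classified.
      partner : ∃[ S′ ] (S′ ∈ 𝒮 × ∣ S₀ ∩ S′ ∣ ≤ t)
      partner with point S₀ (≤-trans j≥1 (≤-trans (m≤n+m j t) (≤-reflexive (sym S₀#))))
      ... | x , mx with minimal S₀ S₀∈ S₀# x mx
      ...   | S′ , mS′ , lt = S′ , mS′ , slin 3 1 (λ s x s′ t → (# 1 ⊹ ∥ (s ∩′ ∁′ x) ∩′ s′ ∥ ≼ t) ⇒ (∥ x ∥ ≼ # 1) ⇒ ⊢ (∥ s ∩′ s′ ∥ ≼ t)) S₀ ⁅ x ⁆ S′ t lt (≤-reflexive (∣⁅⁆∣ x))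

    S′ : Subset m
    S′ = proj₁ partner
    S′∈ : S′ ∈ 𝒮
    S′∈ = proj₁ (proj₂ partner)
    P Q Q′ Z : Subset m
    P = S₀ ∩ S′
    Q = S₀ ∩ ∁ S′
    Q′ = S′ ∩ ∁ S₀
    Z = S₀ ∪ S′

    private
      P≤ : ∣ P ∣ ≤ t
      P≤ = proj₂ (proj₂ partner)
      P≥ : t ≤ ∣ P ∣
      P≥ = tint S₀ S′ S₀∈ S′∈
      S₀≤ : ∣ S₀ ∣ ≤ t + j
      S₀≤ = ≤-reflexive S₀#
      S₀≥ : t + j ≤ ∣ S₀ ∣
      S₀≥ = ≤-reflexive (sym S₀#)
      S′≤ : ∣ S′ ∣ ≤ t + j
      S′≤ = sized S′ S′∈
      Q≤ : ∣ Q ∣ ≤ j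
      Q≤ = slin 2 2 (λ a b t j → (∥ a ∥ ≼ t ⊹ j) ⇒ (t ≼ ∥ a ∩′ b ∥) ⇒ ⊢ (∥ a ∩′ ∁′ b ∥ ≼ j)) S₀ S′ t j S₀≤ P≥
      Q′≤ : ∣ Q′ ∣ ≤ j
      Q′≤ = slin 2 2 (λ a b t j → (∥ b ∥ ≼ t ⊹ j) ⇒ (t ≼ ∥ a ∩′ b ∥) ⇒ ⊢ (∥ b ∩′ ∁′ a ∥ ≼ j)) S₀ S′ t j S′≤ P≥

      Cls : Subset m → Subset m → Subset m → Set
      Cls Y O S = S ∩ S₀ ≡ Y × O ⊑ S

      cls? : ∀ Y O S → Dec (Cls Y O S)
      cls? Y O S = (S ∩ S₀ ≟ˢ Y) ×-dec (O ⊑? S)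

      none⇒0 : {R : Subset m → Set} (R? : ∀ S → Dec (R S)) → (∀ S → S ∈ W → ¬ R S) → ∀ {b} → Σ W (λ S → 𝟙 (R? S)) ≤ b
      none⇒0 R? none = ≤-trans (≤-trans (Σ-≤const W 0 (λ S mS → ≤-reflexive (𝟙-no (R? S) (none S mS)))) (≤-reflexive (*-zeroʳ (length W)))) z≤n

      single : {R : Subset m → Set} (R? : ∀ S → Dec (R S)) → (∀ {S T} → S ∈ W → T ∈ W → R S → R T → S ≡ T) → Σ W (λ S → 𝟙 (R? S)) ≤ 1
      single R? same with dec∃ R? W
      ... | inj₂ none = none⇒0 R? none
      ... | inj₁ (S , mS , rS) = ≤-trans (Σ-mono W (λ T mT → 𝟙-mono (R? T) (T ≟ˢ S) (λ rT → same mT mS rT rS))) (Σ-≟ W-unique S)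

    -- Let S be in the class and x a point of S outside Y ∪ O, with critical witness S″. Every R of
    -- the class meets S″ in t points, of which fewer than t lie in S₀ ∪ O, since there R stays
    -- inside S minus x. So R has a point in X = S″ minus (S₀ ∪ O), and X has at most j points
    -- because S″ meets S₀ in t. Each round fixes one more point at the price of a factor j.
    branch : ∀ rem Y O → ∣ O ∩ S₀ ∣ ≤ 0 → ∣ Y ∣ + ∣ O ∣ + rem ≡ t + j → Σ W (λ S → 𝟙 (cls? Y O S)) ≤ j ^ rem
    branch zero Y O dis e = single (cls? Y O) λ mS mT a b → trans (eq mS a) (sym (eq mT b))
      where
      eq : ∀ {S} → S ∈ W → Cls Y O S → S ≡ Y ∪ O
      eq {S} mS (refl , O⊑) = ⊑-antisym
        (slin 3 1 (λ s s₀ o a → (∥ s ∥ ≼ a) ⇒ (a ≼ ∥ s ∩′ s₀ ∥ ⊹ ∥ o ∥ ⊹ # 0) ⇒ (∥ o ∩′ s₀ ∥ ≼ # 0) ⇒ (∥ o ∩′ ∁′ s ∥ ≼ # 0) ⇒ ⊢ (∥ s ∩′ ∁′ ((s ∩′ s₀) ∪′ o) ∥ ≼ # 0))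
          S S₀ O (t + j) (≤-reflexive (proj₂ (W⇒ mS))) (≤-reflexive (sym e)) dis O⊑)
        (slin 3 0 (λ s s₀ o → (∥ o ∩′ ∁′ s ∥ ≼ # 0) ⇒ ⊢ (∥ ((s ∩′ s₀) ∪′ o) ∩′ ∁′ s ∥ ≼ # 0)) S S₀ O O⊑)
    branch (suc rem) Y O dis e with dec∃ (cls? Y O) W
    ... | inj₂ none = none⇒0 (cls? Y O) none
    ... | inj₁ (S , mS , refl , O⊑) = begin
        Σ W (λ R → 𝟙 (cls? Y O R)) ≤⟨ Σ-mono W step ⟩
        Σ W (λ R → Σ (elements m) (λ z → 𝟙 (⁅ z ⁆ ⊑? X) * 𝟙 (cls? Y (O ∪ ⁅ z ⁆) R))) ≡⟨ Σ-swap W (elements m) _ ⟩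
        Σ (elements m) (λ z → Σ W (λ R → 𝟙 (⁅ z ⁆ ⊑? X) * 𝟙 (cls? Y (O ∪ ⁅ z ⁆) R))) ≡⟨ Σ-cong (elements m) (λ z → Σ-*ˡ W (𝟙 (⁅ z ⁆ ⊑? X)) _) ⟩
        Σ (elements m) (λ z → 𝟙 (⁅ z ⁆ ⊑? X) * Σ W (λ R → 𝟙 (cls? Y (O ∪ ⁅ z ⁆) R))) ≤⟨ Σ-mono′ (elements m) (λ z → 𝟙*-mono (⁅ z ⁆ ⊑? X) (λ mz → branch rem Y (O ∪ ⁅ z ⁆) (dis′ z mz) (e′ z mz))) ⟩
        Σ (elements m) (λ z → 𝟙 (⁅ z ⁆ ⊑? X) * j ^ rem) ≡⟨ Σ-*ʳ (elements m) (j ^ rem) _ ⟩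
        Σ (elements m) (λ z → 𝟙 (⁅ z ⁆ ⊑? X)) * j ^ rem ≡⟨ cong (_* j ^ rem) (Σ-elements X) ⟩
        ∣ X ∣ * j ^ rem ≤⟨ *-monoˡ-≤ (j ^ rem) X≤ ⟩
        j * j ^ rem ∎
      where
      open ≤-Reasoning
      outside : 1 ≤ ∣ S ∩ ∁ ((S ∩ S₀) ∪ O) ∣
      outside = slin 3 2 (λ s s₀ o a r → (a ≼ ∥ s ∥) ⇒ (∥ s ∩′ s₀ ∥ ⊹ ∥ o ∥ ⊹ (# 1 ⊹ r) ≼ a) ⇒ ⊢ (# 1 ≼ ∥ s ∩′ ∁′ ((s ∩′ s₀) ∪′ o) ∥))
        S S₀ O (t + j) rem (≤-reflexive (sym (proj₂ (W⇒ mS)))) (≤-reflexive e)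
      x = proj₁ (point (S ∩ ∁ ((S ∩ S₀) ∪ O)) outside)
      x∈ : ⁅ x ⁆ ⊑ S ∩ ∁ ((S ∩ S₀) ∪ O)
      x∈ = proj₂ (point (S ∩ ∁ ((S ∩ S₀) ∪ O)) outside)
      wit = minimal S (proj₁ (W⇒ mS)) (proj₂ (W⇒ mS)) x (slin 3 0 (λ e s y → (∥ e ∩′ ∁′ (s ∩′ y) ∥ ≼ # 0) ⇒ ⊢ (∥ e ∩′ ∁′ s ∥ ≼ # 0)) ⁅ x ⁆ S (∁ ((S ∩ S₀) ∪ O)) x∈)
      S″ = proj₁ wit
      S″∈ : S″ ∈ 𝒮
      S″∈ = proj₁ (proj₂ wit)
      X = S″ ∩ ∁ (S₀ ∪ O)
      X≤ : ∣ X ∣ ≤ j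
      X≤ = slin 3 2 (λ s₀ o s″ t j → (∥ s″ ∥ ≼ t ⊹ j) ⇒ (t ≼ ∥ s″ ∩′ s₀ ∥) ⇒ ⊢ (∥ s″ ∩′ ∁′ (s₀ ∪′ o) ∥ ≼ j)) S₀ O S″ t j (sized S″ S″∈) (tint S″ S₀ S″∈ S₀∈)
      meets : ∀ R → R ∈ W → Cls Y O R → 1 ≤ ∣ R ∩ X ∣
      meets R mR (eq , O⊑R) = slin 6 1 (λ r s s₀ o e s″ t → (t ≼ ∥ r ∩′ s″ ∥) ⇒ (# 1 ⊹ ∥ (s ∩′ ∁′ e) ∩′ s″ ∥ ≼ t) ⇒ (∥ (r ∩′ s₀) ∩′ ∁′ (s ∩′ s₀) ∥ ≼ # 0)
           ⇒ (∥ o ∩′ ∁′ s ∥ ≼ # 0) ⇒ (∥ e ∩′ ∁′ (s ∩′ ∁′ ((s ∩′ s₀) ∪′ o)) ∥ ≼ # 0) ⇒ ⊢ (# 1 ≼ ∥ r ∩′ (s″ ∩′ ∁′ (s₀ ∪′ o)) ∥))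
           R S S₀ O ⁅ x ⁆ S″ t (tint R S″ (proj₁ (W⇒ mR)) S″∈) (proj₂ (proj₂ wit)) (subst (_⊑ S ∩ S₀) (sym eq) (⊑-refl (S ∩ S₀))) O⊑ x∈
      step : ∀ R → R ∈ W → 𝟙 (cls? Y O R) ≤ Σ (elements m) (λ z → 𝟙 (⁅ z ⁆ ⊑? X) * 𝟙 (cls? Y (O ∪ ⁅ z ⁆) R))
      step R mR = 𝟙-if (cls? Y O R) λ c → let (z , mz) = point (R ∩ X) (meets R mR c) in
        ≤-trans (*-mono-≤ (𝟙-yes (⁅ z ⁆ ⊑? X) (slin 3 0 (λ e r x → (∥ e ∩′ ∁′ (r ∩′ x) ∥ ≼ # 0) ⇒ ⊢ (∥ e ∩′ ∁′ x ∥ ≼ # 0)) ⁅ z ⁆ R X mz))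
                          (𝟙-yes (cls? Y (O ∪ ⁅ z ⁆) R) (proj₁ c , slin 4 0 (λ e r x o → (∥ e ∩′ ∁′ (r ∩′ x) ∥ ≼ # 0) ⇒ (∥ o ∩′ ∁′ r ∥ ≼ # 0) ⇒ ⊢ (∥ (o ∪′ e) ∩′ ∁′ r ∥ ≼ # 0)) ⁅ z ⁆ R X O mz (proj₂ c))))
                (Σ-member (λ z → 𝟙 (⁅ z ⁆ ⊑? X) * 𝟙 (cls? Y (O ∪ ⁅ z ⁆) R)) (∈elements z))
      dis′ : ∀ z → ⁅ z ⁆ ⊑ X → ∣ (O ∪ ⁅ z ⁆) ∩ S₀ ∣ ≤ 0
      dis′ z mz = slin 4 0 (λ e s″ s₀ o → (∥ e ∩′ ∁′ (s″ ∩′ ∁′ (s₀ ∪′ o)) ∥ ≼ # 0) ⇒ (∥ o ∩′ s₀ ∥ ≼ # 0) ⇒ ⊢ (∥ (o ∪′ e) ∩′ s₀ ∥ ≼ # 0)) ⁅ z ⁆ S″ S₀ O mz dis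
      e′ : ∀ z → ⁅ z ⁆ ⊑ X → ∣ Y ∣ + ∣ O ∪ ⁅ z ⁆ ∣ + rem ≡ t + j
      e′ z mz = trans (cong (λ k → ∣ Y ∣ + k + rem) size) (trans (lem ∣ Y ∣ ∣ O ∣ rem) e)
        where
        lem : ∀ a b c → a + suc b + c ≡ a + b + suc c
        lem = solve-∀
        size : ∣ O ∪ ⁅ z ⁆ ∣ ≡ suc ∣ O ∣
        size = ≤-antisym
          (slin 2 0 (λ o e → (∥ e ∥ ≼ # 1) ⇒ ⊢ (∥ o ∪′ e ∥ ≼ # 1 ⊹ ∥ o ∥)) O ⁅ z ⁆ (≤-reflexive (∣⁅⁆∣ z)))
          (slin 4 0 (λ o e s″ s₀ → (# 1 ≼ ∥ e ∥) ⇒ (∥ e ∩′ ∁′ (s″ ∩′ ∁′ (s₀ ∪′ o)) ∥ ≼ # 0) ⇒ ⊢ (# 1 ⊹ ∥ o ∥ ≼ ∥ o ∪′ e ∥)) O ⁅ z ⁆ S″ S₀ (≤-reflexive (sym (∣⁅⁆∣ z))) mz)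

    -- S is described by P minus S, Q minus S, Q′ ∩ S and its remaining points. Meeting S′ in t
    -- points forces x points of Q′ into S, so at most j - x = y points are left for `branch`.
    class# : ∀ x y → x + y ≡ j → Σ W (λ S → 𝟙 (∣ P ∩ ∁ S ∣ ≟ x)) ≤ bin t x * (4 ^ j * j ^ y)
    class# x y xy = begin
        Σ W (λ S → 𝟙 (Pr₁? S)) ≤⟨ group W Pr₁? (λ S → P ∩ ∁ S) (λ D → 𝟙 ((D ⊑? P) ×-dec (∣ D ∣ ≟ x))) (2 ^ ∣ Q ∣ * (2 ^ ∣ Q′ ∣ * j ^ y))
                                                                       (λ S _ e → 𝟙-yes (((P ∩ ∁ S) ⊑? P) ×-dec (∣ P ∩ ∁ S ∣ ≟ x)) (sub₁ P (∁ S) , e)) byD ⟩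
        Σ (subs m) (λ D → 𝟙 ((D ⊑? P) ×-dec (∣ D ∣ ≟ x))) * (2 ^ ∣ Q ∣ * (2 ^ ∣ Q′ ∣ * j ^ y)) ≡⟨ cong (_* _) (trans (subsets# P x) (cong (λ p → bin p x) (≤-antisym P≤ P≥))) ⟩
        bin t x * (2 ^ ∣ Q ∣ * (2 ^ ∣ Q′ ∣ * j ^ y)) ≤⟨ *-monoʳ-≤ (bin t x) (≤-trans (*-mono-≤ (^-monoʳ-≤ 2 Q≤) (*-monoˡ-≤ (j ^ y) (^-monoʳ-≤ 2 Q′≤))) (≤-reflexive (trans (sym (*-assoc (2 ^ j) (2 ^ j) _)) (cong (_* j ^ y) (sym (^-distribʳ j 2 2)))))) ⟩
        bin t x * (4 ^ j * j ^ y) ∎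
      where
      open ≤-Reasoning
      sub₁ : ∀ (a b : Subset m) → a ∩ b ⊑ a
      sub₁ = slin 2 0 (λ a b → ⊢ (∥ (a ∩′ b) ∩′ ∁′ a ∥ ≼ # 0))
      Pr₁? : ∀ S → Dec (∣ P ∩ ∁ S ∣ ≡ x)
      Pr₁? S = ∣ P ∩ ∁ S ∣ ≟ x
      byDEO : ∀ D E O → Σ W (λ S → 𝟙 (((Pr₁? S ×-dec (P ∩ ∁ S ≟ˢ D)) ×-dec (Q ∩ ∁ S ≟ˢ E)) ×-dec (Q′ ∩ S ≟ˢ O))) ≤ j ^ y
      byDEO D E O with dec∃ (λ S → ((Pr₁? S ×-dec (P ∩ ∁ S ≟ˢ D)) ×-dec (Q ∩ ∁ S ≟ˢ E)) ×-dec (Q′ ∩ S ≟ˢ O)) W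
      ... | inj₂ none = none⇒0 (λ S → ((Pr₁? S ×-dec (P ∩ ∁ S ≟ˢ D)) ×-dec (Q ∩ ∁ S ≟ˢ E)) ×-dec (Q′ ∩ S ≟ˢ O)) none
      ... | inj₁ (S , mS , ((e₁ , refl) , refl) , refl) = begin
            Σ W (λ R → 𝟙 (((Pr₁? R ×-dec (P ∩ ∁ R ≟ˢ P ∩ ∁ S)) ×-dec (Q ∩ ∁ R ≟ˢ Q ∩ ∁ S)) ×-dec (Q′ ∩ R ≟ˢ Q′ ∩ S)))
              ≤⟨ Σ-mono W (λ R mR → 𝟙-mono (((Pr₁? R ×-dec (P ∩ ∁ R ≟ˢ P ∩ ∁ S)) ×-dec (Q ∩ ∁ R ≟ˢ Q ∩ ∁ S)) ×-dec (Q′ ∩ R ≟ˢ Q′ ∩ S)) (cls? (S ∩ S₀) (Q′ ∩ S) R) (same R)) ⟩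
            Σ W (λ R → 𝟙 (cls? (S ∩ S₀) (Q′ ∩ S) R))
              ≤⟨ branch rem (S ∩ S₀) (Q′ ∩ S) (slin 3 0 (λ s s₀ s′ → ⊢ (∥ ((s′ ∩′ ∁′ s₀) ∩′ s) ∩′ s₀ ∥ ≼ # 0)) S S₀ S′) (m+[n∸m]≡n le) ⟩
            j ^ rem ≤⟨ ^-monoʳ-≤ j {{>-nonZero j≥1}} rem≤ ⟩
            j ^ y ∎
        where
        le : ∣ S ∩ S₀ ∣ + ∣ Q′ ∩ S ∣ ≤ t + j
        le = slin 3 1 (λ s s₀ s′ a → (∥ s ∥ ≼ a) ⇒ ⊢ (∥ s ∩′ s₀ ∥ ⊹ ∥ (s′ ∩′ ∁′ s₀) ∩′ s ∥ ≼ a)) S S₀ S′ (t + j) (≤-reflexive (proj₂ (W⇒ mS)))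
        rem = t + j ∸ (∣ S ∩ S₀ ∣ + ∣ Q′ ∩ S ∣)
        rem≤ : rem ≤ y
        rem≤ = ≤-trans (∸-monoˡ-≤ (∣ S ∩ S₀ ∣ + ∣ Q′ ∩ S ∣) bound) (≤-reflexive (m+n∸m≡n (∣ S ∩ S₀ ∣ + ∣ Q′ ∩ S ∣) y))
          where
          bound : t + j ≤ ∣ S ∩ S₀ ∣ + ∣ Q′ ∩ S ∣ + y
          bound = slin 3 4 (λ s s₀ s′ t j x y → (t ≼ ∥ s ∩′ s₀ ∥) ⇒ (t ≼ ∥ s ∩′ s′ ∥) ⇒ (x ≼ ∥ (s₀ ∩′ s′) ∩′ ∁′ s ∥) ⇒ (∥ s₀ ∩′ s′ ∥ ≼ t) ⇒ (j ≼ x ⊹ y)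
                     ⇒ ⊢ (t ⊹ j ≼ ∥ s ∩′ s₀ ∥ ⊹ ∥ (s′ ∩′ ∁′ s₀) ∩′ s ∥ ⊹ y)) S S₀ S′ t j x y
                     (tint S S₀ (proj₁ (W⇒ mS)) S₀∈) (tint S S′ (proj₁ (W⇒ mS)) S′∈) (≤-reflexive (sym e₁)) P≤ (≤-reflexive (sym xy))
        same : ∀ R → ((∣ P ∩ ∁ R ∣ ≡ x × P ∩ ∁ R ≡ P ∩ ∁ S) × Q ∩ ∁ R ≡ Q ∩ ∁ S) × Q′ ∩ R ≡ Q′ ∩ S → Cls (S ∩ S₀) (Q′ ∩ S) R
        same R (((_ , eP) , eQ) , eQ′) = ⊑-antisym (incl R S (sub eP) (sub eQ)) (incl S R (sub (sym eP)) (sub (sym eQ)))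
            , subst (_⊑ R) eQ′ (slin 2 0 (λ a b → ⊢ (∥ (a ∩′ b) ∩′ ∁′ b ∥ ≼ # 0)) Q′ R)
          where
          sub : ∀ {a b : Subset m} → a ≡ b → b ⊑ a
          sub {a} refl = ⊑-refl a
          incl : ∀ R S → P ∩ ∁ S ⊑ P ∩ ∁ R → Q ∩ ∁ S ⊑ Q ∩ ∁ R → R ∩ S₀ ⊑ S ∩ S₀
          incl R S = slin 4 0 (λ r s s₀ s′ → (∥ ((s₀ ∩′ s′) ∩′ ∁′ s) ∩′ ∁′ ((s₀ ∩′ s′) ∩′ ∁′ r) ∥ ≼ # 0) ⇒ (∥ ((s₀ ∩′ ∁′ s′) ∩′ ∁′ s) ∩′ ∁′ ((s₀ ∩′ ∁′ s′) ∩′ ∁′ r) ∥ ≼ # 0)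
                       ⇒ ⊢ (∥ (r ∩′ s₀) ∩′ ∁′ (s ∩′ s₀) ∥ ≼ # 0)) R S S₀ S′
      byDE : ∀ D E → Σ W (λ S → 𝟙 ((Pr₁? S ×-dec (P ∩ ∁ S ≟ˢ D)) ×-dec (Q ∩ ∁ S ≟ˢ E))) ≤ 2 ^ ∣ Q′ ∣ * j ^ y
      byDE D E = ≤-trans (group W (λ S → (Pr₁? S ×-dec (P ∩ ∁ S ≟ˢ D)) ×-dec (Q ∩ ∁ S ≟ˢ E)) (λ S → Q′ ∩ S) (λ O → 𝟙 (O ⊑? Q′)) (j ^ y)
                   (λ S _ _ → 𝟙-yes ((Q′ ∩ S) ⊑? Q′) (sub₁ Q′ S)) (byDEO D E)) (≤-reflexive (cong (_* j ^ y) (powerset# Q′)))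
      byD : ∀ D → Σ W (λ S → 𝟙 (Pr₁? S ×-dec (P ∩ ∁ S ≟ˢ D))) ≤ 2 ^ ∣ Q ∣ * (2 ^ ∣ Q′ ∣ * j ^ y)
      byD D = ≤-trans (group W (λ S → Pr₁? S ×-dec (P ∩ ∁ S ≟ˢ D)) (λ S → Q ∩ ∁ S) (λ E → 𝟙 (E ⊑? Q)) (2 ^ ∣ Q′ ∣ * j ^ y)
                   (λ S _ _ → 𝟙-yes ((Q ∩ ∁ S) ⊑? Q) (sub₁ Q (∁ S))) (byDE D)) (≤-reflexive (cong (_* (2 ^ ∣ Q′ ∣ * j ^ y)) (powerset# Q)))

    -- Since bin t x * x! ≤ t^x ≤ rising t x, the binomial coefficient of the count cancels against
    -- the weight of a single set, and t disappears from the bound.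
    weight-from-count : {R : Subset m → Set} (R? : ∀ S → Dec (R S)) → ∀ x y c → x + y ≡ j → Σ W (λ S → 𝟙 (R? S)) ≤ bin t x * c →
                        Σ W (λ S → 𝟙 (R? S) * w S) * (n ^ y * x !) ≤ c * (2 ^ y * M)
    weight-from-count R? x y c xy h with dec∃ R? W
    ... | inj₂ none = ≤-trans (*-monoˡ-≤ (n ^ y * x !) (Σ𝟙-empty W {m} R? none w)) z≤n
    ... | inj₁ (S , mS , rS) = *-cancelˡ-≤ (bin t x) {{>-nonZero bin≥1}} (begin
        bin t x * (Σ W (λ S → 𝟙 (R? S) * w S) * (n ^ y * x !)) ≡⟨ arr₁ (bin t x) (Σ W (λ S → 𝟙 (R? S) * w S)) (n ^ y) (x !) ⟩
        Σ W (λ S → 𝟙 (R? S) * w S) * (n ^ y * (bin t x * x !)) ≡⟨ sym (Σ-*ʳ W _ _) ⟩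
        Σ W (λ S → 𝟙 (R? S) * w S * (n ^ y * (bin t x * x !))) ≤⟨ Σ-mono W (λ S mS → ≤-trans (≤-reflexive (*-assoc (𝟙 (R? S)) _ _)) (*-monoʳ-≤ (𝟙 (R? S)) (each S mS))) ⟩
        Σ W (λ S → 𝟙 (R? S) * (2 ^ y * M)) ≡⟨ Σ-*ʳ W (2 ^ y * M) _ ⟩
        Σ W (λ S → 𝟙 (R? S)) * (2 ^ y * M) ≤⟨ *-monoˡ-≤ (2 ^ y * M) h ⟩
        bin t x * c * (2 ^ y * M) ≡⟨ *-assoc (bin t x) c _ ⟩
        bin t x * (c * (2 ^ y * M)) ∎)
      where
      open ≤-Reasoning
      bin≥1 : 1 ≤ bin t x
      bin≥1 with bin t x | ≤-trans (𝟙-yes (R? S) rS) (≤-trans (Σ-member (λ S → 𝟙 (R? S)) mS) h)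
      ... | suc _ | _ = s≤s z≤n
      arr₁ : ∀ b s p f → b * (s * (p * f)) ≡ s * (p * (b * f))
      arr₁ = solve-∀
      each : ∀ S → S ∈ W → w S * (n ^ y * (bin t x * x !)) ≤ 2 ^ y * M
      each S mS = ≤-trans (≤-reflexive (sym (*-assoc (w S) (n ^ y) _)))
        (≤-trans (*-monoʳ-≤ (w S * n ^ y) (≤-trans (bin-! t x) (rising≥ t x))) (wt S x y (trans (proj₂ (W⇒ mS)) (cong (t +_) (sym xy)))))

    wx : ℕ → ℕ
    wx x = Σ W (λ S → 𝟙 (∣ P ∩ ∁ S ∣ ≟ x) * w S)

    -- At least one point is charged to n rather than to t. Each such point gains n against a factor
    -- of order j, and n ≥ 128 C K q pays for its share 16 and for the constants; 16^x is absorbed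
    -- by C x!.
    few : ∀ x y → x + suc y ≡ j → wx x * (4 ^ j * (2 * K)) ≤ M
    few x y xy = *-cancelˡ-≤ (C * ((2 * j) ^ suc y * 4 ^ j)) {{>-nonZero pos}} (begin
        C * ((2 * j) ^ y′ * 4 ^ j) * (wx x * (4 ^ j * (2 * K))) ≡⟨ arr₁ C ((2 * j) ^ y′) (4 ^ j) (wx x) K ⟩
        wx x * ((2 * j) ^ y′ * (4 ^ j * 4 ^ j) * (2 * (C * K))) ≡⟨ cong (λ e → wx x * ((2 * j) ^ y′ * e * (2 * (C * K)))) 16j ⟩
        wx x * ((2 * j) ^ y′ * (16 ^ x * 16 ^ y′) * (2 * (C * K))) ≡⟨ arr₂ (wx x) ((2 * j) ^ y′) (16 ^ x) (16 ^ y′) (2 * (C * K)) ⟩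
        wx x * ((2 * j) ^ y′ * 16 ^ y′ * (2 * (C * K))) * 16 ^ x ≤⟨ *-mono-≤ (*-monoʳ-≤ (wx x) n^y) (hC x) ⟩
        wx x * n ^ y′ * (C * x !) ≡⟨ arr₃ (wx x) (n ^ y′) C (x !) ⟩
        C * (wx x * (n ^ y′ * x !)) ≤⟨ *-monoʳ-≤ C (weight-from-count (λ S → ∣ P ∩ ∁ S ∣ ≟ x) x y′ (4 ^ j * j ^ y′) xy (class# x y′ xy)) ⟩
        C * (4 ^ j * j ^ y′ * (2 ^ y′ * M)) ≡⟨ trans (arr₄ C (4 ^ j) (j ^ y′) (2 ^ y′) M) (cong (λ e → C * (e * 4 ^ j) * M) (sym (^-distribʳ y′ 2 j))) ⟩
        C * ((2 * j) ^ y′ * 4 ^ j) * M ∎)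
      where
      open ≤-Reasoning
      y′ = suc y
      CK≥1 : 1 ≤ 2 * (C * K)
      CK≥1 = *-mono-≤ {1} {2} (s≤s z≤n) (*-mono-≤ C≥1 K≥1)
      2j≥1 : 1 ≤ 2 * j
      2j≥1 = *-mono-≤ {1} {2} (s≤s z≤n) j≥1
      pos : 1 ≤ C * ((2 * j) ^ suc y * 4 ^ j)
      pos = *-mono-≤ C≥1 (*-mono-≤ (m^n>0 (2 * j) {{>-nonZero 2j≥1}} y′) (m^n>0 4 j))
      arr₁ : ∀ c a f s k → c * (a * f) * (s * (f * (2 * k))) ≡ s * (a * (f * f) * (2 * (c * k)))
      arr₁ = solve-∀
      arr₂ : ∀ s a b c d → s * (a * (b * c) * d) ≡ s * (a * c * d) * b
      arr₂ = solve-∀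
      arr₃ : ∀ s a c f → s * a * (c * f) ≡ c * (s * (a * f))
      arr₃ = solve-∀
      arr₄ : ∀ c f a b M → c * (f * a * (b * M)) ≡ c * (b * a * f) * M
      arr₄ = solve-∀
      16j : 4 ^ j * 4 ^ j ≡ 16 ^ x * 16 ^ y′
      16j = trans (sym (^-distribʳ j 4 4)) (trans (cong (16 ^_) (sym xy)) (^-distribˡ-+-* 16 x y′))
      base : 2 * j * 16 * (2 * (C * K)) ≤ n
      base = ≤-trans (≤-reflexive (lem j (C * K))) (≤-trans (*-mono-≤ (*-monoˡ-≤ (C * K) (≤ᵇ⇒≤ 64 128 tt)) j≤q) (≤-trans (≤-reflexive (*-assoc 128 (C * K) q)) (unscaled nbig)))
        where
        lem : ∀ j c → 2 * j * 16 * (2 * c) ≡ 64 * c * j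
        lem = solve-∀
      n^y : (2 * j) ^ y′ * 16 ^ y′ * (2 * (C * K)) ≤ n ^ y′
      n^y = begin
        (2 * j) ^ y′ * 16 ^ y′ * (2 * (C * K)) ≤⟨ *-monoʳ-≤ ((2 * j) ^ y′ * 16 ^ y′) (≤-trans (≤-reflexive (sym (^-identityʳ (2 * (C * K))))) (^-monoʳ-≤ (2 * (C * K)) {{>-nonZero CK≥1}} {1} {y′} (s≤s z≤n))) ⟩
        (2 * j) ^ y′ * 16 ^ y′ * (2 * (C * K)) ^ y′ ≡⟨ sym (trans (^-distribʳ y′ (2 * j * 16) (2 * (C * K))) (cong (_* (2 * (C * K)) ^ y′) (^-distribʳ y′ (2 * j) 16))) ⟩
        (2 * j * 16 * (2 * (C * K))) ^ y′ ≤⟨ ^-monoˡ-≤ y′ base ⟩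
        n ^ y′ ∎

    ng g : ℕ
    ng = Σ W (λ S → 𝟙 (∣ P ∩ ∁ S ∣ <? j) * w S)
    g = wx j

    -- The number j of classes costs at most 2^j, which is why `few` provides 4^j.
    ng-small : ng * (2 ^ j * (2 * K)) ≤ M
    ng-small = *-cancelˡ-≤ (2 ^ j) {{m^n≢0 2 j}} (begin
        2 ^ j * (ng * (2 ^ j * (2 * K))) ≡⟨ arr (2 ^ j) ng (2 * K) ⟩
        ng * (2 ^ j * 2 ^ j * (2 * K)) ≡⟨ cong (λ e → ng * (e * (2 * K))) (sym (^-distribʳ j 2 2)) ⟩
        ng * (4 ^ j * (2 * K)) ≤⟨ *-monoˡ-≤ (4 ^ j * (2 * K)) ng≤ ⟩
        Σ (List.upTo j) wx * (4 ^ j * (2 * K)) ≡⟨ sym (Σ-*ʳ (List.upTo j) _ wx) ⟩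
        Σ (List.upTo j) (λ x → wx x * (4 ^ j * (2 * K))) ≤⟨ Σ-≤const (List.upTo j) M (λ x mx → let x<j = Listₘ.∈-upTo⁻ mx in few x (j ∸ suc x) (trans (+-suc x _) (m+[n∸m]≡n x<j))) ⟩
        length (List.upTo j) * M ≡⟨ cong (_* M) (Listₚ.length-upTo j) ⟩
        j * M ≤⟨ *-monoˡ-≤ M (<⇒≤ (n<2^n j)) ⟩
        2 ^ j * M ∎)
      where
      open ≤-Reasoning
      arr : ∀ a b c → a * (b * (a * c)) ≡ b * (a * a * c)
      arr = solve-∀
      ng≤ : ng ≤ Σ (List.upTo j) wx
      ng≤ = ≤-trans (Σ-mono′ W (λ S → 𝟙*-≤ (∣ P ∩ ∁ S ∣ <? j) (λ lt →
               ≤-trans (≤-trans (≤-reflexive (sym (*-identityˡ (w S)))) (*-monoˡ-≤ (w S) (𝟙-yes (∣ P ∩ ∁ S ∣ ≟ ∣ P ∩ ∁ S ∣) refl)))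
                       (Σ-member (λ x → 𝟙 (∣ P ∩ ∁ S ∣ ≟ x) * w S) (Listₘ.∈-upTo⁺ lt)))))
            (≤-reflexive (Σ-swap W (List.upTo j) _))

    total : Σ W w ≤ ng + g
    total = ≤-trans (Σ-mono W each) (≤-reflexive (Σ-+ W _ _))
      where
      each : ∀ S → S ∈ W → w S ≤ 𝟙 (∣ P ∩ ∁ S ∣ <? j) * w S + 𝟙 (∣ P ∩ ∁ S ∣ ≟ j) * w S
      each S mS with ∣ P ∩ ∁ S ∣ <? j | ∣ P ∩ ∁ S ∣ ≟ j
      ... | yes _ | _ = ≤-trans (≤-reflexive (sym (*-identityˡ (w S)))) (m≤m+n _ _)
      ... | no _ | yes _ = ≤-reflexive (sym (*-identityˡ (w S)))
      ... | no ≮ | no ≢ = ⊥-elim (≢ (≤-antisym le (≮⇒≥ ≮)))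
        where
        le : ∣ P ∩ ∁ S ∣ ≤ j
        le = slin 3 2 (λ s s₀ s′ t j → (∥ s₀ ∥ ≼ t ⊹ j) ⇒ (t ≼ ∥ s ∩′ s₀ ∥) ⇒ ⊢ (∥ (s₀ ∩′ s′) ∩′ ∁′ s ∥ ≼ j)) S S₀ S′ t j S₀≤ (tint S S₀ (proj₁ (W⇒ mS)) S₀∈)

    -- When j points of P are missing, meeting S₀ and S′ in t points leaves no freedom: S contains Q
    -- and Q′ and has nothing outside Z.
    module Generic {S : Subset m} (mS : S ∈ W) (gen : ∣ P ∩ ∁ S ∣ ≡ j) where
      private
        h₆ = tint S S₀ (proj₁ (W⇒ mS)) S₀∈
        h₇ = tint S S′ (proj₁ (W⇒ mS)) S′∈
        h₅ : j ≤ ∣ P ∩ ∁ S ∣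
        h₅ = ≤-reflexive (sym gen)
      Q⊑ : Q ⊑ S
      Q⊑ = slin 3 2 (λ s s₀ s′ t j → (∥ s₀ ∥ ≼ t ⊹ j) ⇒ (t ≼ ∥ s ∩′ s₀ ∥) ⇒ (j ≼ ∥ (s₀ ∩′ s′) ∩′ ∁′ s ∥) ⇒ ⊢ (∥ (s₀ ∩′ ∁′ s′) ∩′ ∁′ s ∥ ≼ # 0)) S S₀ S′ t j S₀≤ h₆ h₅
      Q′⊑ : Q′ ⊑ S
      Q′⊑ = slin 3 2 (λ s s₀ s′ t j → (∥ s′ ∥ ≼ t ⊹ j) ⇒ (t ≼ ∥ s ∩′ s′ ∥) ⇒ (j ≼ ∥ (s₀ ∩′ s′) ∩′ ∁′ s ∥) ⇒ ⊢ (∥ (s′ ∩′ ∁′ s₀) ∩′ ∁′ s ∥ ≼ # 0)) S S₀ S′ t j S′≤ h₇ h₅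
      ⊑Z : S ⊑ Z
      ⊑Z = slin 3 2 (λ s s₀ s′ t j → (∥ s ∥ ≼ t ⊹ j) ⇒ (t ≼ ∥ s ∩′ s₀ ∥) ⇒ (t ≼ ∥ s ∩′ s′ ∥) ⇒ (j ≼ ∥ (s₀ ∩′ s′) ∩′ ∁′ s ∥) ⇒ (∥ s₀ ∩′ s′ ∥ ≼ t)
             ⇒ ⊢ (∥ s ∩′ ∁′ (s₀ ∪′ s′) ∥ ≼ # 0)) S S₀ S′ t j (≤-reflexive (proj₂ (W⇒ mS))) h₆ h₇ h₅ P≤

    generic-determined : ∀ {S R} → S ∈ W → R ∈ W → ∣ P ∩ ∁ S ∣ ≡ j → ∣ P ∩ ∁ R ∣ ≡ j → P ∩ ∁ S ≡ P ∩ ∁ R → S ≡ R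
    generic-determined mS mR gS gR eq = ⊑-antisym (incl mS mR gS gR (sub (sym eq))) (incl mR mS gR gS (sub eq))
      where
      sub : ∀ {a b : Subset m} → a ≡ b → a ⊑ b
      sub {a} refl = ⊑-refl a
      incl : ∀ {S R} → S ∈ W → R ∈ W → ∣ P ∩ ∁ S ∣ ≡ j → ∣ P ∩ ∁ R ∣ ≡ j → P ∩ ∁ R ⊑ P ∩ ∁ S → S ⊑ R
      incl {S} {R} mS mR gS gR le = slin 4 0 (λ s r s₀ s′ → (∥ ((s₀ ∩′ s′) ∩′ ∁′ r) ∩′ ∁′ ((s₀ ∩′ s′) ∩′ ∁′ s) ∥ ≼ # 0) ⇒ (∥ s ∩′ ∁′ (s₀ ∪′ s′) ∥ ≼ # 0)
        ⇒ (∥ (s₀ ∩′ ∁′ s′) ∩′ ∁′ r ∥ ≼ # 0) ⇒ (∥ (s′ ∩′ ∁′ s₀) ∩′ ∁′ r ∥ ≼ # 0) ⇒ ⊢ (∥ s ∩′ ∁′ r ∥ ≼ # 0)) S R S₀ S′ le (Generic.⊑Z mS gS) (Generic.Q⊑ mR gR) (Generic.Q′⊑ mR gR)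

    -- A generic set is determined by P minus S, a j-subset of the t-set P. The resulting bound M /
    -- j! is useful from j = 2 on; for j = 1 it is only M, and this is where the triangle-like core
    -- comes from.
    generic-small : g * j ! ≤ M
    generic-small = ≤-trans (≤-reflexive (cong (g *_) (sym (*-identityˡ (j !)))))
      (≤-trans (weight-from-count (λ S → ∣ P ∩ ∁ S ∣ ≟ j) j 0 1 (+-identityʳ j) count)
        (≤-reflexive (trans (*-identityˡ (1 * M)) (*-identityˡ M))))
      where
      count : Σ W (λ S → 𝟙 (∣ P ∩ ∁ S ∣ ≟ j)) ≤ bin t j * 1
      count = ≤-trans (group W (λ S → ∣ P ∩ ∁ S ∣ ≟ j) (λ S → P ∩ ∁ S) (λ D → 𝟙 ((D ⊑? P) ×-dec (∣ D ∣ ≟ j))) 1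
                (λ S _ e → 𝟙-yes (((P ∩ ∁ S) ⊑? P) ×-dec (∣ P ∩ ∁ S ∣ ≟ j)) (slin 2 0 (λ a b → ⊢ (∥ (a ∩′ b) ∩′ ∁′ a ∥ ≼ # 0)) P (∁ S) , e))
                (λ D → single (λ S → (∣ P ∩ ∁ S ∣ ≟ j) ×-dec (P ∩ ∁ S ≟ˢ D)) (λ mS mR (gS , eS) (gR , eR) → generic-determined mS mR gS gR (trans eS (sym eR)))))
              (≤-reflexive (cong (_* 1) (trans (subsets# P j) (cong (λ p → bin p j) (≤-antisym P≤ P≥)))))

    Inside : Subset m → Set
    Inside S = S ⊑ Z × ∣ S ∣ ≡ t + j

    inside? : ∀ S → Dec (Inside S)
    inside? S = (S ⊑? Z) ×-dec (∣ S ∣ ≟ t + j)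

    -- If P minus S avoided V for a generic S, then S₁ would contain P minus S; together with t
    -- points of S this fills S₁, which would then be a (t + j)-subset of Z. So every P minus S hits
    -- V, which has at most 2j points, and one point can be charged to n instead of t.
    module Blocked {S₁ : Subset m} (S₁∈ : S₁ ∈ 𝒮) (¬in : ¬ Inside S₁) (j′ : ℕ) (j≡ : suc j′ ≡ j) where
      V : Subset m
      V = Z ∩ ∁ S₁

      private
        V≤ : ∣ V ∣ ≤ 2 * j
        V≤ = slin 3 2 (λ s₁ s₀ s′ t j → (∥ s₀ ∥ ≼ t ⊹ j) ⇒ (∥ s′ ∥ ≼ t ⊹ j) ⇒ (t ≼ ∥ s₀ ∩′ s′ ∥) ⇒ (t ≼ ∥ s₁ ∩′ s₀ ∥) ⇒ ⊢ (∥ (s₀ ∪′ s′) ∩′ ∁′ s₁ ∥ ≼ 2 ⋆ j))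
               S₁ S₀ S′ t j S₀≤ S′≤ P≥ (tint S₁ S₀ S₁∈ S₀∈)

        hit : ∀ {S} → S ∈ W → ∣ P ∩ ∁ S ∣ ≡ j → 1 ≤ ∣ (P ∩ ∁ S) ∩ V ∣
        hit {S} mS gen = ≰⇒> λ le → ¬in
          ( slin 4 2 (λ s s₁ s₀ s′ t j → (∥ ((s₀ ∩′ s′) ∩′ ∁′ s) ∩′ ((s₀ ∪′ s′) ∩′ ∁′ s₁) ∥ ≼ # 0) ⇒ (∥ s ∩′ ∁′ (s₀ ∪′ s′) ∥ ≼ # 0) ⇒ (t ≼ ∥ s₁ ∩′ s ∥)
               ⇒ (∥ s₁ ∥ ≼ t ⊹ j) ⇒ (j ≼ ∥ (s₀ ∩′ s′) ∩′ ∁′ s ∥) ⇒ ⊢ (∥ s₁ ∩′ ∁′ (s₀ ∪′ s′) ∥ ≼ # 0))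
               S S₁ S₀ S′ t j le (Generic.⊑Z mS gen) h (sized S₁ S₁∈) (≤-reflexive (sym gen))
          , ≤-antisym (sized S₁ S₁∈)
              (slin 4 2 (λ s s₁ s₀ s′ t j → (∥ ((s₀ ∩′ s′) ∩′ ∁′ s) ∩′ ((s₀ ∪′ s′) ∩′ ∁′ s₁) ∥ ≼ # 0) ⇒ (t ≼ ∥ s₁ ∩′ s ∥) ⇒ (j ≼ ∥ (s₀ ∩′ s′) ∩′ ∁′ s ∥) ⇒ ⊢ (t ⊹ j ≼ ∥ s₁ ∥))
               S S₁ S₀ S′ t j le h (≤-reflexive (sym gen))))
          where
          h = tint S₁ S S₁∈ (proj₁ (W⇒ mS))

        At : Fin m → Subset m → Set
        At z S = ∣ P ∩ ∁ S ∣ ≡ j × ⁅ z ⁆ ⊑ P ∩ ∁ S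

        at? : ∀ z S → Dec (At z S)
        at? z S = (∣ P ∩ ∁ S ∣ ≟ j) ×-dec (⁅ z ⁆ ⊑? P ∩ ∁ S)

        at# : ∀ z → Σ W (λ S → 𝟙 (at? z S)) ≤ bin t j′
        at# z = ≤-trans (group W (at? z) (λ S → (P ∩ ∁ S) ∩ ∁ ⁅ z ⁆) (λ D → 𝟙 ((D ⊑? P) ×-dec (∣ D ∣ ≟ j′))) 1 fits one)
                  (≤-reflexive (trans (*-identityʳ _) (trans (subsets# P j′) (cong (λ p → bin p j′) (≤-antisym P≤ P≥)))))
          where
          fits : ∀ S → S ∈ W → At z S → 1 ≤ 𝟙 ((((P ∩ ∁ S) ∩ ∁ ⁅ z ⁆) ⊑? P) ×-dec (∣ (P ∩ ∁ S) ∩ ∁ ⁅ z ⁆ ∣ ≟ j′))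
          fits S mS (gen , mz) = 𝟙-yes ((((P ∩ ∁ S) ∩ ∁ ⁅ z ⁆) ⊑? P) ×-dec (∣ (P ∩ ∁ S) ∩ ∁ ⁅ z ⁆ ∣ ≟ j′))
            ( slin 3 0 (λ a b c → ⊢ (∥ ((a ∩′ b) ∩′ c) ∩′ ∁′ a ∥ ≼ # 0)) P (∁ S) (∁ ⁅ z ⁆)
            , ≤-antisym (slin 2 1 (λ d e j → (∥ d ∥ ≼ # 1 ⊹ j) ⇒ (∥ e ∩′ ∁′ d ∥ ≼ # 0) ⇒ (# 1 ≼ ∥ e ∥) ⇒ ⊢ (∥ d ∩′ ∁′ e ∥ ≼ j)) (P ∩ ∁ S) ⁅ z ⁆ j′ (≤-reflexive (trans gen (sym j≡))) mz (≤-reflexive (sym (∣⁅⁆∣ z))))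
                        (slin 2 1 (λ d e j → (# 1 ⊹ j ≼ ∥ d ∥) ⇒ (∥ e ∥ ≼ # 1) ⇒ ⊢ (j ≼ ∥ d ∩′ ∁′ e ∥)) (P ∩ ∁ S) ⁅ z ⁆ j′ (≤-reflexive (trans j≡ (sym gen))) (≤-reflexive (∣⁅⁆∣ z))))
          one : ∀ D → Σ W (λ S → 𝟙 (at? z S ×-dec ((P ∩ ∁ S) ∩ ∁ ⁅ z ⁆ ≟ˢ D))) ≤ 1
          one D = single (λ S → at? z S ×-dec ((P ∩ ∁ S) ∩ ∁ ⁅ z ⁆ ≟ˢ D)) λ {S} {R} mS mR ((gS , zS) , eS) ((gR , zR) , eR) →
              generic-determined mS mR gS gR (⊑-antisym (incl S R zR (sub (trans eS (sym eR)))) (incl R S zS (sub (trans eR (sym eS)))))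
            where
            sub : ∀ {a b : Subset m} → a ≡ b → a ⊑ b
            sub {a} refl = ⊑-refl a
            incl : ∀ S R → ⁅ z ⁆ ⊑ P ∩ ∁ R → (P ∩ ∁ S) ∩ ∁ ⁅ z ⁆ ⊑ (P ∩ ∁ R) ∩ ∁ ⁅ z ⁆ → P ∩ ∁ S ⊑ P ∩ ∁ R
            incl S R = slin 3 0 (λ a b e → (∥ e ∩′ ∁′ b ∥ ≼ # 0) ⇒ (∥ (a ∩′ ∁′ e) ∩′ ∁′ (b ∩′ ∁′ e) ∥ ≼ # 0) ⇒ ⊢ (∥ a ∩′ ∁′ b ∥ ≼ # 0)) (P ∩ ∁ S) (P ∩ ∁ R) ⁅ z ⁆

        count : Σ W (λ S → 𝟙 (∣ P ∩ ∁ S ∣ ≟ j)) ≤ bin t j′ * (2 * j)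
        count = begin
          Σ W (λ S → 𝟙 (∣ P ∩ ∁ S ∣ ≟ j)) ≤⟨ Σ-mono W (λ S mS → 𝟙-if (∣ P ∩ ∁ S ∣ ≟ j) (λ gen → located S mS gen)) ⟩
          Σ W (λ S → Σ (elements m) (λ z → 𝟙 (⁅ z ⁆ ⊑? V) * 𝟙 (at? z S))) ≡⟨ Σ-swap W (elements m) _ ⟩
          Σ (elements m) (λ z → Σ W (λ S → 𝟙 (⁅ z ⁆ ⊑? V) * 𝟙 (at? z S))) ≡⟨ Σ-cong (elements m) (λ z → Σ-*ˡ W (𝟙 (⁅ z ⁆ ⊑? V)) _) ⟩
          Σ (elements m) (λ z → 𝟙 (⁅ z ⁆ ⊑? V) * Σ W (λ S → 𝟙 (at? z S))) ≤⟨ Σ-mono′ (elements m) (λ z → *-monoʳ-≤ (𝟙 (⁅ z ⁆ ⊑? V)) (at# z)) ⟩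
          Σ (elements m) (λ z → 𝟙 (⁅ z ⁆ ⊑? V) * bin t j′) ≡⟨ trans (Σ-*ʳ (elements m) (bin t j′) _) (cong (_* bin t j′) (Σ-elements V)) ⟩
          ∣ V ∣ * bin t j′ ≤⟨ *-monoˡ-≤ (bin t j′) V≤ ⟩
          2 * j * bin t j′ ≡⟨ *-comm (2 * j) _ ⟩
          bin t j′ * (2 * j) ∎
          where
          open ≤-Reasoning
          located : ∀ S → S ∈ W → ∣ P ∩ ∁ S ∣ ≡ j → 1 ≤ Σ (elements m) (λ z → 𝟙 (⁅ z ⁆ ⊑? V) * 𝟙 (at? z S))
          located S mS gen = let (z , mz) = point ((P ∩ ∁ S) ∩ V) (hit mS gen) in
            ≤-trans (*-mono-≤ (𝟙-yes (⁅ z ⁆ ⊑? V) (slin 3 0 (λ e d v → (∥ e ∩′ ∁′ (d ∩′ v) ∥ ≼ # 0) ⇒ ⊢ (∥ e ∩′ ∁′ v ∥ ≼ # 0)) ⁅ z ⁆ (P ∩ ∁ S) V mz))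
                              (𝟙-yes (at? z S) (gen , slin 3 0 (λ e d v → (∥ e ∩′ ∁′ (d ∩′ v) ∥ ≼ # 0) ⇒ ⊢ (∥ e ∩′ ∁′ d ∥ ≼ # 0)) ⁅ z ⁆ (P ∩ ∁ S) V mz)))
                    (Σ-member (λ z → 𝟙 (⁅ z ⁆ ⊑? V) * 𝟙 (at? z S)) (∈elements z))

      blocked-small : g * (2 ^ j * (2 * K)) ≤ M
      blocked-small = *-cancelˡ-≤ (C * 2 ^ j * 64) {{>-nonZero (*-mono-≤ {1} {_} {1} (*-mono-≤ C≥1 (m^n>0 2 j)) (s≤s z≤n))}} (begin
          C * 2 ^ j * 64 * (g * (2 ^ j * (2 * K))) ≡⟨ arr₁ C (2 ^ j) g K ⟩
          g * (128 * (C * K)) * (2 ^ j * 2 ^ j) ≤⟨ *-mono-≤ (*-monoʳ-≤ g n≥) (≤-trans (≤-reflexive (sym (^-distribʳ j 2 2))) (^-monoˡ-≤ j (≤ᵇ⇒≤ 4 16 tt))) ⟩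
          g * n * 16 ^ j ≡⟨ cong (λ e → g * n * 16 ^ e) (sym j≡) ⟩
          g * n * (16 * 16 ^ j′) ≤⟨ *-monoʳ-≤ (g * n) (*-monoʳ-≤ 16 (hC j′)) ⟩
          g * n * (16 * (C * j′ !)) ≡⟨ arr₂ g n C (j′ !) ⟩
          16 * C * (g * (n ^ 1 * j′ !)) ≤⟨ *-monoʳ-≤ (16 * C) (weight-from-count (λ S → ∣ P ∩ ∁ S ∣ ≟ j) j′ 1 (2 * j) (trans (+-comm j′ 1) j≡) count) ⟩
          16 * C * (2 * j * (2 ^ 1 * M)) ≡⟨ arr₃ C j M ⟩
          C * j * 64 * M ≤⟨ *-monoˡ-≤ M (*-monoˡ-≤ 64 (*-monoʳ-≤ C (<⇒≤ (n<2^n j)))) ⟩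
          C * 2 ^ j * 64 * M ∎)
        where
        open ≤-Reasoning
        n≥ : 128 * (C * K) ≤ n
        n≥ = ≤-trans (≤-trans (≤-reflexive (sym (*-identityʳ _))) (*-monoʳ-≤ (128 * (C * K)) (≤-trans j≥1 j≤q))) (≤-trans (≤-reflexive (*-assoc 128 (C * K) q)) (unscaled nbig))
        arr₁ : ∀ c p g k → c * p * 64 * (g * (p * (2 * k))) ≡ g * (128 * (c * k)) * (p * p)
        arr₁ = solve-∀
        arr₂ : ∀ g n c f → g * n * (16 * (c * f)) ≡ 16 * c * (g * (n * 1 * f))
        arr₂ = solve-∀
        arr₃ : ∀ c j M → 16 * c * (2 * j * (2 * M)) ≡ c * j * 64 * M
        arr₃ = solve-∀

    full-size : (∀ S → S ∈ 𝒮 → Inside S) → ∣ Z ∣ ≡ t + 2 * j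
    full-size all = ≤-antisym
      (slin 2 2 (λ a b t j → (∥ a ∥ ≼ t ⊹ j) ⇒ (∥ b ∥ ≼ t ⊹ j) ⇒ (t ≼ ∥ a ∩′ b ∥) ⇒ ⊢ (∥ a ∪′ b ∥ ≼ t ⊹ 2 ⋆ j)) S₀ S′ t j S₀≤ S′≤ P≥)
      (slin 2 2 (λ a b t j → (t ⊹ j ≼ ∥ a ∥) ⇒ (t ⊹ j ≼ ∥ b ∥) ⇒ (∥ a ∩′ b ∥ ≼ t) ⇒ ⊢ (t ⊹ 2 ⋆ j ≼ ∥ a ∪′ b ∥)) S₀ S′ t j S₀≥ (≤-reflexive (sym (proj₂ (all S′ S′∈)))) P≤)

    dichotomy : Σ W w * (2 ^ j * K) ≤ M ⊎ (∣ Z ∣ ≡ t + 2 * j × (∀ S → S ∈ 𝒮 → Inside S))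
    dichotomy with decAll inside? 𝒮
    ... | inj₁ all = inj₂ (full-size all , all)
    ... | inj₂ (S₁ , mS₁ , ¬in) = inj₁ (*-cancelˡ-≤ 2 (begin
        2 * (Σ W w * (2 ^ j * K)) ≤⟨ *-monoʳ-≤ 2 (*-monoˡ-≤ (2 ^ j * K) total) ⟩
        2 * ((ng + g) * (2 ^ j * K)) ≡⟨ arr ng g (2 ^ j) K ⟩
        ng * (2 ^ j * (2 * K)) + g * (2 ^ j * (2 * K)) ≤⟨ +-mono-≤ ng-small (blocked j refl) ⟩
        M + M ≡⟨ cong (M +_) (sym (+-identityʳ M)) ⟩
        2 * M ∎))
      where
      open ≤-Reasoning
      arr : ∀ a b p k → 2 * ((a + b) * (p * k)) ≡ a * (p * (2 * k)) + b * (p * (2 * k))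
      arr = solve-∀
      blocked : ∀ i → i ≡ j → g * (2 ^ j * (2 * K)) ≤ M
      blocked zero e = ⊥-elim (<-irrefl refl (≤-trans j≥1 (≤-reflexive (sym e))))
      blocked (suc j′) e = Blocked.blocked-small mS₁ ¬in j′ e

-- Descent through the levels

Σ-unique⊆ : ∀ {m} {F T : List (Subset m)} → Unique F → (∀ A → A ∈ F → A ∈ T) → (f : Subset m → ℕ) → Σ F f ≤ Σ T f
Σ-unique⊆ {F = F} {T} u sub f = begin
    Σ F f ≤⟨ Σ-mono F (λ A mA → ≤-trans (≤-trans (≤-reflexive (sym (*-identityˡ (f A)))) (*-monoˡ-≤ (f A) (𝟙-yes (A ≟ˢ A) refl))) (Σ-member (λ B → 𝟙 (A ≟ˢ B) * f B) (sub A mA))) ⟩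
    Σ F (λ A → Σ T (λ B → 𝟙 (A ≟ˢ B) * f B)) ≡⟨ Σ-swap F T _ ⟩
    Σ T (λ B → Σ F (λ A → 𝟙 (A ≟ˢ B) * f B)) ≡⟨ Σ-cong T (λ B → Σ-*ʳ F (f B) _) ⟩
    Σ T (λ B → Σ F (λ A → 𝟙 (A ≟ˢ B)) * f B) ≤⟨ Σ-mono′ T (λ B → ≤-trans (*-monoˡ-≤ (f B) (Σ-≟ u B)) (≤-reflexive (*-identityˡ (f B)))) ⟩
    Σ T f ∎
  where open ≤-Reasoning

𝟙-exclusive : {P Q R : Set} (d : Dec P) (e : Dec Q) (e′ : Dec R) → (Q → R → ⊥) → 𝟙 (d ×-dec e) + 𝟙 (d ×-dec e′) ≤ 𝟙 d
𝟙-exclusive (no _) _ _ h = z≤n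
𝟙-exclusive (yes _) (no _) (yes _) h = ≤-refl
𝟙-exclusive (yes _) (no _) (no _) h = z≤n
𝟙-exclusive (yes _) (yes _) (no _) h = ≤-refl
𝟙-exclusive (yes _) (yes q) (yes r) h = ⊥-elim (h q r)

-- A light set is either missed by F altogether or has 10 f < N; in both cases 10 f s ≤ M.
heavy-or-light : ∀ {f N M s} (d : Dec (1 ≤ f)) (e : Dec (N ≤ 10 * f)) → N * s ≤ M → f ≤ N → 10 * f * s ≤ 𝟙 (d ×-dec e) * (10 * M) + M
heavy-or-light {f} {N} {M} {s} (yes _) (yes _) Ns f≤ = ≤-trans (≤-trans (≤-trans (≤-reflexive (*-assoc 10 f s)) (*-monoʳ-≤ 10 (≤-trans (*-monoˡ-≤ s f≤) Ns))) (≤-reflexive (sym (*-identityˡ (10 * M))))) (m≤m+n _ M)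
heavy-or-light {s = s} (yes _) (no light) Ns _ = ≤-trans (*-monoˡ-≤ s (<⇒≤ (≰⇒> light))) Ns
heavy-or-light {s = s} (no none) _ _ _ = ≤-trans (≤-reflexive (cong (λ e → 10 * e * s) (n≤0⇒n≡0 (≤-pred (≰⇒> none))))) z≤n

module _ {m : ℕ} (t M K : ℕ) (w : Subset m → ℕ) where
  -- The possible ends of the descent: a single set at level 0; a full level j ≥ 2, or nothing left
  -- at all; a full level 1.
  data Core : List (Subset m) → Set where
    core-star : ∀ {T₀} → ∣ T₀ ∣ ≡ t → Core (T₀ ∷ [])
    core-big  : ∀ {D} → Σ D w * (2 * K) ≤ (K + 1) * M → Core D
    core-tri  : ∀ {I} Z → ∣ Z ∣ ≡ t + 2 → Unique I → (∀ Y → Y ∈ I → Y ⊑ Z × ∣ Y ∣ ≡ t + 1) → Core I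

  -- The budget says that the discarded sets D weigh at most (M / K)(1/2 + 1/4 + ... + 2^-j), level
  -- i contributing M / (2^i K).
  Outcome : ℕ → List (Subset m) → Set
  Outcome j 𝒮 = ∃[ D ] ∃[ E ] (Σ D w * (2 ^ j * K) + M ≤ 2 ^ j * M × Core E × (∀ S → S ∈ 𝒮 → AboveL (D ++ E) S))

module Levels {m : ℕ} (t q n M C K : ℕ) (w : Subset m → ℕ)
  (wt : ∀ S x y → ∣ S ∣ ≡ t + (x + y) → w S * n ^ y * rising t x ≤ 2 ^ y * M)
  (hC : ∀ x → 16 ^ x ≤ C * x !) (nbig : Scaled 128 (C * K * q) n) (C≥1 : 1 ≤ C) (K≥1 : 1 ≤ K) where

  open Weights t q n M C K w wt hC nbig C≥1 K≥1

  private
    AboveL-trans : ∀ {L} {S S′ : Subset m} → AboveL L S′ → S′ ⊑ S → AboveL L S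
    AboveL-trans {S = S} {S′} (Y , mY , le) le′ = Y , mY , ⊑-trans Y S′ S le le′

    double : ∀ {a} j → a * (2 ^ j * K) + M ≤ 2 ^ j * M → a * (2 ^ suc j * K) + (M + M) ≤ 2 ^ suc j * M
    double {a} j h = begin
      a * (2 * 2 ^ j * K) + (M + M) ≡⟨ arr a (2 ^ j) K M ⟩
      2 * (a * (2 ^ j * K) + M) ≤⟨ *-monoʳ-≤ 2 h ⟩
      2 * (2 ^ j * M) ≡⟨ sym (*-assoc 2 (2 ^ j) M) ⟩
      2 * 2 ^ j * M ∎
      where
      open ≤-Reasoning
      arr : ∀ a p k M → a * (2 * p * k) + (M + M) ≡ 2 * (a * (p * k) + M)
      arr = solve-∀

  descend : ∀ j → j ≤ q → ∀ 𝒮 → TInt t 𝒮 → (∀ S → S ∈ 𝒮 → ∣ S ∣ ≤ t + j) → Outcome t M K w j 𝒮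
  descend zero _ [] tint sized = [] , [] , ≤-reflexive (sym (*-identityˡ M)) , core-big z≤n , λ S ()
  descend zero _ (T₀ ∷ 𝒮) tint sized = [] , T₀ ∷ [] , ≤-reflexive (sym (*-identityˡ M)) , core-star (≤-antisym T₀≤ (≤-trans (tint T₀ T₀ (here refl) (here refl)) (slin 1 0 (λ a → ⊢ (∥ a ∩′ a ∥ ≼ ∥ a ∥)) T₀)))
      , λ S mS → T₀ , here refl , slin 2 1 (λ a s t → (∥ a ∥ ≼ t) ⇒ (t ≼ ∥ a ∩′ s ∥) ⇒ ⊢ (∥ a ∩′ ∁′ s ∥ ≼ # 0)) T₀ S t T₀≤ (tint T₀ S (here refl) mS)
    where
    T₀≤ : ∣ T₀ ∣ ≤ t
    T₀≤ = ≤-trans (sized T₀ (here refl)) (≤-reflexive (+-identityʳ t))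
  descend (suc j) j<q 𝒮 tint sized = go (peel (suc (Σ 𝒮 ∣_∣)) 𝒮 tint sized ≤-refl)
    where
    open Peel {m} t (suc j) (s≤s z≤n)
    go : ∃[ 𝒮′ ] (TInt t 𝒮′ × Sized 𝒮′ × Minimal 𝒮′ × Refines 𝒮 𝒮′) → Outcome t M K w (suc j) 𝒮
    go (𝒮′ , tint′ , sized′ , minimal′ , refines) = split (dec∃ (λ S → ∣ S ∣ ≟ t + suc j) 𝒮′)
      where
      lower : ∀ {S} → S ∈ 𝒮′ → ¬ (∣ S ∣ ≡ t + suc j) → ∣ S ∣ ≤ t + j
      lower {S} mS ≢ = ≤-pred (≤-trans (≤∧≢⇒< (sized′ S mS) ≢) (≤-reflexive (+-suc t j)))
      pull : ∀ {L : List (Subset m)} → (∀ S → S ∈ 𝒮′ → AboveL L S) → ∀ S → S ∈ 𝒮 → AboveL L S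
      pull h S mS = let (S′ , mS′ , le) = refines S mS in AboveL-trans (h S′ mS′) le
      split : _ → Outcome t M K w (suc j) 𝒮
      split (inj₂ none) =
        let (D , E , b , core , cov) = descend j (<⇒≤ j<q) 𝒮′ tint′ (λ S mS → lower mS (none S mS))
        in D , E , ≤-trans (+-monoʳ-≤ (Σ D w * (2 ^ suc j * K)) (m≤m+n M M)) (double {Σ D w} j b) , core , pull cov
      split (inj₁ (S₀ , mS₀ , S₀#)) = use dichotomy
        where
        open Level (suc j) (s≤s z≤n) j<q 𝒮′ tint′ sized′ minimal′ S₀ mS₀ S₀#
        use : _ → Outcome t M K w (suc j) 𝒮
        use (inj₁ small) = W ++ D , E , budget , core , pull cov′
          where
          R = List.filter (λ S → ¬? (∣ S ∣ ≟ t + suc j)) 𝒮′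
          R⇒ : ∀ {S} → S ∈ R → S ∈ 𝒮′ × ¬ (∣ S ∣ ≡ t + suc j)
          R⇒ = ∈-filter⁻ (λ S → ¬? (∣ S ∣ ≟ t + suc j)) {xs = 𝒮′}
          rec : Outcome t M K w j R
          rec = descend j (<⇒≤ j<q) R (λ A B a b → tint′ A B (proj₁ (R⇒ a)) (proj₁ (R⇒ b))) (λ S mS → lower (proj₁ (R⇒ mS)) (proj₂ (R⇒ mS)))
          D = proj₁ rec
          E = proj₁ (proj₂ rec)
          core : Core t M K w E
          core = proj₁ (proj₂ (proj₂ (proj₂ rec)))
          cov : ∀ S → S ∈ R → AboveL (D ++ E) S
          cov = proj₂ (proj₂ (proj₂ (proj₂ rec)))
          cov′ : ∀ S → S ∈ 𝒮′ → AboveL ((W ++ D) ++ E) S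
          cov′ S mS with ∣ S ∣ ≟ t + suc j
          ... | yes e = S , ∈-++⁺ˡ (∈-++⁺ˡ (⇒W mS e)) , ⊑-refl S
          ... | no ≢ = let (Y , mY , le) = cov S (∈-filter⁺ (λ S → ¬? (∣ S ∣ ≟ t + suc j)) mS ≢) in
                Y , subst (Y ∈_) (sym (Listₚ.++-assoc W D E)) (∈-++⁺ʳ W mY) , le
          budget : Σ (W ++ D) w * (2 ^ suc j * K) + M ≤ 2 ^ suc j * M
          budget = begin
            Σ (W ++ D) w * (2 ^ suc j * K) + M ≡⟨ cong (λ e → e * (2 ^ suc j * K) + M) (Σ-++ W D w) ⟩
            (Σ W w + Σ D w) * (2 ^ suc j * K) + M ≡⟨ arr (Σ W w) (Σ D w) (2 ^ suc j * K) M ⟩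
            Σ W w * (2 ^ suc j * K) + (Σ D w * (2 ^ suc j * K) + M) ≤⟨ +-monoˡ-≤ _ small ⟩
            M + (Σ D w * (2 ^ suc j * K) + M) ≡⟨ arr′ M (Σ D w * (2 ^ suc j * K)) ⟩
            Σ D w * (2 ^ suc j * K) + (M + M) ≤⟨ double {Σ D w} j (proj₁ (proj₂ (proj₂ rec))) ⟩
            2 ^ suc j * M ∎
            where
            open ≤-Reasoning
            arr : ∀ a b p M → (a + b) * p + M ≡ a * p + (b * p + M)
            arr = solve-∀
            arr′ : ∀ M a → M + (a + M) ≡ a + (M + M)
            arr′ = solve-∀
        use (inj₂ (Z# , all)) = [] , W , ≤-trans (≤-reflexive (sym (*-identityˡ M))) (*-monoˡ-≤ M (m^n>0 2 (suc j))) , kind j refl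
            , pull (λ S mS → S , ⇒W mS (proj₂ (all S mS)) , ⊑-refl S)
          where
          -- The level is i + 1 here. From level 2 on the generic sets weigh at most M / 2 and the
          -- others M / (2K), too little to cover F.
          kind : ∀ i → i ≡ j → Core t M K w W
          kind zero refl = core-tri Z Z# W-unique (λ Y mY → all Y (proj₁ (W⇒ mY)))
          kind (suc i) refl = core-big (begin
              Σ W w * (2 * K) ≤⟨ *-monoˡ-≤ (2 * K) total ⟩
              (ng + g) * (2 * K) ≡⟨ arr ng g K ⟩
              ng * (1 * (2 * K)) + g * 2 * K ≤⟨ +-mono-≤ (≤-trans (*-monoʳ-≤ ng (*-monoˡ-≤ (2 * K) (m^n>0 2 (suc j)))) ng-small) (*-monoˡ-≤ K (≤-trans (*-monoʳ-≤ g (2≤! i)) generic-small)) ⟩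
              M + M * K ≡⟨ arr′ M K ⟩
              (K + 1) * M ∎)
            where
            open ≤-Reasoning
            arr : ∀ a b k → (a + b) * (2 * k) ≡ a * (1 * (2 * k)) + b * 2 * k
            arr = solve-∀
            arr′ : ∀ M k → M + M * k ≡ (k + 1) * M
            arr′ = solve-∀
            2≤! : ∀ i → 2 ≤ suc (suc i) !
            2≤! i = *-mono-≤ {2} {suc (suc i)} {1} (s≤s (s≤s z≤n)) (!≥1 (suc i))
              where
              !≥1 : ∀ i → 1 ≤ i !
              !≥1 zero = ≤-refl
              !≥1 (suc i) = *-mono-≤ {1} {suc i} {1} (s≤s z≤n) (!≥1 i)

-- Excluding every core other than a star that contains F

private
  -- The errors ρ and d take at most 3M / 32 together, so more than half of M is left for f.
  enough : ∀ {F ρ d f M} → M ≤ F → F ≤ ρ + (d + (f + 0)) → 32 * ρ ≤ M → d * 16 ≤ M → M ≤ 2 * f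
  enough {F} {ρ} {d} {f} {M} M≤F cov 32ρ d≤ = *-cancelˡ-≤ 8 (≤-trans (*-monoˡ-≤ M (≤ᵇ⇒≤ 8 14 tt)) (≤-trans
    (lin 5 (λ M F ρ d f → (16 ⋆ M ≼ 16 ⋆ F) ⇒ (16 ⋆ F ≼ 16 ⋆ (ρ ⊹ (d ⊹ (f ⊹ # 0)))) ⇒ (32 ⋆ ρ ≼ M) ⇒ (16 ⋆ ρ ≼ 32 ⋆ ρ) ⇒ (16 ⋆ d ≼ M) ⇒ ⊢ (14 ⋆ M ≼ 16 ⋆ f))
         M F ρ d f (*-monoʳ-≤ 16 M≤F) (*-monoʳ-≤ 16 cov) 32ρ (*-monoˡ-≤ ρ (≤ᵇ⇒≤ 16 32 tt)) (≤-trans (≤-reflexive (*-comm 16 d)) d≤))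
    (≤-reflexive (*-assoc 8 2 f))))

  -- A core of weight 17M / 32 and errors of 3M / 32 do not add up to M.
  not-big : ∀ {F ρ d e M} → 1 ≤ M → M ≤ F → F ≤ ρ + (d + e) → 32 * ρ ≤ M → d * 16 ≤ M → e * (2 * 16) ≤ (16 + 1) * M → ⊥
  not-big {F} {ρ} {d} {e} {M} M≥1 M≤F cov 32ρ d≤ e≤ = <-irrefl refl (lin 5 (λ M F ρ d e → (# 1 ≼ M) ⇒ (32 ⋆ M ≼ 32 ⋆ F) ⇒ (32 ⋆ F ≼ 32 ⋆ (ρ ⊹ (d ⊹ e))) ⇒ (32 ⋆ ρ ≼ M) ⇒ (2 ⋆ 16 ⋆ d ≼ 2 ⋆ M) ⇒ (32 ⋆ e ≼ 17 ⋆ M)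
          ⇒ (11 ⋆ # 1 ≼ 11 ⋆ M) ⇒ ⊢ (# 1 ≼ # 0))
        M F ρ d e M≥1 (*-monoʳ-≤ 32 M≤F) (*-monoʳ-≤ 32 cov) 32ρ
        (*-monoʳ-≤ 2 (≤-trans (≤-reflexive (*-comm 16 d)) d≤)) (≤-trans (≤-reflexive (*-comm 32 e)) e≤) (*-monoʳ-≤ 11 M≥1))

  -- Light members weigh little, so two heavy ones cannot carry F (here t ≥ 2 enters).
  not-light : ∀ {F ρ d c t M} → 2 ≤ t → 1 ≤ M → M ≤ F → F ≤ ρ + (d + c) → 32 * ρ ≤ M → d * 16 ≤ M → 10 * c * (t + 1) ≤ 20 * M + (t * M + 2 * M) → ⊥
  not-light {F} {ρ} {d} {c} {t} {M} t≥2 M≥1 M≤F cov 32ρ d≤ c≤ = <-irrefl refl (lin 6 (λ tM M a b c s → (# 1 ≼ M) ⇒ (35 ⋆ # 1 ≼ 35 ⋆ M) ⇒ (160 ⋆ (tM ⊹ M) ≼ 10 ⋆ (a ⊹ (b ⊹ 16 ⋆ s))) ⇒ (10 ⋆ a ≼ 10 ⋆ (tM ⊹ M)) ⇒ (10 ⋆ b ≼ 10 ⋆ (tM ⊹ M)) ⇒ (16 ⋆ c ≼ 16 ⋆ (20 ⋆ M ⊹ (tM ⊹ 2 ⋆ M)))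
            ⇒ (16 ⋆ (10 ⋆ s) ≼ 16 ⋆ c) ⇒ (124 ⋆ (2 ⋆ M) ≼ 124 ⋆ tM) ⇒ ⊢ (# 1 ≼ # 0))
          (t * M) M (16 * ρ * (t + 1)) (16 * d * (t + 1)) (10 * c * (t + 1)) (c * (t + 1))
          M≥1 (*-monoʳ-≤ 35 M≥1) main (*-monoʳ-≤ 10 ρ≤) (*-monoʳ-≤ 10 D≤) (*-monoʳ-≤ 16 c≤)
          (≤-reflexive (cong (16 *_) (sym (*-assoc 10 c (t + 1)))))
          (*-monoʳ-≤ 124 (*-monoˡ-≤ M t≥2)))
    where
    M[t+1] : (t + 1) * M ≡ t * M + M
    M[t+1] = trans (*-distribʳ-+ M t 1) (cong (t * M +_) (*-identityˡ M))
    ρ≤ : 16 * ρ * (t + 1) ≤ t * M + M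
    ρ≤ = ≤-trans (*-monoˡ-≤ (t + 1) (≤-trans (*-monoˡ-≤ ρ (≤ᵇ⇒≤ 16 32 tt)) 32ρ)) (≤-reflexive (trans (*-comm M (t + 1)) M[t+1]))
    D≤ : 16 * d * (t + 1) ≤ t * M + M
    D≤ = ≤-trans (*-monoˡ-≤ (t + 1) (≤-trans (≤-reflexive (*-comm 16 d)) d≤)) (≤-reflexive (trans (*-comm M (t + 1)) M[t+1]))
    main : 160 * (t * M + M) ≤ 10 * (16 * ρ * (t + 1) + (16 * d * (t + 1) + 16 * (c * (t + 1))))
    main = begin
      160 * (t * M + M) ≡⟨ cong (160 *_) (trans (sym M[t+1]) (*-comm (t + 1) M)) ⟩
      160 * (M * (t + 1)) ≤⟨ *-monoʳ-≤ 160 (*-monoˡ-≤ (t + 1) (≤-trans M≤F cov)) ⟩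
      160 * ((ρ + (d + c)) * (t + 1)) ≡⟨ arr ρ d c (t + 1) ⟩
      10 * (16 * ρ * (t + 1) + (16 * d * (t + 1) + 16 * (c * (t + 1)))) ∎
      where
      open ≤-Reasoning
      arr : ∀ a b c s → 160 * ((a + (b + c)) * s) ≡ 10 * (16 * a * s + (16 * b * s + 16 * (c * s)))
      arr = solve-∀

module _ {m : ℕ} {t : ℕ} {Z : Subset m} (Z# : ∣ Z ∣ ≡ t + 2) where
  private
    Facet : Subset m → Set
    Facet Y = Y ⊑ Z × ∣ Y ∣ ≡ t + 1

    missing : ∀ {Y} → Facet Y → 1 ≤ ∣ Z ∩ ∁ Y ∣
    missing {Y} (_ , Y#) = slin 2 1 (λ z y t → (t ⊹ # 2 ≼ ∥ z ∥) ⇒ (∥ y ∥ ≼ t ⊹ # 1) ⇒ ⊢ (# 1 ≼ ∥ z ∩′ ∁′ y ∥)) Z Y t (≤-reflexive (sym Z#)) (≤-reflexive Y#)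

    apart : ∀ {X Y} → Facet X → Facet Y → ¬ (X ≡ Y) → ∣ (Z ∩ ∁ X) ∩ ∁ Y ∣ ≤ 0
    apart {X} {Y} (X⊑ , X#) (Y⊑ , Y#) X≢Y =
      slin 3 1 (λ z x y t → (∥ z ∥ ≼ t ⊹ # 2) ⇒ (t ⊹ # 1 ≼ ∥ x ∥) ⇒ (# 1 ≼ ∥ y ∩′ ∁′ x ∥) ⇒ (∥ x ∩′ ∁′ z ∥ ≼ # 0) ⇒ (∥ y ∩′ ∁′ z ∥ ≼ # 0) ⇒ ⊢ (∥ (z ∩′ ∁′ x) ∩′ ∁′ y ∥ ≼ # 0))
        Z X Y t (≤-reflexive Z#) (≤-reflexive (sym X#)) 1≤ X⊑ Y⊑
      where
      1≤ : 1 ≤ ∣ Y ∩ ∁ X ∣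
      1≤ = ≰⇒> λ le → X≢Y (⊑-antisym (slin 2 0 (λ x y → (∥ x ∥ ≼ ∥ y ∥) ⇒ (∥ y ∩′ ∁′ x ∥ ≼ # 0) ⇒ ⊢ (∥ x ∩′ ∁′ y ∥ ≼ # 0)) X Y (≤-reflexive (trans X# (sym Y#))) le) le)

  few-facets : ∀ {I} → Unique I → (∀ Y → Y ∈ I → Facet Y) → length I ≤ t + 2
  few-facets {I} I! I⇒ = begin
      length I ≤⟨ cover I (elements m) (λ Y x → 𝟙 (⁅ x ⁆ ⊑? Z) * 𝟙 (Y ≟ˢ Z ∩ ∁ ⁅ x ⁆)) each ⟩
      Σ (elements m) (λ x → Σ I (λ Y → 𝟙 (⁅ x ⁆ ⊑? Z) * 𝟙 (Y ≟ˢ Z ∩ ∁ ⁅ x ⁆))) ≤⟨ Σ-mono′ (elements m) (λ x → ≤-trans (≤-reflexive (Σ-*ˡ I (𝟙 (⁅ x ⁆ ⊑? Z)) _)) (≤-trans (*-monoʳ-≤ (𝟙 (⁅ x ⁆ ⊑? Z)) (Σ-≟ I! (Z ∩ ∁ ⁅ x ⁆))) (≤-reflexive (*-identityʳ _)))) ⟩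
      Σ (elements m) (λ x → 𝟙 (⁅ x ⁆ ⊑? Z)) ≡⟨ trans (Σ-elements Z) Z# ⟩
      t + 2 ∎
    where
    open ≤-Reasoning
    each : ∀ Y → Y ∈ I → ∃[ x ] (x ∈ elements m × 1 ≤ 𝟙 (⁅ x ⁆ ⊑? Z) * 𝟙 (Y ≟ˢ Z ∩ ∁ ⁅ x ⁆))
    each Y mY = x , ∈elements x , *-mono-≤ (𝟙-yes (⁅ x ⁆ ⊑? Z) (slin 3 0 (λ e z y → (∥ e ∩′ ∁′ (z ∩′ ∁′ y) ∥ ≼ # 0) ⇒ ⊢ (∥ e ∩′ ∁′ z ∥ ≼ # 0)) ⁅ x ⁆ Z Y x∈))
                  (𝟙-yes (Y ≟ˢ Z ∩ ∁ ⁅ x ⁆) (⊑-antisym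
                     (slin 3 0 (λ e z y → (∥ e ∩′ ∁′ (z ∩′ ∁′ y) ∥ ≼ # 0) ⇒ (∥ y ∩′ ∁′ z ∥ ≼ # 0) ⇒ ⊢ (∥ y ∩′ ∁′ (z ∩′ ∁′ e) ∥ ≼ # 0)) ⁅ x ⁆ Z Y x∈ Y⊑)
                     (slin 3 1 (λ e z y t → (∥ e ∩′ ∁′ (z ∩′ ∁′ y) ∥ ≼ # 0) ⇒ (# 1 ≼ ∥ e ∥) ⇒ (∥ z ∥ ≼ t ⊹ # 2) ⇒ (t ⊹ # 1 ≼ ∥ y ∥) ⇒ (∥ y ∩′ ∁′ z ∥ ≼ # 0) ⇒ ⊢ (∥ (z ∩′ ∁′ e) ∩′ ∁′ y ∥ ≼ # 0)) ⁅ x ⁆ Z Y t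
                        x∈ (≤-reflexive (sym (∣⁅⁆∣ x))) (≤-reflexive Z#) (≤-reflexive (sym (proj₂ (I⇒ Y mY)))) Y⊑)))
      where
      Y⊑ = proj₁ (I⇒ Y mY)
      p : ∃[ x ] (⁅ x ⁆ ⊑ Z ∩ ∁ Y)
      p = point (Z ∩ ∁ Y) (missing (I⇒ Y mY))
      x = proj₁ p
      x∈ : ⁅ x ⁆ ⊑ Z ∩ ∁ Y
      x∈ = proj₂ p

  -- If S met Z in only t points, then S ∩ Z would lie in all three facets, hence in Z without three
  -- points, which is a set of t - 1 points.
  three-facets : ∀ {Y₁ Y₂ Y₃} → Facet Y₁ → Facet Y₂ → Facet Y₃ → ¬ (Y₁ ≡ Y₂) → ¬ (Y₁ ≡ Y₃) → ¬ (Y₂ ≡ Y₃) →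
                 ∀ S → t ≤ ∣ S ∩ Y₁ ∣ → t ≤ ∣ S ∩ Y₂ ∣ → t ≤ ∣ S ∩ Y₃ ∣ → t + 1 ≤ ∣ S ∩ Z ∣
  three-facets {Y₁} {Y₂} {Y₃} in₁ in₂ in₃ ≢₁₂ ≢₁₃ ≢₂₃ S s₁ s₂ s₃ = ≤-trans (≤-reflexive (+-comm t 1)) (≰⇒> λ le → <-irrefl refl
      (slin 5 1 (λ s z a b c t → (∥ z ∥ ≼ t ⊹ # 2) ⇒ (t ≼ ∥ s ∩′ a ∥) ⇒ (∥ a ∩′ ∁′ z ∥ ≼ # 0) ⇒ (# 1 ≼ ∥ z ∩′ ∁′ a ∥) ⇒ (# 1 ≼ ∥ z ∩′ ∁′ b ∥) ⇒ (# 1 ≼ ∥ z ∩′ ∁′ c ∥)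
              ⇒ (∥ (z ∩′ ∁′ a) ∩′ ∁′ b ∥ ≼ # 0) ⇒ (∥ (z ∩′ ∁′ a) ∩′ ∁′ c ∥ ≼ # 0) ⇒ (∥ (z ∩′ ∁′ b) ∩′ ∁′ c ∥ ≼ # 0)
              ⇒ (∥ (s ∩′ z) ∩′ ∁′ a ∥ ≼ # 0) ⇒ (∥ (s ∩′ z) ∩′ ∁′ b ∥ ≼ # 0) ⇒ (∥ (s ∩′ z) ∩′ ∁′ c ∥ ≼ # 0) ⇒ ⊢ (# 1 ≼ # 0))
              S Z Y₁ Y₂ Y₃ t (≤-reflexive Z#) s₁ (proj₁ in₁) (missing in₁) (missing in₂) (missing in₃) (apart in₁ in₂ ≢₁₂) (apart in₁ in₃ ≢₁₃) (apart in₂ in₃ ≢₂₃) (out le in₁ s₁) (out le in₂ s₂) (out le in₃ s₃)))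
    where
    out : ∣ S ∩ Z ∣ ≤ t → ∀ {Y} → Facet Y → t ≤ ∣ S ∩ Y ∣ → ∣ (S ∩ Z) ∩ ∁ Y ∣ ≤ 0
    out le {Y} (Y⊑ , _) sY = slin 3 1 (λ s z y t → (∥ s ∩′ z ∥ ≼ t) ⇒ (t ≼ ∥ s ∩′ y ∥) ⇒ (∥ y ∩′ ∁′ z ∥ ≼ # 0) ⇒ ⊢ (∥ (s ∩′ z) ∩′ ∁′ y ∥ ≼ # 0)) S Z Y t le sY Y⊑

split-rest : ∀ {m} (F 𝒮 : List (Subset m)) {R : Subset m → Set} (R? : ∀ A → Dec (R A)) → (∀ A → A ∈ F → AboveL 𝒮 A → R A) → length F ≤ rest# F 𝒮 + Σ F (λ A → 𝟙 (R? A))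
split-rest F 𝒮 {R} R? h = ≤-trans (≤-reflexive (sym (Σ-1 F))) (≤-trans (Σ-mono F each) (≤-reflexive (Σ-+ F (λ A → 𝟙 (¬? (above? 𝒮 A))) (λ A → 𝟙 (R? A)))))
  where
  go : ∀ A → A ∈ F → (d : Dec (AboveL 𝒮 A)) → 1 ≤ 𝟙 (¬? d) + 𝟙 (R? A)
  go A mA (yes a) = 𝟙-yes (R? A) (h A mA a)
  go A mA (no _) = s≤s z≤n
  each : ∀ A → A ∈ F → 1 ≤ 𝟙 (¬? (above? 𝒮 A)) + 𝟙 (R? A)
  each A mA = go A mA (above? 𝒮 A)

covered : ∀ {m} (F 𝒮 D E : List (Subset m)) → (∀ S → S ∈ 𝒮 → AboveL (D ++ E) S) → length F ≤ rest# F 𝒮 + (Σ D (cnt F) + Σ E (cnt F))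
covered F 𝒮 D E above𝒮 = ≤-trans (split-rest F 𝒮 (above? (D ++ E)) above) (+-monoʳ-≤ (rest# F 𝒮) bound)
  where
  above : ∀ A → A ∈ F → AboveL 𝒮 A → AboveL (D ++ E) A
  above A mA (S , mS , S⊑) = let (Y , mY , Y⊑) = above𝒮 S mS in Y , mY , ⊑-trans Y S A Y⊑ S⊑
  bound : Σ F (λ A → 𝟙 (above? (D ++ E) A)) ≤ Σ D (cnt F) + Σ E (cnt F)
  bound = begin
    Σ F (λ A → 𝟙 (above? (D ++ E) A)) ≤⟨ Σ-mono′ F (λ A → 𝟙-if (above? (D ++ E) A) (λ (Y , mY , Y⊑) → ≤-trans (𝟙-yes (Y ⊑? A) Y⊑) (Σ-member (λ Y → 𝟙 (Y ⊑? A)) mY))) ⟩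
    Σ F (λ A → Σ (D ++ E) (λ Y → 𝟙 (Y ⊑? A))) ≡⟨ Σ-swap F (D ++ E) _ ⟩
    Σ (D ++ E) (cnt F) ≡⟨ Σ-++ D E (cnt F) ⟩
    Σ D (cnt F) + Σ E (cnt F) ∎
    where open ≤-Reasoning

-- N and f are the densities of 𝒯 and F; a member of I is heavy when F takes a tenth of its star.
heavy-sum : ∀ {m} (N f : Subset m → ℕ) (I : List (Subset m)) (heavy? : ∀ Y → Dec (1 ≤ f Y × N Y ≤ 10 * f Y)) (t M : ℕ) →
  (∀ Y → Y ∈ I → 10 * f Y * (t + 1) ≤ 𝟙 (heavy? Y) * (10 * M) + M) → length I ≤ t + 2 → length (List.filter heavy? I) ≤ 2 → 10 * Σ I f * (t + 1) ≤ 20 * M + (t * M + 2 * M)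
heavy-sum N f I heavy? t M each I# J≤ = begin
    10 * Σ I f * (t + 1) ≡⟨ trans (cong (_* (t + 1)) (sym (Σ-*ˡ I 10 f))) (sym (Σ-*ʳ I (t + 1) (λ Y → 10 * f Y))) ⟩
    Σ I (λ Y → 10 * f Y * (t + 1)) ≤⟨ Σ-mono I each ⟩
    Σ I (λ Y → 𝟙 (heavy? Y) * (10 * M) + M) ≡⟨ trans (Σ-+ I _ _) (cong₂ _+_ (Σ-*ʳ I (10 * M) _) (Σ-const I M)) ⟩
    Σ I (λ Y → 𝟙 (heavy? Y)) * (10 * M) + length I * M ≤⟨ +-mono-≤ (*-monoˡ-≤ (10 * M) (≤-trans (≤-reflexive (sym (length-filter heavy? I))) J≤)) (*-monoˡ-≤ M I#) ⟩
    2 * (10 * M) + (t + 2) * M ≡⟨ cong₂ _+_ (sym (*-assoc 2 10 M)) (*-distribʳ-+ M t 2) ⟩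
    20 * M + (t * M + 2 * M) ∎
  where open ≤-Reasoning

-- The lever is `heavy`: a set that F fills to a tenth is itself a spread set, so `meet` applies to
-- it and every member of 𝒮. Information about a heavy set is thereby transferred to 𝒮 and back to
-- all of F except the ρ uncovered members.
module Assembly {m : ℕ} (t M L q r : ℕ) (𝒯 F 𝒮 : List (Subset m))
  (at-most : ∀ S → ∣ S ∣ ≡ t → cnt 𝒯 S ≤ M) (at-most₁ : ∀ S → ∣ S ∣ ≡ t + 1 → cnt 𝒯 S * (t + 1) ≤ M)
  (H₄ : ∀ T₀ B → ∣ T₀ ∣ ≡ t → B ∈ 𝒯 → ¬ (T₀ ⊑ B) → cnt 𝒯 T₀ ≤ L * Σ 𝒯 (λ A → 𝟙 ((T₀ ⊑? A) ×-dec (∣ A ∩ B ∣ <? t))))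
  (H₅ : ∀ Z → ∣ Z ∣ ≡ t + 2 → Σ 𝒯 (λ A → 𝟙 (t + 1 ≤? ∣ A ∩ Z ∣)) * L + M ≤ L * M)
  (uniq : Unique F) (F⊆ : ∀ A → A ∈ F → A ∈ 𝒯) (tint : TInt t F) (t≥2 : 2 ≤ t) (M≥1 : 1 ≤ M) (q≥1 : 1 ≤ q)
  (heavy : ∀ Y → 1 ≤ cnt F Y → cnt 𝒯 Y ≤ 10 * cnt F Y → Spread F r Y)
  (meet : ∀ S Y → Spread F r S → Spread F r Y → ∣ S ∣ ≤ t + q → ∣ Y ∣ ≤ t + q → t ≤ ∣ S ∩ Y ∣)
  (good : SpreadIn F r (t + q) 𝒮) (32ρ : 32 * rest# F 𝒮 ≤ M) (2Lρ : 2 * (L * rest# F 𝒮) < M) (M≤F : M ≤ length F)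
  (d : ℕ) (D-budget : d * 16 ≤ M) where

  private
    N f : Subset m → ℕ
    N = cnt 𝒯
    f = cnt F

    ρ : ℕ
    ρ = rest# F 𝒮

    f≤N : ∀ X → f X ≤ N X
    f≤N X = Σ-unique⊆ uniq F⊆ (λ A → 𝟙 (X ⊑? A))

    meet𝒮 : ∀ Y → Spread F r Y → ∣ Y ∣ ≤ t + q → ∀ S → S ∈ 𝒮 → t ≤ ∣ S ∩ Y ∣
    meet𝒮 Y sp le S mS = meet S Y (proj₁ (good S mS)) sp (proj₂ (good S mS)) le

    module Star (T₀ : Subset m) (T₀# : ∣ T₀ ∣ ≡ t) (cov : length F ≤ ρ + (d + (f T₀ + 0))) (B : Subset m) (mB : B ∈ F) (¬B : ¬ (T₀ ⊑ B)) where
      f≥ : M ≤ 2 * f T₀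
      f≥ = enough {length F} {ρ} {d} M≤F cov 32ρ D-budget

      f≥1 : 1 ≤ f T₀
      f≥1 = pos (f T₀) (≤-trans M≥1 f≥)
        where
        pos : ∀ g → 1 ≤ 2 * g → 1 ≤ g
        pos (suc g) _ = s≤s z≤n

      T₀⊑ : ∀ S → S ∈ 𝒮 → T₀ ⊑ S
      T₀⊑ S mS = slin 2 1 (λ a s t → (∥ a ∥ ≼ t) ⇒ (t ≼ ∥ s ∩′ a ∥) ⇒ ⊢ (∥ a ∩′ ∁′ s ∥ ≼ # 0)) T₀ S t (≤-reflexive T₀#)
        (meet𝒮 T₀ (heavy T₀ f≥1 (≤-trans (at-most T₀ T₀#) (≤-trans f≥ (*-monoˡ-≤ (f T₀) (≤ᵇ⇒≤ 2 10 tt))))) (≤-trans (≤-reflexive T₀#) (m≤m+n t q)) S mS)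

      F≤ : length F ≤ ρ + f T₀
      F≤ = split-rest F 𝒮 (T₀ ⊑?_) (λ A mA (S , mS , le) → ⊑-trans T₀ S A (T₀⊑ S mS) le)

      avoid : ℕ
      avoid = Σ 𝒯 (λ A → 𝟙 ((T₀ ⊑? A) ×-dec (∣ A ∩ B ∣ <? t)))

      -- Members of F meet B in t edges; the trees counted by `avoid` do not, so they are lost to F.
      f+avoid : f T₀ + avoid ≤ N T₀
      f+avoid = begin
          f T₀ + avoid ≤⟨ +-monoˡ-≤ avoid (≤-trans (Σ-mono F (λ A mA → 𝟙-mono (T₀ ⊑? A) ((T₀ ⊑? A) ×-dec (t ≤? ∣ A ∩ B ∣)) (λ p → p , tint A B mA mB))) (Σ-unique⊆ uniq F⊆ (λ A → 𝟙 ((T₀ ⊑? A) ×-dec (t ≤? ∣ A ∩ B ∣))))) ⟩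
          Σ 𝒯 (λ A → 𝟙 ((T₀ ⊑? A) ×-dec (t ≤? ∣ A ∩ B ∣))) + avoid ≡⟨ sym (Σ-+ 𝒯 (λ A → 𝟙 ((T₀ ⊑? A) ×-dec (t ≤? ∣ A ∩ B ∣))) (λ A → 𝟙 ((T₀ ⊑? A) ×-dec (∣ A ∩ B ∣ <? t)))) ⟩
          Σ 𝒯 (λ A → 𝟙 ((T₀ ⊑? A) ×-dec (t ≤? ∣ A ∩ B ∣)) + 𝟙 ((T₀ ⊑? A) ×-dec (∣ A ∩ B ∣ <? t))) ≤⟨ Σ-mono′ 𝒯 (λ A → 𝟙-exclusive (T₀ ⊑? A) (t ≤? ∣ A ∩ B ∣) (∣ A ∩ B ∣ <? t) (λ p p′ → <-irrefl refl (<-≤-trans p′ p))) ⟩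
          N T₀ ∎
        where open ≤-Reasoning

      avoid≤ρ : avoid ≤ ρ
      avoid≤ρ = lin 6 (λ M F ρ f a N → (M ≼ F) ⇒ (F ≼ ρ ⊹ f) ⇒ (f ⊹ a ≼ N) ⇒ (N ≼ M) ⇒ ⊢ (a ≼ ρ)) M (length F) ρ (f T₀) avoid (N T₀) M≤F F≤ f+avoid (at-most T₀ T₀#)

      absurd : ⊥
      absurd = <-irrefl refl (<-≤-trans 2Lρ (≤-trans f≥ (*-monoʳ-≤ 2 (≤-trans (≤-trans (m≤m+n (f T₀) avoid) f+avoid) (≤-trans (H₄ T₀ B T₀# (F⊆ B mB) ¬B) (*-monoʳ-≤ L avoid≤ρ))))))

  case-star : ∀ T₀ → ∣ T₀ ∣ ≡ t → length F ≤ ρ + (d + (f T₀ + 0)) → (∀ A → A ∈ F → T₀ ⊑ A)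
  case-star T₀ T₀# cov = [ id , (λ (B , mB , ¬B) → ⊥-elim (Star.absurd T₀ T₀# cov B mB ¬B)) ]′ (decAll (T₀ ⊑?_) F)

  private
    -- If at most two facets of Z are heavy, the light ones carry too little. Three heavy ones force
    -- every set of 𝒮, hence all but ρ members of F, to meet Z in t + 1 points, and by `H₅` there
    -- are at most M - M / L such trees.
    module Triangle (Z : Subset m) (Z# : ∣ Z ∣ ≡ t + 2) (I : List (Subset m)) (I! : Unique I) (I⇒ : ∀ Y → Y ∈ I → Y ⊑ Z × ∣ Y ∣ ≡ t + 1)
      (cov : length F ≤ ρ + (d + Σ I f)) where
      heavy? : ∀ Y → Dec (1 ≤ f Y × N Y ≤ 10 * f Y)
      heavy? Y = (1 ≤? f Y) ×-dec (N Y ≤? 10 * f Y)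

      Js : List (Subset m)
      Js = List.filter heavy? I

      J⇒ : ∀ Y → Y ∈ Js → Y ∈ I × (1 ≤ f Y × N Y ≤ 10 * f Y)
      J⇒ Y = ∈-filter⁻ heavy? {xs = I}

      facet : ∀ Y → Y ∈ Js → Y ⊑ Z × ∣ Y ∣ ≡ t + 1
      facet Y mY = I⇒ Y (proj₁ (J⇒ Y mY))

      few-heavy : length Js ≤ 2 → ⊥
      few-heavy J≤2 = not-light {length F} {ρ} {d} {Σ I f} {t} {M} t≥2 M≥1 M≤F cov 32ρ D-budget (heavy-sum N f I heavy? t M
        (λ Y mY → heavy-or-light (1 ≤? f Y) (N Y ≤? 10 * f Y) (at-most₁ Y (proj₂ (I⇒ Y mY))) (f≤N Y)) (few-facets {m} {t} {Z} Z# I! I⇒) J≤2)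

      meetJ : ∀ Y → Y ∈ Js → ∀ S → S ∈ 𝒮 → t ≤ ∣ S ∩ Y ∣
      meetJ Y mY = meet𝒮 Y (heavy Y (proj₁ (proj₂ (J⇒ Y mY))) (proj₂ (proj₂ (J⇒ Y mY)))) (≤-trans (≤-reflexive (proj₂ (facet Y mY))) (+-monoʳ-≤ t q≥1))

      F₁ : ℕ
      F₁ = Σ 𝒯 (λ A → 𝟙 (t + 1 ≤? ∣ A ∩ Z ∣))

      all-deep : (∀ S → S ∈ 𝒮 → t + 1 ≤ ∣ S ∩ Z ∣) → ⊥
      all-deep deep = <-irrefl refl (<-≤-trans 2Lρ (≤-trans M≤Lρ (m≤m+n (L * ρ) (L * ρ + 0))))
        where
        F≤ : length F ≤ ρ + F₁
        F≤ = ≤-trans (split-rest F 𝒮 (λ A → t + 1 ≤? ∣ A ∩ Z ∣) (λ A mA (S , mS , S⊑) → slin 3 1 (λ a s z k → (k ≼ ∥ s ∩′ z ∥) ⇒ (∥ s ∩′ ∁′ a ∥ ≼ # 0) ⇒ ⊢ (k ≼ ∥ a ∩′ z ∥)) A S Z (t + 1) (deep S mS) S⊑))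
               (+-monoʳ-≤ ρ (Σ-unique⊆ uniq F⊆ (λ A → 𝟙 (t + 1 ≤? ∣ A ∩ Z ∣))))
        M≤Lρ : M ≤ L * ρ
        M≤Lρ = lin 4 (λ M lm lρ lf → (lm ≼ lρ ⊹ lf) ⇒ (lf ⊹ M ≼ lm) ⇒ ⊢ (M ≼ lρ)) M (L * M) (L * ρ) (F₁ * L)
          (≤-trans (*-monoʳ-≤ L (≤-trans M≤F F≤)) (≤-reflexive (trans (*-distribˡ-+ L ρ F₁) (cong (L * ρ +_) (*-comm L F₁))))) (H₅ Z Z#)

      go : ∀ J′ → (∀ Y → Y ∈ J′ → Y ∈ Js) → Unique J′ → (length J′ ≤ 2 → ⊥) → ⊥
      go [] _ _ few = few z≤n
      go (_ ∷ []) _ _ few = few (s≤s z≤n)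
      go (_ ∷ _ ∷ []) _ _ few = few (s≤s (s≤s z≤n))
      go (Y₁ ∷ Y₂ ∷ Y₃ ∷ _) sub J! _ = all-deep (λ S mS →
          three-facets {m} {t} {Z} Z# {Y₁} {Y₂} {Y₃} (facet Y₁ m₁) (facet Y₂ m₂) (facet Y₃ m₃) (All.lookup (AllPairs.head J!) (here refl)) (All.lookup (AllPairs.head J!) (there (here refl)))
            (All.lookup (AllPairs.head (AllPairs.tail J!)) (here refl)) S (meetJ Y₁ m₁ S mS) (meetJ Y₂ m₂ S mS) (meetJ Y₃ m₃ S mS))
        where
        m₁ = sub Y₁ (here refl)
        m₂ = sub Y₂ (there (here refl))
        m₃ = sub Y₃ (there (there (here refl)))

      absurd : ⊥
      absurd = go Js (λ _ → id) (Uniqueₚ.filter⁺ heavy? I!) few-heavy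

  finish : ∀ {E} → Core t M 16 N E → length F ≤ ρ + (d + Σ E f) → ∃[ T₀ ] (∣ T₀ ∣ ≡ t × (∀ A → A ∈ F → T₀ ⊑ A))
  finish (core-star {T₀} T₀#) cov = T₀ , T₀# , case-star T₀ T₀# cov
  finish {E} (core-big b) cov = ⊥-elim (not-big {length F} {ρ} {d} {Σ E N} {M} M≥1 M≤F (≤-trans cov (+-monoʳ-≤ ρ (+-monoʳ-≤ d (Σ-mono′ E f≤N)))) 32ρ D-budget b)
  finish (core-tri {I} Z Z# I! I⇒) cov = ⊥-elim (Triangle.absurd Z Z# I I! I⇒ cov)

-- The abstract alternative: F is small or lies above a t-set

module Main {m : ℕ} (n t M C θ L q y z h zD hD : ℕ) (𝒯 F : List (Subset m))
  (sizes : ∀ A → A ∈ 𝒯 → ∣ A ∣ ≤ n)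
  (H₂ : ∀ S e → ∣ ⁅ e ⁆ ∩ S ∣ ≤ 0 → cnt 𝒯 (S ∪ ⁅ e ⁆) * n ≤ 2 * cnt 𝒯 S)
  (H₃ : ∀ S x y → ∣ S ∣ ≡ t + (x + y) → cnt 𝒯 S * n ^ y * rising t x ≤ 2 ^ y * M)
  (H₄ : ∀ T₀ B → ∣ T₀ ∣ ≡ t → B ∈ 𝒯 → ¬ (T₀ ⊑ B) → cnt 𝒯 T₀ ≤ L * Σ 𝒯 (λ A → 𝟙 ((T₀ ⊑? A) ×-dec (∣ A ∩ B ∣ <? t))))
  (H₅ : ∀ Z → ∣ Z ∣ ≡ t + 2 → Σ 𝒯 (λ A → 𝟙 (t + 1 ≤? ∣ A ∩ Z ∣)) * L + M ≤ L * M)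
  (uniq : Unique F) (F⊆ : ∀ A → A ∈ F → A ∈ 𝒯) (tint : TInt t F) (t≥2 : 2 ≤ t) (M≥1 : 1 ≤ M)
  (hC : ∀ x → 16 ^ x ≤ C * x !) (C≥1 : 1 ≤ C) (nbig : Scaled 128 (C * 16 * q) n)
  (y≥1 : 1 ≤ y) (r≤ : Scaled 20 (y ^ 3) n) (zy : 2 * z ≤ y) (n≤ : 2 * n ≤ z * h) (θq : θ * 2 ^ h ≤ 2 ^ q)
  (r≥16 : 16 ≤ y ^ 3) (qr : Scaled 32 q (y ^ 3)) (zr : Scaled 24 zD (y ^ 3)) (n≤D : n ≤ zD * hD) (hr : Scaled 384 (hD + 3) (y ^ 3))
  (θL : 2 * L ≤ θ) (θ32 : 32 ≤ θ) where

  private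
    r = y ^ 3
    r≥1 : 1 ≤ r
    r≥1 = m^n>0 y {{>-nonZero y≥1}} 3

    sizesF : ∀ A → A ∈ F → ∣ A ∣ ≤ n
    sizesF A mA = sizes A (F⊆ A mA)

    cnt≤ : ∀ X → cnt F X ≤ cnt 𝒯 X
    cnt≤ X = Σ-unique⊆ uniq F⊆ _

    N : Subset m → ℕ
    N = cnt 𝒯

    H₂* : ∀ k S X → ∣ X ∩ ∁ S ∣ ≡ k → N (S ∪ X) * n ^ k ≤ 2 ^ k * N S
    H₂* zero S X e = ≤-trans (≤-reflexive (*-identityʳ _)) (≤-trans (Σ-mono′ 𝒯 (λ A → 𝟙-mono ((S ∪ X) ⊑? A) (S ⊑? A)
        (slin 3 0 (λ s x a → (∥ (s ∪′ x) ∩′ ∁′ a ∥ ≼ # 0) ⇒ ⊢ (∥ s ∩′ ∁′ a ∥ ≼ # 0)) S X A))) (m≤m+n _ _))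
    H₂* (suc k) S X e = begin
        N (S ∪ X) * (n * n ^ k) ≡⟨ cong (λ Y → N Y * (n * n ^ k)) S∪X ⟩
        N (S₁ ∪ X) * (n * n ^ k) ≡⟨ a*bc≡b*ac (N (S₁ ∪ X)) n (n ^ k) ⟩
        n * (N (S₁ ∪ X) * n ^ k) ≤⟨ *-monoʳ-≤ n (H₂* k S₁ X k≡) ⟩
        n * (2 ^ k * N S₁) ≡⟨ arr n (2 ^ k) (N S₁) ⟩
        2 ^ k * (N S₁ * n) ≤⟨ *-monoʳ-≤ (2 ^ k) (H₂ S x (slin 3 0 (λ e s x → (∥ e ∩′ ∁′ (x ∩′ ∁′ s) ∥ ≼ # 0) ⇒ ⊢ (∥ e ∩′ s ∥ ≼ # 0)) ⁅ x ⁆ S X x∈)) ⟩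
        2 ^ k * (2 * N S) ≡⟨ arr′ (2 ^ k) (N S) ⟩
        2 * 2 ^ k * N S ∎
      where
      open ≤-Reasoning
      pt′ = point (X ∩ ∁ S) (≤-trans (s≤s z≤n) (≤-reflexive (sym e)))
      x = proj₁ pt′
      x∈ : ⁅ x ⁆ ⊑ X ∩ ∁ S
      x∈ = proj₂ pt′
      S₁ = S ∪ ⁅ x ⁆
      arr : ∀ a b c → a * (b * c) ≡ b * (c * a)
      arr = solve-∀
      arr′ : ∀ a b → a * (2 * b) ≡ 2 * a * b
      arr′ = solve-∀
      S∪X : S ∪ X ≡ S₁ ∪ X
      S∪X = ⊑-antisym (slin 3 0 (λ e s x → ⊢ (∥ (s ∪′ x) ∩′ ∁′ ((s ∪′ e) ∪′ x) ∥ ≼ # 0)) ⁅ x ⁆ S X)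
                      (slin 3 0 (λ e s x → (∥ e ∩′ ∁′ (x ∩′ ∁′ s) ∥ ≼ # 0) ⇒ ⊢ (∥ ((s ∪′ e) ∪′ x) ∩′ ∁′ (s ∪′ x) ∥ ≼ # 0)) ⁅ x ⁆ S X x∈)
      k≡ : ∣ X ∩ ∁ S₁ ∣ ≡ k
      k≡ = ≤-antisym
        (slin 3 1 (λ e s x k → (∥ x ∩′ ∁′ s ∥ ≼ # 1 ⊹ k) ⇒ (∥ e ∩′ ∁′ (x ∩′ ∁′ s) ∥ ≼ # 0) ⇒ (# 1 ≼ ∥ e ∥) ⇒ ⊢ (∥ x ∩′ ∁′ (s ∪′ e) ∥ ≼ k)) ⁅ x ⁆ S X k (≤-reflexive e) x∈ (≤-reflexive (sym (∣⁅⁆∣ x))))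
        (slin 3 1 (λ e s x k → (# 1 ⊹ k ≼ ∥ x ∩′ ∁′ s ∥) ⇒ (∥ e ∥ ≼ # 1) ⇒ ⊢ (k ≼ ∥ x ∩′ ∁′ (s ∪′ e) ∥)) ⁅ x ⁆ S X k (≤-reflexive (sym e)) (≤-reflexive (∣⁅⁆∣ x)))

    -- Above Y, each further point divides the count in 𝒯 by at least n / 2. Passing from 𝒯 to F
    -- costs H once; it is charged to the points of X outside Y, hence the condition 2 * H * r ≤ n
    -- and the separate case without such points.
    heavy : ∀ Y H → 1 ≤ H → 2 * H * r ≤ n → 1 ≤ cnt F Y → N Y ≤ H * cnt F Y → Spread F r Y
    heavy Y H H≥1 Hr f≥1 NY = record
      { fam = G
      ; fam⊆ = λ A mA → proj₁ (∈-filter⁻ (Y ⊑?_) {xs = F} mA)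
      ; fam≥1 = subst (1 ≤_) (sym len) f≥1
      ; above = λ A mA → proj₂ (∈-filter⁻ (Y ⊑?_) {xs = F} mA)
      ; links = λ X → subst (cnt G X * r ^ ∣ X ∩ ∁ Y ∣ ≤_) (sym len) (link X ∣ X ∩ ∁ Y ∣ refl)
      }
      where
      G = List.filter (Y ⊑?_) F
      f = cnt F Y
      len : length G ≡ f
      len = length-filter (Y ⊑?_) F
      n≥1 : 1 ≤ n
      n≥1 = ≤-trans (*-mono-≤ {1} {2 * H} {1} (*-mono-≤ {1} {2} (s≤s z≤n) H≥1) r≥1) Hr
      link : ∀ X d → ∣ X ∩ ∁ Y ∣ ≡ d → cnt G X * r ^ d ≤ f
      link X zero e = ≤-trans (≤-reflexive (*-identityʳ _)) (≤-trans (≤-reflexive (Σ-filter (Y ⊑?_) F _)) (Σ-mono′ F (λ A → ≤-trans (*-monoʳ-≤ (𝟙 (Y ⊑? A)) (𝟙≤1 (X ⊑? A))) (≤-reflexive (*-identityʳ _)))))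
      link X (suc d) e = *-cancelʳ-≤ _ _ ((2 * H) ^ suc d) {{m^n≢0 (2 * H) (suc d) {{>-nonZero (*-mono-≤ {1} {2} (s≤s z≤n) H≥1)}}}} (begin
          cnt G X * r ^ suc d * (2 * H) ^ suc d ≡⟨ trans (*-assoc (cnt G X) _ _) (cong (cnt G X *_) (trans (*-comm (r ^ suc d) _) (sym (^-distribʳ (suc d) (2 * H) r)))) ⟩
          cnt G X * (2 * H * r) ^ suc d ≤⟨ *-mono-≤ inG (^-monoˡ-≤ (suc d) Hr) ⟩
          N (Y ∪ X) * n ^ suc d ≤⟨ H₂* (suc d) Y X e ⟩
          2 ^ suc d * N Y ≤⟨ *-monoʳ-≤ (2 ^ suc d) NY ⟩
          2 ^ suc d * (H * f) ≤⟨ *-monoʳ-≤ (2 ^ suc d) (*-monoˡ-≤ f (≤-trans (≤-reflexive (sym (^-identityʳ H))) (^-monoʳ-≤ H {{>-nonZero H≥1}} {1} {suc d} (s≤s z≤n)))) ⟩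
          2 ^ suc d * (H ^ suc d * f) ≡⟨ trans (sym (*-assoc (2 ^ suc d) _ f)) (trans (cong (_* f) (sym (^-distribʳ (suc d) 2 H))) (*-comm _ f)) ⟩
          f * (2 * H) ^ suc d ∎)
        where
        open ≤-Reasoning
        inG : cnt G X ≤ N (Y ∪ X)
        inG = ≤-trans (≤-reflexive (Σ-filter (Y ⊑?_) F _)) (≤-trans (Σ-mono′ F (λ A → 𝟙*-≤ (Y ⊑? A) (λ yA → 𝟙-mono (X ⊑? A) ((Y ∪ X) ⊑? A)
                (slin 3 0 (λ y x a → (∥ y ∩′ ∁′ a ∥ ≼ # 0) ⇒ (∥ x ∩′ ∁′ a ∥ ≼ # 0) ⇒ ⊢ (∥ (y ∪′ x) ∩′ ∁′ a ∥ ≼ # 0)) Y X A yA)))) (cnt≤ (Y ∪ X)))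

    module App = Approximate F t q n y z h θ M tint sizesF
      (λ S d e → ≤-trans (*-monoˡ-≤ (n ^ d) (cnt≤ S)) (≤-trans (≤-reflexive (sym (*-identityʳ _))) (H₃ S 0 d e)))
      M≥1 y≥1 (≤-trans (*-monoˡ-≤ r (≤ᵇ⇒≤ 4 20 tt)) (unscaled r≤)) zy n≤ θq
    module Mt = Meet F t q n r zD hD tint sizesF r≥16 qr zr n≤D hr

    module Lv = Levels t q n M C 16 N H₃ hC nbig C≥1 (s≤s z≤n)

  small-or-star : length F < M ⊎ ∃[ T₀ ] (∣ T₀ ∣ ≡ t × (∀ A → A ∈ F → T₀ ⊑ A))
  small-or-star = go (M ≤? length F)
    where
    q≥1 : 1 ≤ q
    q≥1 = pos q (≤-trans (*-mono-≤ {2} {θ} {1} (≤-trans (s≤s (s≤s z≤n)) θ32) (m^n>0 2 h)) θq)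
      where
      pos : ∀ q → 2 ≤ 2 ^ q → 1 ≤ q
      pos (suc _) _ = s≤s z≤n
      pos zero (s≤s ())
    outcome : ∀ 𝒮 → SpreadIn F r (t + q) 𝒮 → Outcome t M 16 N q 𝒮
    outcome 𝒮 good = Lv.descend q ≤-refl 𝒮 (λ A B a b → Mt.spread-meet {A} {B} (proj₁ (good A a)) (proj₁ (good B b)) (proj₂ (good A a)) (proj₂ (good B b))) (λ S mS → proj₂ (good S mS))
    at-most : ∀ S x → ∣ S ∣ ≡ t + x → N S * rising t x ≤ M
    at-most S x S# = ≤-trans (≤-reflexive (cong (_* rising t x) (sym (*-identityʳ (N S))))) (≤-trans (H₃ S x 0 (trans S# (cong (t +_) (sym (+-identityʳ x))))) (≤-reflexive (*-identityˡ M)))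
    large : M ≤ length F → ∃[ 𝒮 ] (SpreadIn F r (t + q) 𝒮 × θ * rest# F 𝒮 < M) → ∃[ T₀ ] (∣ T₀ ∣ ≡ t × (∀ A → A ∈ F → T₀ ⊑ A))
    large le (𝒮 , good , ρ<) = finish′ (outcome 𝒮 good)
      where
      ρ = rest# F 𝒮
      finish′ : Outcome t M 16 N q 𝒮 → ∃[ T₀ ] (∣ T₀ ∣ ≡ t × (∀ A → A ∈ F → T₀ ⊑ A))
      finish′ (D , E , budget , core , cov) = Assembly.finish t M L q r 𝒯 F 𝒮
          (λ S S# → subst (_≤ M) (*-identityʳ (N S)) (at-most S 0 (trans S# (sym (+-identityʳ t)))))
          (λ S S# → subst (λ e → N S * e ≤ M) (*-identityˡ (t + 1)) (at-most S 1 S#)) H₄ H₅ uniq F⊆ tint t≥2 M≥1 q≥1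
          (λ Y → heavy Y 10 (s≤s z≤n) (unscaled r≤)) (λ S Y → Mt.spread-meet {S} {Y})
          good (≤-trans (*-monoˡ-≤ ρ θ32) (<⇒≤ ρ<)) (≤-<-trans (≤-trans (≤-reflexive (sym (*-assoc 2 L ρ))) (*-monoˡ-≤ ρ θL)) ρ<) le
          (Σ D N) D-budget {E} core (≤-trans (covered F 𝒮 D E cov) (+-monoʳ-≤ ρ (+-monoˡ-≤ (Σ E (cnt F)) (Σ-mono′ D cnt≤))))
        where
        arr : ∀ a p → a * 16 * p ≡ a * (p * 16)
        arr = solve-∀
        D-budget : Σ D N * 16 ≤ M
        D-budget = *-cancelʳ-≤ (Σ D N * 16) M (2 ^ q) {{m^n≢0 2 q}} (≤-trans (≤-reflexive (arr (Σ D N) (2 ^ q))) (≤-trans (m≤m+n (Σ D N * (2 ^ q * 16)) M) (≤-trans budget (≤-reflexive (*-comm (2 ^ q) M)))))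
    go : Dec (M ≤ length F) → length F < M ⊎ ∃[ T₀ ] (∣ T₀ ∣ ≡ t × (∀ A → A ∈ F → T₀ ⊑ A))
    go (no ¬le) = inj₁ (≰⇒> ¬le)
    go (yes le) = inj₂ (large le App.approx)

-- Sums over product index sets, points of unions

Σ-tabulate : ∀ {k} {A : Set} (g : Fin k → A) (f : A → ℕ) → Σ (List.tabulate g) f ≡ Σ (elements k) (f ∘ g)
Σ-tabulate {zero} g f = refl
Σ-tabulate {suc k} g f = cong (f (g zero) +_) (trans (Σ-tabulate (g ∘ suc) f) (sym (Σ-tabulate suc (f ∘ g))))

Σ-↑ : ∀ a b (f : Fin (a + b) → ℕ) → Σ (elements (a + b)) f ≡ Σ (elements a) (λ i → f (i Fin.↑ˡ b)) + Σ (elements b) (λ j → f (a Fin.↑ʳ j))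
Σ-↑ zero b f = refl
Σ-↑ (suc a) b f = trans (cong (f zero +_) (trans (Σ-tabulate suc f) (Σ-↑ a b (f ∘ suc))))
  (trans (sym (+-assoc (f zero) _ _)) (cong (λ s → f zero + s + Σ (elements b) (λ j → f (suc a Fin.↑ʳ j))) (sym (Σ-tabulate suc (λ i → f (i Fin.↑ˡ b))))))

Σ-combine : ∀ a b (f : Fin (a * b) → ℕ) → Σ (elements (a * b)) f ≡ Σ (elements a) (λ i → Σ (elements b) (λ j → f (Fin.combine i j)))
Σ-combine zero b f = refl
Σ-combine (suc a) b f = trans (Σ-↑ b (a * b) f) (cong (Σ (elements b) (λ j → f (j Fin.↑ˡ (a * b))) +_)
  (trans (Σ-combine a b (λ e → f (b Fin.↑ʳ e))) (sym (Σ-tabulate {a} {Fin (suc a)} suc (λ (i : Fin (suc a)) → Σ (elements b) (λ j → f (Fin.combine i j)))))))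

point-≡ : ∀ {m} (e f : Fin m) → ⁅ e ⁆ ⊑ ⁅ f ⁆ → e ≡ f
point-≡ zero zero h = refl
point-≡ zero (suc f) ()
point-≡ {suc m} (suc e) zero h = ⊥-elim (<-irrefl refl (slin 2 0 (λ x o → (# 1 ≼ ∥ x ∥) ⇒ (∥ x ∩′ ∁′ o ∥ ≼ # 0) ⇒ (∥ o ∥ ≼ # 0) ⇒ ⊢ (# 1 ≼ # 0)) ⁅ e ⁆ Sub.⊥ (≤-reflexive (sym (∣⁅⁆∣ e))) h (≤-reflexive (Subₚ.∣⊥∣≡0 m))))
point-≡ (suc e) (suc f) h = cong suc (point-≡ e f h)

point-∪ : ∀ {m} (v : Fin m) (X Y : Subset m) → v ∈ˢ X ∪ Y → v ∈ˢ X ⊎ v ∈ˢ Y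
point-∪ v X Y h with ⁅ v ⁆ ⊑? X
... | yes p = inj₁ p
... | no ¬p = inj₂ (slin 3 0 (λ e x y → (∥ e ∥ ≼ # 1) ⇒ (∥ e ∩′ ∁′ (x ∪′ y) ∥ ≼ # 0) ⇒ (# 1 ≼ ∥ e ∩′ ∁′ x ∥) ⇒ ⊢ (∥ e ∩′ ∁′ y ∥ ≼ # 0)) ⁅ v ⁆ X Y (≤-reflexive (∣⁅⁆∣ v)) h (≰⇒> ¬p))

∪-left : ∀ {m} (v : Fin m) (X Y : Subset m) → v ∈ˢ X → v ∈ˢ X ∪ Y
∪-left v = λ X Y → slin 3 0 (λ e x y → (∥ e ∩′ ∁′ x ∥ ≼ # 0) ⇒ ⊢ (∥ e ∩′ ∁′ (x ∪′ y) ∥ ≼ # 0)) ⁅ v ⁆ X Y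

∪-right : ∀ {m} (v : Fin m) (X Y : Subset m) → v ∈ˢ Y → v ∈ˢ X ∪ Y
∪-right v = λ X Y → slin 3 0 (λ e x y → (∥ e ∩′ ∁′ y ∥ ≼ # 0) ⇒ ⊢ (∥ e ∩′ ∁′ (x ∪′ y) ∥ ≼ # 0)) ⁅ v ⁆ X Y

∈ˢ-⊑ : ∀ {m} (v : Fin m) {X Y : Subset m} → X ⊑ Y → v ∈ˢ X → v ∈ˢ Y
∈ˢ-⊑ v {X} {Y} le h = ⊑-trans ⁅ v ⁆ X Y h le

-- Unordered pairs of list entries, with the remaining entries.

sel : {A : Set} → List A → List (A × List A)
sel [] = []
sel (x ∷ xs) = (x , xs) ∷ List.map (λ (y , r) → y , x ∷ r) (sel xs)

pairs : {A : Set} → List A → List (A × A × List A)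
pairs [] = []
pairs (x ∷ xs) = List.map (λ (y , r) → x , y , r) (sel xs) ++ List.map (λ (y , z , r) → y , z , x ∷ r) (pairs xs)

module _ {A : Set} where
  sel-spec : ∀ {xs : List A} {y r} → (y , r) ∈ sel xs → y ∈ xs × (∀ z → z ∈ r → z ∈ xs) × (∀ f → Σ xs f ≡ f y + Σ r f) × length xs ≡ suc (length r)
  sel-spec {x ∷ xs} (here refl) = here refl , (λ z → there) , (λ f → refl) , refl
  sel-spec {x ∷ xs} (there p) with ∈-map⁻ (λ (y , r) → y , x ∷ r) p
  ... | (y , r) , q , refl = let (a , b , c , d) = sel-spec q in there a , (λ { z (here refl) → here refl ; z (there w) → there (b z w) })
        , (λ f → trans (cong (f x +_) (c f)) (swap (f x) (f y) (Σ r f))) , cong suc d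
    where
    swap : ∀ a b c → a + (b + c) ≡ b + (a + c)
    swap = solve-∀

  sel-complete : ∀ {xs : List A} {y} → y ∈ xs → ∃[ r ] ((y , r) ∈ sel xs)
  sel-complete {x ∷ xs} (here refl) = xs , here refl
  sel-complete {x ∷ xs} (there p) = let (r , q) = sel-complete p in x ∷ r , there (∈-map⁺ (λ (y , r) → y , x ∷ r) q)

  pairs-spec : ∀ {xs : List A} {y z r} → (y , z , r) ∈ pairs xs →
    y ∈ xs × z ∈ xs × (∀ w → w ∈ r → w ∈ xs) × (∀ f → Σ xs f ≡ f y + (f z + Σ r f)) × length xs ≡ suc (suc (length r))
  pairs-spec {x ∷ xs} p with ∈-++⁻ (List.map (λ (y , r) → x , y , r) (sel xs)) p
  ... | inj₁ p′ with ∈-map⁻ (λ (y , r) → x , y , r) p′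
  ...   | (y , r) , q , refl = let (a , b , c , d) = sel-spec q in here refl , there a , (λ z w → there (b z w)) , (λ f → cong (f x +_) (c f)) , cong suc d
  pairs-spec {x ∷ xs} p | inj₂ p′ with ∈-map⁻ (λ (y , z , r) → y , z , x ∷ r) p′
  ...   | (y , z , r) , q , refl = let (a , b , c , d , e) = pairs-spec q in there a , there b , (λ { w (here refl) → here refl ; w (there v) → there (c w v) })
        , (λ f → trans (cong (f x +_) (d f)) (swap (f x) (f y) (f z) (Σ r f))) , cong suc e
    where
    swap : ∀ a b c d → a + (b + (c + d)) ≡ b + (c + (a + d))
    swap = solve-∀

  pair-or-same : {P Q : A → Set} → ∀ {xs : List A} → ∃[ x ] (x ∈ xs × P x) → ∃[ y ] (y ∈ xs × Q y) →
    (∃[ x ] (x ∈ xs × P x × Q x)) ⊎ (∃[ y ] ∃[ z ] ∃[ r ] ((y , z , r) ∈ pairs xs × ((P y × Q z) ⊎ (Q y × P z))))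
  pair-or-same {xs = x ∷ xs} (_ , here refl , p) (_ , here refl , q) = inj₁ (x , here refl , p , q)
  pair-or-same {xs = x ∷ xs} (_ , here refl , p) (y , there my , q) = let (r , s) = sel-complete my in inj₂ (x , y , r , ∈-++⁺ˡ (∈-map⁺ (λ (y , r) → x , y , r) s) , inj₁ (p , q))
  pair-or-same {xs = x ∷ xs} (y , there my , p) (_ , here refl , q) = let (r , s) = sel-complete my in inj₂ (x , y , r , ∈-++⁺ˡ (∈-map⁺ (λ (y , r) → x , y , r) s) , inj₂ (q , p))
  pair-or-same {xs = x ∷ xs} (y , there my , p) (z , there mz , q) with pair-or-same (y , my , p) (z , mz , q)
  ... | inj₁ (w , mw , h) = inj₁ (w , there mw , h)
  ... | inj₂ (a , b , r , m , h) = inj₂ (a , b , x ∷ r , ∈-++⁺ʳ (List.map (λ (y , r) → x , y , r) (sel xs)) (∈-map⁺ (λ (y , z , r) → y , z , x ∷ r) m) , h)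

  Σ-sel : (xs : List A) (f : A → ℕ) → Σ (sel xs) (f ∘ proj₁) ≡ Σ xs f
  Σ-sel [] f = refl
  Σ-sel (x ∷ xs) f = cong (f x +_) (trans (Σ-map _ (sel xs) _) (Σ-sel xs f))

  Σ-pairs : (xs : List A) (h : A → A → ℕ) → Σ (pairs xs) (λ (y , z , _) → h y z + h z y) + Σ xs (λ x → h x x) ≡ Σ xs (λ x → Σ xs (h x))
  Σ-pairs [] h = refl
  Σ-pairs (x ∷ xs) h = begin
      Σ (pairs (x ∷ xs)) H + (h x x + D) ≡⟨ cong (_+ (h x x + D)) (trans (Σ-++ (List.map (λ (y , r) → x , y , r) (sel xs)) _ H) (cong₂ _+_ (trans (Σ-map _ (sel xs) H) (trans (Σ-sel xs (λ y → h x y + h y x)) (Σ-+ xs (h x) (λ y → h y x)))) (Σ-map _ (pairs xs) H))) ⟩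
      (R + C + Σ (pairs xs) H) + (h x x + D) ≡⟨ arr R C (Σ (pairs xs) H) (h x x) D ⟩
      h x x + R + (C + (Σ (pairs xs) H + D)) ≡⟨ cong (λ e → h x x + R + (C + e)) (Σ-pairs xs h) ⟩
      h x x + R + (C + Σ xs (λ y → Σ xs (h y))) ≡⟨ cong (h x x + R +_) (sym (Σ-+ xs (λ y → h y x) (λ y → Σ xs (h y)))) ⟩
      Σ (x ∷ xs) (λ y → Σ (x ∷ xs) (h y)) ∎
    where
    open ≡-Reasoning
    H : A × A × List A → ℕ
    H (y , z , _) = h y z + h z y
    D = Σ xs (λ y → h y y)
    R = Σ xs (h x)
    C = Σ xs (λ y → h y x)
    arr : ∀ r c p a d → (r + c + p) + (a + d) ≡ a + r + (c + (p + d))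
    arr = solve-∀

-- Graphs on Fin n as sets of edge codes

-- The edge {i , j} with i < j is the element combine i j of Fin (n * n); codes with i ≥ j are junk, excluded by Valid.
module Graphs (n : ℕ) where

  m : ℕ
  m = n * n

  V : List (Fin n)
  V = elements n

  code : Fin n → Fin n → Fin m
  code u v with u Fin.<? v
  ... | yes _ = Fin.combine u v
  ... | no _ = Fin.combine v u

  code-< : ∀ {u v} → u Fin.< v → code u v ≡ Fin.combine u v
  code-< {u} {v} lt with u Fin.<? v
  ... | yes _ = refl
  ... | no ¬lt = ⊥-elim (¬lt lt)

  code-≮ : ∀ {u v} → ¬ (u Fin.< v) → code u v ≡ Fin.combine v u
  code-≮ {u} {v} ¬lt with u Fin.<? v
  ... | yes lt = ⊥-elim (¬lt lt)
  ... | no _ = refl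

  code-sym : ∀ u v → code u v ≡ code v u
  code-sym u v with Finₚ.<-cmp u v
  ... | tri< lt _ ¬gt = trans (code-< lt) (sym (code-≮ ¬gt))
  ... | tri≈ _ refl _ = refl
  ... | tri> ¬lt _ gt = trans (code-≮ ¬lt) (sym (code-< gt))

  combine-inj : ∀ {i j k l : Fin n} → Fin.combine i j ≡ Fin.combine k l → i ≡ k × j ≡ l
  combine-inj {i} {j} {k} {l} e = Finₚ.combine-injectiveˡ i j k l e , Finₚ.combine-injectiveʳ i j k l e

  code-inj : ∀ x y u v → code x y ≡ code u v → (x ≡ u × y ≡ v) ⊎ (x ≡ v × y ≡ u)
  code-inj x y u v e with x Fin.<? y | u Fin.<? v
  ... | yes _ | yes _ = inj₁ (combine-inj e)
  ... | yes _ | no _ = inj₂ (combine-inj e)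
  ... | no _ | yes _ = let (a , b) = combine-inj e in inj₂ (b , a)
  ... | no _ | no _ = let (a , b) = combine-inj e in inj₁ (b , a)

  Valid : Subset m → Set
  Valid X = ∀ (i j : Fin n) → ⁅ Fin.combine i j ⁆ ⊑ X → i Fin.< j

  Adj : Subset m → Fin n → Fin n → Set
  Adj X u v = ⁅ code u v ⁆ ⊑ X

  adj : Subset m → Fin n → Fin n → ℕ
  adj X u v = 𝟙 (⁅ code u v ⁆ ⊑? X)

  adj-sym : ∀ X u v → adj X u v ≡ adj X v u
  adj-sym X u v = cong (λ e → 𝟙 (⁅ e ⁆ ⊑? X)) (code-sym u v)

  Σ-adj : ∀ X → Valid X → Σ V (λ u → Σ V (adj X u)) ≡ ∣ X ∣ + ∣ X ∣
  Σ-adj X val = trans (Σ-cong V (λ u → trans (Σ-cong V (each u)) (Σ-+ V _ _))) (trans (Σ-+ V _ _)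
      (cong₂ _+_ half′ (trans (Σ-swap V V (λ u v → 𝟙 (⁅ Fin.combine v u ⁆ ⊑? X))) half′)))
    where
    half′ : Σ V (λ u → Σ V (λ v → 𝟙 (⁅ Fin.combine u v ⁆ ⊑? X))) ≡ ∣ X ∣
    half′ = trans (sym (Σ-combine n n (λ e → 𝟙 (⁅ e ⁆ ⊑? X)))) (Σ-elements X)
    each : ∀ u v → adj X u v ≡ 𝟙 (⁅ Fin.combine u v ⁆ ⊑? X) + 𝟙 (⁅ Fin.combine v u ⁆ ⊑? X)
    each u v with u Fin.<? v
    ... | yes lt = sym (trans (cong (𝟙 (⁅ Fin.combine u v ⁆ ⊑? X) +_) (𝟙-no (⁅ Fin.combine v u ⁆ ⊑? X) (λ h → Finₚ.<-asym lt (val v u h)))) (+-identityʳ _))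
    ... | no ¬lt = sym (cong (_+ 𝟙 (⁅ Fin.combine v u ⁆ ⊑? X)) (𝟙-no (⁅ Fin.combine u v ⁆ ⊑? X) (λ h → ¬lt (val u v h))))

  Adj⇒≢ : ∀ {X u v} → Valid X → Adj X u v → ¬ (u ≡ v)
  Adj⇒≢ {X} {u} val a refl = Finₚ.<-irrefl refl (val u u (subst (λ e → ⁅ e ⁆ ⊑ X) (code-≮ (Finₚ.<-irrefl refl)) a))

  data Path (X : Subset m) (u : Fin n) : Fin n → Set where
    nil  : Path X u u
    snoc : ∀ {v w} → Path X u v → Adj X v w → Path X u w

  path-trans : ∀ {X u v w} → Path X u v → Path X v w → Path X u w
  path-trans p nil = p
  path-trans p (snoc q a) = snoc (path-trans p q) a

  path-sym : ∀ {X u v} → Path X u v → Path X v u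
  path-sym nil = nil
  path-sym {X} (snoc {v} {w} p a) = path-trans (snoc nil (subst (λ e → ⁅ e ⁆ ⊑ X) (code-sym v w) a)) (path-sym p)

  path-mono : ∀ {X Y u v} → X ⊑ Y → Path X u v → Path Y u v
  path-mono le nil = nil
  path-mono le (snoc {v} {w} p a) = snoc (path-mono le p) (∈ˢ-⊑ (code v w) le a)

  Blocks : Set
  Blocks = List (Subset n)

  -- A certificate that Bs lists the connected components of X. By `size`, δ is the cycle rank, and
  -- δ = 0 expresses that X is a forest without speaking of cycles.
  record Comp (X : Subset m) (Bs : Blocks) (δ : ℕ) : Set where
    field
      valid  : Valid X
      part   : ∀ v → Σ Bs (λ B → 𝟙 (⁅ v ⁆ ⊑? B)) ≡ 1
      ne     : ∀ B → B ∈ Bs → 1 ≤ ∣ B ∣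
      closed : ∀ B → B ∈ Bs → ∀ u v → u ∈ˢ B → Adj X u v → v ∈ˢ B
      conn   : ∀ B → B ∈ Bs → ∀ u v → u ∈ˢ B → v ∈ˢ B → Path X u v
      size   : ∣ X ∣ + length Bs ≡ n + δ

  block : ∀ {X Bs δ} → Comp X Bs δ → ∀ v → ∃[ B ] (B ∈ Bs × v ∈ˢ B)
  block {Bs = Bs} c v with Σ-pos Bs (≤-reflexive (sym (Comp.part c v)))
  ... | B , mB , h = B , mB , 𝟙-inv (⁅ v ⁆ ⊑? B) h

  closed-path : ∀ {X Bs δ} → Comp X Bs δ → ∀ {B} → B ∈ Bs → ∀ {u v} → u ∈ˢ B → Path X u v → v ∈ˢ B
  closed-path c mB hu nil = hu
  closed-path c {B} mB {u} hu (snoc {v} {w} p a) = Comp.closed c B mB v w (closed-path c mB hu p) a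

  pair-disjoint : ∀ {X Bs δ} → Comp X Bs δ → ∀ {B C r} → (B , C , r) ∈ pairs Bs → ∀ v → v ∈ˢ B → v ∈ˢ C → ⊥
  pair-disjoint {Bs = Bs} c {B} {C} {r} p v hB hC = <-irrefl refl (≤-trans (+-mono-≤ (𝟙-yes (⁅ v ⁆ ⊑? B) hB) (𝟙-yes (⁅ v ⁆ ⊑? C) hC))
    (≤-trans (+-monoʳ-≤ (𝟙 (⁅ v ⁆ ⊑? B)) (m≤m+n (𝟙 (⁅ v ⁆ ⊑? C)) (Σ r (λ B → 𝟙 (⁅ v ⁆ ⊑? B))))) (≤-reflexive (trans (sym (proj₁ (proj₂ (proj₂ (proj₂ (pairs-spec {xs = Bs} {B} {C} {r} p)))) (λ B → 𝟙 (⁅ v ⁆ ⊑? B)))) (Comp.part c v)))))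

  pair-disjointˢ : ∀ {X Bs δ} → Comp X Bs δ → ∀ {B C r} → (B , C , r) ∈ pairs Bs → ∣ B ∩ C ∣ ≤ 0
  pair-disjointˢ c {B} {C} p = ≮⇒≥ λ lt → let (v , h) = point (B ∩ C) lt in
    pair-disjoint c p v (⊑-trans ⁅ v ⁆ (B ∩ C) B h (slin 2 0 (λ b c → ⊢ (∥ (b ∩′ c) ∩′ ∁′ b ∥ ≼ # 0)) B C)) (⊑-trans ⁅ v ⁆ (B ∩ C) C h (slin 2 0 (λ b c → ⊢ (∥ (b ∩′ c) ∩′ ∁′ c ∥ ≼ # 0)) B C))

  code-ordered : ∀ {u v} {i j : Fin n} → ¬ (u ≡ v) → Fin.combine i j ≡ code u v → i Fin.< j
  code-ordered {u} {v} u≢v e with u Fin.<? v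
  ... | yes lt = let (a , b) = combine-inj e in subst₂ Fin._<_ (sym a) (sym b) lt
  ... | no ¬lt = let (a , b) = combine-inj e in subst₂ Fin._<_ (sym a) (sym b) (Finₚ.≤∧≢⇒< (≮⇒≥ ¬lt) (λ e → u≢v (sym e)))

  edge-valid : ∀ {X u v} → Valid X → ¬ (u ≡ v) → Valid (X ∪ ⁅ code u v ⁆)
  edge-valid {X} {u} {v} val u≢v i j h = [ val i j , (λ h′ → code-ordered u≢v (point-≡ _ _ h′)) ]′ (point-∪ (Fin.combine i j) X ⁅ code u v ⁆ h)

  edge-size : ∀ (X : Subset m) (e : Fin m) → ∣ ⁅ e ⁆ ∩ X ∣ ≤ 0 → ∣ X ∪ ⁅ e ⁆ ∣ ≡ suc ∣ X ∣
  edge-size X e h = ≤-antisym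
    (slin 2 0 (λ x e → (∥ e ∥ ≼ # 1) ⇒ ⊢ (∥ x ∪′ e ∥ ≼ # 1 ⊹ ∥ x ∥)) X ⁅ e ⁆ (≤-reflexive (∣⁅⁆∣ e)))
    (slin 2 0 (λ x e → (# 1 ≼ ∥ e ∥) ⇒ (∥ e ∩′ x ∥ ≼ # 0) ⇒ ⊢ (# 1 ⊹ ∥ x ∥ ≼ ∥ x ∪′ e ∥)) X ⁅ e ⁆ (≤-reflexive (sym (∣⁅⁆∣ e))) h)

  edge-adj : ∀ {X u v x y} → Adj (X ∪ ⁅ code u v ⁆) x y → Adj X x y ⊎ ((x ≡ u × y ≡ v) ⊎ (x ≡ v × y ≡ u))
  edge-adj {X} {u} {v} {x} {y} a with point-∪ (code x y) X ⁅ code u v ⁆ a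
  ... | inj₁ h = inj₁ h
  ... | inj₂ h = inj₂ (code-inj x y u v (point-≡ _ _ h))

  new-edge : ∀ X u v → Adj (X ∪ ⁅ code u v ⁆) u v
  new-edge X u v = ∪-right (code u v) X ⁅ code u v ⁆ (⊑-refl ⁅ code u v ⁆)

  add-inner : ∀ {X Bs δ} → Comp X Bs δ → ∀ {u v B} → ¬ (u ≡ v) → B ∈ Bs → u ∈ˢ B → v ∈ˢ B → ∣ ⁅ code u v ⁆ ∩ X ∣ ≤ 0 → Comp (X ∪ ⁅ code u v ⁆) Bs (suc δ)
  add-inner {X} {Bs} {δ} c {u} {v} {B} u≢v mB hu hv new = record
    { valid = edge-valid valid u≢v
    ; part = part
    ; ne = ne
    ; closed = λ C mC x y hx a → cl C mC x y hx (edge-adj a)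
    ; conn = λ C mC x y hx hy → path-mono (slin 2 0 (λ x e → ⊢ (∥ x ∩′ ∁′ (x ∪′ e) ∥ ≼ # 0)) X ⁅ code u v ⁆) (conn C mC x y hx hy)
    ; size = trans (cong (_+ length Bs) (edge-size X (code u v) new)) (trans (cong suc size) (sym (+-suc n δ)))
    }
    where
    open Comp c
    cl : ∀ C → C ∈ Bs → ∀ x y → x ∈ˢ C → Adj X x y ⊎ ((x ≡ u × y ≡ v) ⊎ (x ≡ v × y ≡ u)) → y ∈ˢ C
    cl C mC x y hx (inj₁ a) = closed C mC x y hx a
    cl C mC x y hx (inj₂ (inj₁ (refl , refl))) = closed-path c mC hx (conn B mB u v hu hv)
    cl C mC x y hx (inj₂ (inj₂ (refl , refl))) = closed-path c mC hx (conn B mB v u hv hu)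

  merge : ∀ {X Bs δ} → Comp X Bs δ → ∀ {u v B C r} → (B , C , r) ∈ pairs Bs → u ∈ˢ B → v ∈ˢ C →
          Comp (X ∪ ⁅ code u v ⁆) ((B ∪ C) ∷ r) δ × ∣ ⁅ code u v ⁆ ∩ X ∣ ≤ 0 × ¬ (u ≡ v)
  merge {X} {Bs} {δ} c {u} {v} {B} {C} {r} p hu hv = record
    { valid = edge-valid valid u≢v
    ; part = part′
    ; ne = ne′
    ; closed = λ D mD x y hx a → cl D mD x y hx (edge-adj a)
    ; conn = conn′
    ; size = trans (cong (_+ length ((B ∪ C) ∷ r)) (edge-size X (code u v) new)) (trans (sym (+-suc ∣ X ∣ _)) (trans (cong (∣ X ∣ +_) (sym len)) size))
    } , new , u≢v
    where
    open Comp c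
    spec = pairs-spec p
    mB : B ∈ Bs
    mB = proj₁ spec
    mC : C ∈ Bs
    mC = proj₁ (proj₂ spec)
    mr : ∀ D → D ∈ r → D ∈ Bs
    mr = proj₁ (proj₂ (proj₂ spec))
    Σs : ∀ f → Σ Bs f ≡ f B + (f C + Σ r f)
    Σs = proj₁ (proj₂ (proj₂ (proj₂ spec)))
    len : length Bs ≡ suc (suc (length r))
    len = proj₂ (proj₂ (proj₂ (proj₂ spec)))
    u≢v : ¬ (u ≡ v)
    u≢v refl = pair-disjoint c p u hu hv
    new : ∣ ⁅ code u v ⁆ ∩ X ∣ ≤ 0
    new with point-∈ (code u v) X
    ... | inj₂ h = h
    ... | inj₁ h = ⊥-elim (pair-disjoint c p v (closed B mB u v hu h) hv)
    X⊑ : X ⊑ X ∪ ⁅ code u v ⁆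
    X⊑ = slin 2 0 (λ x e → ⊢ (∥ x ∩′ ∁′ (x ∪′ e) ∥ ≼ # 0)) X ⁅ code u v ⁆
    part′ : ∀ w → 𝟙 (⁅ w ⁆ ⊑? (B ∪ C)) + Σ r (λ D → 𝟙 (⁅ w ⁆ ⊑? D)) ≡ 1
    part′ w = trans (cong (_+ Σ r (λ D → 𝟙 (⁅ w ⁆ ⊑? D))) bc) (trans (+-assoc (𝟙 (⁅ w ⁆ ⊑? B)) _ _) (trans (sym (Σs (λ D → 𝟙 (⁅ w ⁆ ⊑? D)))) (part w)))
      where
      bc : 𝟙 (⁅ w ⁆ ⊑? (B ∪ C)) ≡ 𝟙 (⁅ w ⁆ ⊑? B) + 𝟙 (⁅ w ⁆ ⊑? C)
      bc with ⁅ w ⁆ ⊑? B | ⁅ w ⁆ ⊑? C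
      ... | yes b | yes c′ = ⊥-elim (pair-disjoint c p w b c′)
      ... | yes b | no _ = ≤-antisym (𝟙≤1 (⁅ w ⁆ ⊑? (B ∪ C))) (𝟙-yes (⁅ w ⁆ ⊑? (B ∪ C)) (∪-left w B C b))
      ... | no _ | yes c′ = ≤-antisym (𝟙≤1 (⁅ w ⁆ ⊑? (B ∪ C))) (𝟙-yes (⁅ w ⁆ ⊑? (B ∪ C)) (∪-right w B C c′))
      ... | no ¬b | no ¬c = 𝟙-no (⁅ w ⁆ ⊑? (B ∪ C)) (λ h → [ ¬b , ¬c ]′ (point-∪ w B C h))
    ne′ : ∀ D → D ∈ ((B ∪ C) ∷ r) → 1 ≤ ∣ D ∣
    ne′ D (here refl) = ≤-trans (ne B mB) (slin 2 0 (λ b c → ⊢ (∥ b ∥ ≼ ∥ b ∪′ c ∥)) B C)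
    ne′ D (there mD) = ne D (mr D mD)
    not-rest : ∀ D → D ∈ r → ∀ w → w ∈ˢ D → w ∈ˢ B ⊎ w ∈ˢ C → ⊥
    not-rest D mD w hD h = <-irrefl refl (≤-trans (+-mono-≤ (one h) (≤-trans (𝟙-yes (⁅ w ⁆ ⊑? D) hD) (Σ-member (λ D → 𝟙 (⁅ w ⁆ ⊑? D)) mD))) (≤-reflexive (part′ w)))
      where
      one : w ∈ˢ B ⊎ w ∈ˢ C → 1 ≤ 𝟙 (⁅ w ⁆ ⊑? (B ∪ C))
      one (inj₁ b) = 𝟙-yes (⁅ w ⁆ ⊑? (B ∪ C)) (∪-left w B C b)
      one (inj₂ c′) = 𝟙-yes (⁅ w ⁆ ⊑? (B ∪ C)) (∪-right w B C c′)
    cl : ∀ D → D ∈ ((B ∪ C) ∷ r) → ∀ x y → x ∈ˢ D → Adj X x y ⊎ ((x ≡ u × y ≡ v) ⊎ (x ≡ v × y ≡ u)) → y ∈ˢ D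
    cl D (here refl) x y hx (inj₁ a) with point-∪ x B C hx
    ... | inj₁ b = ∪-left y B C (closed B mB x y b a)
    ... | inj₂ c′ = ∪-right y B C (closed C mC x y c′ a)
    cl D (here refl) x y hx (inj₂ (inj₁ (refl , refl))) = ∪-right y B C hv
    cl D (here refl) x y hx (inj₂ (inj₂ (refl , refl))) = ∪-left y B C hu
    cl D (there mD) x y hx (inj₁ a) = closed D (mr D mD) x y hx a
    cl D (there mD) x y hx (inj₂ (inj₁ (refl , refl))) = ⊥-elim (not-rest D mD x hx (inj₁ hu))
    cl D (there mD) x y hx (inj₂ (inj₂ (refl , refl))) = ⊥-elim (not-rest D mD x hx (inj₂ hv))
    to-u : ∀ x → x ∈ˢ B ∪ C → Path (X ∪ ⁅ code u v ⁆) x u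
    to-u x hx with point-∪ x B C hx
    ... | inj₁ b = path-mono X⊑ (conn B mB x u b hu)
    ... | inj₂ c′ = snoc (path-mono X⊑ (conn C mC x v c′ hv)) (subst (λ e → ⁅ e ⁆ ⊑ X ∪ ⁅ code u v ⁆) (code-sym u v) (new-edge X u v))
    conn′ : ∀ D → D ∈ ((B ∪ C) ∷ r) → ∀ x y → x ∈ˢ D → y ∈ˢ D → Path (X ∪ ⁅ code u v ⁆) x y
    conn′ D (here refl) x y hx hy = path-trans (to-u x hx) (path-sym (to-u y hy))
    conn′ D (there mD) x y hx hy = path-mono X⊑ (conn D (mr D mD) x y hx hy)

  -- An edge inside a block raises the cycle rank by one, an edge between two blocks merges them.
  add-edge : ∀ {X Bs δ} → Comp X Bs δ → ∀ u v → ¬ (u ≡ v) → ∣ ⁅ code u v ⁆ ∩ X ∣ ≤ 0 → ∃[ Bs′ ] ∃[ δ′ ] (δ ≤ δ′ × Comp (X ∪ ⁅ code u v ⁆) Bs′ δ′)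
  add-edge {X} {Bs} {δ} c u v u≢v new with pair-or-same (block c u) (block c v)
  ... | inj₁ (B , mB , hu , hv) = Bs , suc δ , n≤1+n δ , add-inner c u≢v mB hu hv new
  ... | inj₂ (B , C , r , p , inj₁ (hu , hv)) = (B ∪ C) ∷ r , δ , ≤-refl , proj₁ (merge c {u} {v} p hu hv)
  ... | inj₂ (B , C , r , p , inj₂ (hv , hu)) = (B ∪ C) ∷ r , δ , ≤-refl , subst (λ e → Comp (X ∪ ⁅ e ⁆) ((B ∪ C) ∷ r) δ) (code-sym v u) (proj₁ (merge c {v} {u} p hv hu))

  edge-ends : ∀ {X} → Valid X → ∀ e → ⁅ e ⁆ ⊑ X → ∃[ u ] ∃[ v ] (e ≡ code u v × ¬ (u ≡ v) × u Fin.< v × e ≡ Fin.combine u v)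
  edge-ends {X} val e h = u , v , trans eq (sym (code-< lt)) , Finₚ.<⇒≢ lt , lt , eq
    where
    u = proj₁ (Fin.remQuot {n} n e)
    v = proj₂ (Fin.remQuot {n} n e)
    eq : e ≡ Fin.combine u v
    eq = sym (Finₚ.combine-remQuot {n} n e)
    lt : u Fin.< v
    lt = val u v (subst (λ e → ⁅ e ⁆ ⊑ X) eq h)

  -- Adding the missing edges one by one never lowers δ. This monotonicity replaces all arguments
  -- about cycles in subgraphs of trees.
  extend-comp : ∀ k {X A Bs δ} → ∣ A ∩ ∁ X ∣ ≡ k → X ⊑ A → Valid A → Comp X Bs δ → ∃[ Bs′ ] ∃[ δ′ ] (δ ≤ δ′ × Comp A Bs′ δ′)
  extend-comp zero {X} {A} {Bs} {δ} e le val c = Bs , δ , ≤-refl , subst (λ Y → Comp Y Bs δ) (⊑-antisym le (≤-reflexive e)) c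
  extend-comp (suc k) {X} {A} e le val c =
      let (Bs₁ , δ₁ , le₁ , comp₁) = add-edge c u v u≢v new
          (Bs₂ , δ₂ , le₂ , comp₂) = extend-comp k k≡ le′ val comp₁
      in Bs₂ , δ₂ , ≤-trans le₁ le₂ , comp₂
    where
    pt′ = point (A ∩ ∁ X) (≤-trans (s≤s z≤n) (≤-reflexive (sym e)))
    f = proj₁ pt′
    f∈ : ⁅ f ⁆ ⊑ A ∩ ∁ X
    f∈ = proj₂ pt′
    ends = edge-ends val f (⊑-trans ⁅ f ⁆ (A ∩ ∁ X) A f∈ (slin 2 0 (λ a b → ⊢ (∥ (a ∩′ b) ∩′ ∁′ a ∥ ≼ # 0)) A (∁ X)))
    u = proj₁ ends
    v = proj₁ (proj₂ ends)
    f≡ : f ≡ code u v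
    f≡ = proj₁ (proj₂ (proj₂ ends))
    u≢v : ¬ (u ≡ v)
    u≢v = proj₁ (proj₂ (proj₂ (proj₂ ends)))
    g∈ : ⁅ code u v ⁆ ⊑ A ∩ ∁ X
    g∈ = subst (λ g → ⁅ g ⁆ ⊑ A ∩ ∁ X) f≡ f∈
    new : ∣ ⁅ code u v ⁆ ∩ X ∣ ≤ 0
    new = slin 3 0 (λ e a x → (∥ e ∩′ ∁′ (a ∩′ ∁′ x) ∥ ≼ # 0) ⇒ ⊢ (∥ e ∩′ x ∥ ≼ # 0)) ⁅ code u v ⁆ A X g∈
    le′ : X ∪ ⁅ code u v ⁆ ⊑ A
    le′ = slin 3 0 (λ e a x → (∥ e ∩′ ∁′ (a ∩′ ∁′ x) ∥ ≼ # 0) ⇒ (∥ x ∩′ ∁′ a ∥ ≼ # 0) ⇒ ⊢ (∥ (x ∪′ e) ∩′ ∁′ a ∥ ≼ # 0)) ⁅ code u v ⁆ A X g∈ le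
    k≡ : ∣ A ∩ ∁ (X ∪ ⁅ code u v ⁆) ∣ ≡ k
    k≡ = ≤-antisym
      (slin 3 1 (λ e a x k → (∥ a ∩′ ∁′ x ∥ ≼ # 1 ⊹ k) ⇒ (∥ e ∩′ ∁′ (a ∩′ ∁′ x) ∥ ≼ # 0) ⇒ (# 1 ≼ ∥ e ∥) ⇒ ⊢ (∥ a ∩′ ∁′ (x ∪′ e) ∥ ≼ k)) ⁅ code u v ⁆ A X k (≤-reflexive e) g∈ (≤-reflexive (sym (∣⁅⁆∣ (code u v)))))
      (slin 3 1 (λ e a x k → (# 1 ⊹ k ≼ ∥ a ∩′ ∁′ x ∥) ⇒ (∥ e ∥ ≼ # 1) ⇒ ⊢ (k ≼ ∥ a ∩′ ∁′ (x ∪′ e) ∥)) ⁅ code u v ⁆ A X k (≤-reflexive (sym e)) (≤-reflexive (∣⁅⁆∣ (code u v))))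

  singletons : Blocks
  singletons = List.map ⁅_⁆ V

  empty-comp : Comp Sub.⊥ singletons 0
  empty-comp = record
    { valid = λ i j h → ⊥-elim (none (Fin.combine i j) h)
    ; part = λ v → trans (Σ-map ⁅_⁆ V _) (trans (Σ-cong V (λ w → ≤-antisym (𝟙-mono (⁅ v ⁆ ⊑? ⁅ w ⁆) (⁅ w ⁆ ⊑? ⁅ v ⁆) (flip v w)) (𝟙-mono (⁅ w ⁆ ⊑? ⁅ v ⁆) (⁅ v ⁆ ⊑? ⁅ w ⁆) (flip w v)))) (trans (Σ-elements ⁅ v ⁆) (∣⁅⁆∣ v)))
    ; ne = λ B mB → let (v , _ , e) = ∈-map⁻ ⁅_⁆ mB in ≤-reflexive (sym (trans (cong ∣_∣ e) (∣⁅⁆∣ v)))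
    ; closed = λ B mB u v hu a → ⊥-elim (none (code u v) a)
    ; conn = λ B mB u v hu hv → let (w , _ , e) = ∈-map⁻ ⁅_⁆ mB in
        subst (Path Sub.⊥ u) (trans (point-≡ u w (subst (⁅ u ⁆ ⊑_) e hu)) (sym (point-≡ v w (subst (⁅ v ⁆ ⊑_) e hv)))) nil
    ; size = trans (cong₂ _+_ (Subₚ.∣⊥∣≡0 m) (trans (Listₚ.length-map ⁅_⁆ V) (Listₚ.length-tabulate id))) (sym (+-identityʳ n))
    }
    where
    none : ∀ e → ⁅ e ⁆ ⊑ Sub.⊥ → ⊥
    none e h = <-irrefl refl (slin 2 0 (λ e o → (# 1 ≼ ∥ e ∥) ⇒ (∥ e ∩′ ∁′ o ∥ ≼ # 0) ⇒ (∥ o ∥ ≼ # 0) ⇒ ⊢ (# 1 ≼ # 0)) ⁅ e ⁆ Sub.⊥ (≤-reflexive (sym (∣⁅⁆∣ e))) h (≤-reflexive (Subₚ.∣⊥∣≡0 m)))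
    flip : ∀ v w → ⁅ v ⁆ ⊑ ⁅ w ⁆ → ⁅ w ⁆ ⊑ ⁅ v ⁆
    flip v w h = subst (λ z → ⁅ w ⁆ ⊑ ⁅ z ⁆) (sym (point-≡ v w h)) (⊑-refl ⁅ w ⁆)

  components : ∀ A → Valid A → ∃[ Bs ] ∃[ δ ] Comp A Bs δ
  components A val = let (Bs , δ , _ , c) = extend-comp ∣ A ∩ ∁ Sub.⊥ ∣ refl (⊥⊑ A) val empty-comp in Bs , δ , c

  Spanning : Subset m → Set
  Spanning A = ∀ u v → Path A u v

  one-block : ∀ {A Bs δ} → 1 ≤ n → Spanning A → Comp A Bs δ → length Bs ≡ 1
  one-block {A} {[]} n≥1 sp c = ⊥-elim (0≢1 (Comp.part c (Fin.fromℕ< n≥1)))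
    where
    0≢1 : 0 ≡ 1 → ⊥
    0≢1 ()
  one-block {A} {B ∷ []} n≥1 sp c = refl
  one-block {A} {B ∷ C ∷ Bs} n≥1 sp c = ⊥-elim (pair-disjoint c {B} {C} {Bs} (here refl) w (closed-path c (here refl) hu (sp u w)) hw)
    where
    pu = point B (Comp.ne c B (here refl))
    u = proj₁ pu
    hu = proj₂ pu
    pw = point C (Comp.ne c C (there (here refl)))
    w = proj₁ pw
    hw = proj₂ pw

-- Spanning trees and the number of trees containing a forest

module _ {A : Set} (f : A → ℕ) where
  Π : List A → ℕ
  Π [] = 1
  Π (x ∷ xs) = f x * Π xs

  Π-sel : ∀ {xs : List A} {y r} → (y , r) ∈ sel xs → Π xs ≡ f y * Π r
  Π-sel {x ∷ xs} (here refl) = refl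
  Π-sel {x ∷ xs} (there p) with ∈-map⁻ (λ (y , r) → y , x ∷ r) p
  ... | (y , r) , q , refl = trans (cong (f x *_) (Π-sel q)) (a*bc≡b*ac (f x) (f y) (Π r))

  Π-pairs : ∀ {xs : List A} {y z r} → (y , z , r) ∈ pairs xs → Π xs ≡ f y * (f z * Π r)
  Π-pairs {x ∷ xs} p with ∈-++⁻ (List.map (λ (y , r) → x , y , r) (sel xs)) p
  ... | inj₁ p′ with ∈-map⁻ (λ (y , r) → x , y , r) p′
  ...   | (y , r) , q , refl = cong (f x *_) (Π-sel q)
  Π-pairs {x ∷ xs} p | inj₂ p′ with ∈-map⁻ (λ (y , z , r) → y , z , x ∷ r) p′
  ...   | (y , z , r) , q , refl = trans (cong (f x *_) (Π-pairs {xs} {y} {z} {r} q)) (trans (a*bc≡b*ac (f x) (f y) _) (cong (f y *_) (a*bc≡b*ac (f x) (f z) (Π r))))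

  Π≥1 : ∀ (xs : List A) → (∀ x → x ∈ xs → 1 ≤ f x) → 1 ≤ Π xs
  Π≥1 [] h = ≤-refl
  Π≥1 (x ∷ xs) h = *-mono-≤ (h x (here refl)) (Π≥1 xs (λ y m → h y (there m)))

module Trees (n : ℕ) (n≥1 : 1 ≤ n) where

  open Graphs n

  IsTree : Subset m → Set
  IsTree A = ∃[ B ] Comp A (B ∷ []) 0

  tree-spanning : ∀ {A} → IsTree A → Spanning A
  tree-spanning (B , c) u v = Comp.conn c B (here refl) u v (inB u) (inB v)
    where
    inB : ∀ w → w ∈ˢ B
    inB w with block c w
    ... | _ , here refl , h = h

  tree-size : ∀ {A} → IsTree A → ∣ A ∣ + 1 ≡ n
  tree-size (B , c) = trans (Comp.size c) (+-identityʳ n)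

  valid? : ∀ A → Dec (Valid A)
  valid? A with decAll′ (λ i → decAll′ (λ j → (⁅ Fin.combine i j ⁆ ⊑? A) →-dec (i Fin.<? j)) V) V
  ... | yes h = yes (λ i j → h i (∈elements i) j (∈elements j))
  ... | no ¬h = no (λ v → ¬h (λ i _ j _ → v i j))

  -- The certificate of a graph is not unique as data, but a connected graph has a single block, and
  -- then `size` fixes δ.
  tree-defect : ∀ {A} → IsTree A → ∀ {Bs δ} → Comp A Bs δ → length Bs ≡ 1 × δ ≡ 0
  tree-defect {A} tr {Bs} {δ} c = one , +-cancelˡ-≡ n δ 0 (trans (sym (Comp.size c)) (trans (cong (∣ A ∣ +_) one) (Comp.size (proj₂ tr))))
    where
    one : length Bs ≡ 1
    one = one-block n≥1 (tree-spanning tr) c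

  isTree? : ∀ A → Dec (IsTree A)
  isTree? A with valid? A
  ... | no ¬v = no (λ (B , c) → ¬v (Comp.valid c))
  ... | yes v with components A v
  ...   | [] , δ , c = no (λ t → 0≢1 (proj₁ (tree-defect t c)))
    where
    0≢1 : 0 ≡ 1 → ⊥
    0≢1 ()
  ...   | B ∷ C ∷ Bs , δ , c = no (λ t → absurd (proj₁ (tree-defect t c)))
    where
    absurd : suc (suc (length Bs)) ≡ 1 → ⊥
    absurd ()
  ...   | B ∷ [] , suc δ , c = no (λ t → absurd (proj₂ (tree-defect t c)))
    where
    absurd : suc δ ≡ 0 → ⊥
    absurd ()
  ...   | B ∷ [] , zero , c = yes (B , c)

  𝒯 : List (Subset m)
  𝒯 = List.deduplicate _≟ˢ_ (List.filter isTree? (subs m))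

  𝒯-unique : Unique 𝒯
  𝒯-unique = UniqueDec.deduplicate-! _≟ˢ_ _

  𝒯⇒ : ∀ {A} → A ∈ 𝒯 → IsTree A
  𝒯⇒ mA = proj₂ (∈-filter⁻ isTree? {xs = subs m} (Listₘ.∈-deduplicate⁻ _≟ˢ_ _ mA))

  ⇒𝒯 : ∀ {A} → IsTree A → A ∈ 𝒯
  ⇒𝒯 {A} t = Listₘ.∈-deduplicate⁺ _≟ˢ_ (∈-filter⁺ isTree? (∈subs A) t)

  N : Subset m → ℕ
  N = cnt 𝒯

  N≥1⇒ : ∀ X → 1 ≤ N X → ∃[ A ] (A ∈ 𝒯 × X ⊑ A)
  N≥1⇒ X h with Σ-pos 𝒯 h
  ... | A , mA , p = A , mA , 𝟙-inv (X ⊑? A) p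

  valid-sub : ∀ {X A} → X ⊑ A → Valid A → Valid X
  valid-sub {X} {A} le val i j h = val i j (⊑-trans ⁅ Fin.combine i j ⁆ X A h le)

  subforest : ∀ {X A} → IsTree A → X ⊑ A → ∃[ Bs ] Comp X Bs 0
  subforest {X} {A} t le =
    let (Bs , δ , c) = components X (valid-sub le (Comp.valid (proj₂ t)))
        (Bs′ , δ′ , le′ , c′) = extend-comp ∣ A ∩ ∁ X ∣ refl le (Comp.valid (proj₂ t)) c
    in Bs , subst (Comp X Bs) (n≤0⇒n≡0 (≤-trans le′ (≤-reflexive (proj₂ (tree-defect t c′))))) c

  -- Otherwise adding the edge to X would raise δ to 1, and `extend-comp` would carry this up to the
  -- tree A.
  no-inner : ∀ {X A Bs} → IsTree A → X ⊑ A → Comp X Bs 0 → ∀ {B u v} → B ∈ Bs → u ∈ˢ B → v ∈ˢ B → Adj A u v → Adj X u v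
  no-inner {X} {A} {Bs} t le c {B} {u} {v} mB hu hv a with point-∈ (code u v) X
  ... | inj₁ h = h
  ... | inj₂ new = ⊥-elim (1≰0 (≤-trans (proj₁ (proj₂ (proj₂ ext))) (≤-reflexive (proj₂ (tree-defect t (proj₂ (proj₂ (proj₂ ext))))))))
    where
    1≰0 : ¬ (1 ≤ 0)
    1≰0 ()
    le′ : X ∪ ⁅ code u v ⁆ ⊑ A
    le′ = slin 3 0 (λ x e a → (∥ x ∩′ ∁′ a ∥ ≼ # 0) ⇒ (∥ e ∩′ ∁′ a ∥ ≼ # 0) ⇒ ⊢ (∥ (x ∪′ e) ∩′ ∁′ a ∥ ≼ # 0)) X ⁅ code u v ⁆ A le a
    ext : ∃[ Bs′ ] ∃[ δ′ ] (1 ≤ δ′ × Comp A Bs′ δ′)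
    ext = extend-comp ∣ A ∩ ∁ (X ∪ ⁅ code u v ⁆) ∣ refl le′ (Comp.valid (proj₂ t)) (add-inner c {u} {v} {B} (Adj⇒≢ {A} {u} {v} (Comp.valid (proj₂ t)) a) mB hu hv new)

  Σpart : ∀ {X Bs δ} → Comp X Bs δ → (f : Fin n → ℕ) → Σ Bs (λ B → Σ V (λ v → 𝟙 (⁅ v ⁆ ⊑? B) * f v)) ≡ Σ V f
  Σpart {Bs = Bs} c f = trans (Σ-swap Bs V _) (Σ-cong V (λ v → trans (Σ-*ʳ Bs (f v) _) (trans (cong (_* f v) (Comp.part c v)) (*-identityˡ (f v)))))

  sizes-sum : ∀ {X Bs δ} → Comp X Bs δ → Σ Bs ∣_∣ ≡ n
  sizes-sum {Bs = Bs} c = trans (Σ-cong Bs (λ B → sym (trans (Σ-cong V (λ v → *-identityʳ _)) (Σ-elements B)))) (trans (Σpart c (λ _ → 1)) (trans (Σ-1 V) (Listₚ.length-tabulate id)))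

  between : (Fin n → Fin n → ℕ) → Subset n → Subset n → ℕ
  between f B C = Σ V (λ u → 𝟙 (⁅ u ⁆ ⊑? B) * Σ V (λ v → 𝟙 (⁅ v ⁆ ⊑? C) * f u v))

  between-total : ∀ {X Bs δ} → Comp X Bs δ → ∀ f → Σ Bs (λ B → Σ Bs (between f B)) ≡ Σ V (λ u → Σ V (f u))
  between-total {Bs = Bs} c f = trans (Σ-cong Bs (λ B → trans (Σ-swap Bs V _) (Σ-cong V (λ u → Σ-*ˡ Bs (𝟙 (⁅ u ⁆ ⊑? B)) _))))
    (trans (Σpart c (λ u → Σ Bs (λ C → Σ V (λ v → 𝟙 (⁅ v ⁆ ⊑? C) * f u v)))) (Σ-cong V (λ u → Σpart c (f u))))

  between-mono : ∀ f g B C → (∀ u v → u ∈ˢ B → v ∈ˢ C → f u v ≤ g u v) → between f B C ≤ between g B C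
  between-mono f g B C h = Σ-mono′ V (λ u → 𝟙*-mono (⁅ u ⁆ ⊑? B) (λ hu → Σ-mono′ V (λ v → 𝟙*-mono (⁅ v ⁆ ⊑? C) (λ hv → h u v hu hv))))

  between-const : ∀ k B C → between (λ _ _ → k) B C ≡ ∣ B ∣ * (∣ C ∣ * k)
  between-const k B C = trans (Σ-*ʳ V (Σ V (λ v → 𝟙 (⁅ v ⁆ ⊑? C) * k)) _) (cong₂ _*_ (Σ-elements B) (trans (Σ-*ʳ V k _) (cong (_* k) (Σ-elements C))))

  between-*ˡ : ∀ k f B C → between (λ u v → k * f u v) B C ≡ k * between f B C
  between-*ˡ k f B C = trans (Σ-cong V (λ u → trans (cong (𝟙 (⁅ u ⁆ ⊑? B) *_) (trans (Σ-cong V (λ v → a*bc≡b*ac (𝟙 (⁅ v ⁆ ⊑? C)) k (f u v))) (Σ-*ˡ V k _)))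
      (a*bc≡b*ac (𝟙 (⁅ u ⁆ ⊑? B)) k _))) (Σ-*ˡ V k _)

  between-sym : ∀ f → (∀ u v → f u v ≡ f v u) → ∀ B C → between f B C ≡ between f C B
  between-sym f s B C = trans (Σ-cong V (λ u → sym (Σ-*ˡ V (𝟙 (⁅ u ⁆ ⊑? B)) _)))
    (trans (Σ-swap V V _) (Σ-cong V (λ v → trans (Σ-cong V (λ u → trans (a*bc≡b*ac (𝟙 (⁅ u ⁆ ⊑? B)) (𝟙 (⁅ v ⁆ ⊑? C)) (f u v)) (cong (λ e → 𝟙 (⁅ v ⁆ ⊑? C) * (𝟙 (⁅ u ⁆ ⊑? B) * e)) (s u v)))) (Σ-*ˡ V (𝟙 (⁅ v ⁆ ⊑? C)) _))))

  between-Σ : ∀ {A : Set} (xs : List A) (f : A → Fin n → Fin n → ℕ) B C → between (λ u v → Σ xs (λ x → f x u v)) B C ≡ Σ xs (λ x → between (f x) B C)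
  between-Σ xs f B C = trans (Σ-cong V (λ u → trans (cong (𝟙 (⁅ u ⁆ ⊑? B) *_) (trans (Σ-cong V (λ v → sym (Σ-*ˡ xs (𝟙 (⁅ v ⁆ ⊑? C)) (λ x → f x u v)))) (Σ-swap V xs _))) (sym (Σ-*ˡ xs (𝟙 (⁅ u ⁆ ⊑? B)) _)))) (Σ-swap V xs _)

  Cross : Blocks → (Subset n → Subset n → ℕ) → ℕ
  Cross Bs f = Σ (pairs Bs) (λ (B , C , _) → f B C)

  -- Contracting the blocks of X turns A into a tree on them. The proof compares adjacency sums,
  -- which count each edge twice: by `no-inner`, A and X agree inside blocks, and X has nothing
  -- between them.
  crossing-edges : ∀ {X A Bs} → IsTree A → X ⊑ A → Comp X Bs 0 → suc (Cross Bs (between (adj A))) ≡ length Bs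
  crossing-edges {X} {A} {Bs} t le c = +-cancelˡ-≡ ∣ X ∣ _ _ (trans (trans (+-suc ∣ X ∣ E) (cong suc (trans (+-comm ∣ X ∣ E) E+X))) (trans (+-comm 1 ∣ A ∣) (trans (tree-size t) (trans (sym (+-identityʳ n)) (sym (Comp.size c))))))
    where
    E = Cross Bs (between (adj A))
    inner : ∀ Y → (adj Y ≡ adj Y) → ℕ
    inner Y _ = Σ Bs (λ B → between (adj Y) B B)
    sums : ∀ Y → Valid Y → Σ (pairs Bs) (λ (B , C , _) → between (adj Y) B C + between (adj Y) C B) + Σ Bs (λ B → between (adj Y) B B) ≡ ∣ Y ∣ + ∣ Y ∣
    sums Y val = trans (Σ-pairs Bs (between (adj Y))) (trans (between-total c (adj Y)) (Σ-adj Y val))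
    double′ : ∀ Y → Σ (pairs Bs) (λ (B , C , _) → between (adj Y) B C + between (adj Y) C B) ≡ Cross Bs (between (adj Y)) + Cross Bs (between (adj Y))
    double′ Y = trans (Σ-cong (pairs Bs) (λ (B , C , _) → cong (between (adj Y) B C +_) (between-sym (adj Y) (adj-sym Y) C B))) (Σ-+ (pairs Bs) _ _)
    same : ∀ B → B ∈ Bs → between (adj A) B B ≡ between (adj X) B B
    same B mB = ≤-antisym
      (between-mono (adj A) (adj X) B B (λ u v hu hv → 𝟙-mono (⁅ code u v ⁆ ⊑? A) (⁅ code u v ⁆ ⊑? X) (no-inner t le c {B} {u} {v} mB hu hv)))
      (between-mono (adj X) (adj A) B B (λ u v hu hv → 𝟙-mono (⁅ code u v ⁆ ⊑? X) (⁅ code u v ⁆ ⊑? A) (λ h → ⊑-trans ⁅ code u v ⁆ X A h le)))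
    Σ-cong-∈ : ∀ (xs : Blocks) (f g : Subset n → ℕ) → (∀ x → x ∈ xs → f x ≡ g x) → Σ xs f ≡ Σ xs g
    Σ-cong-∈ xs f g h = ≤-antisym (Σ-mono xs (λ x mx → ≤-reflexive (h x mx))) (Σ-mono xs (λ x mx → ≤-reflexive (sym (h x mx))))
    X-cross : Cross Bs (between (adj X)) ≡ 0
    X-cross = n≤0⇒n≡0 (≤-trans (Σ-≤const (pairs Bs) 0 (λ (B , C , r) p → ≤-trans (between-mono (adj X) (λ _ _ → 0) B C (λ u v hu hv → ≤-reflexive (𝟙-no (⁅ code u v ⁆ ⊑? X) (λ h →
        pair-disjoint c {B} {C} {r} p v (Comp.closed c B (proj₁ (pairs-spec {xs = Bs} {B} {C} {r} p)) u v hu h) hv)))) (≤-reflexive (trans (between-const 0 B C) (trans (cong (∣ B ∣ *_) (*-zeroʳ ∣ C ∣)) (*-zeroʳ ∣ B ∣)))))) (≤-reflexive (*-zeroʳ (length (pairs Bs)))))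
    D = Σ Bs (λ B → between (adj X) B B)
    2X : D ≡ ∣ X ∣ + ∣ X ∣
    2X = trans (cong (λ e → e + e + D) (sym X-cross)) (trans (cong (_+ D) (sym (double′ X))) (sums X (Comp.valid c)))
    2A : E + E + (∣ X ∣ + ∣ X ∣) ≡ ∣ A ∣ + ∣ A ∣
    2A = trans (cong (E + E +_) (trans (sym 2X) (sym (Σ-cong-∈ Bs _ _ same)))) (trans (cong (_+ Σ Bs (λ B → between (adj A) B B)) (sym (double′ A))) (sums A (Comp.valid (proj₂ t))))
    halve : ∀ a b → a + a ≡ b + b → a ≡ b
    halve a b e = *-cancelˡ-≡ a b 2 (trans (cong (a +_) (+-identityʳ a)) (trans e (cong (b +_) (sym (+-identityʳ b)))))
    E+X : E + ∣ X ∣ ≡ ∣ A ∣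
    E+X = halve _ _ (trans (interchange E (∣ X ∣) E (∣ X ∣)) 2A)

  -- Trees above Y that use edges of B₀ only inside Y. For empty B₀ this is `N Y`, so Moon's formula
  -- and the lower bound for avoiding trees share one recursion.
  avoiding : Subset m → Subset m → ℕ
  avoiding B₀ Y = Σ 𝒯 (λ A → 𝟙 (Y ⊑? A) * 𝟙 ((A ∩ B₀) ⊑? Y))

  private
    per-tree : ∀ B₀ {X Bs} → Comp X Bs 0 → ∀ {B C r} → (B , C , r) ∈ pairs Bs → ∀ A u v → u ∈ˢ B → v ∈ˢ C →
      𝟙 (¬? (⁅ code u v ⁆ ⊑? B₀)) * (𝟙 ((X ∪ ⁅ code u v ⁆) ⊑? A) * 𝟙 ((A ∩ B₀) ⊑? (X ∪ ⁅ code u v ⁆))) ≡ 𝟙 (X ⊑? A) * 𝟙 ((A ∩ B₀) ⊑? X) * adj A u v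
    per-tree B₀ {X} {Bs} c {B} {C} {r} p A u v hu hv = ≤-antisym fwd bwd
      where
      e = ⁅ code u v ⁆
      new : ∣ e ∩ X ∣ ≤ 0
      new = proj₁ (proj₂ (merge c {u} {v} {B} {C} {r} p hu hv))
      fwd : 𝟙 (¬? (e ⊑? B₀)) * (𝟙 ((X ∪ e) ⊑? A) * 𝟙 ((A ∩ B₀) ⊑? (X ∪ e))) ≤ 𝟙 (X ⊑? A) * 𝟙 ((A ∩ B₀) ⊑? X) * adj A u v
      fwd = 𝟙*-≤ (¬? (e ⊑? B₀)) λ ∉B → 𝟙*-≤ ((X ∪ e) ⊑? A) λ le → 𝟙-if ((A ∩ B₀) ⊑? (X ∪ e)) λ av →
        *-mono-≤ (*-mono-≤ (𝟙-yes (X ⊑? A) (slin 3 0 (λ x e a → (∥ (x ∪′ e) ∩′ ∁′ a ∥ ≼ # 0) ⇒ ⊢ (∥ x ∩′ ∁′ a ∥ ≼ # 0)) X e A le))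
          (𝟙-yes ((A ∩ B₀) ⊑? X) (slin 4 0 (λ a b x e → (∥ (a ∩′ b) ∩′ ∁′ (x ∪′ e) ∥ ≼ # 0) ⇒ (∥ e ∥ ≼ # 1) ⇒ (# 1 ≼ ∥ e ∩′ ∁′ b ∥) ⇒ ⊢ (∥ (a ∩′ b) ∩′ ∁′ x ∥ ≼ # 0)) A B₀ X e av (≤-reflexive (∣⁅⁆∣ (code u v))) (≰⇒> ∉B))))
          (𝟙-yes (e ⊑? A) (slin 3 0 (λ x e a → (∥ (x ∪′ e) ∩′ ∁′ a ∥ ≼ # 0) ⇒ ⊢ (∥ e ∩′ ∁′ a ∥ ≼ # 0)) X e A le))
      bwd : 𝟙 (X ⊑? A) * 𝟙 ((A ∩ B₀) ⊑? X) * adj A u v ≤ 𝟙 (¬? (e ⊑? B₀)) * (𝟙 ((X ∪ e) ⊑? A) * 𝟙 ((A ∩ B₀) ⊑? (X ∪ e)))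
      bwd = ≤-trans (≤-reflexive (*-assoc (𝟙 (X ⊑? A)) _ _)) (𝟙*-≤ (X ⊑? A) λ le → 𝟙*-≤ ((A ∩ B₀) ⊑? X) λ av → 𝟙-if (e ⊑? A) λ ea →
        *-mono-≤ (𝟙-yes (¬? (e ⊑? B₀)) (λ eb → <-irrefl refl (slin 4 0 (λ a b x e → (∥ (a ∩′ b) ∩′ ∁′ x ∥ ≼ # 0) ⇒ (# 1 ≼ ∥ e ∥) ⇒ (∥ e ∩′ ∁′ a ∥ ≼ # 0) ⇒ (∥ e ∩′ ∁′ b ∥ ≼ # 0) ⇒ (∥ e ∩′ x ∥ ≼ # 0) ⇒ ⊢ (# 1 ≼ # 0)) A B₀ X e av (≤-reflexive (sym (∣⁅⁆∣ (code u v)))) ea eb new)))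
          (*-mono-≤ (𝟙-yes ((X ∪ e) ⊑? A) (slin 3 0 (λ x e a → (∥ x ∩′ ∁′ a ∥ ≼ # 0) ⇒ (∥ e ∩′ ∁′ a ∥ ≼ # 0) ⇒ ⊢ (∥ (x ∪′ e) ∩′ ∁′ a ∥ ≼ # 0)) X e A le ea))
            (𝟙-yes ((A ∩ B₀) ⊑? (X ∪ e)) (slin 3 0 (λ s x e → (∥ s ∩′ ∁′ x ∥ ≼ # 0) ⇒ ⊢ (∥ s ∩′ ∁′ (x ∪′ e) ∥ ≼ # 0)) (A ∩ B₀) X e av))))

  -- Double counting of the pairs (tree counted for X, one of its edges outside X).
  double-count : ∀ B₀ {X Bs} → Comp X Bs 0 →
    Cross Bs (between (λ u v → 𝟙 (¬? (⁅ code u v ⁆ ⊑? B₀)) * avoiding B₀ (X ∪ ⁅ code u v ⁆))) + avoiding B₀ X ≡ length Bs * avoiding B₀ X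
  double-count B₀ {X} {Bs} c = begin
      Cross Bs (between F) + avoiding B₀ X ≡⟨ cong (_+ avoiding B₀ X) step₁ ⟩
      Σ 𝒯 (λ A → g A * Cross Bs (between (adj A))) + avoiding B₀ X ≡⟨ sym (Σ-+ 𝒯 _ g) ⟩
      Σ 𝒯 (λ A → g A * Cross Bs (between (adj A)) + g A) ≡⟨ ≤-antisym (Σ-mono 𝒯 (λ A mA → ≤-reflexive (each A mA))) (Σ-mono 𝒯 (λ A mA → ≤-reflexive (sym (each A mA)))) ⟩
      Σ 𝒯 (λ A → length Bs * g A) ≡⟨ Σ-*ˡ 𝒯 (length Bs) g ⟩
      length Bs * avoiding B₀ X ∎
    where
    open ≡-Reasoning
    g : Subset m → ℕ
    g A = 𝟙 (X ⊑? A) * 𝟙 ((A ∩ B₀) ⊑? X)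
    F : Fin n → Fin n → ℕ
    F u v = 𝟙 (¬? (⁅ code u v ⁆ ⊑? B₀)) * avoiding B₀ (X ∪ ⁅ code u v ⁆)
    each : ∀ A → A ∈ 𝒯 → g A * Cross Bs (between (adj A)) + g A ≡ length Bs * g A
    each A mA with X ⊑? A
    ... | no _ = sym (*-zeroʳ (length Bs))
    ... | yes le = trans (lem (1 * 𝟙 ((A ∩ B₀) ⊑? X)) (Cross Bs (between (adj A)))) (cong (_* (1 * 𝟙 ((A ∩ B₀) ⊑? X))) (crossing-edges (𝒯⇒ mA) le c))
      where
      lem : ∀ g x → g * x + g ≡ suc x * g
      lem = solve-∀
    cell : ∀ B C r → (B , C , r) ∈ pairs Bs → between F B C ≡ Σ 𝒯 (λ A → g A * between (adj A) B C)
    cell B C r p = trans (≤-antisym (between-mono F G B C (λ u v hu hv → ≤-reflexive (pt′ u v hu hv))) (between-mono G F B C (λ u v hu hv → ≤-reflexive (sym (pt′ u v hu hv)))))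
        (trans (between-Σ 𝒯 (λ A u v → g A * adj A u v) B C) (Σ-cong 𝒯 (λ A → between-*ˡ (g A) (adj A) B C)))
      where
      G : Fin n → Fin n → ℕ
      G u v = Σ 𝒯 (λ A → g A * adj A u v)
      pt′ : ∀ u v → u ∈ˢ B → v ∈ˢ C → F u v ≡ G u v
      pt′ u v hu hv = trans (sym (Σ-*ˡ 𝒯 (𝟙 (¬? (⁅ code u v ⁆ ⊑? B₀))) _)) (Σ-cong 𝒯 (λ A → per-tree B₀ c {B} {C} {r} p A u v hu hv))
    step₁ : Cross Bs (between F) ≡ Σ 𝒯 (λ A → g A * Cross Bs (between (adj A)))
    step₁ = trans (≤-antisym (Σ-mono (pairs Bs) (λ (B , C , r) p → ≤-reflexive (cell B C r p))) (Σ-mono (pairs Bs) (λ (B , C , r) p → ≤-reflexive (sym (cell B C r p)))))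
      (trans (Σ-swap (pairs Bs) 𝒯 _) (Σ-cong 𝒯 (λ A → Σ-*ˡ (pairs Bs) (g A) _)))

  P : Blocks → ℕ
  P = Π ∣_∣

  Cross-sizes : ∀ {X Bs δ} → Comp X Bs δ → Cross Bs (λ B C → ∣ B ∣ + ∣ C ∣) + n ≡ length Bs * n
  Cross-sizes {Bs = Bs} c = trans (cong (Cross Bs (λ B C → ∣ B ∣ + ∣ C ∣) +_) (sym (sizes-sum c))) (trans (Σ-pairs Bs (λ B _ → ∣ B ∣))
    (trans (Σ-cong Bs (λ B → Σ-const Bs ∣ B ∣)) (trans (Σ-*ˡ Bs (length Bs) ∣_∣) (cong (length Bs *_) (sizes-sum c)))))

  -- All |B| |C| possible edges between two blocks lead to the same product of block sizes, so
  -- summing over them cancels the factor |B| |C| and leaves |B| + |C|.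
  merged-P : ∀ {X Bs δ} → Comp X Bs δ → ∀ {B C r} → (B , C , r) ∈ pairs Bs → ∣ B ∣ * (∣ C ∣ * P ((B ∪ C) ∷ r)) ≡ (∣ B ∣ + ∣ C ∣) * P Bs
  merged-P {Bs = Bs} c {B} {C} {r} p = trans (cong (λ s → ∣ B ∣ * (∣ C ∣ * (s * P r))) union) (trans (lem ∣ B ∣ ∣ C ∣ (∣ B ∣ + ∣ C ∣) (P r)) (cong ((∣ B ∣ + ∣ C ∣) *_) (sym (Π-pairs ∣_∣ {Bs} {B} {C} {r} p))))
    where
    lem : ∀ b c s r → b * (c * (s * r)) ≡ s * (b * (c * r))
    lem = solve-∀
    union : ∣ B ∪ C ∣ ≡ ∣ B ∣ + ∣ C ∣
    union = ≤-antisym (slin 2 0 (λ b c → ⊢ (∥ b ∪′ c ∥ ≼ ∥ b ∥ ⊹ ∥ c ∥)) B C)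
      (slin 2 0 (λ b c → (∥ b ∩′ c ∥ ≼ # 0) ⇒ ⊢ (∥ b ∥ ⊹ ∥ c ∥ ≼ ∥ b ∪′ c ∥)) B C (pair-disjointˢ c {B} {C} {r} p))

  merged-P≤ : ∀ {X Bs δ} → Comp X Bs δ → ∀ {B C r} → (B , C , r) ∈ pairs Bs → P ((B ∪ C) ∷ r) ≤ 2 * P Bs
  merged-P≤ {Bs = Bs} c {B} {C} {r} p = ≤-trans (*-monoˡ-≤ (P r) (slin 2 0 (λ b c → ⊢ (∥ b ∪′ c ∥ ≼ ∥ b ∥ ⊹ ∥ c ∥)) B C))
      (≤-trans (*-monoˡ-≤ (P r) (sum≤2prod ∣ B ∣ ∣ C ∣ (Comp.ne c B (proj₁ (pairs-spec {xs = Bs} {B} {C} {r} p))) (Comp.ne c C (proj₁ (proj₂ (pairs-spec {xs = Bs} {B} {C} {r} p))))))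
        (≤-reflexive (trans (lem ∣ B ∣ ∣ C ∣ (P r)) (cong (2 *_) (sym (Π-pairs ∣_∣ {Bs} {B} {C} {r} p))))))
    where
    lem : ∀ b c r → 2 * (b * c) * r ≡ 2 * (b * (c * r))
    lem = solve-∀
    sum≤2prod : ∀ a b → 1 ≤ a → 1 ≤ b → a + b ≤ 2 * (a * b)
    sum≤2prod (suc a) (suc b) _ _ = lin 3 (λ a b p → ⊢ ((# 1 ⊹ a) ⊹ (# 1 ⊹ b) ≼ 2 ⋆ (# 1 ⊹ b ⊹ (a ⊹ p)))) a b (a * b) ∙ lem′ a b
      where
      lem′ : ∀ a b → 2 * (1 + b + (a + a * b)) ≡ 2 * (suc a * suc b)
      lem′ = solve-∀
      _∙_ : ∀ {x y z} → x ≤ y → y ≡ z → x ≤ z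
      h ∙ refl = h

  -- Moon's formula a₁ ⋯ a_k n^(k-2), by induction on k through double-count.
  forest-count : ∀ k {X Bs} → Comp X Bs 0 → length Bs ≡ suc k → N X * n ≡ P Bs * n ^ k
  forest-count zero {X} {B ∷ []} c e = trans (cong (_* n) one) (trans (*-identityˡ n) (sym (trans (*-identityʳ (P (B ∷ []))) (sizes-sum′))))
    where
    sizes-sum′ : ∣ B ∣ * 1 ≡ n
    sizes-sum′ = trans (*-identityʳ _) (trans (sym (+-identityʳ _)) (sizes-sum c))
    tX : IsTree X
    tX = B , c
    one : N X ≡ 1
    one = ≤-antisym
      (≤-trans (Σ-mono 𝒯 (λ A mA → 𝟙-mono (X ⊑? A) (A ≟ˢ X) (λ le → ⊑-antisym
        (slin 2 0 (λ x a → (∥ a ∥ ≼ ∥ x ∥) ⇒ (∥ x ∩′ ∁′ a ∥ ≼ # 0) ⇒ ⊢ (∥ a ∩′ ∁′ x ∥ ≼ # 0)) X A (+-cancelʳ-≤ 1 _ _ (≤-reflexive (trans (tree-size (𝒯⇒ mA)) (sym (tree-size tX))))) le) le))) (Σ-≟ 𝒯-unique X))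
      (≤-trans (𝟙-yes (X ⊑? X) (⊑-refl X)) (Σ-member (λ A → 𝟙 (X ⊑? A)) (⇒𝒯 tX)))
  forest-count (suc k) {X} {Bs} c e = *-cancelˡ-≡ _ _ (suc k) (+-cancelʳ-≡ (N X * n) _ _ (begin
      suc k * (N X * n) + N X * n ≡⟨ lem₁ k (N X) n ⟩
      suc (suc k) * N X * n ≡⟨ cong (λ l → l * N X * n) (sym e) ⟩
      length Bs * N X * n ≡⟨ cong (_* n) (trans (cong (length Bs *_) (sym (N≡ X))) (sym (double-count Sub.⊥ c))) ⟩
      (Cross Bs (between F) + avoiding Sub.⊥ X) * n ≡⟨ trans (*-distribʳ-+ n (Cross Bs (between F)) _) (cong₂ _+_ cross (cong (_* n) (N≡ X))) ⟩
      suc k * (P Bs * n ^ suc k) + N X * n ∎))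
    where
    open ≡-Reasoning
    lem₁ : ∀ k N n → suc k * (N * n) + N * n ≡ suc (suc k) * N * n
    lem₁ = solve-∀
    N≡ : ∀ Y → avoiding Sub.⊥ Y ≡ N Y
    N≡ Y = Σ-cong 𝒯 (λ A → trans (cong (𝟙 (Y ⊑? A) *_) (≤-antisym (𝟙≤1 ((A ∩ Sub.⊥) ⊑? Y)) (𝟙-yes ((A ∩ Sub.⊥) ⊑? Y)
      (slin 3 0 (λ a o y → (∥ o ∥ ≼ # 0) ⇒ ⊢ (∥ (a ∩′ o) ∩′ ∁′ y ∥ ≼ # 0)) A Sub.⊥ Y (≤-reflexive (Subₚ.∣⊥∣≡0 m)))))) (*-identityʳ _))
    F : Fin n → Fin n → ℕ
    F u v = 𝟙 (¬? (⁅ code u v ⁆ ⊑? Sub.⊥)) * avoiding Sub.⊥ (X ∪ ⁅ code u v ⁆)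
    F≡ : ∀ B C r → (B , C , r) ∈ pairs Bs → ∀ u v → u ∈ˢ B → v ∈ˢ C → F u v * n ≡ P ((B ∪ C) ∷ r) * n ^ k
    F≡ B C r p u v hu hv = trans (cong (_* n) (trans (cong (_* avoiding Sub.⊥ (X ∪ ⁅ code u v ⁆)) not⊥) (trans (*-identityˡ _) (N≡ (X ∪ ⁅ code u v ⁆)))))
        (forest-count k (proj₁ (merge c {u} {v} {B} {C} {r} p hu hv)) (suc-injective (trans (sym (proj₂ (proj₂ (proj₂ (proj₂ (pairs-spec {xs = Bs} {B} {C} {r} p)))))) e)))
      where
      not⊥ : 𝟙 (¬? (⁅ code u v ⁆ ⊑? Sub.⊥)) ≡ 1
      not⊥ = ≤-antisym (𝟙≤1 (¬? (⁅ code u v ⁆ ⊑? Sub.⊥))) (𝟙-yes (¬? (⁅ code u v ⁆ ⊑? Sub.⊥)) (λ h →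
        <-irrefl refl (slin 2 0 (λ e o → (# 1 ≼ ∥ e ∥) ⇒ (∥ e ∩′ ∁′ o ∥ ≼ # 0) ⇒ (∥ o ∥ ≼ # 0) ⇒ ⊢ (# 1 ≼ # 0)) ⁅ code u v ⁆ Sub.⊥ (≤-reflexive (sym (∣⁅⁆∣ (code u v)))) h (≤-reflexive (Subₚ.∣⊥∣≡0 m)))))
    cell : ∀ B C r → (B , C , r) ∈ pairs Bs → between F B C * n ≡ (∣ B ∣ + ∣ C ∣) * (P Bs * n ^ k)
    cell B C r p = begin
      between F B C * n ≡⟨ trans (*-comm _ n) (sym (between-*ˡ n F B C)) ⟩
      between (λ u v → n * F u v) B C ≡⟨ ≤-antisym (between-mono _ _ B C (λ u v hu hv → ≤-reflexive (eq u v hu hv))) (between-mono _ _ B C (λ u v hu hv → ≤-reflexive (sym (eq u v hu hv)))) ⟩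
      between (λ _ _ → P ((B ∪ C) ∷ r) * n ^ k) B C ≡⟨ between-const (P ((B ∪ C) ∷ r) * n ^ k) B C ⟩
      ∣ B ∣ * (∣ C ∣ * (P ((B ∪ C) ∷ r) * n ^ k)) ≡⟨ lem₂ ∣ B ∣ ∣ C ∣ (P ((B ∪ C) ∷ r)) (n ^ k) ⟩
      ∣ B ∣ * (∣ C ∣ * P ((B ∪ C) ∷ r)) * n ^ k ≡⟨ cong (_* n ^ k) (merged-P c {B} {C} {r} p) ⟩
      (∣ B ∣ + ∣ C ∣) * P Bs * n ^ k ≡⟨ *-assoc (∣ B ∣ + ∣ C ∣) (P Bs) (n ^ k) ⟩
      (∣ B ∣ + ∣ C ∣) * (P Bs * n ^ k) ∎
      where
      lem₂ : ∀ b c p q → b * (c * (p * q)) ≡ b * (c * p) * q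
      lem₂ = solve-∀
      eq : ∀ u v → u ∈ˢ B → v ∈ˢ C → n * F u v ≡ P ((B ∪ C) ∷ r) * n ^ k
      eq u v hu hv = trans (*-comm n (F u v)) (F≡ B C r p u v hu hv)
    cross : Cross Bs (between F) * n ≡ suc k * (P Bs * n ^ suc k)
    cross = begin
      Cross Bs (between F) * n ≡⟨ sym (Σ-*ʳ (pairs Bs) n _) ⟩
      Σ (pairs Bs) (λ (B , C , _) → between F B C * n) ≡⟨ ≤-antisym (Σ-mono (pairs Bs) (λ (B , C , r) p → ≤-reflexive (cell B C r p))) (Σ-mono (pairs Bs) (λ (B , C , r) p → ≤-reflexive (sym (cell B C r p)))) ⟩
      Σ (pairs Bs) (λ (B , C , _) → (∣ B ∣ + ∣ C ∣) * (P Bs * n ^ k)) ≡⟨ Σ-*ʳ (pairs Bs) (P Bs * n ^ k) _ ⟩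
      Cross Bs (λ B C → ∣ B ∣ + ∣ C ∣) * (P Bs * n ^ k) ≡⟨ cong (_* (P Bs * n ^ k)) (+-cancelʳ-≡ n _ (suc k * n) (trans (Cross-sizes c) (trans (cong (_* n) e) (+-comm n (suc k * n))))) ⟩
      suc k * n * (P Bs * n ^ k) ≡⟨ lem₃ k n (P Bs) (n ^ k) ⟩
      suc k * (P Bs * n ^ suc k) ∎
      where
      lem₃ : ∀ k n p q → suc k * n * (p * q) ≡ suc k * (p * (n * q))
      lem₃ = solve-∀

-- Products of positive parts with prescribed sum

record Parts (n ℓ : ℕ) (xs : List ℕ) : Set where
  field
    len : length xs ≡ ℓ
    pos : ∀ x → x ∈ xs → 1 ≤ x
    tot : Σ xs id ≡ n

module _ {n : ℕ} where
  replace-part : ∀ {ℓ xs a r} → Parts n ℓ xs → (a , r) ∈ sel xs → ∀ b c → 1 ≤ b → 1 ≤ c → b + c ≡ a → Parts n (suc ℓ) (b ∷ c ∷ r)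
  replace-part {ℓ} {xs} {a} {r} p s b c b≥1 c≥1 e = record
    { len = cong suc (trans (sym (proj₂ (proj₂ (proj₂ (sel-spec s))))) (Parts.len p))
    ; pos = λ { x (here refl) → b≥1 ; x (there (here refl)) → c≥1 ; x (there (there mx)) → Parts.pos p x (proj₁ (proj₂ (sel-spec s)) x mx) }
    ; tot = trans (sym (+-assoc b c (Σ r id))) (trans (cong (_+ Σ r id) e) (trans (sym (proj₁ (proj₂ (proj₂ (sel-spec s))) id)) (Parts.tot p)))
    }

  bounded : ∀ (xs : List ℕ) a → (∀ x → x ∈ xs → x ≤ a) → Σ xs id ≤ length xs * a
  bounded xs a h = Σ-≤const xs a h

  largest : ∀ {ℓ xs} → Parts n ℓ xs → 1 ≤ n → ∃[ a ] (a ∈ xs × (∀ x → x ∈ xs → x ≤ a))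
  largest {xs = []} p n≥1 = ⊥-elim (<-irrefl refl (≤-trans n≥1 (≤-reflexive (sym (Parts.tot p)))))
  largest {xs = x ∷ xs} p n≥1 = argmax id x xs

  -- The largest part is at least the average n / ℓ.
  largest-bound : ∀ {ℓ xs} d a → Parts n ℓ xs → ℓ + d ≡ n → (∀ x → x ∈ xs → x ≤ suc a) → suc a * d ≤ n * a
  largest-bound {ℓ} {xs} d a p e h = +-cancelʳ-≤ n _ _ (begin
      suc a * d + n ≤⟨ +-monoʳ-≤ (suc a * d) n≤ ⟩
      suc a * d + suc a * ℓ ≡⟨ trans (sym (*-distribˡ-+ (suc a) d ℓ)) (cong (suc a *_) (trans (+-comm d ℓ) e)) ⟩
      suc a * n ≡⟨ lem a n ⟩
      n * a + n ∎)
    where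
    open ≤-Reasoning
    lem : ∀ a n → suc a * n ≡ n * a + n
    lem = solve-∀
    n≤ : n ≤ suc a * ℓ
    n≤ = begin
      n ≡⟨ sym (Parts.tot p) ⟩
      Σ xs id ≤⟨ bounded xs (suc a) h ⟩
      length xs * suc a ≡⟨ trans (cong (_* suc a) (Parts.len p)) (*-comm ℓ (suc a)) ⟩
      suc a * ℓ ∎

  -- Splitting 1 off a largest part a changes the product by (a - 1) / a, which is at least d / n by
  -- `largest-bound` and at least 1 / 2 in any case.
  split-part : ∀ {ℓ xs} d → Parts n ℓ xs → 1 ≤ n → 1 ≤ d → ℓ + d ≡ n →
               ∃[ ys ] (Parts n (suc ℓ) ys × Π id xs * d ≤ n * Π id ys × Π id xs ≤ 2 * Π id ys)
  split-part {ℓ} {xs} d p n≥1 d≥1 e with largest p n≥1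
  ... | zero , ma , h = ⊥-elim (<-irrefl refl (≤-trans (Parts.pos p 0 ma) ≤-refl))
  ... | suc zero , ma , h = ⊥-elim (<-irrefl refl (≤-trans d≥1 (≤-trans (≤-reflexive (sym (*-identityˡ d))) (≤-trans (largest-bound d 0 p e h) (≤-reflexive (*-zeroʳ n))))))
  ... | suc (suc a) , ma , h = let (r , s) = sel-complete ma in
      1 ∷ suc a ∷ r , replace-part p s 1 (suc a) (s≤s z≤n) (s≤s z≤n) refl
      , ≤-trans (≤-reflexive (cong (_* d) (Π-sel id s))) (≤-trans (≤-reflexive (lem₁ (suc (suc a)) (Π id r) d)) (≤-trans (*-monoˡ-≤ (Π id r) (largest-bound d (suc a) p e h)) (≤-reflexive (lem₂ n (suc a) (Π id r)))))
      , ≤-trans (≤-reflexive (Π-sel id s)) (≤-trans (*-monoˡ-≤ (Π id r) (lin 1 (λ a → ⊢ (# 2 ⊹ a ≼ 2 ⋆ (# 1 ⊹ a))) a)) (≤-reflexive (lem₃ (suc a) (Π id r))))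
    where
    lem₁ : ∀ a r d → a * r * d ≡ a * d * r
    lem₁ = solve-∀
    lem₂ : ∀ n a r → n * a * r ≡ n * (1 * (a * r))
    lem₂ = solve-∀
    lem₃ : ∀ a r → 2 * a * r ≡ 2 * (1 * (a * r))
    lem₃ = solve-∀

  -- The y splittings with loss 2 come first. During the last x the excess d runs through t + x,
  -- ..., t + 1, whose product is `rising t x`.
  split-parts : ∀ x y {t k ℓ xs} → t + k ≡ n → 1 ≤ n → Parts n ℓ xs → ℓ + (x + y) ≡ k →
                ∃[ ys ] (Parts n k ys × Π id xs * rising t x ≤ n ^ x * (2 ^ y * Π id ys))
  split-parts zero zero {xs = xs} tk n≥1 p e = xs , subst (λ k → Parts n k xs) (trans (sym (+-identityʳ _)) e) p
      , ≤-reflexive (lem (Π id xs))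
    where
    lem : ∀ a → a * 1 ≡ 1 * (1 * a)
    lem = solve-∀
  split-parts (suc x) zero {t} {k} {ℓ} {xs} tk n≥1 p e =
      let (ys , p₁ , a , _) = split-part (t + suc x) p n≥1 (≤-trans (s≤s z≤n) (m≤n+m (suc x) t)) (trans (lem₁ ℓ t x) (trans (cong (t +_) e) tk))
          (zs , p₂ , b) = split-parts x zero {t} {k} tk n≥1 p₁ (trans (sym (+-suc ℓ (x + 0))) e)
      in zs , p₂ , (begin
        Π id xs * (rising t x * (t + suc x)) ≡⟨ lem₂ (Π id xs) (rising t x) (t + suc x) ⟩
        Π id xs * (t + suc x) * rising t x ≤⟨ *-monoˡ-≤ (rising t x) a ⟩
        n * Π id ys * rising t x ≡⟨ *-assoc n (Π id ys) _ ⟩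
        n * (Π id ys * rising t x) ≤⟨ *-monoʳ-≤ n b ⟩
        n * (n ^ x * (1 * Π id zs)) ≡⟨ sym (*-assoc n (n ^ x) _) ⟩
        n * n ^ x * (1 * Π id zs) ∎)
    where
    open ≤-Reasoning
    lem₁ : ∀ ℓ t x → ℓ + (t + suc x) ≡ t + (ℓ + (suc x + 0))
    lem₁ = solve-∀
    lem₂ : ∀ a b c → a * (b * c) ≡ a * c * b
    lem₂ = solve-∀
  split-parts x (suc y) {t} {k} {ℓ} {xs} tk n≥1 p e =
      let (ys , p₁ , _ , a) = split-part (t + (x + suc y)) p n≥1 (≤-trans (s≤s z≤n) (≤-trans (m≤n+m (suc y) x) (m≤n+m (x + suc y) t))) (trans (lem₁ ℓ t x y) (trans (cong (t +_) e) tk))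
          (zs , p₂ , b) = split-parts x y {t} {k} tk n≥1 p₁ (trans (lem₃ ℓ x y) e)
      in zs , p₂ , (begin
        Π id xs * rising t x ≤⟨ *-monoˡ-≤ (rising t x) a ⟩
        2 * Π id ys * rising t x ≡⟨ *-assoc 2 (Π id ys) _ ⟩
        2 * (Π id ys * rising t x) ≤⟨ *-monoʳ-≤ 2 b ⟩
        2 * (n ^ x * (2 ^ y * Π id zs)) ≡⟨ lem₂ (n ^ x) (2 ^ y) (Π id zs) ⟩
        n ^ x * (2 * 2 ^ y * Π id zs) ∎)
    where
    open ≤-Reasoning
    lem₁ : ∀ ℓ t x y → ℓ + (t + (x + suc y)) ≡ t + (ℓ + (x + suc y))
    lem₁ = solve-∀
    lem₂ : ∀ a b c → 2 * (a * (b * c)) ≡ a * (2 * b * c)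
    lem₂ = solve-∀
    lem₃ : ∀ ℓ x y → suc ℓ + (x + y) ≡ ℓ + (x + suc y)
    lem₃ = solve-∀

  -- If some part exceeds 2, an extra part can be created at a gain of 6/5 over split-part.
  split-large : ∀ {ℓ xs} d → Parts n ℓ xs → 9 ≤ n → ℓ + d ≡ n → ∃[ x ] (x ∈ xs × 3 ≤ x) →
                ∃[ ys ] (Parts n (suc ℓ) ys × Π id xs * (6 * d) ≤ 5 * (n * Π id ys))
  split-large {ℓ} {xs} d p n≥9 e (x₀ , mx₀ , x₀≥3) with largest p (≤-trans (s≤s z≤n) n≥9)
  ... | 0 , ma , h = ⊥-elim (<-irrefl refl (≤-trans (s≤s z≤n) (≤-trans x₀≥3 (h x₀ mx₀))))
  ... | 1 , ma , h = ⊥-elim (<-irrefl refl (≤-trans (s≤s (s≤s z≤n)) (≤-trans x₀≥3 (h x₀ mx₀))))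
  ... | 2 , ma , h = ⊥-elim (<-irrefl refl (≤-trans x₀≥3 (h x₀ mx₀)))
  -- A largest part of at least 4 loses 2 instead of 1.
  ... | suc (suc (suc (suc a))) , ma , h = let (r , s) = sel-complete ma in
      2 ∷ suc (suc a) ∷ r , replace-part p s 2 (suc (suc a)) (s≤s z≤n) (s≤s z≤n) refl , (begin
        Π id xs * (6 * d) ≡⟨ cong (_* (6 * d)) (Π-sel id s) ⟩
        (4 + a) * Π id r * (6 * d) ≡⟨ lem₁ (4 + a) (Π id r) d ⟩
        6 * ((4 + a) * d) * Π id r ≤⟨ *-monoˡ-≤ (Π id r) (*-monoʳ-≤ 6 (largest-bound d (3 + a) p e h)) ⟩
        6 * (n * (3 + a)) * Π id r ≤⟨ *-monoˡ-≤ (Π id r) (lin 3 (λ n na x → ⊢ (18 ⋆ n ⊹ 6 ⋆ na ≼ 20 ⋆ n ⊹ 10 ⋆ na)) n (n * a) 0 ⟨≡⟩ (lem₂ n a , lem₃ n a)) ⟩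
        5 * (n * (2 * (2 + a))) * Π id r ≡⟨ lem₄ n (2 + a) (Π id r) ⟩
        5 * (n * (2 * ((2 + a) * Π id r))) ∎)
    where
    open ≤-Reasoning
    lem₁ : ∀ a r d → a * r * (6 * d) ≡ 6 * (a * d) * r
    lem₁ = solve-∀
    lem₂ : ∀ n a → 18 * n + 6 * (n * a) ≡ 6 * (n * (3 + a))
    lem₂ = solve-∀
    lem₃ : ∀ n a → 20 * n + 10 * (n * a) ≡ 5 * (n * (2 * (2 + a)))
    lem₃ = solve-∀
    lem₄ : ∀ n b r → 5 * (n * (2 * b)) * r ≡ 5 * (n * (2 * (b * r)))
    lem₄ = solve-∀
    _⟨≡⟩_ : ∀ {a b c d : ℕ} → a ≤ b → a ≡ c × b ≡ d → c ≤ d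
    h ⟨≡⟩ (refl , refl) = h
  ... | 3 , ma , h with sel-complete ma
  ...   | r , s with dec∃ (λ x → 3 ≟ x) r
  -- Splitting a single 3 loses too much when the average is near 3; turning two parts 3 into three
  -- parts 2 costs only 8 / 9.
  ...     | inj₁ (_ , m3 , refl) = let (r′ , s′) = sel-complete m3 in
      2 ∷ 2 ∷ 2 ∷ r′ , two r′ s′ , (begin
        Π id xs * (6 * d) ≡⟨ cong (_* (6 * d)) (trans (Π-sel id s) (cong (3 *_) (Π-sel id s′))) ⟩
        3 * (3 * Π id r′) * (6 * d) ≡⟨ lem₁ (Π id r′) d ⟩
        18 * (3 * d) * Π id r′ ≤⟨ *-monoˡ-≤ (Π id r′) (≤-trans (*-monoʳ-≤ 18 (largest-bound d 2 p e h)) (lin 1 (λ n → ⊢ (36 ⋆ n ≼ 40 ⋆ n)) n ⟨≡⟩ (lem₂ n , refl))) ⟩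
        40 * n * Π id r′ ≡⟨ lem₃ n (Π id r′) ⟩
        5 * (n * (2 * (2 * (2 * Π id r′)))) ∎)
    where
    open ≤-Reasoning
    lem₁ : ∀ r d → 3 * (3 * r) * (6 * d) ≡ 18 * (3 * d) * r
    lem₁ = solve-∀
    lem₂ : ∀ n → 36 * n ≡ 18 * (n * 2)
    lem₂ = solve-∀
    lem₃ : ∀ n r → 40 * n * r ≡ 5 * (n * (2 * (2 * (2 * r))))
    lem₃ = solve-∀
    _⟨≡⟩_ : ∀ {a b c d : ℕ} → a ≤ b → a ≡ c × b ≡ d → c ≤ d
    h ⟨≡⟩ (refl , refl) = h
    two : ∀ r′ → (3 , r′) ∈ sel r → Parts n (suc ℓ) (2 ∷ 2 ∷ 2 ∷ r′)
    two r′ s′ = record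
      { len = cong suc (trans (cong suc (sym (proj₂ (proj₂ (proj₂ (sel-spec s′)))))) (trans (sym (proj₂ (proj₂ (proj₂ (sel-spec s))))) (Parts.len p)))
      ; pos = λ { x (here refl) → s≤s z≤n ; x (there (here refl)) → s≤s z≤n ; x (there (there (here refl))) → s≤s z≤n
                ; x (there (there (there mx))) → Parts.pos p x (proj₁ (proj₂ (sel-spec s)) x (proj₁ (proj₂ (sel-spec s′)) x mx)) }
      ; tot = trans (cong (3 +_) (sym (proj₁ (proj₂ (proj₂ (sel-spec s′))) id))) (trans (sym (proj₁ (proj₂ (proj₂ (sel-spec s))) id)) (Parts.tot p))
      }
  -- A single 3 among parts at most 2: the product keeps two thirds, and 2 d ≤ n + 1 because the
  -- other parts average at most 2; n ≥ 9 absorbs the 1.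
  ...     | inj₂ none = 1 ∷ 2 ∷ r , replace-part p s 1 2 (s≤s z≤n) (s≤s z≤n) refl , (begin
        Π id xs * (6 * d) ≡⟨ cong (_* (6 * d)) (Π-sel id s) ⟩
        3 * Π id r * (6 * d) ≡⟨ lem₁ (Π id r) d ⟩
        9 * (2 * d) * Π id r ≤⟨ *-monoˡ-≤ (Π id r) (≤-trans (*-monoʳ-≤ 9 2d) (lin 1 (λ n → (# 9 ≼ n) ⇒ ⊢ (9 ⋆ (n ⊹ # 1) ≼ 10 ⋆ n)) n n≥9)) ⟩
        10 * n * Π id r ≡⟨ lem₃ n (Π id r) ⟩
        5 * (n * (1 * (2 * Π id r))) ∎)
    where
    open ≤-Reasoning
    lem₁ : ∀ r d → 3 * r * (6 * d) ≡ 9 * (2 * d) * r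
    lem₁ = solve-∀
    lem₃ : ∀ n r → 10 * n * r ≡ 5 * (n * (1 * (2 * r)))
    lem₃ = solve-∀
    r≤2 : Σ r id ≤ length r * 2
    r≤2 = bounded r 2 (λ x mx → ≤-pred (≤∧≢⇒< (h x (proj₁ (proj₂ (sel-spec s)) x mx)) (λ e → none x mx (sym e))))
    2d : 2 * d ≤ n + 1
    2d = lin 5 (λ n d ℓ r s → (2 ⋆ (ℓ ⊹ d) ≼ 2 ⋆ n) ⇒ (n ≼ # 3 ⊹ s) ⇒ (s ≼ r) ⇒ (r ⊹ # 2 ≼ 2 ⋆ ℓ) ⇒ ⊢ (2 ⋆ d ≼ n ⊹ # 1)) n d ℓ (length r * 2) (Σ r id) (*-monoʳ-≤ 2 (≤-reflexive e))
            (≤-reflexive (trans (sym (Parts.tot p)) (proj₁ (proj₂ (proj₂ (sel-spec s))) id))) r≤2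
            (≤-reflexive (trans (lem (length r)) (cong (2 *_) (trans (sym (proj₂ (proj₂ (proj₂ (sel-spec s))))) (Parts.len p)))))
      where
      lem : ∀ l → l * 2 + 2 ≡ 2 * suc l
      lem = solve-∀

-- The counts of trees demanded by the abstract alternative

distinct-points : ∀ {m} (u v : Fin m) → ¬ (u ≡ v) → ∣ ⁅ u ⁆ ∩ ⁅ v ⁆ ∣ ≤ 0
distinct-points u v u≢v with point-∈ u ⁅ v ⁆
... | inj₁ h = ⊥-elim (u≢v (point-≡ u v h))
... | inj₂ h = h

another : ∀ {A : Set} {P : A → Set} (P? : ∀ x → Dec (P x)) (_≟_ : ∀ (x y : A) → Dec (x ≡ y)) {xs : List A} → (∀ y → Σ xs (λ x → 𝟙 (x ≟ y)) ≤ 1) →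
          2 ≤ Σ xs (λ x → 𝟙 (P? x)) → ∃[ x ] ∃[ y ] (P x × P y × ¬ (x ≡ y))
another {P = P} P? _≟_ {xs} u h with Σ-pos xs (≤-trans (s≤s z≤n) h)
... | x , mx , px with dec∃ (λ y → P? y ×-dec ¬? (y ≟ x)) xs
...   | inj₁ (y , _ , py , y≢x) = x , y , 𝟙-inv (P? x) px , py , (λ e → y≢x (sym e))
...   | inj₂ none = ⊥-elim (<-irrefl refl (≤-trans h (≤-trans (Σ-mono xs (λ y my → 𝟙-mono (P? y) (y ≟ x) (only y my))) (u x))))
  where
  only : ∀ y → y ∈ xs → P y → y ≡ x
  only y my py with y ≟ x
  ... | yes e = e
  ... | no ne = ⊥-elim (none y my (py , ne))

Σ-fin-≟ : ∀ {n} (y : Fin n) → Σ (elements n) (λ x → 𝟙 (x Finₚ.≟ y)) ≤ 1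
Σ-fin-≟ y = ≤-trans (Σ-mono′ (elements _) (λ x → 𝟙-mono (x Finₚ.≟ y) (⁅ x ⁆ ⊑? ⁅ y ⁆) (λ { refl → ⊑-refl ⁅ x ⁆ }))) (≤-reflexive (trans (Σ-elements ⁅ y ⁆) (∣⁅⁆∣ y)))

module Bounds (n : ℕ) (n≥1 : 1 ≤ n) (t k₂ c : ℕ) (tk : t + suc (suc k₂) ≡ n)
  (c-max : ∀ ys → Parts n (suc (suc k₂)) ys → Π id ys ≤ c) where

  open Graphs n
  open Trees n n≥1

  M : ℕ
  M = c * n ^ k₂

  private
    n≢0 : NonZero n
    n≢0 = >-nonZero n≥1

  Mn : M * n ≡ c * n ^ suc k₂
  Mn = trans (*-assoc c (n ^ k₂) n) (cong (c *_) (*-comm (n ^ k₂) n))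

  N-zero? : ∀ X → N X ≡ 0 ⊎ ∃[ Bs ] (Comp X Bs 0 × 1 ≤ N X)
  N-zero? X with 1 ≤? N X
  ... | no ¬h = inj₁ (n≤0⇒n≡0 (≤-pred (≰⇒> ¬h)))
  ... | yes h = let (A , mA , le) = N≥1⇒ X h ; (Bs , cp) = subforest (𝒯⇒ mA) le in inj₂ (Bs , cp , h)

  sizes : Blocks → List ℕ
  sizes = List.map ∣_∣

  Π-sizes : ∀ Bs → Π id (sizes Bs) ≡ P Bs
  Π-sizes [] = refl
  Π-sizes (B ∷ Bs) = cong (∣ B ∣ *_) (Π-sizes Bs)

  parts : ∀ {X Bs δ} → Comp X Bs δ → Parts n (length Bs) (sizes Bs)
  parts {Bs = Bs} cp = record
    { len = Listₚ.length-map ∣_∣ Bs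
    ; pos = λ x mx → let (B , mB , e) = ∈-map⁻ ∣_∣ mx in subst (1 ≤_) (sym e) (Comp.ne cp B mB)
    ; tot = trans (Σ-map ∣_∣ Bs id) (sizes-sum cp)
    }

  blocks≥1 : ∀ {X Bs δ} → Comp X Bs δ → ∃[ ℓ ] (length Bs ≡ suc ℓ)
  blocks≥1 {Bs = B ∷ Bs} cp = length Bs , refl
  blocks≥1 {Bs = []} cp = ⊥-elim (<-irrefl refl (≤-trans n≥1 (≤-reflexive (sym (sizes-sum cp)))))

  -- If some tree contains S and e, then e joins two blocks of S: the product at most doubles, while
  -- the power of n drops by one.
  H₂ : ∀ S e → ∣ ⁅ e ⁆ ∩ S ∣ ≤ 0 → N (S ∪ ⁅ e ⁆) * n ≤ 2 * N S
  H₂ S e new with N-zero? (S ∪ ⁅ e ⁆)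
  ... | inj₁ z = ≤-trans (≤-reflexive (cong (_* n) z)) z≤n
  ... | inj₂ (_ , _ , h) = go (N≥1⇒ (S ∪ ⁅ e ⁆) h)
    where
    go : ∃[ A ] (A ∈ 𝒯 × S ∪ ⁅ e ⁆ ⊑ A) → N (S ∪ ⁅ e ⁆) * n ≤ 2 * N S
    go (A , mA , le) = cross (pair-or-same (block cp u) (block cp v))
      where
      tA = 𝒯⇒ mA
      e∈A : ⁅ e ⁆ ⊑ A
      e∈A = slin 3 0 (λ s e a → (∥ (s ∪′ e) ∩′ ∁′ a ∥ ≼ # 0) ⇒ ⊢ (∥ e ∩′ ∁′ a ∥ ≼ # 0)) S ⁅ e ⁆ A le
      S⊑A : S ⊑ A
      S⊑A = slin 3 0 (λ s e a → (∥ (s ∪′ e) ∩′ ∁′ a ∥ ≼ # 0) ⇒ ⊢ (∥ s ∩′ ∁′ a ∥ ≼ # 0)) S ⁅ e ⁆ A le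
      ends = edge-ends (Comp.valid (proj₂ tA)) e e∈A
      u = proj₁ ends
      v = proj₁ (proj₂ ends)
      e≡ : e ≡ code u v
      e≡ = proj₁ (proj₂ (proj₂ ends))
      sub = subforest tA S⊑A
      Bs = proj₁ sub
      cp : Comp S Bs 0
      cp = proj₂ sub
      count : ∀ {x y B C r} → (B , C , r) ∈ pairs Bs → x ∈ˢ B → y ∈ˢ C → e ≡ code x y → N (S ∪ ⁅ e ⁆) * n ≤ 2 * N S
      count {x} {y} {B} {C} {r} p hx hy e≡′ = *-cancelʳ-≤ _ _ n {{n≢0}} (begin
          N (S ∪ ⁅ e ⁆) * n * n ≡⟨ cong (λ f → N (S ∪ ⁅ f ⁆) * n * n) e≡′ ⟩
          N (S ∪ ⁅ code x y ⁆) * n * n ≡⟨ cong (_* n) (forest-count ℓ (proj₁ (merge cp {x} {y} {B} {C} {r} p hx hy)) refl) ⟩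
          P ((B ∪ C) ∷ r) * n ^ ℓ * n ≤⟨ *-monoˡ-≤ n (*-monoˡ-≤ (n ^ ℓ) (merged-P≤ cp {B} {C} {r} p)) ⟩
          2 * P Bs * n ^ ℓ * n ≡⟨ lem (P Bs) (n ^ ℓ) n ⟩
          2 * (P Bs * n ^ suc ℓ) ≡⟨ cong (2 *_) (sym (forest-count (suc ℓ) cp (proj₂ (proj₂ (proj₂ (proj₂ (pairs-spec {xs = Bs} {B} {C} {r} p))))))) ⟩
          2 * (N S * n) ≡⟨ sym (*-assoc 2 (N S) n) ⟩
          2 * N S * n ∎)
        where
        open ≤-Reasoning
        ℓ = length r
        lem : ∀ p q n → 2 * p * q * n ≡ 2 * (p * (n * q))
        lem = solve-∀
      cross : _ → N (S ∪ ⁅ e ⁆) * n ≤ 2 * N S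
      cross (inj₁ (B , mB , hu , hv)) = ⊥-elim (<-irrefl refl (slin 2 0 (λ e s → (# 1 ≼ ∥ e ∥) ⇒ (∥ e ∩′ s ∥ ≼ # 0) ⇒ (∥ e ∩′ ∁′ s ∥ ≼ # 0) ⇒ ⊢ (# 1 ≼ # 0)) ⁅ e ⁆ S (≤-reflexive (sym (∣⁅⁆∣ e))) new
        (subst (λ f → ⁅ f ⁆ ⊑ S) (sym e≡) (no-inner tA S⊑A cp {B} {u} {v} mB hu hv (subst (λ f → ⁅ f ⁆ ⊑ A) e≡ e∈A)))))
      cross (inj₂ (B , C , r , p , inj₁ (hu , hv))) = count {u} {v} {B} {C} {r} p hu hv e≡
      cross (inj₂ (B , C , r , p , inj₂ (hv , hu))) = count {v} {u} {B} {C} {r} p hv hu (trans e≡ (code-sym u v))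

  private
    size⇒ : ∀ {S Bs d} → Comp S Bs 0 → ∣ S ∣ ≡ t + d → length Bs + d ≡ suc (suc k₂)
    size⇒ {S} {Bs} {d} cp e = +-cancelˡ-≡ t _ _ (trans (lem t (length Bs) d) (trans (cong (_+ length Bs) (sym e)) (trans (Comp.size cp) (trans (+-identityʳ n) (sym tk)))))
      where
      lem : ∀ t b d → t + (b + d) ≡ t + d + b
      lem = solve-∀

  -- `split-parts` refines the block sizes of S to n - t parts, whose product is at most c. Its
  -- losses n^x and 2^y are set against the power of n in Moon's formula.
  H₃ : ∀ S x y → ∣ S ∣ ≡ t + (x + y) → N S * n ^ y * rising t x ≤ 2 ^ y * M
  H₃ S x y e with N-zero? S
  ... | inj₁ z = ≤-trans (≤-reflexive (cong (λ a → a * n ^ y * rising t x) z)) z≤n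
  ... | inj₂ (Bs , cp , _) = *-cancelʳ-≤ _ _ n {{n≢0}} (begin
        N S * n ^ y * rising t x * n ≡⟨ lem₁ (N S) (n ^ y) (rising t x) n ⟩
        N S * n * (n ^ y * rising t x) ≡⟨ cong (_* (n ^ y * rising t x)) (forest-count ℓ cp ℓ≡) ⟩
        P Bs * n ^ ℓ * (n ^ y * rising t x) ≡⟨ lem₂ (P Bs) (n ^ ℓ) (n ^ y) (rising t x) ⟩
        P Bs * rising t x * (n ^ ℓ * n ^ y) ≡⟨ cong (λ p → p * rising t x * (n ^ ℓ * n ^ y)) (sym (Π-sizes Bs)) ⟩
        Π id (sizes Bs) * rising t x * (n ^ ℓ * n ^ y) ≤⟨ *-monoˡ-≤ (n ^ ℓ * n ^ y) (≤-trans (proj₂ (proj₂ sp)) (*-monoʳ-≤ (n ^ x) (*-monoʳ-≤ (2 ^ y) (c-max (proj₁ sp) (proj₁ (proj₂ sp)))))) ⟩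
        n ^ x * (2 ^ y * c) * (n ^ ℓ * n ^ y) ≡⟨ lem₃ (n ^ x) (2 ^ y) c (n ^ ℓ) (n ^ y) ⟩
        2 ^ y * (c * (n ^ ℓ * (n ^ x * n ^ y))) ≡⟨ cong (λ q → 2 ^ y * (c * q)) (trans (cong (n ^ ℓ *_) (sym (^-distribˡ-+-* n x y))) (trans (sym (^-distribˡ-+-* n ℓ (x + y))) (cong (n ^_) (suc-injective (trans (cong (_+ (x + y)) (sym ℓ≡)) ℓxy))))) ⟩
        2 ^ y * (c * n ^ suc k₂) ≡⟨ cong (2 ^ y *_) (sym Mn) ⟩
        2 ^ y * (M * n) ≡⟨ sym (*-assoc (2 ^ y) M n) ⟩
        2 ^ y * M * n ∎)
    where
    open ≤-Reasoning
    ℓ = proj₁ (blocks≥1 cp)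
    ℓ≡ = proj₂ (blocks≥1 cp)
    ℓxy : length Bs + (x + y) ≡ suc (suc k₂)
    ℓxy = size⇒ cp e
    sp = split-parts x y {t} {suc (suc k₂)} tk n≥1 (parts cp) ℓxy
    lem₁ : ∀ a b r n → a * b * r * n ≡ a * n * (b * r)
    lem₁ = solve-∀
    lem₂ : ∀ p q b r → p * q * (b * r) ≡ p * r * (q * b)
    lem₂ = solve-∀
    lem₃ : ∀ x y c l w → x * (y * c) * (l * w) ≡ y * (c * (l * (x * w)))
    lem₃ = solve-∀

  -- The case x = 1, y = 0 of `H₃`, improved by the factor 5 / 6 through `split-large`.
  N-large-block : 9 ≤ n → ∀ {Y Bs B} → ∣ Y ∣ ≡ t + 1 → Comp Y Bs 0 → B ∈ Bs → 3 ≤ ∣ B ∣ → N Y * (6 * (t + 1)) ≤ 5 * M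
  N-large-block n≥9 {Y} {Bs} {B} e cp mB B≥3 = *-cancelʳ-≤ _ _ n {{n≢0}} (begin
      N Y * (6 * (t + 1)) * n ≡⟨ lem₁ (N Y) (6 * (t + 1)) n ⟩
      N Y * n * (6 * (t + 1)) ≡⟨ cong (_* (6 * (t + 1))) (forest-count k₂ cp ℓ) ⟩
      P Bs * n ^ k₂ * (6 * (t + 1)) ≡⟨ lem₂ (P Bs) (n ^ k₂) (6 * (t + 1)) ⟩
      P Bs * (6 * (t + 1)) * n ^ k₂ ≡⟨ cong (λ p → p * (6 * (t + 1)) * n ^ k₂) (sym (Π-sizes Bs)) ⟩
      Π id (sizes Bs) * (6 * (t + 1)) * n ^ k₂ ≤⟨ *-monoˡ-≤ (n ^ k₂) (≤-trans (proj₂ (proj₂ sp)) (*-monoʳ-≤ 5 (*-monoʳ-≤ n (c-max (proj₁ sp) (subst (λ l → Parts n l (proj₁ sp)) (cong suc ℓ) (proj₁ (proj₂ sp))))))) ⟩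
      5 * (n * c) * n ^ k₂ ≡⟨ lem₃ n c (n ^ k₂) ⟩
      5 * M * n ∎)
    where
    open ≤-Reasoning
    ℓ : length Bs ≡ suc k₂
    ℓ = suc-injective (trans (+-comm 1 (length Bs)) (size⇒ cp e))
    sp = split-large (t + 1) (parts cp) n≥9 (trans (+-comm (length Bs) (t + 1)) (trans (cong (_+ length Bs) (sym e)) (trans (Comp.size cp) (+-identityʳ n)))) (∣ B ∣ , ∈-map⁺ ∣_∣ mB , B≥3)
    lem₁ : ∀ a b c → a * b * c ≡ a * c * b
    lem₁ = solve-∀
    lem₂ : ∀ a b c → a * b * c ≡ a * c * b
    lem₂ = solve-∀
    lem₃ : ∀ n c p → 5 * (n * c) * p ≡ 5 * (c * p) * n
    lem₃ = solve-∀

  deg : Subset m → Fin n → ℕ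
  deg Z u = Σ V (adj Z u)

  module Matching (Z : Subset m) (val : Valid Z) (deg≤1 : ∀ u → deg Z u ≤ 1) where
    private
      comps = components Z val
      Bs = proj₁ comps
      δ = proj₁ (proj₂ comps)
      cp : Comp Z Bs δ
      cp = proj₂ (proj₂ comps)

      only : ∀ {u v w} → Adj Z u v → Adj Z u w → v ≡ w
      only {u} {v} {w} a b with v Finₚ.≟ w
      ... | yes e = e
      ... | no ne = ⊥-elim (<-irrefl refl (≤-trans (two V (∈elements v) (∈elements w)) (deg≤1 u)))
        where
        two : ∀ xs → v ∈ xs → w ∈ xs → 2 ≤ Σ xs (adj Z u)
        two (x ∷ xs) (here refl) (here refl) = ⊥-elim (ne refl)
        two (x ∷ xs) (here refl) (there mw) = +-mono-≤ (𝟙-yes (⁅ code u v ⁆ ⊑? Z) a) (≤-trans (𝟙-yes (⁅ code u w ⁆ ⊑? Z) b) (Σ-member (adj Z u) mw))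
        two (x ∷ xs) (there mv) (here refl) = +-mono-≤ (𝟙-yes (⁅ code u w ⁆ ⊑? Z) b) (≤-trans (𝟙-yes (⁅ code u v ⁆ ⊑? Z) a) (Σ-member (adj Z u) mv))
        two (x ∷ xs) (there mv) (there mw) = ≤-trans (two xs mv mw) (m≤n+m _ (adj Z u x))

      near : ∀ {u w} → Path Z u w → w ≡ u ⊎ Adj Z u w
      near nil = inj₁ refl
      near {u} (snoc {v} {w} p a) with near p
      ... | inj₁ refl = inj₂ a
      ... | inj₂ b = inj₁ (only a (subst (λ e → ⁅ e ⁆ ⊑ Z) (code-sym u v) b))

      block≤2 : ∀ B → B ∈ Bs → ∣ B ∣ ≤ 2
      block≤2 B mB = let (u , hu) = point B (Comp.ne cp B mB) in begin
          ∣ B ∣ ≡⟨ sym (Σ-elements B) ⟩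
          Σ V (λ w → 𝟙 (⁅ w ⁆ ⊑? B)) ≤⟨ Σ-mono′ V (λ w → 𝟙-if (⁅ w ⁆ ⊑? B) (λ hw → [ (λ e → ≤-trans (𝟙-yes (w Finₚ.≟ u) e) (m≤m+n _ _)) , (λ a → ≤-trans (𝟙-yes (⁅ code u w ⁆ ⊑? Z) a) (m≤n+m _ (𝟙 (w Finₚ.≟ u)))) ]′ (near (Comp.conn cp B mB u w hu hw)))) ⟩
          Σ V (λ w → 𝟙 (w Finₚ.≟ u) + adj Z u w) ≡⟨ Σ-+ V _ _ ⟩
          Σ V (λ w → 𝟙 (w Finₚ.≟ u)) + deg Z u ≤⟨ +-mono-≤ (Σ-fin-≟ u) (deg≤1 u) ⟩
          2 ∎
        where open ≤-Reasoning

      inside-degree : ∀ B → B ∈ Bs → Σ V (λ u → 𝟙 (⁅ u ⁆ ⊑? B) * deg Z u) + 2 ≤ 2 * ∣ B ∣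
      inside-degree B mB = go ∣ B ∣ refl (Comp.ne cp B mB) (block≤2 B mB)
        where
        go : ∀ b → ∣ B ∣ ≡ b → 1 ≤ b → b ≤ 2 → Σ V (λ u → 𝟙 (⁅ u ⁆ ⊑? B) * deg Z u) + 2 ≤ 2 * b
        go 1 e _ _ = +-monoˡ-≤ 2 (≤-trans (Σ-≤const V 0 (λ u _ → 𝟙*-≤ (⁅ u ⁆ ⊑? B) (λ hu → ≤-trans (Σ-≤const V 0 (λ w _ → ≤-reflexive (𝟙-no (⁅ code u w ⁆ ⊑? Z) (lonely u w hu)))) (≤-reflexive (*-zeroʳ (length V)))))) (≤-reflexive (*-zeroʳ (length V))))
          where
          lonely : ∀ u w → u ∈ˢ B → ¬ Adj Z u w
          lonely u w hu a = <-irrefl refl (slin 3 0 (λ x y b → (# 1 ≼ ∥ x ∥) ⇒ (# 1 ≼ ∥ y ∥) ⇒ (∥ x ∩′ y ∥ ≼ # 0) ⇒ (∥ x ∩′ ∁′ b ∥ ≼ # 0) ⇒ (∥ y ∩′ ∁′ b ∥ ≼ # 0) ⇒ (∥ b ∥ ≼ # 1) ⇒ ⊢ (# 1 ≼ # 0)) ⁅ u ⁆ ⁅ w ⁆ B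
            (≤-reflexive (sym (∣⁅⁆∣ u))) (≤-reflexive (sym (∣⁅⁆∣ w))) (distinct-points u w (Adj⇒≢ {Z} {u} {w} val a)) hu (Comp.closed cp B mB u w hu a) (≤-reflexive e))
        go 2 e _ _ = +-monoˡ-≤ 2 (≤-trans (Σ-mono′ V (λ u → ≤-trans (*-monoʳ-≤ (𝟙 (⁅ u ⁆ ⊑? B)) (deg≤1 u)) (≤-reflexive (*-identityʳ _)))) (≤-reflexive (trans (Σ-elements B) e)))
        go (suc (suc (suc b))) e _ (s≤s (s≤s ()))

    half-n : 2 * ∣ Z ∣ ≤ n
    half-n = begin
        2 * ∣ Z ∣ ≡⟨ cong (∣ Z ∣ +_) (+-identityʳ ∣ Z ∣) ⟩
        ∣ Z ∣ + ∣ Z ∣ ≡⟨ sym (Σ-adj Z val) ⟩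
        Σ V (deg Z) ≤⟨ Σ-≤const V 1 (λ u _ → deg≤1 u) ⟩
        length V * 1 ≡⟨ trans (*-identityʳ _) (Listₚ.length-tabulate id) ⟩
        n ∎
      where open ≤-Reasoning

    private
      δ≡0 : δ ≡ 0
      δ≡0 = n≤0⇒n≡0 (*-cancelˡ-≤ 2 (lin 5 (λ z b d n s → (2 ⋆ (n ⊹ d) ≼ 2 ⋆ (z ⊹ b)) ⇒ (z ⊹ z ⊹ 2 ⋆ b ≼ 2 ⋆ n) ⇒ ⊢ (2 ⋆ d ≼ 2 ⋆ # 0)) ∣ Z ∣ (length Bs) δ n 0
               (*-monoʳ-≤ 2 (≤-reflexive (sym (Comp.size cp)))) 2z))
        where
        open ≤-Reasoning
        2z : ∣ Z ∣ + ∣ Z ∣ + 2 * length Bs ≤ 2 * n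
        2z = begin
          ∣ Z ∣ + ∣ Z ∣ + 2 * length Bs ≡⟨ cong₂ _+_ (sym (trans (Σpart cp (deg Z)) (Σ-adj Z val))) (trans (*-comm 2 (length Bs)) (sym (Σ-const Bs 2))) ⟩
          Σ Bs (λ B → Σ V (λ u → 𝟙 (⁅ u ⁆ ⊑? B) * deg Z u)) + Σ Bs (λ _ → 2) ≡⟨ sym (Σ-+ Bs _ _) ⟩
          Σ Bs (λ B → Σ V (λ u → 𝟙 (⁅ u ⁆ ⊑? B) * deg Z u) + 2) ≤⟨ Σ-mono Bs inside-degree ⟩
          Σ Bs (λ B → 2 * ∣ B ∣) ≡⟨ trans (Σ-*ˡ Bs 2 ∣_∣) (cong (2 *_) (sizes-sum cp)) ⟩
          2 * n ∎

      cp₀ : Comp Z Bs 0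
      cp₀ = subst (Comp Z Bs) δ≡0 cp

      P-pow : ∀ Cs → (∀ B → B ∈ Cs → 1 ≤ ∣ B ∣ × ∣ B ∣ ≤ 2) → P Cs * 2 ^ length Cs ≡ 2 ^ Σ Cs ∣_∣
      P-pow [] h = refl
      P-pow (B ∷ Cs) h = trans ([m*n]*[o*p]≡[m*o]*[n*p] ∣ B ∣ (P Cs) 2 (2 ^ length Cs)) (trans (cong₂ _*_ (two ∣ B ∣ (h B (here refl))) (P-pow Cs (λ C mC → h C (there mC)))) (sym (^-distribˡ-+-* 2 ∣ B ∣ _)))
        where
        two : ∀ b → 1 ≤ b × b ≤ 2 → b * 2 ≡ 2 ^ b
        two 1 _ = refl
        two 2 _ = refl
        two (suc (suc (suc b))) (_ , s≤s (s≤s ()))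

    -- A block size b of 1 or 2 satisfies 2 b = 2^b, so the product is 2 to the number of vertices
    -- minus the number of blocks.
    P-matching : P Bs ≡ 2 ^ ∣ Z ∣
    P-matching = *-cancelʳ-≡ _ _ (2 ^ length Bs) {{m^n≢0 2 (length Bs)}} (trans (P-pow Bs (λ B mB → Comp.ne cp B mB , block≤2 B mB))
      (trans (cong (2 ^_) (trans (sizes-sum cp) (trans (sym (+-identityʳ n)) (sym (Comp.size cp₀))))) (^-distribˡ-+-* 2 ∣ Z ∣ (length Bs))))

    matching-count : ∀ ℓ → ∣ Z ∣ + suc ℓ ≡ n → N Z * n ≡ 2 ^ ∣ Z ∣ * n ^ ℓ
    matching-count ℓ e = trans (forest-count ℓ cp₀ (+-cancelˡ-≡ ∣ Z ∣ _ _ (trans (Comp.size cp₀) (trans (+-identityʳ n) (sym e))))) (cong (_* n ^ ℓ) P-matching)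

-- Trees with at least t + 1 edges in a set of t + 2

two-marks : {P Q : Set} (d : Dec P) (e : Dec Q) {x M : ℕ} (s : ℕ) → (¬ P → ¬ Q → x * s ≤ 5 * M) → x * s ≤ 5 * M + 1 * M → x * s ≤ 5 * M + (𝟙 d + 𝟙 e) * M
two-marks (no a) (no b) {x} {M} s h six = ≤-trans (h a b) (m≤m+n (5 * M) 0)
two-marks (yes _) e {x} {M} s h six = ≤-trans six (+-monoʳ-≤ (5 * M) (*-monoˡ-≤ M (m≤m+n 1 (𝟙 e))))
two-marks (no _) (yes _) s h six = six

module Deep (n : ℕ) (n≥29 : 29 ≤ n) (t k₂ c : ℕ) (tk : t + suc (suc k₂) ≡ n)
  (c-max : ∀ ys → Parts n (suc (suc k₂)) ys → Π id ys ≤ c) (c-att : ∃[ zs ] (Parts n (suc (suc k₂)) zs × Π id zs ≡ c)) where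

  n≥1 : 1 ≤ n
  n≥1 = ≤-trans (s≤s z≤n) n≥29

  open Graphs n
  open Trees n n≥1
  open Bounds n n≥1 t k₂ c tk c-max

  L : ℕ
  L = n ^ 10

  private
    L≥ : ∀ j → j ≤ 10 → n ^ j ≤ L
    L≥ j le = ^-monoʳ-≤ n {{>-nonZero n≥1}} le

    -- A part y is at most 2^(y - 1), and the exponents y - 1 add up to t.
    c≤2^t : c ≤ 2 ^ t
    c≤2^t = *-cancelʳ-≤ _ _ (2 ^ k) {{m^n≢0 2 k}} (begin
        c * 2 ^ k ≡⟨ cong₂ _*_ (sym (proj₂ (proj₂ c-att))) (cong (2 ^_) (sym (Parts.len p))) ⟩
        Π id zs * 2 ^ length zs ≤⟨ go zs (Parts.pos p) ⟩
        2 ^ Σ zs id ≡⟨ cong (2 ^_) (trans (Parts.tot p) (sym tk)) ⟩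
        2 ^ (t + k) ≡⟨ ^-distribˡ-+-* 2 t k ⟩
        2 ^ t * 2 ^ k ∎)
      where
      open ≤-Reasoning
      k = suc (suc k₂)
      zs = proj₁ c-att
      p = proj₁ (proj₂ c-att)
      double : ∀ y → 1 ≤ y → y * 2 ≤ 2 ^ y
      double (suc y) _ = ≤-trans (*-monoˡ-≤ 2 (n<2^n y)) (≤-reflexive (*-comm (2 ^ y) 2))
      go : ∀ ys → (∀ y → y ∈ ys → 1 ≤ y) → Π id ys * 2 ^ length ys ≤ 2 ^ Σ ys id
      go [] h = ≤-refl
      go (y ∷ ys) h = ≤-trans (≤-reflexive ([m*n]*[o*p]≡[m*o]*[n*p] y (Π id ys) 2 (2 ^ length ys)))
        (≤-trans (*-mono-≤ (double y (h y (here refl))) (go ys (λ z mz → h z (there mz)))) (≤-reflexive (sym (^-distribˡ-+-* 2 y (Σ ys id)))))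

  module _ (Z : Subset m) (Z# : ∣ Z ∣ ≡ t + 2) where
    F₁ : ℕ
    F₁ = Σ 𝒯 (λ A → 𝟙 (t + 1 ≤? ∣ A ∩ Z ∣))

    private
      E = elements m
      Z- : Fin m → Subset m
      Z- z = Z ∩ ∁ ⁅ z ⁆

      Z-# : ∀ z → ⁅ z ⁆ ⊑ Z → ∣ Z- z ∣ ≡ t + 1
      Z-# z h = ≤-antisym
        (slin 2 1 (λ z e t → (∥ z ∥ ≼ t ⊹ # 2) ⇒ (∥ e ∩′ ∁′ z ∥ ≼ # 0) ⇒ (# 1 ≼ ∥ e ∥) ⇒ ⊢ (∥ z ∩′ ∁′ e ∥ ≼ t ⊹ # 1)) Z ⁅ z ⁆ t (≤-reflexive Z#) h (≤-reflexive (sym (∣⁅⁆∣ z))))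
        (slin 2 1 (λ z e t → (t ⊹ # 2 ≼ ∥ z ∥) ⇒ (∥ e ∥ ≼ # 1) ⇒ ⊢ (t ⊹ # 1 ≼ ∥ z ∩′ ∁′ e ∥)) Z ⁅ z ⁆ t (≤-reflexive (sym Z#)) (≤-reflexive (∣⁅⁆∣ z)))

      S₁ : ℕ
      S₁ = Σ E (λ z → 𝟙 (⁅ z ⁆ ⊑? Z) * N (Z- z))

      -- A tree with t + 1 edges in Z lies above some `Z- z`; one containing Z lies above all t + 2
      -- of them and may be counted twice. The surplus `N Z` is what saves the matching case.
      per : ∀ A → 𝟙 (t + 1 ≤? ∣ A ∩ Z ∣) + 𝟙 (Z ⊑? A) ≤ Σ E (λ z → 𝟙 (⁅ z ⁆ ⊑? Z) * 𝟙 (Z- z ⊑? A))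
      per A = cases (Z ⊑? A)
        where
        cases : (d : Dec (Z ⊑ A)) → 𝟙 (t + 1 ≤? ∣ A ∩ Z ∣) + 𝟙 d ≤ Σ E (λ z → 𝟙 (⁅ z ⁆ ⊑? Z) * 𝟙 (Z- z ⊑? A))
        cases (yes Z⊑A) = ≤-trans (+-monoˡ-≤ 1 (𝟙≤1 (t + 1 ≤? ∣ A ∩ Z ∣))) (≤-trans (≤-trans (m≤n+m 2 t) (≤-reflexive (trans (sym Z#) (sym (Σ-elements Z)))))
              (Σ-mono′ E (λ z → 𝟙-if (⁅ z ⁆ ⊑? Z) (λ h → *-mono-≤ {1} {_} {1} (𝟙-yes (⁅ z ⁆ ⊑? Z) h) (𝟙-yes (Z- z ⊑? A) (slin 3 0 (λ z e a → (∥ z ∩′ ∁′ a ∥ ≼ # 0) ⇒ ⊢ (∥ (z ∩′ ∁′ e) ∩′ ∁′ a ∥ ≼ # 0)) Z ⁅ z ⁆ A Z⊑A))))))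
        cases (no ¬Z⊑A) = ≤-trans (≤-reflexive (+-identityʳ _)) (𝟙-if (t + 1 ≤? ∣ A ∩ Z ∣) λ le →
              let (z , hz) = point (Z ∩ ∁ A) (≰⇒> ¬Z⊑A) in
              ≤-trans (*-mono-≤ {1} {_} {1} (𝟙-yes (⁅ z ⁆ ⊑? Z) (slin 3 0 (λ z e a → (∥ e ∩′ ∁′ (z ∩′ ∁′ a) ∥ ≼ # 0) ⇒ ⊢ (∥ e ∩′ ∁′ z ∥ ≼ # 0)) Z ⁅ z ⁆ A hz))
                (𝟙-yes (Z- z ⊑? A) (slin 3 1 (λ z e a t → (∥ z ∥ ≼ t ⊹ # 2) ⇒ (t ⊹ # 1 ≼ ∥ a ∩′ z ∥) ⇒ (∥ e ∩′ ∁′ (z ∩′ ∁′ a) ∥ ≼ # 0) ⇒ (# 1 ≼ ∥ e ∥) ⇒ ⊢ (∥ (z ∩′ ∁′ e) ∩′ ∁′ a ∥ ≼ # 0))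
                   Z ⁅ z ⁆ A t (≤-reflexive Z#) le hz (≤-reflexive (sym (∣⁅⁆∣ z))))))
                (Σ-member (λ z → 𝟙 (⁅ z ⁆ ⊑? Z) * 𝟙 (Z- z ⊑? A)) (∈elements z)))

      F₁+N≤ : F₁ + N Z ≤ S₁
      F₁+N≤ = begin
          F₁ + N Z ≡⟨ sym (Σ-+ 𝒯 _ _) ⟩
          Σ 𝒯 (λ A → 𝟙 (t + 1 ≤? ∣ A ∩ Z ∣) + 𝟙 (Z ⊑? A)) ≤⟨ Σ-mono′ 𝒯 per ⟩
          Σ 𝒯 (λ A → Σ E (λ z → 𝟙 (⁅ z ⁆ ⊑? Z) * 𝟙 (Z- z ⊑? A))) ≡⟨ Σ-swap 𝒯 E _ ⟩
          Σ E (λ z → Σ 𝒯 (λ A → 𝟙 (⁅ z ⁆ ⊑? Z) * 𝟙 (Z- z ⊑? A))) ≡⟨ Σ-cong E (λ z → Σ-*ˡ 𝒯 (𝟙 (⁅ z ⁆ ⊑? Z)) _) ⟩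
          S₁ ∎
        where open ≤-Reasoning

      F₁≤ : F₁ ≤ S₁
      F₁≤ = ≤-trans (m≤m+n F₁ (N Z)) F₁+N≤

      n*S₁ : n * S₁ ≤ (t + 2) * (2 * M)
      n*S₁ = begin
          n * S₁ ≡⟨ sym (Σ-*ˡ E n _) ⟩
          Σ E (λ z → n * (𝟙 (⁅ z ⁆ ⊑? Z) * N (Z- z))) ≤⟨ Σ-mono′ E (λ z → ≤-trans (≤-reflexive (a*bc≡b*ac n (𝟙 (⁅ z ⁆ ⊑? Z)) (N (Z- z)))) (𝟙*-mono (⁅ z ⁆ ⊑? Z) (λ h → bound z h))) ⟩
          Σ E (λ z → 𝟙 (⁅ z ⁆ ⊑? Z) * (2 * M)) ≡⟨ trans (Σ-*ʳ E (2 * M) _) (cong (_* (2 * M)) (trans (Σ-elements Z) Z#)) ⟩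
          (t + 2) * (2 * M) ∎
        where
        open ≤-Reasoning
        bound : ∀ z → ⁅ z ⁆ ⊑ Z → n * N (Z- z) ≤ 2 * M
        bound z h = ≤-trans (≤-reflexive (lem n (N (Z- z)))) (H₃ (Z- z) 0 1 (Z-# z h))
          where
          lem : ∀ n N → n * N ≡ N * (n * 1) * 1
          lem = solve-∀

      Goal : Set
      Goal = F₁ * L + M ≤ L * M

      -- For bounded t the crude bound 2 (t + 2) M / n ≤ 28 M / n already suffices, with n ≥ 29
      -- leaving room for the extra M.
      small-t : t ≤ 12 → Goal
      small-t t≤ = begin
          F₁ * L + M ≡⟨ cong (_+ M) (lem F₁ n (n ^ 9)) ⟩
          n * F₁ * n ^ 9 + M ≤⟨ +-mono-≤ (*-monoˡ-≤ (n ^ 9) (≤-trans (*-monoʳ-≤ n F₁≤) (≤-trans n*S₁ (*-monoˡ-≤ (2 * M) (+-monoˡ-≤ 2 t≤))))) (≤-trans (≤-reflexive (sym (*-identityʳ M))) (*-monoʳ-≤ M (m^n>0 n {{>-nonZero n≥1}} 9))) ⟩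
          14 * (2 * M) * n ^ 9 + M * n ^ 9 ≡⟨ lem₂ M (n ^ 9) ⟩
          29 * (n ^ 9 * M) ≤⟨ *-monoˡ-≤ (n ^ 9 * M) n≥29 ⟩
          n * (n ^ 9 * M) ≡⟨ sym (*-assoc n (n ^ 9) M) ⟩
          L * M ∎
        where
        open ≤-Reasoning
        lem : ∀ f n p → f * (n * p) ≡ n * f * p
        lem = solve-∀
        lem₂ : ∀ M p → 14 * (2 * M) * p + M * p ≡ 29 * (p * M)
        lem₂ = solve-∀

      -- All but two of the sets Z - z are covered by N-large-block.
      two-exceptions : ∀ s → 13 + s ≡ t → ∀ e e′ → (∀ z → ⁅ z ⁆ ⊑ Z → ¬ (z ≡ e) → ¬ (z ≡ e′) → N (Z- z) * (6 * (t + 1)) ≤ 5 * M) → Goal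
      two-exceptions s ts e e′ h = *-cancelˡ-≤ (6 * (t + 1)) {{>-nonZero (*-mono-≤ {1} {6} {1} (s≤s z≤n) (m≤n+m 1 t))}} (begin
          6 * (t + 1) * (F₁ * L + M) ≡⟨ lem₁ (6 * (t + 1)) F₁ L M ⟩
          F₁ * (6 * (t + 1)) * L + 6 * (t + 1) * M ≤⟨ +-monoˡ-≤ (6 * (t + 1) * M) (*-monoˡ-≤ L total) ⟩
          ((t + 2) * (5 * M) + 2 * M) * L + 6 * (t + 1) * M ≡⟨ cong (_+ 6 * (t + 1) * M) (*-distribʳ-+ L ((t + 2) * (5 * M)) (2 * M)) ⟩
          (t + 2) * (5 * M) * L + 2 * M * L + 6 * (t + 1) * M ≡⟨ cong (λ t → (t + 2) * (5 * M) * L + 2 * M * L + 6 * (t + 1) * M) (sym ts) ⟩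
          (13 + s + 2) * (5 * M) * L + 2 * M * L + 6 * (13 + s + 1) * M ≡⟨ lem₂ s M L ⟩
          (77 + 5 * s) * (L * M) + (84 + 6 * s) * M ≤⟨ +-monoʳ-≤ ((77 + 5 * s) * (L * M)) (≤-trans (*-monoˡ-≤ M (lin 1 (λ s → ⊢ (# 84 ⊹ 6 ⋆ s ≼ 14 ⋆ (# 7 ⊹ s))) s)) (*-monoˡ-≤ M (*-monoˡ-≤ (7 + s) 14≤L))) ⟩
          (77 + 5 * s) * (L * M) + L * (7 + s) * M ≡⟨ lem₃ s L M ⟩
          6 * (13 + s + 1) * (L * M) ≡⟨ cong (λ t → 6 * (t + 1) * (L * M)) ts ⟩
          6 * (t + 1) * (L * M) ∎)
        where
        open ≤-Reasoning
        14≤L : 14 ≤ L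
        14≤L = ≤-trans (≤-trans (≤ᵇ⇒≤ 14 29 tt) n≥29) (≤-trans (≤-reflexive (sym (*-identityʳ n))) (L≥ 1 (s≤s z≤n)))
        lem₁ : ∀ a f L M → a * (f * L + M) ≡ f * a * L + a * M
        lem₁ = solve-∀
        lem₂ : ∀ s M L → (13 + s + 2) * (5 * M) * L + 2 * M * L + 6 * (13 + s + 1) * M ≡ (77 + 5 * s) * (L * M) + (84 + 6 * s) * M
        lem₂ = solve-∀
        lem₃ : ∀ s L M → (77 + 5 * s) * (L * M) + L * (7 + s) * M ≡ 6 * (13 + s + 1) * (L * M)
        lem₃ = solve-∀
        six : ∀ z → ⁅ z ⁆ ⊑ Z → N (Z- z) * (6 * (t + 1)) ≤ 5 * M + 1 * M
        six z hz = ≤-trans (≤-reflexive (lem (N (Z- z)) (t + 1))) (≤-trans (*-monoʳ-≤ 6 (H₃ (Z- z) 1 0 (Z-# z hz))) (≤-reflexive (lem′ M)))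
          where
          lem : ∀ N s → N * (6 * s) ≡ 6 * (N * 1 * (1 * s))
          lem = solve-∀
          lem′ : ∀ M → 6 * (1 * M) ≡ 5 * M + 1 * M
          lem′ = solve-∀
        each : ∀ z → ⁅ z ⁆ ⊑ Z → N (Z- z) * (6 * (t + 1)) ≤ 5 * M + (𝟙 (z Finₚ.≟ e) + 𝟙 (z Finₚ.≟ e′)) * M
        each z hz = two-marks (z Finₚ.≟ e) (z Finₚ.≟ e′) {N (Z- z)} {M} (6 * (t + 1)) (h z hz) (six z hz)
        total′ : S₁ * (6 * (t + 1)) ≤ (t + 2) * (5 * M) + 2 * M
        total′ = begin
          S₁ * (6 * (t + 1)) ≡⟨ sym (Σ-*ʳ E (6 * (t + 1)) _) ⟩
          Σ E (λ z → 𝟙 (⁅ z ⁆ ⊑? Z) * N (Z- z) * (6 * (t + 1))) ≤⟨ Σ-mono′ E (λ z → ≤-trans (≤-reflexive (*-assoc (𝟙 (⁅ z ⁆ ⊑? Z)) _ _)) (≤-trans (𝟙*-mono (⁅ z ⁆ ⊑? Z) (each z)) (≤-trans (≤-reflexive (*-distribˡ-+ (𝟙 (⁅ z ⁆ ⊑? Z)) (5 * M) _)) (+-monoʳ-≤ (𝟙 (⁅ z ⁆ ⊑? Z) * (5 * M)) (𝟙*-≤ (⁅ z ⁆ ⊑? Z) (λ _ → ≤-refl)))))) ⟩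
          Σ E (λ z → 𝟙 (⁅ z ⁆ ⊑? Z) * (5 * M) + (𝟙 (z Finₚ.≟ e) + 𝟙 (z Finₚ.≟ e′)) * M) ≡⟨ trans (Σ-+ E _ _) (cong₂ _+_ (trans (Σ-*ʳ E (5 * M) _) (cong (_* (5 * M)) (trans (Σ-elements Z) Z#))) (trans (Σ-*ʳ E M _) (cong (_* M) (Σ-+ E _ _)))) ⟩
          (t + 2) * (5 * M) + (Σ E (λ z → 𝟙 (z Finₚ.≟ e)) + Σ E (λ z → 𝟙 (z Finₚ.≟ e′))) * M ≤⟨ +-monoʳ-≤ ((t + 2) * (5 * M)) (*-monoˡ-≤ M (+-mono-≤ (Σ-fin-≟ e) (Σ-fin-≟ e′))) ⟩
          (t + 2) * (5 * M) + 2 * M ∎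
        total : F₁ * (6 * (t + 1)) ≤ (t + 2) * (5 * M) + 2 * M
        total = ≤-trans (*-monoˡ-≤ (6 * (t + 1)) F₁≤) total′

      in-Z- : ∀ z f → ¬ (z ≡ f) → ⁅ f ⁆ ⊑ Z → ⁅ f ⁆ ⊑ Z- z
      in-Z- z f z≢f hf = slin 3 0 (λ f z e → (∥ f ∩′ ∁′ z ∥ ≼ # 0) ⇒ (∥ e ∩′ f ∥ ≼ # 0) ⇒ ⊢ (∥ f ∩′ ∁′ (z ∩′ ∁′ e) ∥ ≼ # 0)) ⁅ f ⁆ Z ⁅ z ⁆ hf (distinct-points z f z≢f)

      -- An invalid code in Z survives in every other `Z- z`, and no tree lies above such a set.
      invalid : ∀ s → 13 + s ≡ t → ∀ i j → ⁅ Fin.combine i j ⁆ ⊑ Z → ¬ (i Fin.< j) → Goal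
      invalid s ts i j hij ¬lt = two-exceptions s ts (Fin.combine i j) (Fin.combine i j) λ z hz z≢ _ → go z z≢ (N-zero? (Z- z))
        where
        go : ∀ z → ¬ (z ≡ Fin.combine i j) → N (Z- z) ≡ 0 ⊎ ∃[ Bs ] (Comp (Z- z) Bs 0 × 1 ≤ N (Z- z)) → N (Z- z) * (6 * (t + 1)) ≤ 5 * M
        go z z≢ (inj₁ e) = ≤-trans (≤-reflexive (cong (_* (6 * (t + 1))) e)) z≤n
        go z z≢ (inj₂ (Bs , cp , _)) = ⊥-elim (¬lt (Comp.valid cp i j (in-Z- z (Fin.combine i j) z≢ hij)))

      -- Unless z is one of the two edges at u, the vertices u, w and w′ lie in one block of `Z- z`.
      high-degree : ∀ s → 13 + s ≡ t → Valid Z → ∀ u w w′ → Adj Z u w → Adj Z u w′ → ¬ (w ≡ w′) → Goal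
      high-degree s ts val u w w′ a a′ w≢w′ = two-exceptions s ts (code u w) (code u w′) λ z hz z≢ z≢′ → go z hz z≢ z≢′ (N-zero? (Z- z))
        where
        go : ∀ z → ⁅ z ⁆ ⊑ Z → ¬ (z ≡ code u w) → ¬ (z ≡ code u w′) → N (Z- z) ≡ 0 ⊎ ∃[ Bs ] (Comp (Z- z) Bs 0 × 1 ≤ N (Z- z)) → N (Z- z) * (6 * (t + 1)) ≤ 5 * M
        go z hz z≢ z≢′ (inj₁ e) = ≤-trans (≤-reflexive (cong (_* (6 * (t + 1))) e)) z≤n
        go z hz z≢ z≢′ (inj₂ (Bs , cp , _)) = let (B , mB , hu) = block cp u in
          N-large-block (≤-trans (≤ᵇ⇒≤ 9 29 tt) n≥29) {Y = Z- z} {Bs} {B} (Z-# z hz) cp mB (three B hu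
             (Comp.closed cp B mB u w hu (in-Z- z (code u w) z≢ a)) (Comp.closed cp B mB u w′ hu (in-Z- z (code u w′) z≢′ a′)))
          where
          three : ∀ B → ⁅ u ⁆ ⊑ B → ⁅ w ⁆ ⊑ B → ⁅ w′ ⁆ ⊑ B → 3 ≤ ∣ B ∣
          three B = λ hu hw hw′ → slin 4 0 (λ x y z b → (# 1 ≼ ∥ x ∥) ⇒ (# 1 ≼ ∥ y ∥) ⇒ (# 1 ≼ ∥ z ∥) ⇒ (∥ x ∩′ y ∥ ≼ # 0) ⇒ (∥ x ∩′ z ∥ ≼ # 0) ⇒ (∥ y ∩′ z ∥ ≼ # 0)
              ⇒ (∥ x ∩′ ∁′ b ∥ ≼ # 0) ⇒ (∥ y ∩′ ∁′ b ∥ ≼ # 0) ⇒ (∥ z ∩′ ∁′ b ∥ ≼ # 0) ⇒ ⊢ (# 3 ≼ ∥ b ∥)) ⁅ u ⁆ ⁅ w ⁆ ⁅ w′ ⁆ B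
              (≤-reflexive (sym (∣⁅⁆∣ u))) (≤-reflexive (sym (∣⁅⁆∣ w))) (≤-reflexive (sym (∣⁅⁆∣ w′)))
              (distinct-points u w (Adj⇒≢ {Z} {u} {w} val a)) (distinct-points u w′ (Adj⇒≢ {Z} {u} {w′} val a′)) (distinct-points w w′ w≢w′) hu hw hw′

      -- A matching of t + 2 edges has 2 (t + 2) ≤ n, so `n*S₁` gives F₁ + N Z ≤ M. The trees above
      -- Z supply the saving M / L: their blocks have product 2^(t + 2), which is at least c, so
      -- only powers of n are lost.
      matching : Valid Z → (∀ u → deg Z u ≤ 1) → Goal
      matching val d = go k₂ refl
        where
        open Matching Z val d
        open ≤-Reasoning
        sum≤M : F₁ + N Z ≤ M
        sum≤M = *-cancelˡ-≤ n {{>-nonZero n≥1}} (begin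
          n * (F₁ + N Z) ≤⟨ *-monoʳ-≤ n F₁+N≤ ⟩
          n * S₁ ≤⟨ n*S₁ ⟩
          (t + 2) * (2 * M) ≡⟨ trans (lem (t + 2) M) (cong (λ z → 2 * z * M) (sym Z#)) ⟩
          2 * ∣ Z ∣ * M ≤⟨ *-monoˡ-≤ M half-n ⟩
          n * M ∎)
          where
          lem : ∀ a M → a * (2 * M) ≡ 2 * a * M
          lem = solve-∀
        M≤ : ∀ ℓ → suc ℓ ≡ k₂ → M ≤ N Z * n ^ 2
        M≤ ℓ e = begin
          c * n ^ k₂ ≤⟨ *-monoˡ-≤ (n ^ k₂) (≤-trans c≤2^t (^-monoʳ-≤ 2 (≤-trans (m≤m+n t 2) (≤-reflexive (sym Z#))))) ⟩
          2 ^ ∣ Z ∣ * n ^ k₂ ≡⟨ cong (λ j → 2 ^ ∣ Z ∣ * n ^ j) (sym e) ⟩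
          2 ^ ∣ Z ∣ * (n * n ^ ℓ) ≡⟨ lem (2 ^ ∣ Z ∣) n (n ^ ℓ) ⟩
          2 ^ ∣ Z ∣ * n ^ ℓ * n ≡⟨ cong (_* n) (sym (matching-count ℓ (trans (cong (_+ suc ℓ) Z#) (trans (cong (t + 2 +_) e) (trans (+-assoc t 2 k₂) tk))))) ⟩
          N Z * n * n ≡⟨ lem₂ (N Z) n ⟩
          N Z * n ^ 2 ∎
          where
          lem : ∀ a n p → a * (n * p) ≡ a * p * n
          lem = solve-∀
          lem₂ : ∀ N n → N * n * n ≡ N * (n * (n * 1))
          lem₂ = solve-∀
        go : ∀ k → k ≡ k₂ → Goal
        go zero e = ⊥-elim (<-irrefl refl (lin 2 (λ t n → (2 ⋆ (t ⊹ # 2) ≼ n) ⇒ (n ≼ t ⊹ # 2) ⇒ ⊢ (# 1 ≼ # 0)) t n (subst (λ z → 2 * z ≤ n) Z# half-n) (≤-reflexive (trans (sym tk) (cong (λ k → t + suc (suc k)) (sym e))))))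
        go (suc ℓ) e = begin
          F₁ * L + M ≤⟨ +-monoʳ-≤ (F₁ * L) (≤-trans (M≤ ℓ e) (*-monoʳ-≤ (N Z) (L≥ 2 (s≤s (s≤s z≤n))))) ⟩
          F₁ * L + N Z * L ≡⟨ sym (*-distribʳ-+ L F₁ (N Z)) ⟩
          (F₁ + N Z) * L ≤⟨ *-monoˡ-≤ L sum≤M ⟩
          M * L ≡⟨ *-comm M L ⟩
          L * M ∎

    H₅ : F₁ * L + M ≤ L * M
    H₅ = cases (t ≤? 12)
      where
      orientation : Valid Z ⊎ ∃[ i ] ∃[ j ] (⁅ Fin.combine i j ⁆ ⊑ Z × ¬ (i Fin.< j))
      orientation = [ (λ all → inj₁ (λ i j → all i (∈elements i) j (∈elements j))) , (λ (i , _ , ¬i) → inj₂ (i , row i ¬i)) ]′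
          (decAll (λ i → decAll′ (λ j → (⁅ Fin.combine i j ⁆ ⊑? Z) →-dec (i Fin.<? j)) V) V)
        where
        row : ∀ i → ¬ (∀ j → j ∈ V → ⁅ Fin.combine i j ⁆ ⊑ Z → i Fin.< j) → ∃[ j ] (⁅ Fin.combine i j ⁆ ⊑ Z × ¬ (i Fin.< j))
        row i ¬i = [ (λ all → ⊥-elim (¬i all)) , (λ (j , _ , ¬j) → j , decidable-stable (⁅ Fin.combine i j ⁆ ⊑? Z) (λ ¬h → ¬j (λ h → ⊥-elim (¬h h))) , λ lt → ¬j (λ _ → lt)) ]′
          (decAll (λ j → (⁅ Fin.combine i j ⁆ ⊑? Z) →-dec (i Fin.<? j)) V)
      degrees : ∀ s → 13 + s ≡ t → Valid Z → Goal
      degrees s ts val = [ (λ d → matching val (λ u → d u (∈elements u))) , (λ (u , _ , ¬d) →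
          let (w , w′ , a , a′ , ne) = another (λ w → ⁅ code u w ⁆ ⊑? Z) Finₚ._≟_ {V} Σ-fin-≟ (≰⇒> ¬d) in high-degree s ts val u w w′ a a′ ne) ]′ (decAll (λ u → deg Z u ≤? 1) V)
      large : ∀ s → 13 + s ≡ t → Goal
      large s ts = [ degrees s ts , (λ (i , j , h , ¬lt) → invalid s ts i j h ¬lt) ]′ orientation
      cases : Dec (t ≤ 12) → Goal
      cases (yes p) = small-t p
      cases (no ¬p) = large (t ∸ 13) (m+[n∸m]≡n (≰⇒> ¬p))

-- Trees above T₀ that meet a given tree B in fewer than t edges

either-≤ : {P : Set} (d : Dec P) {x k a b : ℕ} → (P → x ≤ b) → (¬ P → x ≤ k * a) → x ≤ k * (𝟙 (¬? d) * a) + b * 𝟙 d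
either-≤ (yes p) {x} {k} {a} {b} f g = ≤-trans (f p) (≤-trans (≤-reflexive (sym (*-identityʳ b))) (m≤n+m (b * 1) (k * 0)))
either-≤ (no ¬p) {x} {k} {a} {b} f g = ≤-trans (g ¬p) (≤-trans (≤-reflexive (cong (k *_) (sym (+-identityʳ a)))) (m≤m+n (k * (a + 0)) (b * 0)))

module Avoid (n : ℕ) (n≥29 : 29 ≤ n) where

  n≥1′ : 1 ≤ n
  n≥1′ = ≤-trans (s≤s z≤n) n≥29

  open Graphs n
  open Trees n n≥1′

  private
    n^≤ : ∀ {i j} → i ≤ j → n ^ i ≤ n ^ j
    n^≤ le = ^-monoʳ-≤ n {{>-nonZero n≥1′}} le

    two-points : ∀ {u v} {D : Subset n} → ¬ (u ≡ v) → u ∈ˢ D → v ∈ˢ D → 2 ≤ ∣ D ∣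
    two-points {u} {v} {D} ne = λ hu hv → slin 3 0 (λ x y b → (# 1 ≼ ∥ x ∥) ⇒ (# 1 ≼ ∥ y ∥) ⇒ (∥ x ∩′ y ∥ ≼ # 0) ⇒ (∥ x ∩′ ∁′ b ∥ ≼ # 0) ⇒ (∥ y ∩′ ∁′ b ∥ ≼ # 0) ⇒ ⊢ (# 2 ≼ ∥ b ∥)) ⁅ u ⁆ ⁅ v ⁆ D
      (≤-reflexive (sym (∣⁅⁆∣ u))) (≤-reflexive (sym (∣⁅⁆∣ v))) (distinct-points u v ne) hu hv

    third : ∀ (x v : Fin n) → ∃[ w ] (¬ (w ≡ x) × ¬ (w ≡ v))
    third x v with dec∃ (λ w → ¬? (w Finₚ.≟ x) ×-dec ¬? (w Finₚ.≟ v)) V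
    ... | inj₁ (w , _ , h) = w , h
    ... | inj₂ none = ⊥-elim (<-irrefl refl (<-≤-trans (≤-trans (≤ᵇ⇒≤ 3 29 tt) n≥29) (begin
        n ≡⟨ sym (trans (Σ-1 V) (Listₚ.length-tabulate id)) ⟩
        Σ V (λ _ → 1) ≤⟨ Σ-mono V each ⟩
        Σ V (λ w → 𝟙 (w Finₚ.≟ x) + 𝟙 (w Finₚ.≟ v)) ≡⟨ Σ-+ V _ _ ⟩
        Σ V (λ w → 𝟙 (w Finₚ.≟ x)) + Σ V (λ w → 𝟙 (w Finₚ.≟ v)) ≤⟨ +-mono-≤ (Σ-fin-≟ x) (Σ-fin-≟ v) ⟩
        2 ∎)))
      where
      open ≤-Reasoning
      each : ∀ w → w ∈ V → 1 ≤ 𝟙 (w Finₚ.≟ x) + 𝟙 (w Finₚ.≟ v)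
      each w mw = 𝟙-or (w Finₚ.≟ x) (w Finₚ.≟ v) (λ a → decidable-stable (w Finₚ.≟ v) (λ b → none w mw (a , b)))

  module _ (B : Subset m) (tB : IsTree B) where

    -- A block {v} all of whose edges belong to B can never be joined while avoiding B.
    Good : Blocks → Set
    Good Bs = ∀ D → D ∈ Bs → ∀ v → v ∈ˢ D → ∣ D ∣ ≡ 1 → ∃[ w ] (¬ (w ≡ v) × ¬ Adj B v w)

    private
      valB : Valid B
      valB = Comp.valid (proj₂ tB)

      |B| : suc ∣ B ∣ ≡ n
      |B| = trans (+-comm 1 ∣ B ∣) (tree-size tB)

      av = avoiding B

      F : Subset m → Fin n → Fin n → ℕ
      F X u v = 𝟙 (¬? (⁅ code u v ⁆ ⊑? B)) * av (X ∪ ⁅ code u v ⁆)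

    good-merge : ∀ {X Bs} → Comp X Bs 0 → Good Bs → ∀ {C D r} → (C , D , r) ∈ pairs Bs → Good ((C ∪ D) ∷ r)
    good-merge {X} {Bs} cp good {C} {D} {r} p .(C ∪ D) (here refl) v hv e = ⊥-elim (<-irrefl refl (slin 2 0 (λ c d → (# 1 ≼ ∥ c ∥) ⇒ (# 1 ≼ ∥ d ∥) ⇒ (∥ c ∩′ d ∥ ≼ # 0) ⇒ (∥ c ∪′ d ∥ ≼ # 1) ⇒ ⊢ (# 1 ≼ # 0)) C D
      (Comp.ne cp C (proj₁ (pairs-spec {xs = Bs} {C} {D} {r} p))) (Comp.ne cp D (proj₁ (proj₂ (pairs-spec {xs = Bs} {C} {D} {r} p)))) (pair-disjointˢ cp {C} {D} {r} p) (≤-reflexive e)))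
    good-merge {X} {Bs} cp good {C} {D} {r} p E (there mE) v hv e = good E (proj₁ (proj₂ (proj₂ (pairs-spec {xs = Bs} {C} {D} {r} p))) E mE) v hv e

    cross-B : ∀ {X Bs δ} → Comp X Bs δ → Cross Bs (between (adj B)) ≤ ∣ B ∣
    cross-B {Bs = Bs} cp = *-cancelˡ-≤ 2 (begin
        2 * Cross Bs (between (adj B)) ≡⟨ cong (Cross Bs (between (adj B)) +_) (+-identityʳ _) ⟩
        Cross Bs (between (adj B)) + Cross Bs (between (adj B)) ≡⟨ sym (trans (Σ-cong (pairs Bs) (λ (C , D , _) → cong (between (adj B) C D +_) (between-sym (adj B) (adj-sym B) D C))) (Σ-+ (pairs Bs) _ _)) ⟩
        Σ (pairs Bs) (λ (C , D , _) → between (adj B) C D + between (adj B) D C) ≤⟨ m≤m+n _ _ ⟩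
        Σ (pairs Bs) (λ (C , D , _) → between (adj B) C D + between (adj B) D C) + Σ Bs (λ C → between (adj B) C C) ≡⟨ trans (Σ-pairs Bs (between (adj B))) (trans (between-total cp (adj B)) (Σ-adj B valB)) ⟩
        ∣ B ∣ + ∣ B ∣ ≡⟨ cong (∣ B ∣ +_) (sym (+-identityʳ ∣ B ∣)) ⟩
        2 * ∣ B ∣ ∎)
      where open ≤-Reasoning

    Free : Blocks → Set
    Free Bs = ∃[ C ] ∃[ D ] ∃[ r ] ((C , D , r) ∈ pairs Bs × ∃[ u ] ∃[ v ] (u ∈ˢ C × v ∈ˢ D × ¬ Adj B u v))

    free-or-full : ∀ Bs → Free Bs ⊎ (∀ C D r → (C , D , r) ∈ pairs Bs → ∀ u v → u ∈ˢ C → v ∈ˢ D → Adj B u v)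
    free-or-full Bs = [ (λ { ((C , D , r) , p , u , _ , v , _ , hu , hv , na) → inj₁ (C , D , r , p , u , v , hu , hv , na) }) , (λ none → inj₂ (full none)) ]′
        (dec∃ (λ (C , D , r) → dec∃′ (λ u → dec∃′ (λ v → (⁅ u ⁆ ⊑? C) ×-dec ((⁅ v ⁆ ⊑? D) ×-dec ¬? (⁅ code u v ⁆ ⊑? B))) V) V) (pairs Bs))
      where
      full : (∀ q → q ∈ pairs Bs → ¬ (∃[ u ] (u ∈ V × ∃[ v ] (v ∈ V × (u ∈ˢ proj₁ q × (v ∈ˢ proj₁ (proj₂ q) × ¬ Adj B u v)))))) →
        ∀ C D r → (C , D , r) ∈ pairs Bs → ∀ u v → u ∈ˢ C → v ∈ˢ D → Adj B u v
      full none C D r p u v hu hv = decidable-stable (⁅ code u v ⁆ ⊑? B) (λ na → none (C , D , r) p (u , ∈elements u , v , ∈elements v , hu , hv , na))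

    -- B has n - 1 edges, so n pairs of vertices in different blocks cannot all be edges of B.
    crowded : ∀ {X Bs δ} → Comp X Bs δ → n ≤ Cross Bs (λ C D → ∣ C ∣ * (∣ D ∣ * 1)) → Free Bs
    crowded {Bs = Bs} cp h = [ id , (λ full → ⊥-elim (<-irrefl refl (≤-trans (≤-reflexive |B|) (≤-trans h (≤-trans (Σ-mono (pairs Bs) (λ (C , D , r) p →
           ≤-trans (≤-reflexive (sym (between-const 1 C D))) (between-mono (λ _ _ → 1) (adj B) C D (λ u v hu hv → 𝟙-yes (⁅ code u v ⁆ ⊑? B) (full C D r p u v hu hv))))) (cross-B cp)))))) ]′ (free-or-full Bs)

    private
      prod≥ : ∀ a b → 1 ≤ a → 1 ≤ b → a + b ≤ a * (b * 1) + 1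
      prod≥ (suc a) (suc b) _ _ = ≤-trans (lin 3 (λ a b p → ⊢ (# 1 ⊹ a ⊹ (# 1 ⊹ b) ≼ # 2 ⊹ a ⊹ b ⊹ p)) a b (a * b)) (≤-reflexive (lem a b))
        where
        lem : ∀ a b → 2 + a + b + a * b ≡ suc a * (suc b * 1) + 1
        lem = solve-∀
      prod≥₂ : ∀ a b → 2 ≤ a → 2 ≤ b → 2 * (a + b) ≤ a * (b * 1) + 4
      prod≥₂ (suc (suc a)) (suc (suc b)) _ _ = ≤-trans (lin 3 (λ a b p → ⊢ (2 ⋆ (# 2 ⊹ a ⊹ (# 2 ⊹ b)) ≼ # 8 ⊹ 2 ⋆ a ⊹ 2 ⋆ b ⊹ p)) a b (a * b)) (≤-reflexive (lem a b))
        where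
        lem : ∀ a b → 8 + 2 * a + 2 * b + a * b ≡ suc (suc a) * (suc (suc b) * 1) + 4
        lem = solve-∀
      prod≥₂ (suc zero) b (s≤s ()) _
      prod≥₂ (suc (suc a)) (suc zero) _ (s≤s ())

    -- If one block is a single vertex, goodness supplies the free edge. Otherwise both sizes are at
    -- least 2 and |C| |D| ≥ 2n - 4 ≥ n.
    free₂ : ∀ {X C D} → Comp X (C ∷ D ∷ []) 0 → Good (C ∷ D ∷ []) → Free (C ∷ D ∷ [])
    free₂ {X} {C} {D} cp good = cases (∣ C ∣ ≟ 1) (∣ D ∣ ≟ 1)
      where
      C-alone : ∣ C ∣ ≡ 1 → ∀ v → v ∈ˢ C → ∃[ w ] (¬ (w ≡ v) × ¬ Adj B v w) → Free (C ∷ D ∷ [])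
      C-alone e v hv (w , w≢v , na) = at (block cp w)
        where
        at : ∃[ E ] (E ∈ (C ∷ D ∷ []) × w ∈ˢ E) → Free (C ∷ D ∷ [])
        at (_ , here refl , hw) = ⊥-elim (<-irrefl refl (≤-trans (two-points {w} {v} {C} w≢v hw hv) (≤-reflexive e)))
        at (_ , there (here refl) , hw) = C , D , [] , here refl , v , w , hv , hw , na
      D-alone : ∣ D ∣ ≡ 1 → ∀ v → v ∈ˢ D → ∃[ w ] (¬ (w ≡ v) × ¬ Adj B v w) → Free (C ∷ D ∷ [])
      D-alone e v hv (w , w≢v , na) = at (block cp w)
        where
        at : ∃[ E ] (E ∈ (C ∷ D ∷ []) × w ∈ˢ E) → Free (C ∷ D ∷ [])
        at (_ , there (here refl) , hw) = ⊥-elim (<-irrefl refl (≤-trans (two-points {w} {v} {D} w≢v hw hv) (≤-reflexive e)))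
        at (_ , here refl , hw) = C , D , [] , here refl , w , v , hw , hv , (λ a → na (subst (λ e → ⁅ e ⁆ ⊑ B) (code-sym w v) a))
      cases : Dec (∣ C ∣ ≡ 1) → Dec (∣ D ∣ ≡ 1) → Free (C ∷ D ∷ [])
      cases (yes e) _ = let (v , hv) = point C (Comp.ne cp C (here refl)) in C-alone e v hv (good C (here refl) v hv e)
      cases (no _) (yes e) = let (v , hv) = point D (Comp.ne cp D (there (here refl))) in D-alone e v hv (good D (there (here refl)) v hv e)
      cases (no c≢1) (no d≢1) = crowded cp (lin 3 (λ n p s → (2 ⋆ n ≼ p ⊹ # 4) ⇒ (# 4 ≼ n) ⇒ ⊢ (n ≼ p ⊹ # 0)) n (∣ C ∣ * (∣ D ∣ * 1)) 0
          (≤-trans (≤-reflexive (cong (2 *_) (sym (trans (cong (∣ C ∣ +_) (sym (+-identityʳ ∣ D ∣))) (sizes-sum cp)))))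
             (prod≥₂ ∣ C ∣ ∣ D ∣ (≤∧≢⇒< (Comp.ne cp C (here refl)) (λ e → c≢1 (sym e))) (≤∧≢⇒< (Comp.ne cp D (there (here refl))) (λ e → d≢1 (sym e)))))
          (≤-trans (≤ᵇ⇒≤ 4 29 tt) n≥29))

    free₃ : ∀ {X C D E} → Comp X (C ∷ D ∷ E ∷ []) 0 → Free (C ∷ D ∷ E ∷ [])
    free₃ {X} {C} {D} {E} cp = crowded cp (lin 7 (λ n c d e p q s → (n ≼ c ⊹ (d ⊹ (e ⊹ # 0))) ⇒ (c ⊹ d ≼ p ⊹ # 1) ⇒ (c ⊹ e ≼ q ⊹ # 1) ⇒ (# 1 ≼ c) ⇒ (# 1 ≼ s) ⇒ ⊢ (n ≼ p ⊹ (q ⊹ (s ⊹ # 0))))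
        n (∣ C ∣) (∣ D ∣) (∣ E ∣) (∣ C ∣ * (∣ D ∣ * 1)) (∣ C ∣ * (∣ E ∣ * 1)) (∣ D ∣ * (∣ E ∣ * 1))
        (≤-reflexive (sym (sizes-sum cp))) (prod≥ ∣ C ∣ ∣ D ∣ hC′ hD′) (prod≥ ∣ C ∣ ∣ E ∣ hC′ hE′) hC′ (*-mono-≤ hD′ (*-mono-≤ hE′ (≤-refl {1}))))
      where
      hC′ = Comp.ne cp C (here refl)
      hD′ = Comp.ne cp D (there (here refl))
      hE′ = Comp.ne cp E (there (there (here refl)))

    cross-av : ∀ {X Bs k} → Comp X Bs 0 → length Bs ≡ suc k → Cross Bs (between (F X)) ≡ k * av X
    cross-av {X} {Bs} {k} cp e = +-cancelʳ-≡ (av X) _ _ (trans (double-count B cp) (trans (cong (_* av X) e) (+-comm (av X) (k * av X))))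

    -- Blocks are joined along one free edge at a time. Goodness survives because a merged block is
    -- not a single vertex.
    av-positive : ∀ k {X Bs} → k ≤ 2 → length Bs ≡ suc k → Comp X Bs 0 → Good Bs → 1 ≤ av X
    av-positive zero {X} {C ∷ []} _ e cp good = ≤-trans (*-mono-≤ {1} {_} {1} (𝟙-yes (X ⊑? X) (⊑-refl X)) (𝟙-yes ((X ∩ B) ⊑? X) (slin 2 0 (λ x b → ⊢ (∥ (x ∩′ b) ∩′ ∁′ x ∥ ≼ # 0)) X B)))
      (Σ-member (λ A → 𝟙 (X ⊑? A) * 𝟙 ((A ∩ B) ⊑? X)) (⇒𝒯 (C , cp)))
    av-positive (suc k) {X} {Bs} k≤ e cp good = from-free (free k Bs k≤ e cp good)
      where
      free : ∀ k Bs → suc k ≤ 2 → length Bs ≡ suc (suc k) → Comp X Bs 0 → Good Bs → Free Bs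
      free zero (C ∷ D ∷ []) _ _ cp good = free₂ cp good
      free (suc zero) (C ∷ D ∷ E ∷ []) _ _ cp _ = free₃ cp
      free (suc (suc k)) _ (s≤s (s≤s ())) _ _ _
      from-free : Free Bs → 1 ≤ av X
      from-free (C , D , r , p , u , v , hu , hv , na) = pos (suc k) (av X) (≤-trans one (≤-reflexive (cross-av cp e)))
        where
        pos : ∀ a b → 1 ≤ a * b → 1 ≤ b
        pos a zero h = ⊥-elim (<-irrefl refl (≤-trans h (≤-reflexive (*-zeroʳ a))))
        pos a (suc b) h = s≤s z≤n
        ih : 1 ≤ av (X ∪ ⁅ code u v ⁆)
        ih = av-positive k (≤-trans (n≤1+n k) k≤) (suc-injective (trans (sym (proj₂ (proj₂ (proj₂ (proj₂ (pairs-spec {xs = Bs} {C} {D} {r} p)))))) e))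
               (proj₁ (merge cp {u} {v} {C} {D} {r} p hu hv)) (good-merge cp good {C} {D} {r} p)
        one : 1 ≤ Cross Bs (between (F X))
        one = ≤-trans (*-mono-≤ {1} {_} {1} (𝟙-yes (⁅ u ⁆ ⊑? C) hu) (≤-trans (*-mono-≤ {1} {_} {1} (𝟙-yes (⁅ v ⁆ ⊑? D) hv) (*-mono-≤ {1} {_} {1} (𝟙-yes (¬? (⁅ code u v ⁆ ⊑? B)) na) ih))
                  (Σ-member (λ v → 𝟙 (⁅ v ⁆ ⊑? D) * F X u v) (∈elements v))))
                (≤-trans (Σ-member (λ u → 𝟙 (⁅ u ⁆ ⊑? C) * Σ V (λ v → 𝟙 (⁅ v ⁆ ⊑? D) * F X u v)) (∈elements u)) (Σ-member (λ (C , D , _) → between (F X) C D) p))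

    P≤ : ∀ (Bs : Blocks) → P Bs ≤ n ^ length Bs
    P≤ [] = ≤-refl
    P≤ (C ∷ Bs) = *-mono-≤ (Subₚ.∣p∣≤n C) (P≤ Bs)

    -- The factors (k - 3)/(k - 1) of the recursion telescope to a polynomial loss.
    av-lower : ∀ s {X Bs} → length Bs ≡ 3 + s → Comp X Bs 0 → Good Bs → P Bs * n ^ (2 + s) ≤ av X * (n ^ 6 * ((2 + s) * (1 + s)))
    -- The factor (k - 3)/(k - 1) of the recursion vanishes at three blocks, so the start uses only
    -- that one avoiding tree exists, at the price n^6.
    av-lower zero {X} {Bs} e cp good = begin
        P Bs * n ^ 2 ≤⟨ *-monoˡ-≤ (n ^ 2) (≤-trans (P≤ Bs) (≤-reflexive (cong (n ^_) e))) ⟩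
        n ^ 3 * n ^ 2 ≡⟨ sym (^-distribˡ-+-* n 3 2) ⟩
        n ^ 5 ≤⟨ n^≤ {5} {6} (≤ᵇ⇒≤ 5 6 tt) ⟩
        n ^ 6 ≤⟨ m≤m*n (n ^ 6) 2 ⟩
        n ^ 6 * 2 ≡⟨ sym (*-identityˡ _) ⟩
        1 * (n ^ 6 * 2) ≤⟨ *-monoˡ-≤ (n ^ 6 * 2) (av-positive 2 ≤-refl e cp good) ⟩
        av X * (n ^ 6 * 2) ∎
      where open ≤-Reasoning
    av-lower (suc s) {X} {Bs} e cp good = *-cancelʳ-≤ _ _ (suc s) (+-cancelʳ-≤ (2 * n * Q) _ _ (begin
        P Bs * n ^ (3 + s) * suc s + 2 * n * Q ≡⟨ lem₁ (P Bs) n (n ^ (2 + s)) s ⟩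
        (3 + s) * n * Q ≡⟨ cong (_* Q) (sym cross-size) ⟩
        Cross Bs (λ C D → ∣ C ∣ + ∣ D ∣) * Q ≡⟨ sym (Σ-*ʳ (pairs Bs) Q _) ⟩
        Σ (pairs Bs) (λ (C , D , _) → (∣ C ∣ + ∣ D ∣) * Q) ≤⟨ Σ-mono (pairs Bs) (λ (C , D , r) p → cell C D r p) ⟩
        Σ (pairs Bs) (λ (C , D , _) → K * between (F X) C D + 2 * Q * between (adj B) C D) ≡⟨ trans (Σ-+ (pairs Bs) _ _) (cong₂ _+_ (Σ-*ˡ (pairs Bs) K _) (Σ-*ˡ (pairs Bs) (2 * Q) _)) ⟩
        K * Cross Bs (between (F X)) + 2 * Q * Cross Bs (between (adj B)) ≤⟨ +-mono-≤ (≤-reflexive (cong (K *_) (cross-av {k = 3 + s} cp e))) (*-monoʳ-≤ (2 * Q) (≤-trans (cross-B cp) (≤-trans (n≤1+n ∣ B ∣) (≤-reflexive |B|)))) ⟩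
        K * ((3 + s) * av X) + 2 * Q * n ≡⟨ lem₂ (n ^ 6) s (av X) Q n ⟩
        av X * (n ^ 6 * ((3 + s) * (2 + s))) * suc s + 2 * n * Q ∎))
      where
      open ≤-Reasoning
      K = n ^ 6 * ((2 + s) * (1 + s))
      Q = P Bs * n ^ (2 + s)
      lem₁ : ∀ p n q s → p * (n * q) * suc s + 2 * n * (p * q) ≡ (3 + s) * n * (p * q)
      lem₁ = solve-∀
      lem₂ : ∀ c s a Q n → c * ((2 + s) * (1 + s)) * ((3 + s) * a) + 2 * Q * n ≡ a * (c * ((3 + s) * (2 + s))) * suc s + 2 * n * Q
      lem₂ = solve-∀
      cross-size : Cross Bs (λ C D → ∣ C ∣ + ∣ D ∣) ≡ (3 + s) * n
      cross-size = +-cancelʳ-≡ n _ _ (trans (Cross-sizes cp) (trans (cong (_* n) e) (+-comm n ((3 + s) * n))))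
      cell : ∀ C D r → (C , D , r) ∈ pairs Bs → (∣ C ∣ + ∣ D ∣) * Q ≤ K * between (F X) C D + 2 * Q * between (adj B) C D
      cell C D r p = begin
          (∣ C ∣ + ∣ D ∣) * Q ≡⟨ sym (*-assoc (∣ C ∣ + ∣ D ∣) (P Bs) _) ⟩
          (∣ C ∣ + ∣ D ∣) * P Bs * n ^ (2 + s) ≡⟨ cong (_* n ^ (2 + s)) (sym (merged-P cp {C} {D} {r} p)) ⟩
          ∣ C ∣ * (∣ D ∣ * P ((C ∪ D) ∷ r)) * n ^ (2 + s) ≡⟨ lem₃ ∣ C ∣ ∣ D ∣ (P ((C ∪ D) ∷ r)) (n ^ (2 + s)) ⟩
          ∣ C ∣ * (∣ D ∣ * (P ((C ∪ D) ∷ r) * n ^ (2 + s))) ≡⟨ sym (between-const (P ((C ∪ D) ∷ r) * n ^ (2 + s)) C D) ⟩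
          between (λ _ _ → P ((C ∪ D) ∷ r) * n ^ (2 + s)) C D ≤⟨ between-mono (λ _ _ → P ((C ∪ D) ∷ r) * n ^ (2 + s)) G C D each ⟩
          between G C D ≡⟨ split-between ⟩
          between (λ u v → K * F X u v) C D + between (λ u v → 2 * Q * adj B u v) C D ≡⟨ cong₂ _+_ (between-*ˡ K (F X) C D) (between-*ˡ (2 * Q) (adj B) C D) ⟩
          K * between (F X) C D + 2 * Q * between (adj B) C D ∎
        where
        lem₃ : ∀ c d p q → c * (d * p) * q ≡ c * (d * (p * q))
        lem₃ = solve-∀
        G : Fin n → Fin n → ℕ
        G u v = K * F X u v + 2 * Q * adj B u v
        split-between : between G C D ≡ between (λ u v → K * F X u v) C D + between (λ u v → 2 * Q * adj B u v) C D
        split-between = trans (Σ-cong V (λ u → trans (cong (𝟙 (⁅ u ⁆ ⊑? C) *_) (trans (Σ-cong V (λ v → *-distribˡ-+ (𝟙 (⁅ v ⁆ ⊑? D)) (K * F X u v) _)) (Σ-+ V _ _))) (*-distribˡ-+ (𝟙 (⁅ u ⁆ ⊑? C)) _ _))) (Σ-+ V _ _)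
        -- An edge of B contributes nothing to `F X`. Its share, at most 2 Q by `merged-P≤`, is
        -- added back instead, and as B has fewer than n crossing edges this amounts to at most 2 n
        -- Q in total.
        each : ∀ u v → u ∈ˢ C → v ∈ˢ D → P ((C ∪ D) ∷ r) * n ^ (2 + s) ≤ G u v
        each u v hu hv = either-≤ (⁅ code u v ⁆ ⊑? B) {_} {K} {av (X ∪ ⁅ code u v ⁆)} {2 * Q}
          (λ _ → ≤-trans (*-monoˡ-≤ (n ^ (2 + s)) (merged-P≤ cp {C} {D} {r} p)) (≤-reflexive (*-assoc 2 (P Bs) (n ^ (2 + s)))))
          (λ _ → ≤-trans (av-lower s (suc-injective (trans (sym (proj₂ (proj₂ (proj₂ (proj₂ (pairs-spec {xs = Bs} {C} {D} {r} p)))))) e)) (proj₁ (merge cp {u} {v} {C} {D} {r} p hu hv)) (good-merge cp good {C} {D} {r} p))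
                       (≤-reflexive (*-comm (av (X ∪ ⁅ code u v ⁆)) K)))

    blocks≤n : ∀ {X Bs} → Comp X Bs 0 → length Bs ≤ n
    blocks≤n {X} {Bs} cp = ≤-trans (m≤n+m (length Bs) ∣ X ∣) (≤-reflexive (trans (Comp.size cp) (+-identityʳ n)))

    -- `av-lower` is set against Moon's formula: for k blocks the factor (k - 1)(k - 2) is at most
    -- n^2, one n of which is already present in `forest-count`.
    avoid-good : ∀ {X Bs} → Comp X Bs 0 → Good Bs → N X ≤ n ^ 7 * av X
    avoid-good {X} {Bs} cp good = *-cancelʳ-≤ _ _ n {{>-nonZero n≥1′}} (go (length Bs) refl)
      where
      open ≤-Reasoning
      lem : ∀ a n p → a * (p * n) ≡ p * a * n
      lem = solve-∀
      go : ∀ l → l ≡ length Bs → N X * n ≤ n ^ 7 * av X * n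
      go zero e = ⊥-elim (<-irrefl refl (≤-trans n≥1′ (≤-reflexive (trans (sym (sizes-sum cp)) (empty Bs (sym e))))))
        where
        empty : ∀ (Bs : Blocks) → length Bs ≡ 0 → Σ Bs ∣_∣ ≡ 0
        empty [] _ = refl
      go (suc (suc (suc s))) e = begin
        N X * n ≡⟨ forest-count (2 + s) cp (sym e) ⟩
        P Bs * n ^ (2 + s) ≤⟨ av-lower s (sym e) cp good ⟩
        av X * (n ^ 6 * ((2 + s) * (1 + s))) ≤⟨ *-monoʳ-≤ (av X) (*-monoʳ-≤ (n ^ 6) (*-mono-≤ (≤-trans (n≤1+n _) 3+s≤n) (≤-trans (≤-trans (n≤1+n _) (n≤1+n _)) 3+s≤n))) ⟩
        av X * (n ^ 6 * (n * n)) ≡⟨ lem′ (av X) (n ^ 6) n ⟩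
        n ^ 7 * av X * n ∎
        where
        3+s≤n : 3 + s ≤ n
        3+s≤n = ≤-trans (≤-reflexive e) (blocks≤n cp)
        lem′ : ∀ a p n → a * (p * (n * n)) ≡ n * p * a * n
        lem′ = solve-∀
      go (suc zero) e = small 0 z≤n (sym e)
        where
        small : ∀ k → k ≤ 1 → length Bs ≡ suc k → N X * n ≤ n ^ 7 * av X * n
        small k k≤ e′ = begin
          N X * n ≡⟨ forest-count k cp e′ ⟩
          P Bs * n ^ k ≤⟨ *-mono-≤ (≤-trans (P≤ Bs) (≤-trans (≤-reflexive (cong (n ^_) e′)) (n^≤ (s≤s k≤)))) (n^≤ k≤) ⟩
          n ^ 2 * n ^ 1 ≡⟨ sym (^-distribˡ-+-* n 2 1) ⟩
          n ^ 3 ≤⟨ n^≤ {3} {8} (≤ᵇ⇒≤ 3 8 tt) ⟩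
          n ^ 8 ≡⟨ trans (*-comm n (n ^ 7)) (sym (*-identityˡ _)) ⟩
          1 * (n ^ 7 * n) ≤⟨ *-monoˡ-≤ (n ^ 7 * n) (av-positive k (≤-trans k≤ (s≤s z≤n)) e′ cp good) ⟩
          av X * (n ^ 7 * n) ≡⟨ lem (av X) n (n ^ 7) ⟩
          n ^ 7 * av X * n ∎
      go (suc (suc zero)) e = begin
          N X * n ≡⟨ forest-count 1 cp (sym e) ⟩
          P Bs * n ^ 1 ≤⟨ *-monoˡ-≤ (n ^ 1) (≤-trans (P≤ Bs) (≤-reflexive (cong (n ^_) (sym e)))) ⟩
          n ^ 2 * n ^ 1 ≡⟨ sym (^-distribˡ-+-* n 2 1) ⟩
          n ^ 3 ≤⟨ n^≤ {3} {8} (≤ᵇ⇒≤ 3 8 tt) ⟩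
          n ^ 8 ≡⟨ trans (*-comm n (n ^ 7)) (sym (*-identityˡ _)) ⟩
          1 * (n ^ 7 * n) ≤⟨ *-monoˡ-≤ (n ^ 7 * n) (av-positive 1 (s≤s z≤n) (sym e) cp good) ⟩
          av X * (n ^ 7 * n) ≡⟨ lem (av X) n (n ^ 7) ⟩
          n ^ 7 * av X * n ∎

    module _ (t : ℕ) (t≥2 : 2 ≤ t) (T₀ : Subset m) (T₀# : ∣ T₀ ∣ ≡ t) (T₀⋢B : ¬ (T₀ ⊑ B)) where

      missing : ℕ
      missing = Σ 𝒯 (λ A → 𝟙 ((T₀ ⊑? A) ×-dec (∣ A ∩ B ∣ <? t)))

      private
        -- A tree above T₀ that meets B only inside T₀ shares at most |T₀ ∩ B| < t edges with B.
        good-case : ∀ {Bs} → Comp T₀ Bs 0 → Good Bs → N T₀ ≤ n ^ 10 * missing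
        good-case cp good = ≤-trans (avoid-good cp good) (*-mono-≤ (n^≤ {7} {10} (≤ᵇ⇒≤ 7 10 tt)) (Σ-mono′ 𝒯 (λ A → 𝟙*-≤ (T₀ ⊑? A) (λ le → 𝟙-if ((A ∩ B) ⊑? T₀) (λ av≤ →
          𝟙-yes ((T₀ ⊑? A) ×-dec (∣ A ∩ B ∣ <? t)) (le , slin 3 1 (λ a b s t → (∥ (a ∩′ b) ∩′ ∁′ s ∥ ≼ # 0) ⇒ (# 1 ≼ ∥ s ∩′ ∁′ b ∥) ⇒ (∥ s ∥ ≼ t) ⇒ ⊢ (# 1 ⊹ ∥ a ∩′ b ∥ ≼ t)) A B T₀ t av≤ (≰⇒> T₀⋢B) (≤-reflexive T₀#)))))))

        -- B is the star at v, and v is isolated in T₀: trees containing T₀ and having v as a leaf work.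
        star-case : ∀ {Bs} → Comp T₀ Bs 0 → ∀ D v → D ∈ Bs → v ∈ˢ D → ∣ D ∣ ≡ 1 → (∀ w → ¬ (w ≡ v) → Adj B v w) → N T₀ ≤ n ^ 10 * missing
        star-case {Bs} cp D v mD hv D# star = attach (pair-or-same (block cp v) (block cp p))
          where
          p = proj₁ (third v v)
          p≢v : ¬ (p ≡ v)
          p≢v = proj₁ (proj₂ (third v v))
          v≢p : ¬ (v ≡ p)
          v≢p e = p≢v (sym e)
          lonely : ∀ w → ¬ (w ≡ v) → w ∈ˢ D → ⊥
          lonely w ne hw = <-irrefl refl (≤-trans (two-points {w} {v} {D} ne hw hv) (≤-reflexive D#))
          adj-flip : ∀ {X} x w → Adj X x w → Adj X w x
          adj-flip {X} x w = subst (λ e → ⁅ e ⁆ ⊑ X) (code-sym x w)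
          -- An edge of B away from v would close a triangle with two edges of the star.
          two-centres : ∀ x w → Adj B x w → ¬ (x ≡ v) → ¬ (w ≡ v) → ⊥
          two-centres x w a x≢v w≢v = cyc (block cpX x)
            where
            e = code x w
            X = B ∩ ∁ ⁅ e ⁆
            X⊑ : X ⊑ B
            X⊑ = slin 2 0 (λ b e → ⊢ (∥ (b ∩′ ∁′ e) ∩′ ∁′ b ∥ ≼ # 0)) B ⁅ e ⁆
            cpX = proj₂ (subforest {X} {B} tB X⊑)
            x≢w : ¬ (x ≡ w)
            x≢w = Adj⇒≢ {B} {x} {w} valB a
            keep : ∀ f → ¬ (f ≡ e) → ⁅ f ⁆ ⊑ B → ⁅ f ⁆ ⊑ X
            keep f ne h = slin 3 0 (λ f e b → (∥ f ∩′ ∁′ b ∥ ≼ # 0) ⇒ (∥ f ∩′ e ∥ ≼ # 0) ⇒ ⊢ (∥ f ∩′ ∁′ (b ∩′ ∁′ e) ∥ ≼ # 0)) ⁅ f ⁆ ⁅ e ⁆ B h (distinct-points f e ne)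
            xv : Adj X x v
            xv = keep (code x v) (λ q → [ (λ (_ , r) → w≢v (sym r)) , (λ (_ , r) → x≢v (sym r)) ]′ (code-inj x v x w q)) (adj-flip {B} v x (star x x≢v))
            vw : Adj X v w
            vw = keep (code v w) (λ q → [ (λ (r , _) → x≢v (sym r)) , (λ (r , _) → w≢v (sym r)) ]′ (code-inj v w x w q)) (star w w≢v)
            cyc : ∃[ C ] (C ∈ proj₁ (subforest {X} {B} tB X⊑) × x ∈ˢ C) → ⊥
            cyc (C , mC , hx) = <-irrefl refl (slin 2 0 (λ e b → (# 1 ≼ ∥ e ∥) ⇒ (∥ e ∩′ ∁′ (b ∩′ ∁′ e) ∥ ≼ # 0) ⇒ ⊢ (# 1 ≼ # 0)) ⁅ e ⁆ B (≤-reflexive (sym (∣⁅⁆∣ e)))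
              (no-inner {X} {B} tB X⊑ cpX {C} {x} {w} mC hx (Comp.closed cpX C mC v w (Comp.closed cpX C mC x v hx xv) vw) a))
          only-star : ∀ x w → Adj B x w → x ≡ v ⊎ w ≡ v
          only-star x w a = cases (x Finₚ.≟ v) (w Finₚ.≟ v)
            where
            cases : Dec (x ≡ v) → Dec (w ≡ v) → x ≡ v ⊎ w ≡ v
            cases (yes e) _ = inj₁ e
            cases (no _) (yes e) = inj₂ e
            cases (no x≢v) (no w≢v) = ⊥-elim (two-centres x w a x≢v w≢v)
          T₀∩B : ∣ T₀ ∩ B ∣ ≤ 0
          T₀∩B = ≮⇒≥ λ lt → clash (point (T₀ ∩ B) lt)
            where
            clash : ∃[ f ] (⁅ f ⁆ ⊑ T₀ ∩ B) → ⊥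
            clash (f , hf) = ends (edge-ends valB f (⊑-trans ⁅ f ⁆ (T₀ ∩ B) B hf (slin 2 0 (λ a b → ⊢ (∥ (a ∩′ b) ∩′ ∁′ b ∥ ≼ # 0)) T₀ B)))
              where
              ends : ∃[ x ] ∃[ w ] (f ≡ code x w × ¬ (x ≡ w) × x Fin.< w × f ≡ Fin.combine x w) → ⊥
              ends (x , w , eq , x≢w , _) = [ at-x , at-w ]′ (only-star x w aB)
                where
                aT : Adj T₀ x w
                aT = subst (λ g → ⁅ g ⁆ ⊑ T₀) eq (⊑-trans ⁅ f ⁆ (T₀ ∩ B) T₀ hf (slin 2 0 (λ a b → ⊢ (∥ (a ∩′ b) ∩′ ∁′ a ∥ ≼ # 0)) T₀ B))
                aB : Adj B x w
                aB = subst (λ g → ⁅ g ⁆ ⊑ B) eq (⊑-trans ⁅ f ⁆ (T₀ ∩ B) B hf (slin 2 0 (λ a b → ⊢ (∥ (a ∩′ b) ∩′ ∁′ b ∥ ≼ # 0)) T₀ B))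
                at-x : x ≡ v → ⊥
                at-x e = lonely w (λ r → x≢w (trans e (sym r))) (Comp.closed cp D mD v w hv (subst (λ z → Adj T₀ z w) e aT))
                at-w : w ≡ v → ⊥
                at-w e = lonely x (λ r → x≢w (trans r (sym e))) (Comp.closed cp D mD v x hv (adj-flip {T₀} x v (subst (λ z → Adj T₀ x z) e aT)))
          e₀ = code v p
          S₁ = T₀ ∪ ⁅ e₀ ⁆
          -- Once v has been attached to p it is not a single block, and no other vertex is joined
          -- in B to all the rest.
          good₁ : ∀ {Bs₁} → Comp S₁ Bs₁ 0 → Good Bs₁
          good₁ cp₁ E mE x hx E# = away (λ { refl → <-irrefl refl (≤-trans (two-points {v} {p} {E} v≢p hx (Comp.closed cp₁ E mE v p hx (new-edge T₀ v p))) (≤-reflexive E#)) })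
            where
            away : ¬ (x ≡ v) → ∃[ w ] (¬ (w ≡ x) × ¬ Adj B x w)
            away x≢v = let (w , w≢x , w≢v) = third x v in w , w≢x , λ a → [ x≢v , w≢v ]′ (only-star x w a)
          -- T₀ and B have no edge in common, so these trees share at most the edge `e₀` with B, and
          -- one edge is fewer than t because t ≥ 2.
          av≤ : av S₁ ≤ missing
          av≤ = Σ-mono′ 𝒯 (λ A → 𝟙*-≤ (S₁ ⊑? A) (λ le → 𝟙-if ((A ∩ B) ⊑? S₁) (λ av≤ → 𝟙-yes ((T₀ ⊑? A) ×-dec (∣ A ∩ B ∣ <? t))
            ( slin 3 0 (λ s e a → (∥ (s ∪′ e) ∩′ ∁′ a ∥ ≼ # 0) ⇒ ⊢ (∥ s ∩′ ∁′ a ∥ ≼ # 0)) T₀ ⁅ e₀ ⁆ A le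
            , slin 4 1 (λ s e a b t → (∥ (a ∩′ b) ∩′ ∁′ (s ∪′ e) ∥ ≼ # 0) ⇒ (∥ s ∩′ b ∥ ≼ # 0) ⇒ (∥ e ∥ ≼ # 1) ⇒ (# 2 ≼ t) ⇒ ⊢ (# 1 ⊹ ∥ a ∩′ b ∥ ≼ t)) T₀ ⁅ e₀ ⁆ A B t av≤ T₀∩B (≤-reflexive (∣⁅⁆∣ e₀)) t≥2))))
          finish : ∀ {C E r x y} → (C , E , r) ∈ pairs Bs → x ∈ˢ C → y ∈ˢ E → e₀ ≡ code x y → N T₀ ≤ n ^ 10 * missing
          finish {C} {E} {r} {x} {y} pr hx hy eq = begin
              N T₀ ≤⟨ N≤ ⟩
              n ^ 3 * N S₁ ≤⟨ *-monoʳ-≤ (n ^ 3) (≤-trans (avoid-good cp₁ (good₁ cp₁)) (*-monoʳ-≤ (n ^ 7) av≤)) ⟩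
              n ^ 3 * (n ^ 7 * missing) ≡⟨ trans (sym (*-assoc (n ^ 3) (n ^ 7) missing)) (cong (_* missing) (sym (^-distribˡ-+-* n 3 7))) ⟩
              n ^ 10 * missing ∎
            where
            open ≤-Reasoning
            cp₁ : Comp S₁ ((C ∪ E) ∷ r) 0
            cp₁ = subst (λ f → Comp (T₀ ∪ ⁅ f ⁆) ((C ∪ E) ∷ r) 0) (sym eq) (proj₁ (merge cp {x} {y} {C} {E} {r} pr hx hy))
            spec = pairs-spec {xs = Bs} {C} {E} {r} pr
            P₁ = P ((C ∪ E) ∷ r)
            PBs≤ : P Bs ≤ n * (n * P₁)
            PBs≤ = begin
              P Bs ≡⟨ sym (*-identityˡ (P Bs)) ⟩
              1 * P Bs ≤⟨ *-monoˡ-≤ (P Bs) (≤-trans (Comp.ne cp C (proj₁ spec)) (m≤m+n ∣ C ∣ ∣ E ∣)) ⟩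
              (∣ C ∣ + ∣ E ∣) * P Bs ≡⟨ sym (merged-P cp {C} {E} {r} pr) ⟩
              ∣ C ∣ * (∣ E ∣ * P₁) ≤⟨ *-mono-≤ (Subₚ.∣p∣≤n C) (*-monoˡ-≤ P₁ (Subₚ.∣p∣≤n E)) ⟩
              n * (n * P₁) ∎
            N≤ : N T₀ ≤ n ^ 3 * N S₁
            N≤ = *-cancelʳ-≤ _ _ n {{>-nonZero n≥1′}} (begin
              N T₀ * n ≡⟨ forest-count (suc (length r)) cp (proj₂ (proj₂ (proj₂ (proj₂ spec)))) ⟩
              P Bs * n ^ suc (length r) ≤⟨ *-monoˡ-≤ (n ^ suc (length r)) PBs≤ ⟩
              n * (n * P₁) * (n * n ^ length r) ≡⟨ lem n P₁ (n ^ length r) ⟩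
              n ^ 3 * (P₁ * n ^ length r) ≡⟨ cong (n ^ 3 *_) (sym (forest-count (length r) cp₁ refl)) ⟩
              n ^ 3 * (N S₁ * n) ≡⟨ sym (*-assoc (n ^ 3) (N S₁) n) ⟩
              n ^ 3 * N S₁ * n ∎)
              where
              lem : ∀ n p q → n * (n * p) * (n * q) ≡ n * (n * (n * 1)) * (p * q)
              lem = solve-∀
          attach : _ → N T₀ ≤ n ^ 10 * missing
          attach (inj₁ (E , mE , hv′ , hp)) = ⊥-elim (lonely p p≢v (closed-path cp mD hv (Comp.conn cp E mE v p hv′ hp)))
          attach (inj₂ (C , E , r , pr , inj₁ (hv′ , hp))) = finish {C} {E} {r} {v} {p} pr hv′ hp refl
          attach (inj₂ (C , E , r , pr , inj₂ (hp , hv′))) = finish {C} {E} {r} {p} {v} pr hp hv′ (code-sym v p)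

      H₄ : N T₀ ≤ n ^ 10 * missing
      H₄ = positive (N T₀) (λ h → go (N≥1⇒ T₀ h))
        where
        positive : ∀ a {b} → (1 ≤ a → a ≤ b) → a ≤ b
        positive zero h = z≤n
        positive (suc a) h = h (s≤s z≤n)
        go : ∃[ A ] (A ∈ 𝒯 × T₀ ⊑ A) → N T₀ ≤ n ^ 10 * missing
        go (A , mA , le) = cases (dec∃ (λ D → dec∃′ (λ v → (⁅ v ⁆ ⊑? D) ×-dec ((∣ D ∣ ≟ 1) ×-dec decAll′ (λ w → ¬? (w Finₚ.≟ v) →-dec (⁅ code v w ⁆ ⊑? B)) V)) V) Bs)
          where
          sub = subforest (𝒯⇒ mA) le
          Bs = proj₁ sub
          cp : Comp T₀ Bs 0
          cp = proj₂ sub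
          cases : _ → N T₀ ≤ n ^ 10 * missing
          cases (inj₁ (D , mD , v , _ , hv , D# , star)) = star-case cp D v mD hv D# (λ w ne → star w (∈elements w) ne)
          cases (inj₂ none) = good-case cp good
            where
            good : Good Bs
            good D mD v hv D# = [ (λ all → ⊥-elim (none D mD (v , ∈elements v , hv , D# , all))) , (λ (w , _ , ¬imp) → w , (λ e → ¬imp (λ ne → ⊥-elim (ne e))) , λ a → ¬imp (λ _ → a)) ]′
              (decAll (λ w → ¬? (w Finₚ.≟ v) →-dec (⁅ code v w ⁆ ⊑? B)) V)

-- Each part satisfies y q^y (q+1)^q ≤ q^(q+1) (q+1)^y, with equality for y ∈ {q , q + 1}; multiply over the parts.

module _ (q : ℕ) where
  private
    above : ∀ d → (q + d) * q ^ d ≤ q * suc q ^ d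
    above zero = ≤-reflexive (lem q)
      where
      lem : ∀ q → (q + 0) * 1 ≡ q * 1
      lem = solve-∀
    above (suc d) = begin
        (q + suc d) * (q * q ^ d) ≡⟨ lem₁ q d (q ^ d) ⟩
        q * ((q + d) * q ^ d) + q * q ^ d ≤⟨ +-mono-≤ (*-monoʳ-≤ q (above d)) (*-monoʳ-≤ q (^-monoˡ-≤ d (n≤1+n q))) ⟩
        q * (q * suc q ^ d) + q * suc q ^ d ≡⟨ lem₂ q (suc q ^ d) ⟩
        q * (suc q * suc q ^ d) ∎
      where
      open ≤-Reasoning
      lem₁ : ∀ q d p → (q + suc d) * (q * p) ≡ q * ((q + d) * p) + q * p
      lem₁ = solve-∀
      lem₂ : ∀ q p → q * (q * p) + q * p ≡ q * (suc q * p)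
      lem₂ = solve-∀

    below : ∀ y d → y + d ≡ q → y * suc q ^ d ≤ q * q ^ d
    below y zero e = *-monoˡ-≤ 1 (≤-reflexive (trans (sym (+-identityʳ y)) e))
    below y (suc d) e = begin
        y * (suc q * suc q ^ d) ≡⟨ sym (*-assoc y (suc q) _) ⟩
        y * suc q * suc q ^ d ≤⟨ *-monoˡ-≤ (suc q ^ d) step ⟩
        q * suc y * suc q ^ d ≡⟨ *-assoc q (suc y) _ ⟩
        q * (suc y * suc q ^ d) ≤⟨ *-monoʳ-≤ q (below (suc y) d (trans (sym (+-suc y d)) e)) ⟩
        q * (q * q ^ d) ∎
      where
      open ≤-Reasoning
      step : y * suc q ≤ q * suc y
      step = ≤-trans (≤-reflexive (lem₁ y q)) (≤-trans (+-monoˡ-≤ (y * q) (≤-trans (m≤m+n y (suc d)) (≤-reflexive e))) (≤-reflexive (lem₂ y q)))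
        where
        lem₁ : ∀ y q → y * suc q ≡ y + y * q
        lem₁ = solve-∀
        lem₂ : ∀ y q → q + y * q ≡ q * suc y
        lem₂ = solve-∀

    a b : ℕ
    a = suc q ^ q
    b = q * q ^ q

    part≤ : ∀ y → y * q ^ y * a ≤ b * suc q ^ y
    part≤ y with ≤-total q y
    ... | inj₁ q≤y = subst (λ y → y * q ^ y * a ≤ b * suc q ^ y) (m+[n∸m]≡n q≤y) (begin
        (q + d) * q ^ (q + d) * a ≡⟨ cong (λ e → (q + d) * e * a) (^-distribˡ-+-* q q d) ⟩
        (q + d) * (q ^ q * q ^ d) * a ≡⟨ lem₁ (q + d) (q ^ q) (q ^ d) a ⟩
        (q + d) * q ^ d * (q ^ q * a) ≤⟨ *-monoˡ-≤ (q ^ q * a) (above d) ⟩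
        q * suc q ^ d * (q ^ q * a) ≡⟨ lem₂ q (suc q ^ d) (q ^ q) a ⟩
        b * (a * suc q ^ d) ≡⟨ cong (b *_) (sym (^-distribˡ-+-* (suc q) q d)) ⟩
        b * suc q ^ (q + d) ∎)
      where
      open ≤-Reasoning
      d = y ∸ q
      lem₁ : ∀ x p r a → x * (p * r) * a ≡ x * r * (p * a)
      lem₁ = solve-∀
      lem₂ : ∀ q r p a → q * r * (p * a) ≡ q * p * (a * r)
      lem₂ = solve-∀
    ... | inj₂ y≤q = begin
        y * q ^ y * a ≡⟨ cong (λ e → y * q ^ y * suc q ^ e) (sym (m+[n∸m]≡n y≤q)) ⟩
        y * q ^ y * suc q ^ (y + d) ≡⟨ cong (y * q ^ y *_) (^-distribˡ-+-* (suc q) y d) ⟩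
        y * q ^ y * (suc q ^ y * suc q ^ d) ≡⟨ lem₁ y (q ^ y) (suc q ^ y) (suc q ^ d) ⟩
        y * suc q ^ d * (q ^ y * suc q ^ y) ≤⟨ *-monoˡ-≤ (q ^ y * suc q ^ y) (below y d (m+[n∸m]≡n y≤q)) ⟩
        q * q ^ d * (q ^ y * suc q ^ y) ≡⟨ lem₂ q (q ^ d) (q ^ y) (suc q ^ y) ⟩
        q * (q ^ y * q ^ d) * suc q ^ y ≡⟨ cong (λ e → q * e * suc q ^ y) (trans (sym (^-distribˡ-+-* q y d)) (cong (q ^_) (m+[n∸m]≡n y≤q))) ⟩
        b * suc q ^ y ∎
      where
      open ≤-Reasoning
      d = q ∸ y
      lem₁ : ∀ y p r s → y * p * (r * s) ≡ y * s * (p * r)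
      lem₁ = solve-∀
      lem₂ : ∀ q r p s → q * r * (p * s) ≡ q * (p * r) * s
      lem₂ = solve-∀

    part≡ : ∀ y → y ≡ q ⊎ y ≡ suc q → y * q ^ y * a ≡ b * suc q ^ y
    part≡ _ (inj₁ refl) = refl
    part≡ _ (inj₂ refl) = lem q (q ^ q) a
      where
      lem : ∀ q p a → suc q * (q * p) * a ≡ q * p * (suc q * a)
      lem = solve-∀

    list≤ : ∀ ys → Π id ys * q ^ Σ ys id * a ^ length ys ≤ b ^ length ys * suc q ^ Σ ys id
    list≤ [] = ≤-refl
    list≤ (y ∷ ys) = begin
        y * Π id ys * q ^ (y + Σ ys id) * (a * a ^ length ys) ≡⟨ cong (λ e → y * Π id ys * e * (a * a ^ length ys)) (^-distribˡ-+-* q y (Σ ys id)) ⟩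
        y * Π id ys * (q ^ y * q ^ Σ ys id) * (a * a ^ length ys) ≡⟨ lem y (Π id ys) (q ^ y) (q ^ Σ ys id) a (a ^ length ys) ⟩
        y * q ^ y * a * (Π id ys * q ^ Σ ys id * a ^ length ys) ≤⟨ *-mono-≤ (part≤ y) (list≤ ys) ⟩
        b * suc q ^ y * (b ^ length ys * suc q ^ Σ ys id) ≡⟨ [m*n]*[o*p]≡[m*o]*[n*p] b (suc q ^ y) (b ^ length ys) _ ⟩
        b * b ^ length ys * (suc q ^ y * suc q ^ Σ ys id) ≡⟨ cong (b * b ^ length ys *_) (sym (^-distribˡ-+-* (suc q) y (Σ ys id))) ⟩
        b * b ^ length ys * suc q ^ (y + Σ ys id) ∎
      where
      open ≤-Reasoning
      lem : ∀ y p r s a t → y * p * (r * s) * (a * t) ≡ y * r * a * (p * s * t)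
      lem = solve-∀

    list≡ : ∀ ys → (∀ y → y ∈ ys → y ≡ q ⊎ y ≡ suc q) → Π id ys * q ^ Σ ys id * a ^ length ys ≡ b ^ length ys * suc q ^ Σ ys id
    list≡ [] h = refl
    list≡ (y ∷ ys) h = begin
        y * Π id ys * q ^ (y + Σ ys id) * (a * a ^ length ys) ≡⟨ cong (λ e → y * Π id ys * e * (a * a ^ length ys)) (^-distribˡ-+-* q y (Σ ys id)) ⟩
        y * Π id ys * (q ^ y * q ^ Σ ys id) * (a * a ^ length ys) ≡⟨ lem y (Π id ys) (q ^ y) (q ^ Σ ys id) a (a ^ length ys) ⟩
        y * q ^ y * a * (Π id ys * q ^ Σ ys id * a ^ length ys) ≡⟨ cong₂ _*_ (part≡ y (h y (here refl))) (list≡ ys (λ z mz → h z (there mz))) ⟩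
        b * suc q ^ y * (b ^ length ys * suc q ^ Σ ys id) ≡⟨ [m*n]*[o*p]≡[m*o]*[n*p] b (suc q ^ y) (b ^ length ys) _ ⟩
        b * b ^ length ys * (suc q ^ y * suc q ^ Σ ys id) ≡⟨ cong (b * b ^ length ys *_) (sym (^-distribˡ-+-* (suc q) y (Σ ys id))) ⟩
        b * b ^ length ys * suc q ^ (y + Σ ys id) ∎
      where
      open ≡-Reasoning
      lem : ∀ y p r s a t → y * p * (r * s) * (a * t) ≡ y * r * a * (p * s * t)
      lem = solve-∀

  balanced-max : 1 ≤ q → ∀ {n ℓ xs ys} → Parts n ℓ xs → Parts n ℓ ys → (∀ x → x ∈ xs → x ≡ q ⊎ x ≡ suc q) → Π id ys ≤ Π id xs
  balanced-max q≥1 {n} {ℓ} {xs} {ys} px py h = *-cancelʳ-≤ _ _ (q ^ n * a ^ ℓ) {{m*n≢0 _ _ {{m^n≢0 q n {{>-nonZero q≥1}}}} {{m^n≢0 a ℓ {{m^n≢0 (suc q) q}}}}}} (begin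
      Π id ys * (q ^ n * a ^ ℓ) ≡⟨ sym (*-assoc (Π id ys) _ _) ⟩
      Π id ys * q ^ n * a ^ ℓ ≡⟨ cong₂ (λ s l → Π id ys * q ^ s * a ^ l) (sym (Parts.tot py)) (sym (Parts.len py)) ⟩
      Π id ys * q ^ Σ ys id * a ^ length ys ≤⟨ list≤ ys ⟩
      b ^ length ys * suc q ^ Σ ys id ≡⟨ cong₂ (λ s l → b ^ l * suc q ^ s) (trans (Parts.tot py) (sym (Parts.tot px))) (trans (Parts.len py) (sym (Parts.len px))) ⟩
      b ^ length xs * suc q ^ Σ xs id ≡⟨ sym (list≡ xs h) ⟩
      Π id xs * q ^ Σ xs id * a ^ length xs ≡⟨ cong₂ (λ s l → Π id xs * q ^ s * a ^ l) (Parts.tot px) (Parts.len px) ⟩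
      Π id xs * q ^ n * a ^ ℓ ≡⟨ *-assoc (Π id xs) _ _ ⟩
      Π id xs * (q ^ n * a ^ ℓ) ∎)
    where open ≤-Reasoning

-- Moving one unit from x to y raises the product x y by x - y - 1, which is positive if x exceeds y
-- + 1.
max-balanced : ∀ {n ℓ xs} → Parts n ℓ xs → (∀ ys → Parts n ℓ ys → Π id ys ≤ Π id xs) → ∀ x y → x ∈ xs → y ∈ xs → x ≤ suc y
max-balanced {n} {ℓ} {xs} p max x y mx my = ≮⇒≥ λ lt → contra lt (pair-or-same {P = x ≡_} {Q = y ≡_} (x , mx , refl) (y , my , refl))
  where
  improve : ∀ u v r → (u , v , r) ∈ pairs xs → ∀ x y → x * y ≡ u * v → x + y ≡ u + v → suc y < x → ⊥
  improve u v r pr zero y _ _ ()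
  improve u v r pr (suc x) y e s (s≤s lt) = <-irrefl refl (<-≤-trans strict (max (x ∷ suc y ∷ r) parts′))
    where
    spec = pairs-spec {xs = xs} {u} {v} {r} pr
    Πr≥1 : 1 ≤ Π id r
    Πr≥1 = Π≥1 id r (λ z mz → Parts.pos p z (proj₁ (proj₂ (proj₂ spec)) z mz))
    parts′ : Parts n ℓ (x ∷ suc y ∷ r)
    parts′ = record
      { len = trans (sym (proj₂ (proj₂ (proj₂ (proj₂ spec))))) (Parts.len p)
      ; pos = λ { z (here refl) → ≤-trans (s≤s z≤n) lt ; z (there (here refl)) → s≤s z≤n ; z (there (there mz)) → Parts.pos p z (proj₁ (proj₂ (proj₂ spec)) z mz) }
      ; tot = trans (lem x y (Σ r id)) (trans (cong (_+ Σ r id) s) (trans (+-assoc u v (Σ r id)) (trans (sym (proj₁ (proj₂ (proj₂ (proj₂ spec))) id)) (Parts.tot p))))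
      }
      where
      lem : ∀ x y s → x + (suc y + s) ≡ suc x + y + s
      lem = solve-∀
    strict : Π id xs < x * (suc y * Π id r)
    strict = begin-strict
      Π id xs ≡⟨ trans (Π-pairs id {xs} {u} {v} {r} pr) (trans (sym (*-assoc u v _)) (cong (_* Π id r) (sym e))) ⟩
      suc x * y * Π id r <⟨ *-monoˡ-< (Π id r) {{>-nonZero Πr≥1}} (≤-trans (≤-reflexive (lem₁ x y)) (≤-trans (+-monoˡ-≤ (x * y) lt) (≤-reflexive (lem₂ x y)))) ⟩
      x * suc y * Π id r ≡⟨ *-assoc x (suc y) _ ⟩
      x * (suc y * Π id r) ∎
      where
      open ≤-Reasoning
      lem₁ : ∀ x y → suc (suc x * y) ≡ suc y + x * y
      lem₁ = solve-∀
      lem₂ : ∀ x y → x + x * y ≡ x * suc y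
      lem₂ = solve-∀
  contra : suc y < x → _ → ⊥
  contra lt (inj₁ (_ , _ , refl , refl)) = <-irrefl refl (≤-trans (n≤1+n _) lt)
  contra lt (inj₂ (_ , _ , r , pr , inj₁ (refl , refl))) = improve x y r pr x y refl refl lt
  contra lt (inj₂ (_ , _ , r , pr , inj₂ (refl , refl))) = improve y x r pr x y (*-comm x y) (+-comm x y) lt

-- Choice of the numerical parameters

record Parameters (C n : ℕ) : Set where
  field
    q y z h zD hD θ : ℕ
    y≥1  : 1 ≤ y
    nbig : Scaled 128 (C * 16 * q) n
    r≤   : Scaled 20 (y ^ 3) n
    zy   : 2 * z ≤ y
    n≤   : 2 * n ≤ z * h
    θq   : θ * 2 ^ h ≤ 2 ^ q
    r≥16 : 16 ≤ y ^ 3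
    qr   : Scaled 32 q (y ^ 3)
    zr   : Scaled 24 zD (y ^ 3)
    n≤D  : n ≤ zD * hD
    hr   : Scaled 384 (hD + 3) (y ^ 3)
    θL   : 2 * n ^ 10 ≤ θ
    θ32  : 32 ≤ θ

least-root : ∀ N k → N ≤ k ^ 4 → ∃[ z ] (N ≤ z ^ 4 × (∀ z′ → suc z′ ≡ z → z′ ^ 4 < N))
least-root N zero h = zero , h , λ _ ()
least-root N (suc k) h with N ≤? k ^ 4
... | yes h′ = least-root N k h′
... | no ¬h = suc k , h , λ { z′ refl → ≰⇒> ¬h }

threshold : ℕ → ℕ
threshold C = (16384 * C) ^ 4

C≤threshold : ∀ C → C ≤ threshold C
C≤threshold zero = z≤n
C≤threshold (suc C) = ≤-trans (m≤m+n (suc C) (16383 * suc C)) (≤-trans (≤-reflexive (sym (*-identityʳ (16384 * suc C)))) (*-monoʳ-≤ (16384 * suc C) (m^n>0 (16384 * suc C) 3)))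

-- Here z is the least number with z^4 ≥ 200 n. The tight conditions are 2n ≤ z h, 384 (h + 3) ≤ y^3
-- and 20 y^3 ≤ n. The 200 keeps h near z^3 / 100 at most, against y^3 = 8 z^3, and `nbig` holds
-- once z ≥ 16384 C; the other terms are of lower order.
parameters : ∀ C n → 32 ≤ C → threshold C ≤ n → Parameters C n
parameters C n C≥32 n≥ = record
    { q = q ; y = y ; z = z ; h = h ; zD = z * z ; hD = h ; θ = θ
    ; y≥1 = *-mono-≤ {1} {2} (s≤s z≤n) z≥1
    ; nbig = scaled (≤-trans (≤-reflexive (sym (*-assoc 128 (C * 16) q))) (*-cancelʳ-≤ (128 * (C * 16) * q) n z {{z≢0}} nbig′))
    ; r≤ = scaled (≤-trans (≤-reflexive (lem-r z)) 160z³)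
    ; zy = ≤-refl
    ; n≤ = n≤′
    ; θq = ≤-reflexive (sym (trans (cong (2 ^_) (+-comm h (40 * z + 5))) (^-distribˡ-+-* 2 (40 * z + 5) h)))
    ; r≥16 = ≤-trans (*-mono-≤ {16} {512} {1} (≤ᵇ⇒≤ 16 512 tt) ≤-refl) (^-monoˡ-≤ 3 {8} {y} (≤-trans (≤ᵇ⇒≤ 8 32 tt) (≤-trans z≥32 (m≤m+n z (z + 0)))))
    ; qr = scaled (*-cancelʳ-≤ _ _ z {{z≢0}} qr′)
    ; zr = scaled (≤-trans (*-monoˡ-≤ (z * z) (≤-trans (≤-trans (≤ᵇ⇒≤ 24 32 tt) z≥32) (m≤m+n z (7 * z)))) (≤-reflexive (lem-zr z)))
    ; n≤D = ≤-trans (≤-trans (m≤m+n n (n + 0)) n≤′) (*-monoˡ-≤ h (≤-trans (≤-reflexive (sym (*-identityˡ z))) (*-monoˡ-≤ z z≥1)))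
    ; hr = scaled (*-cancelʳ-≤ _ _ z {{z≢0}} hr′)
    ; θL = θL′
    ; θ32 = ^-monoʳ-≤ 2 {5} {40 * z + 5} (m≤n+m 5 (40 * z))
    }
  where
  open ≤-Reasoning
  N≥1 : 1 ≤ n
  N≥1 = ≤-trans (m^n>0 (16384 * C) {{>-nonZero (*-mono-≤ {1} {16384} (s≤s z≤n) (≤-trans (s≤s z≤n) C≥32))}} 4) n≥
  root = least-root (200 * n) (200 * n) (≤-trans (≤-reflexive (sym (*-identityʳ (200 * n)))) (≤-trans (≤-reflexive (cong (200 * n *_) refl))
           (*-monoʳ-≤ (200 * n) (m^n>0 (200 * n) {{>-nonZero (*-mono-≤ {1} {200} (s≤s z≤n) N≥1)}} 3))))
  z = proj₁ root
  200n : 200 * n ≤ z ^ 4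
  200n = proj₁ (proj₂ root)
  n≤z⁴ : n ≤ z ^ 4
  n≤z⁴ = ≤-trans (m≤m+n n (199 * n)) 200n
  z≥ : 16384 * C ≤ z
  z≥ = ≮⇒≥ λ lt → <-irrefl refl (<-≤-trans (^-monoˡ-< 4 lt) (≤-trans n≥ n≤z⁴))
  z≥C : ∀ k → k ≤ 16384 * 32 → k ≤ z
  z≥C k le = ≤-trans le (≤-trans (*-monoʳ-≤ 16384 C≥32) z≥)
  z≥1 : 1 ≤ z
  z≥1 = z≥C 1 (≤ᵇ⇒≤ 1 (16384 * 32) tt)
  z≥32 : 32 ≤ z
  z≥32 = z≥C 32 (≤ᵇ⇒≤ 32 (16384 * 32) tt)
  z≢0 : NonZero z
  z≢0 = >-nonZero z≥1
  y = 2 * z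
  h = suc (_/_ (2 * n) z {{z≢0}})
    where open import Data.Nat.DivMod using (_/_)
  q = h + (40 * z + 5)
  θ = 2 ^ (40 * z + 5)
  n≤′ : 2 * n ≤ z * h
  n≤′ = ≤-trans (<⇒≤ (m<n*[m/n]+n (2 * n))) (≤-reflexive (lem z (_/_ (2 * n) z {{z≢0}})))
    where
    open import Data.Nat.DivMod using (_/_; m≡m%n+[m/n]*n; m%n<n)
    m<n*[m/n]+n : ∀ a → a < _/_ a z {{z≢0}} * z + z
    m<n*[m/n]+n a = ≤-trans (s≤s (≤-reflexive (m≡m%n+[m/n]*n a z {{z≢0}}))) (≤-trans (+-monoˡ-≤ (_/_ a z {{z≢0}} * z) (m%n<n a z {{z≢0}})) (≤-reflexive (+-comm z (_/_ a z {{z≢0}} * z))))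
    lem : ∀ z d → d * z + z ≡ z * suc d
    lem = solve-∀
  zh≤ : h * z ≤ 2 * n + z
  zh≤ = ≤-trans (≤-reflexive (+-comm z _)) (+-monoˡ-≤ z (m/n*n≤m (2 * n) z {{z≢0}}))
    where open import Data.Nat.DivMod using (m/n*n≤m)
  zq≤ : q * z ≤ 2 * n + (z + (40 * (z * z) + 5 * z))
  zq≤ = begin
    q * z ≡⟨ lem h z ⟩
    h * z + (40 * (z * z) + 5 * z) ≤⟨ +-monoˡ-≤ _ zh≤ ⟩
    2 * n + z + (40 * (z * z) + 5 * z) ≡⟨ +-assoc (2 * n) z _ ⟩
    2 * n + (z + (40 * (z * z) + 5 * z)) ∎
    where
    lem : ∀ h z → (h + (40 * z + 5)) * z ≡ h * z + (40 * (z * z) + 5 * z)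
    lem = solve-∀
  z≤z² : z ≤ z * z
  z≤z² = ≤-trans (≤-reflexive (sym (*-identityˡ z))) (*-monoˡ-≤ z z≥1)
  zq≤′ : q * z ≤ 2 * n + 46 * (z * z)
  zq≤′ = ≤-trans zq≤ (+-monoʳ-≤ (2 * n) (lin 2 (λ z s → (6 ⋆ z ≼ 6 ⋆ s) ⇒ ⊢ (z ⊹ (40 ⋆ s ⊹ 5 ⋆ z) ≼ 46 ⋆ s)) z (z * z) (*-monoʳ-≤ 6 z≤z²)))
  z⁴-big : 2000 * (z * z) ≤ z ^ 4
  z⁴-big = begin
    2000 * (z * z) ≤⟨ *-monoˡ-≤ (z * z) (≤-trans (z≥C 2000 (≤ᵇ⇒≤ 2000 (16384 * 32) tt)) z≤z²) ⟩
    z * z * (z * z) ≡⟨ lem z ⟩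
    z ^ 4 ∎
    where
    lem : ∀ z → z * z * (z * z) ≡ z * (z * (z * (z * 1)))
    lem = solve-∀
  lem-r : ∀ z → 20 * (2 * z * (2 * z * (2 * z * 1))) ≡ 160 * (z * z * z)
  lem-r = solve-∀
  lem-zr : ∀ z → (z + 7 * z) * (z * z) ≡ 2 * z * (2 * z * (2 * z * 1))
  lem-zr = solve-∀
  lem-y³z : ∀ z → 8 * (z * (z * (z * (z * 1)))) ≡ 2 * z * (2 * z * (2 * z * 1)) * z
  lem-y³z = solve-∀
  160z³ : 160 * (z * z * z) ≤ n
  160z³ = *-cancelˡ-≤ 3200 (begin
      3200 * (160 * (z * z * z)) ≡⟨ sym (*-assoc 3200 160 (z * z * z)) ⟩
      512000 * (z * z * z) ≤⟨ *-monoˡ-≤ (z * z * z) (z≥C 512000 (≤ᵇ⇒≤ 512000 (16384 * 32) tt)) ⟩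
      z * (z * z * z) ≡⟨ lem z ⟩
      z ^ 4 ≤⟨ z⁴≤ z z≥32 (proj₂ (proj₂ root)) ⟩
      3200 * n ∎)
    where
    lem : ∀ z → z * (z * z * z) ≡ z * (z * (z * (z * 1)))
    lem = solve-∀
    z⁴≤ : ∀ z → 32 ≤ z → (∀ z′ → suc z′ ≡ z → z′ ^ 4 < 200 * n) → z ^ 4 ≤ 3200 * n
    z⁴≤ (suc z′) (s≤s le) small = begin
      suc z′ ^ 4 ≤⟨ ^-monoˡ-≤ 4 (≤-trans (+-monoˡ-≤ z′ (≤-trans (s≤s z≤n) le)) (≤-reflexive (cong (z′ +_) (sym (+-identityʳ z′))))) ⟩
      (2 * z′) ^ 4 ≡⟨ lem₂ z′ ⟩
      16 * z′ ^ 4 ≤⟨ *-monoʳ-≤ 16 (<⇒≤ (small z′ refl)) ⟩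
      16 * (200 * n) ≡⟨ sym (*-assoc 16 200 n) ⟩
      3200 * n ∎
      where
      lem₂ : ∀ z → 2 * z * (2 * z * (2 * z * (2 * z * 1))) ≡ 16 * (z * (z * (z * (z * 1))))
      lem₂ = solve-∀
  qr′ : 32 * q * z ≤ y ^ 3 * z
  qr′ = begin
    32 * q * z ≡⟨ *-assoc 32 q z ⟩
    32 * (q * z) ≤⟨ *-monoʳ-≤ 32 zq≤′ ⟩
    32 * (2 * n + 46 * (z * z)) ≤⟨ lin 4 (λ n s f x → (200 ⋆ n ≼ f) ⇒ (2000 ⋆ s ≼ f) ⇒ (# 0 ≼ 6 ⋆ f) ⇒ ⊢ (32 ⋆ (2 ⋆ n ⊹ 46 ⋆ s) ≼ 8 ⋆ f)) n (z * z) (z ^ 4) 0 200n z⁴-big z≤n ⟩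
    8 * z ^ 4 ≡⟨ lem-y³z z ⟩
    y ^ 3 * z ∎
  hr′ : 384 * (h + 3) * z ≤ y ^ 3 * z
  hr′ = begin
    384 * (h + 3) * z ≡⟨ lem h z ⟩
    384 * (h * z + 3 * z) ≤⟨ *-monoʳ-≤ 384 (+-monoˡ-≤ (3 * z) zh≤) ⟩
    384 * (2 * n + z + 3 * z) ≤⟨ lin 4 (λ n s f z → (4 ⋆ (200 ⋆ n) ≼ 4 ⋆ f) ⇒ (2000 ⋆ s ≼ f) ⇒ (2000 ⋆ z ≼ 2000 ⋆ s) ⇒ (# 0 ≼ 3 ⋆ f) ⇒ ⊢ (384 ⋆ (2 ⋆ n ⊹ z ⊹ 3 ⋆ z) ≼ 8 ⋆ f)) n (z * z) (z ^ 4) z (*-monoʳ-≤ 4 200n) z⁴-big (*-monoʳ-≤ 2000 z≤z²) z≤n ⟩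
    8 * z ^ 4 ≡⟨ lem-y³z z ⟩
    y ^ 3 * z ∎
    where
    lem : ∀ h z → 384 * (h + 3) * z ≡ 384 * (h * z + 3 * z)
    lem = solve-∀
  nbig′ : 128 * (C * 16) * q * z ≤ n * z
  nbig′ = begin
    128 * (C * 16) * q * z ≡⟨ lem₁ C q z ⟩
    2048 * C * (q * z) ≤⟨ *-monoʳ-≤ (2048 * C) zq≤′ ⟩
    2048 * C * (2 * n + 46 * (z * z)) ≤⟨ *-monoʳ-≤ (2048 * C) (+-monoʳ-≤ (2 * n) z²≤) ⟩
    2048 * C * (2 * n + 6 * n) ≡⟨ lem₂ C n ⟩
    n * (16384 * C) ≤⟨ *-monoʳ-≤ n z≥ ⟩
    n * z ∎
    where
    lem₁ : ∀ C q z → 128 * (C * 16) * q * z ≡ 2048 * C * (q * z)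
    lem₁ = solve-∀
    lem₂ : ∀ C n → 2048 * C * (2 * n + 6 * n) ≡ n * (16384 * C)
    lem₂ = solve-∀
    z²≤ : 46 * (z * z) ≤ 6 * n
    z²≤ = begin
      46 * (z * z) ≤⟨ *-monoˡ-≤ (z * z) (≤ᵇ⇒≤ 46 960 tt) ⟩
      960 * (z * z) ≤⟨ *-monoʳ-≤ 960 (≤-trans (≤-reflexive (sym (*-identityʳ (z * z)))) (*-monoʳ-≤ (z * z) z≥1)) ⟩
      960 * (z * z * z) ≡⟨ *-assoc 6 160 (z * z * z) ⟩
      6 * (160 * (z * z * z)) ≤⟨ *-monoʳ-≤ 6 160z³ ⟩
      6 * n ∎
  -- The 40 z in θ comes from n^10 ≤ z^40 ≤ 2^(40 z); the 5 leaves room for the factor 2 and for 32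
  -- ≤ θ.
  θL′ : 2 * n ^ 10 ≤ θ
  θL′ = begin
    2 * n ^ 10 ≤⟨ *-mono-≤ {2} {2 ^ 5} (≤ᵇ⇒≤ 2 32 tt) (^-monoˡ-≤ 10 (≤-trans n≤z⁴ (^-monoˡ-≤ 4 (<⇒≤ (n<2^n z))))) ⟩
    2 ^ 5 * ((2 ^ z) ^ 4) ^ 10 ≡⟨ cong (2 ^ 5 *_) (trans (^-*-assoc (2 ^ z) 4 10) (trans (^-*-assoc 2 z 40) (cong (2 ^_) (*-comm z 40)))) ⟩
    2 ^ 5 * 2 ^ (40 * z) ≡⟨ trans (*-comm (2 ^ 5) (2 ^ (40 * z))) (sym (^-distribˡ-+-* 2 (40 * z) 5)) ⟩
    2 ^ (40 * z + 5) ∎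

-- Up to x = a the power is at most a^a; from then on each new factor of x! is larger than a.
pow≤fact : ∀ a x → 1 ≤ a → a ^ x ≤ a ^ a * x !
pow≤fact a zero a≥1 = *-mono-≤ (m^n>0 a {{>-nonZero a≥1}} a) ≤-refl
pow≤fact a (suc x) a≥1 with suc x ≤? a
... | yes le = ≤-trans (^-monoʳ-≤ a {{>-nonZero a≥1}} le) (≤-trans (≤-reflexive (sym (*-identityʳ (a ^ a)))) (*-monoʳ-≤ (a ^ a) (1≤n! (suc x))))
... | no ¬le = ≤-trans (*-mono-≤ (≤-trans (≤-pred (≰⇒> ¬le)) (n≤1+n x)) (pow≤fact a x a≥1)) (≤-reflexive (lem (suc x) (a ^ a) (x !)))
  where
  lem : ∀ b c f → b * (c * f) ≡ c * (b * f)
  lem = solve-∀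

-- The extremal problem for sets of edge codes

-- Adding a missing A to F would give another list without repetitions inside T, but with a larger
-- sum.
Σ-unique-full : ∀ {m} {F T : List (Subset m)} → Unique F → (∀ A → A ∈ F → A ∈ T) → (f : Subset m → ℕ) → Σ T f ≤ Σ F f → ∀ A → A ∈ T → 1 ≤ f A → A ∈ F
Σ-unique-full {F = F} {T} u sub f le A mA fA with dec∃ (A ≟ˢ_) F
... | inj₁ (_ , mem , refl) = mem
... | inj₂ none = ⊥-elim (<-irrefl refl (≤-trans (≤-trans (+-mono-≤ fA ≤-refl) (Σ-unique⊆ u′ sub′ f)) le))
  where
  u′ : Unique (A ∷ F)
  u′ = All.tabulate (λ {B} mB → none B mB) AllPairs.∷ u
  sub′ : ∀ B → B ∈ (A ∷ F) → B ∈ T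
  sub′ B (here refl) = mA
  sub′ B (there mB) = sub B mB

module Extremal (C : ℕ) (C≥1 : 1 ≤ C) (hC : ∀ x → 16 ^ x ≤ C * x !) (n t k₂ c : ℕ) (n≥29 : 29 ≤ n) (params : Parameters C n) (t≥2 : 2 ≤ t)
  (tk : t + suc (suc k₂) ≡ n) (c-max : ∀ ys → Parts n (suc (suc k₂)) ys → Π id ys ≤ c) (c-att : ∃[ zs ] (Parts n (suc (suc k₂)) zs × Π id zs ≡ c)) where

  open Deep n n≥29 t k₂ c tk c-max c-att
  open Graphs n
  open Trees n n≥1
  open Bounds n n≥1 t k₂ c tk c-max

  M≥1 : 1 ≤ M
  M≥1 = *-mono-≤ (subst (1 ≤_) (proj₂ (proj₂ c-att)) (Π≥1 id (proj₁ c-att) (Parts.pos (proj₁ (proj₂ c-att))))) (m^n>0 n {{>-nonZero n≥1}} k₂)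

  module _ (F : List (Subset m)) (uniq : Unique F) (F⊆ : ∀ A → A ∈ F → A ∈ 𝒯) where

    dichotomy : TInt t F → length F < M ⊎ ∃[ T₀ ] (∣ T₀ ∣ ≡ t × (∀ A → A ∈ F → T₀ ⊑ A))
    dichotomy tint = Main.small-or-star n t M C θ L q y z h zD hD 𝒯 F
        (λ A mA → ≤-trans (m≤m+n ∣ A ∣ 1) (≤-reflexive (tree-size (𝒯⇒ mA)))) H₂ H₃
        (λ T₀ B T₀# mB neg → Avoid.H₄ n n≥29 B (𝒯⇒ mB) t t≥2 T₀ T₀# neg) H₅
        uniq F⊆ tint t≥2 M≥1 hC C≥1 nbig y≥1 r≤ zy n≤ θq r≥16 qr zr n≤D hr θL θ32
      where
      open Parameters params

    star-length : ∀ T₀ → (∀ A → A ∈ F → T₀ ⊑ A) → length F ≡ Σ F (λ A → 𝟙 (T₀ ⊑? A))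
    star-length T₀ star = ≤-antisym
      (≤-trans (≤-reflexive (sym (Σ-1 F))) (Σ-mono F (λ A mA → 𝟙-yes (T₀ ⊑? A) (star A mA))))
      (≤-trans (Σ-mono F (λ A _ → 𝟙≤1 (T₀ ⊑? A))) (≤-reflexive (Σ-1 F)))

    star-≤ : ∀ T₀ → (∀ A → A ∈ F → T₀ ⊑ A) → length F ≤ N T₀
    star-≤ T₀ star = ≤-trans (≤-reflexive (star-length T₀ star)) (Σ-unique⊆ uniq F⊆ (λ A → 𝟙 (T₀ ⊑? A)))

    star-full : ∀ T₀ → (∀ A → A ∈ F → T₀ ⊑ A) → N T₀ ≤ length F → ∀ A → A ∈ 𝒯 → T₀ ⊑ A → A ∈ F
    star-full T₀ star le A mA h = Σ-unique-full uniq F⊆ (λ A → 𝟙 (T₀ ⊑? A)) (≤-trans le (≤-reflexive (star-length T₀ star))) A mA (𝟙-yes (T₀ ⊑? A) h)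

    full-star : ∀ T₀ → (∀ A → A ∈ F → T₀ ⊑ A) → (∀ A → A ∈ 𝒯 → T₀ ⊑ A → A ∈ F) → length F ≡ N T₀
    full-star T₀ star full = ≤-antisym (star-≤ T₀ star) (≤-trans (≤-reflexive (trans (sym (length-filter (T₀ ⊑?_) 𝒯)) (sym (Σ-1 (List.filter (T₀ ⊑?_) 𝒯)))))
      (≤-trans (Σ-unique⊆ (Uniqueₚ.filter⁺ (T₀ ⊑?_) 𝒯-unique) (λ A mA → let (mT , h) = ∈-filter⁻ (T₀ ⊑?_) {xs = 𝒯} mA in full A mT h) (λ _ → 1)) (≤-reflexive (Σ-1 F))))

  N≤M : ∀ {T₀} → ∣ T₀ ∣ ≡ t → N T₀ ≤ M
  N≤M {T₀} T₀# = ≤-trans (≤-reflexive (lem (N T₀))) (≤-trans (H₃ T₀ 0 0 (trans T₀# (sym (+-identityʳ t)))) (≤-reflexive (*-identityˡ M)))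
    where
    lem : ∀ a → a ≡ a * 1 * 1
    lem = solve-∀

  forest-blocks : ∀ {T₀ Bs} → Comp T₀ Bs 0 → ∣ T₀ ∣ ≡ t → length Bs ≡ suc (suc k₂)
  forest-blocks {T₀} {Bs} cp T₀# = +-cancelˡ-≡ t _ _ (trans (cong (_+ length Bs) (sym T₀#)) (trans (Comp.size cp) (trans (+-identityʳ n) (sym tk))))

  module _ {T₀ Bs} (cp : Comp T₀ Bs 0) (T₀# : ∣ T₀ ∣ ≡ t) where
    private
      len = forest-blocks cp T₀#

      ps : Parts n (suc (suc k₂)) (sizes Bs)
      ps = subst (λ l → Parts n l (sizes Bs)) len (parts cp)

      count : N T₀ * n ≡ P Bs * n ^ suc k₂
      count = forest-count (suc k₂) cp len

    full⇒balanced : N T₀ ≡ M → ∀ B D → B ∈ Bs → D ∈ Bs → ∣ B ∣ ≤ suc ∣ D ∣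
    full⇒balanced e B D mB mD = max-balanced ps (λ ys py → ≤-trans (c-max ys py) (≤-reflexive (sym (trans (Π-sizes Bs) P≡c)))) ∣ B ∣ ∣ D ∣ (∈-map⁺ ∣_∣ mB) (∈-map⁺ ∣_∣ mD)
      where
      P≡c : P Bs ≡ c
      P≡c = *-cancelʳ-≡ _ _ (n ^ suc k₂) {{m^n≢0 n (suc k₂) {{>-nonZero n≥1}}}} (trans (sym count) (trans (cong (_* n) e) Mn))

    balanced⇒full : ∀ q → 1 ≤ q → (∀ B → B ∈ Bs → ∣ B ∣ ≡ q ⊎ ∣ B ∣ ≡ suc q) → N T₀ ≡ M
    balanced⇒full q q≥1 bal = *-cancelʳ-≡ _ _ n {{>-nonZero n≥1}} (trans count (trans (cong (_* n ^ suc k₂) P≡c) (sym Mn)))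
      where
      P≡c : P Bs ≡ c
      P≡c = trans (sym (Π-sizes Bs)) (≤-antisym (c-max _ ps) (≤-trans (≤-reflexive (sym (proj₂ (proj₂ c-att))))
        (balanced-max q q≥1 ps (proj₁ (proj₂ c-att)) (λ x mx → let (B , mB , e) = ∈-map⁻ ∣_∣ mx in subst (λ s → s ≡ q ⊎ s ≡ suc q) (sym e) (bal B mB)))))

-- Translation between edge lists and sets of edge codes

⊑-points : ∀ {m} {X Y : Subset m} → (∀ e → e ∈ˢ X → e ∈ˢ Y) → X ⊑ Y
⊑-points {X = X} {Y} h = ≮⇒≥ λ lt → let (e , p) = point (X ∩ ∁ Y) lt in
  <-irrefl refl (≤-trans (≤-reflexive (sym (∣⁅⁆∣ e))) (slin 3 0 (λ e x y → (∥ e ∩′ ∁′ (x ∩′ ∁′ y) ∥ ≼ # 0) ⇒ (∥ e ∩′ ∁′ y ∥ ≼ # 0) ⇒ ⊢ (∥ e ∥ ≼ # 0)) ⁅ e ⁆ X Y p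
    (h e (⊑-trans ⁅ e ⁆ (X ∩ ∁ Y) X p (slin 2 0 (λ x y → ⊢ (∥ (x ∩′ ∁′ y) ∩′ ∁′ x ∥ ≼ # 0)) X Y)))))

collect : ∀ {m} → List (Fin m) → Subset m
collect [] = Sub.⊥
collect (x ∷ xs) = collect xs ∪ ⁅ x ⁆

∈⇒collect : ∀ {m} {x : Fin m} {xs} → x ∈ xs → x ∈ˢ collect xs
∈⇒collect {x = x} {_ ∷ xs} (here refl) = ∪-right x (collect xs) ⁅ x ⁆ (⊑-refl ⁅ x ⁆)
∈⇒collect {x = x} {y ∷ xs} (there p) = ∪-left x (collect xs) ⁅ y ⁆ (∈⇒collect p)

collect⇒∈ : ∀ {m} {x : Fin m} {xs} → x ∈ˢ collect xs → x ∈ xs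
collect⇒∈ {m} {x} {[]} h = ⊥-elim (<-irrefl refl (slin 2 0 (λ e o → (# 1 ≼ ∥ e ∥) ⇒ (∥ e ∩′ ∁′ o ∥ ≼ # 0) ⇒ (∥ o ∥ ≼ # 0) ⇒ ⊢ (# 1 ≼ # 0)) ⁅ x ⁆ Sub.⊥ (≤-reflexive (sym (∣⁅⁆∣ x))) h (≤-reflexive (Subₚ.∣⊥∣≡0 m))))
collect⇒∈ {x = x} {y ∷ xs} h with point-∪ x (collect xs) ⁅ y ⁆ h
... | inj₁ p = there (collect⇒∈ p)
... | inj₂ p = here (point-≡ x y p)

collect-size : ∀ {m} {xs : List (Fin m)} → Unique xs → ∣ collect xs ∣ ≡ length xs
collect-size {m} AllPairs.[] = Subₚ.∣⊥∣≡0 m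
collect-size {xs = x ∷ xs} (new AllPairs.∷ u) = trans (≤-antisym
    (slin 2 0 (λ x e → (∥ e ∥ ≼ # 1) ⇒ ⊢ (∥ x ∪′ e ∥ ≼ # 1 ⊹ ∥ x ∥)) (collect xs) ⁅ x ⁆ (≤-reflexive (∣⁅⁆∣ x)))
    (slin 2 0 (λ x e → (# 1 ≼ ∥ e ∥) ⇒ (∥ e ∩′ x ∥ ≼ # 0) ⇒ ⊢ (# 1 ⊹ ∥ x ∥ ≼ ∥ x ∪′ e ∥)) (collect xs) ⁅ x ⁆ (≤-reflexive (sym (∣⁅⁆∣ x))) outside))
  (cong suc (collect-size u))
  where
  outside : ∣ ⁅ x ⁆ ∩ collect xs ∣ ≤ 0
  outside with point-∈ x (collect xs)
  ... | inj₁ h = ⊥-elim (All.lookup new (collect⇒∈ h) refl)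
  ... | inj₂ h = h

unique-middle : ∀ {A : Set} xs {e : A} {ys} → Unique (xs ++ e ∷ ys) → ¬ (e ∈ xs ++ ys)
unique-middle [] (p AllPairs.∷ u) mem = All.lookup p mem refl
unique-middle (x ∷ xs) (p AllPairs.∷ u) (here refl) = All.lookup p (∈-++⁺ʳ xs (here refl)) refl
unique-middle (x ∷ xs) (p AllPairs.∷ u) (there mem) = unique-middle xs u mem

∈-skip : ∀ {A : Set} xs {e f : A} {ys} → f ∈ xs ++ ys → f ∈ xs ++ e ∷ ys
∈-skip xs mem = [ ∈-++⁺ˡ , (λ m → ∈-++⁺ʳ xs (there m)) ]′ (∈-++⁻ xs mem)

reach-mono : ∀ {n} {E E′ : List (Edge n)} → (∀ f → f ∈ E → f ∈ E′) → ∀ {u v} → Reach E u v → Reach E′ u v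
reach-mono h Reach.here = Reach.here
reach-mono h (Reach.step r (inj₁ e)) = Reach.step (reach-mono h r) (inj₁ (h _ e))
reach-mono h (Reach.step r (inj₂ e)) = Reach.step (reach-mono h r) (inj₂ (h _ e))

module EdgeLists (n : ℕ) (n≥1 : 1 ≤ n) where

  open Graphs n
  open Trees n n≥1

  bit : Edge n → Fin m
  bit (i , j) = Fin.combine i j

  bit-inj : ∀ {e f} → bit e ≡ bit f → e ≡ f
  bit-inj eq = let (a , b) = combine-inj eq in cong₂ _,_ a b

  toSet : List (Edge n) → Subset m
  toSet E = collect (List.map bit E)

  ∈⇒toSet : ∀ {e E} → e ∈ E → bit e ∈ˢ toSet E
  ∈⇒toSet p = ∈⇒collect (∈-map⁺ bit p)

  toSet⇒∈ : ∀ {e E} → bit e ∈ˢ toSet E → e ∈ E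
  toSet⇒∈ {e} {E} h with ∈-map⁻ bit (collect⇒∈ {xs = List.map bit E} h)
  ... | f , mf , eq = subst (_∈ E) (sym (bit-inj {e} {f} eq)) mf

  toSet-size : ∀ {E} → Unique E → ∣ toSet E ∣ ≡ length E
  toSet-size {E} u = trans (collect-size (Uniqueₚ.map⁺ (λ {e} {f} → bit-inj {e} {f}) u)) (Listₚ.length-map bit E)

  ⊑-edges : ∀ {X Y} → (∀ e → bit e ∈ˢ X → bit e ∈ˢ Y) → X ⊑ Y
  ⊑-edges {X} {Y} h = ⊑-points (λ f → subst (λ f → f ∈ˢ X → f ∈ˢ Y) (Finₚ.combine-remQuot {n} n f) (h (Fin.remQuot {n} n f)))

  toSet-⊑ : ∀ {E Y} → (∀ e → e ∈ E → bit e ∈ˢ Y) → toSet E ⊑ Y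
  toSet-⊑ h = ⊑-edges (λ e p → h e (toSet⇒∈ p))

  edges : Subset m → List (Edge n)
  edges A = List.filter (λ e → ⁅ bit e ⁆ ⊑? A) (List.cartesianProduct V V)

  ∈⇒edges : ∀ {e A} → bit e ∈ˢ A → e ∈ edges A
  ∈⇒edges {i , j} {A} h = ∈-filter⁺ (λ e → ⁅ bit e ⁆ ⊑? A) (Listₘ.∈-cartesianProduct⁺ (∈elements i) (∈elements j)) h

  edges⇒∈ : ∀ {e A} → e ∈ edges A → bit e ∈ˢ A
  edges⇒∈ {A = A} p = proj₂ (∈-filter⁻ (λ e → ⁅ bit e ⁆ ⊑? A) {xs = List.cartesianProduct V V} p)

  edges-unique : ∀ A → Unique (edges A)
  edges-unique A = Uniqueₚ.filter⁺ (λ e → ⁅ bit e ⁆ ⊑? A) (Uniqueₚ.cartesianProduct⁺ (Uniqueₚ.allFin⁺ n) (Uniqueₚ.allFin⁺ n))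

  toSet-edges : ∀ A → toSet (edges A) ≡ A
  toSet-edges A = ⊑-antisym (toSet-⊑ {edges A} {A} (λ e → edges⇒∈ {e} {A})) (⊑-edges {A} {toSet (edges A)} (λ e h → ∈⇒toSet (∈⇒edges {e} {A} h)))

  edges-graph : ∀ {A} → Valid A → Graph (edges A)
  edges-graph {A} val = All.tabulate (λ {(i , j)} p → val i j (edges⇒∈ {i , j} p)) , edges-unique A

  Ordered : List (Edge n) → Set
  Ordered = All.All (λ e → proj₁ e Fin.< proj₂ e)

  reach⇒path : ∀ {E} → Ordered E → ∀ {u v} → Reach E u v → Path (toSet E) u v
  reach⇒path o Reach.here = nil
  reach⇒path {E} o (Reach.step {v} {w} r (inj₁ p)) = snoc (reach⇒path o r) (subst (_∈ˢ toSet E) (sym (code-< (All.lookup o p))) (∈⇒toSet p))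
  reach⇒path {E} o (Reach.step {v} {w} r (inj₂ p)) = snoc (reach⇒path o r) (subst (_∈ˢ toSet E) (trans (sym (code-< (All.lookup o p))) (code-sym w v)) (∈⇒toSet p))

  path⇒reach : ∀ {E u v} → Path (toSet E) u v → Reach E u v
  path⇒reach nil = Reach.here
  path⇒reach {E} (snoc {v} {w} p a) = Reach.step (path⇒reach p) (joined (v Fin.<? w))
    where
    joined : Dec (v Fin.< w) → (v , w) ∈ E ⊎ (w , v) ∈ E
    joined (yes lt) = inj₁ (toSet⇒∈ {v , w} (subst (_∈ˢ toSet E) (code-< lt) a))
    joined (no ¬lt) = inj₂ (toSet⇒∈ {w , v} (subst (_∈ˢ toSet E) (code-≮ ¬lt) a))

  -- If the ends of a deleted edge were still connected, they would share a block of the remaining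
  -- edges, and `no-inner` would put the edge among them.
  acyclic-sub : ∀ {E A} → IsTree A → Graph E → toSet E ⊑ A → Acyclic E
  acyclic-sub {E} {A} tr (o , uq) le xs ys (u , v) refl r =
    unique-middle xs uq (toSet⇒∈ {u , v} (subst (_∈ˢ toSet (xs ++ ys)) (code-< u<v) inner))
    where
    u<v : u Fin.< v
    u<v = All.lookup o (∈-++⁺ʳ xs (here refl))
    o′ : Ordered (xs ++ ys)
    o′ = All.tabulate (λ p → All.lookup o (∈-skip xs p))
    le′ : toSet (xs ++ ys) ⊑ A
    le′ = toSet-⊑ (λ e p → ∈ˢ-⊑ (bit e) le (∈⇒toSet (∈-skip xs p)))
    sf = subforest tr le′
    bl = block (proj₂ sf) u
    inner : Adj (toSet (xs ++ ys)) u v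
    inner = no-inner {toSet (xs ++ ys)} {A} {proj₁ sf} tr le′ (proj₂ sf) {proj₁ bl} {u} {v} (proj₁ (proj₂ bl)) (proj₂ (proj₂ bl)) (closed-path {toSet (xs ++ ys)} {proj₁ sf} (proj₂ sf) {proj₁ bl} (proj₁ (proj₂ bl)) (proj₂ (proj₂ bl)) (reach⇒path o′ r))
      (subst (_∈ˢ A) (sym (code-< u<v)) (∈ˢ-⊑ (bit (u , v)) {toSet (xs ++ (u , v) ∷ ys)} {A} le (∈⇒toSet (∈-++⁺ʳ xs (here refl)))))

  -- The edges are added one by one; an edge with both ends in one block would contradict
  -- acyclicity, so δ stays 0.
  forest-comp : ∀ {E} → Forest E → ∃[ Bs ] Comp (toSet E) Bs 0
  forest-comp {[]} _ = singletons , empty-comp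
  forest-comp {(u , v) ∷ E} ((u<v All.∷ o , _ AllPairs.∷ uq) , ac) = join (pair-or-same (block cp u) (block cp v))
    where
    ac′ : Acyclic E
    ac′ xs ys f eq r = ac ((u , v) ∷ xs) ys f (cong ((u , v) ∷_) eq) (reach-mono (λ _ → there) r)
    rest = forest-comp ((o , uq) , ac′)
    cp : Comp (toSet E) (proj₁ rest) 0
    cp = proj₂ rest
    add : ∀ {x y Bs} → code x y ≡ code u v → Comp (toSet E ∪ ⁅ code x y ⁆) Bs 0 → Comp (toSet ((u , v) ∷ E)) Bs 0
    add {Bs = Bs} eq = subst (λ e → Comp (toSet E ∪ ⁅ e ⁆) Bs 0) (trans eq (code-< u<v))
    join : _ → ∃[ Bs ] Comp (toSet ((u , v) ∷ E)) Bs 0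
    join (inj₁ (B , mB , hu , hv)) = ⊥-elim (ac [] E (u , v) refl (path⇒reach (Comp.conn cp B mB u v hu hv)))
    join (inj₂ (B , D , r , pr , inj₁ (hu , hv))) = (B ∪ D) ∷ r , add {u} {v} refl (proj₁ (merge cp {u} {v} pr hu hv))
    join (inj₂ (B , D , r , pr , inj₂ (hv , hu))) = (B ∪ D) ∷ r , add {v} {u} (code-sym v u) (proj₁ (merge cp {v} {u} pr hv hu))

  spanning⇒tree : ∀ {T} → SpanningTree T → IsTree (toSet T)
  spanning⇒tree {T} (f , con) = single (proj₁ fc) (proj₂ fc) (one-block n≥1 (λ u v → reach⇒path (proj₁ (proj₁ f)) (con u v)) (proj₂ fc))
    where
    fc = forest-comp f
    single : ∀ Bs → Comp (toSet T) Bs 0 → length Bs ≡ 1 → IsTree (toSet T)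
    single (B ∷ []) cp _ = B , cp

  tree⇒spanning : ∀ {A} → IsTree A → SpanningTree (edges A)
  tree⇒spanning {A} tr = (gr , acyclic-sub tr gr (≤-trans (≤-reflexive (cong (λ X → ∣ X ∩ ∁ A ∣) (toSet-edges A))) (⊑-refl A))) ,
      λ u v → path⇒reach (subst (λ X → Path X u v) (sym (toSet-edges A)) (tree-spanning tr u v))
    where
    gr : Graph (edges A)
    gr = edges-graph (Comp.valid (proj₂ tr))

  common-≤ : ∀ A B → Unique A → common A B ≤ ∣ toSet A ∩ toSet B ∣
  common-≤ A B u = ≤-trans (≤-reflexive (sym (toSet-size (Uniqueₚ.filter⁺ (λ e → Defs._∈?_ e B) u))))
      (slin 3 0 (λ d a b → (∥ d ∩′ ∁′ a ∥ ≼ # 0) ⇒ (∥ d ∩′ ∁′ b ∥ ≼ # 0) ⇒ ⊢ (∥ d ∥ ≼ ∥ a ∩′ b ∥)) (toSet D) (toSet A) (toSet B)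
        (toSet-⊑ (λ e p → ∈⇒toSet (proj₁ (∈-filter⁻ (λ e → Defs._∈?_ e B) {xs = A} p)))) (toSet-⊑ (λ e p → ∈⇒toSet (proj₂ (∈-filter⁻ (λ e → Defs._∈?_ e B) {xs = A} p)))))
    where
    D = List.filter (λ e → Defs._∈?_ e B) A

  ⊆E⇒⊑ : ∀ {E T} → E ⊆E T → toSet E ⊑ toSet T
  ⊆E⇒⊑ h = toSet-⊑ (λ e p → ∈⇒toSet (All.lookup h p))

  ⊑⇒⊆E : ∀ {E T} → toSet E ⊑ toSet T → E ⊆E T
  ⊑⇒⊆E le = All.tabulate (λ {e} p → toSet⇒∈ {e} (∈ˢ-⊑ (bit e) le (∈⇒toSet p)))

  same⇒≡ : ∀ {A B} → SameEdges A B → toSet A ≡ toSet B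
  same⇒≡ h = ⊑-antisym (toSet-⊑ (λ e p → ∈⇒toSet (Equivalence.to (h e) p))) (toSet-⊑ (λ e p → ∈⇒toSet (Equivalence.from (h e) p)))

  ≡⇒same : ∀ {A B} → toSet A ≡ toSet B → SameEdges A B
  ≡⇒same eq e = mk⇔ (λ p → toSet⇒∈ {e} (subst (bit e ∈ˢ_) eq (∈⇒toSet p))) (λ p → toSet⇒∈ {e} (subst (bit e ∈ˢ_) (sym eq) (∈⇒toSet p)))

  module _ {E Bs δ} (o : Ordered E) (cp : Comp (toSet E) Bs δ) {B} (mB : B ∈ Bs) {v} (hv : v ∈ˢ B) where
    private
      in-block : ∀ w → w ∈ˢ B ⇔ Reach E v w
      in-block w = mk⇔ (λ h → path⇒reach (Comp.conn cp B mB v w hv h)) (λ r → closed-path cp mB hv (reach⇒path o r))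

    block-compSize : CompSize E v ∣ B ∣
    block-compSize = List.filter (λ w → ⁅ w ⁆ ⊑? B) V , Uniqueₚ.filter⁺ (λ w → ⁅ w ⁆ ⊑? B) (Uniqueₚ.allFin⁺ n) ,
      trans (length-filter (λ w → ⁅ w ⁆ ⊑? B) V) (Σ-elements B) ,
      λ w → mk⇔ (λ p → Equivalence.to (in-block w) (proj₂ (∈-filter⁻ (λ w → ⁅ w ⁆ ⊑? B) {xs = V} p)))
                (λ r → ∈-filter⁺ (λ w → ⁅ w ⁆ ⊑? B) (∈elements w) (Equivalence.from (in-block w) r))

    compSize⇒ : ∀ {s} → CompSize E v s → s ≡ ∣ B ∣
    compSize⇒ (ws , uq , refl , h) = trans (sym (collect-size uq)) (cong ∣_∣ (⊑-antisym {p = collect ws} {B}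
      (⊑-points {X = collect ws} {B} (λ w p → Equivalence.from (in-block w) (Equivalence.to (h w) (collect⇒∈ p))))
      (⊑-points {X = B} {collect ws} (λ w p → ∈⇒collect (Equivalence.from (h w) (Equivalence.to (in-block w) p))))))

-- The theorem for families of edge lists

product≡Π : ∀ xs → product xs ≡ Π id xs
product≡Π [] = refl
product≡Π (x ∷ xs) = cong (x *_) (product≡Π xs)

sum≡Σ : ∀ xs → sum xs ≡ Σ xs id
sum≡Σ [] = refl
sum≡Σ (x ∷ xs) = cong (x +_) (sum≡Σ xs)

module Families (C : ℕ) (C≥1 : 1 ≤ C) (hC : ∀ x → 16 ^ x ≤ C * x !) (n t : ℕ) (n≥29 : 29 ≤ n) (params : Parameters C n) (t≥2 : 2 ≤ t) (t≤ : t ≤ n ∸ 2)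
  (c : ℕ) (mx : IsMaxProduct n (n ∸ t) c) (𝓕 : List (List (Edge n))) (fam : TreeFamily 𝓕) (tint : TIntersecting t 𝓕) where

  private
    k₂ : ℕ
    k₂ = n ∸ 2 ∸ t

    n≥2 : 2 ≤ n
    n≥2 = ≤-trans t≥2 (≤-trans t≤ (m∸n≤m n 2))

    tk : t + suc (suc k₂) ≡ n
    tk = trans (trans (+-suc t (suc k₂)) (cong suc (+-suc t k₂))) (trans (cong (λ e → suc (suc e)) (m+[n∸m]≡n t≤)) (m+[n∸m]≡n n≥2))

    n∸t : n ∸ t ≡ suc (suc k₂)
    n∸t = trans (cong (_∸ t) (sym tk)) (m+n∸m≡n t (suc (suc k₂)))

    c-max : ∀ ys → Parts n (suc (suc k₂)) ys → Π id ys ≤ c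
    c-max ys p = subst (_≤ c) (product≡Π ys) (proj₂ mx ys (trans (Parts.len p) (sym n∸t)) (All.tabulate (λ {y} my → Parts.pos p y my)) (trans (sum≡Σ ys) (Parts.tot p)))

    c-att : ∃[ zs ] (Parts n (suc (suc k₂)) zs × Π id zs ≡ c)
    c-att = let (zs , len , pos , tot , eq) = proj₁ mx in
      zs , record { len = trans len n∸t ; pos = λ z mz → All.lookup pos mz ; tot = trans (sym (sum≡Σ zs)) tot } , trans (sym (product≡Π zs)) eq

  open Extremal C C≥1 hC n t k₂ c n≥29 params t≥2 tk c-max c-att
  open Deep n n≥29 t k₂ c tk c-max c-att using (n≥1)
  open Graphs n
  open Trees n n≥1
  open Bounds n n≥1 t k₂ c tk c-max using (M; blocks≥1)
  open EdgeLists n n≥1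

  private
    F : List (Subset m)
    F = List.map toSet 𝓕

    F# : length F ≡ length 𝓕
    F# = Listₚ.length-map toSet 𝓕

    spanning : ∀ {T} → T ∈ 𝓕 → SpanningTree T
    spanning mT = All.lookup (proj₁ fam) mT

    F! : Unique F
    F! = AllPairsₚ.map⁺ (AllPairs.map (λ {A} {B} differ eq → differ (≡⇒same {A} {B} eq)) (proj₂ fam))

    F⊆ : ∀ A → A ∈ F → A ∈ 𝒯
    F⊆ A mA = let (T , mT , eq) = ∈-map⁻ toSet mA in subst (_∈ 𝒯) (sym eq) (⇒𝒯 (spanning⇒tree (spanning mT)))

    F-tint : TInt t F
    F-tint A B mA mB =
      let (T , mT , eqA) = ∈-map⁻ toSet mA ; (U , mU , eqB) = ∈-map⁻ toSet mB in
      ≤-trans (tint T U mT mU) (≤-trans (common-≤ T U (proj₂ (proj₁ (proj₁ (spanning mT))))) (≤-reflexive (cong₂ (λ X Y → ∣ X ∩ Y ∣) (sym eqA) (sym eqB))))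

  bound : length 𝓕 ≤ M
  bound = ≤-trans (≤-reflexive (sym F#)) ([ <⇒≤ , (λ (T₀ , T₀# , star) → ≤-trans (star-≤ F F! F⊆ T₀ star) (N≤M {T₀} T₀#)) ]′ (dichotomy F F! F⊆ F-tint))

  Star : List (Edge n) → Set
  Star Fo = Forest Fo × length Fo ≡ t × AlmostEqualComponents Fo × ((T : List (Edge n)) → SpanningTree T → (Fo ⊆E T) ⇔ Any (SameEdges T) 𝓕)

  private
   module FullStar (e : length 𝓕 ≡ M) (T₀ : Subset m) (T₀# : ∣ T₀ ∣ ≡ t) (star : ∀ A → A ∈ F → T₀ ⊑ A) where
    NT₀ : N T₀ ≡ M
    NT₀ = ≤-antisym (N≤M {T₀} T₀#) (≤-trans (≤-reflexive (sym (trans F# e))) (star-≤ F F! F⊆ T₀ star))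
    tree = N≥1⇒ T₀ (≤-trans M≥1 (≤-reflexive (sym NT₀)))
    A₀ = proj₁ tree
    le : T₀ ⊑ A₀
    le = proj₂ (proj₂ tree)
    tr : IsTree A₀
    tr = 𝒯⇒ (proj₁ (proj₂ tree))
    Fo = edges T₀
    gr : Graph Fo
    gr = edges-graph {T₀} (valid-sub {T₀} {A₀} le (Comp.valid (proj₂ tr)))
    sf = subforest {T₀} {A₀} tr le
    Bs = proj₁ sf
    cp : Comp T₀ Bs 0
    cp = proj₂ sf
    cp′ : Comp (toSet Fo) Bs 0
    cp′ = subst (λ X → Comp X Bs 0) (sym (toSet-edges T₀)) cp
    least : ∃[ D ] (D ∈ Bs × (∀ B → B ∈ Bs → ∣ D ∣ ≤ ∣ B ∣))
    least = smallest Bs (blocks≥1 cp)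
      where
      smallest : ∀ Ds → ∃[ ℓ ] (length Ds ≡ suc ℓ) → ∃[ D ] (D ∈ Ds × (∀ B → B ∈ Ds → ∣ D ∣ ≤ ∣ B ∣))
      smallest (D ∷ Ds) _ = argmin ∣_∣ D Ds
    balanced : AlmostEqualComponents Fo
    -- The witness is the size of a smallest block.
    balanced = ∣ D ∣ , λ v s cs → let (B , mB , hv) = block cp v in size v s cs B mB hv
      where
      D = proj₁ least
      mD : D ∈ Bs
      mD = proj₁ (proj₂ least)
      low : ∀ B → B ∈ Bs → ∣ D ∣ ≤ ∣ B ∣
      low = proj₂ (proj₂ least)
      between? : ∀ {k b s} → k ≤ b → s ≤ suc k → s ≡ b → s ≡ k ⊎ s ≡ suc k
      between? {k} k≤ ≤k refl with m≤n⇒m<n∨m≡n k≤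
      ... | inj₁ lt = inj₂ (≤-antisym ≤k lt)
      ... | inj₂ eq = inj₁ (sym eq)
      size : ∀ v s → CompSize Fo v s → ∀ B → B ∈ Bs → v ∈ˢ B → s ≡ ∣ D ∣ ⊎ s ≡ suc ∣ D ∣
      size v s cs B mB hv = between? (low B mB) (subst (_≤ suc ∣ D ∣) (sym s≡) (full⇒balanced cp T₀# NT₀ B D mB mD)) s≡
        where
        s≡ : s ≡ ∣ B ∣
        s≡ = compSize⇒ {Fo} {Bs} {0} (proj₁ gr) cp′ {B} mB {v} hv cs
    char : ∀ T → SpanningTree T → (Fo ⊆E T) ⇔ Any (SameEdges T) 𝓕
    char T sp = mk⇔
      (λ sub → let (U , mU , eq) = ∈-map⁻ toSet (star-full F F! F⊆ T₀ star (≤-reflexive (trans NT₀ (sym (trans F# e)))) (toSet T) (⇒𝒯 (spanning⇒tree sp))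
                                     (subst (_⊑ toSet T) (toSet-edges T₀) (⊆E⇒⊑ {Fo} {T} sub)))
               in lose mU (≡⇒same {T} {U} eq))
      (λ any → let (U , mU , same) = find any in
        ⊑⇒⊆E {Fo} {T} (subst₂ _⊑_ (sym (toSet-edges T₀)) (sym (same⇒≡ {T} {U} same)) (star (toSet U) (∈-map⁺ toSet mU))))

    found : ∃[ Fo ] Star Fo
    found = Fo , (gr , acyclic-sub {Fo} {A₀} tr gr (subst (_⊑ A₀) (sym (toSet-edges T₀)) le)) , trans (sym (toSet-size (edges-unique T₀))) (trans (cong ∣_∣ (toSet-edges T₀)) T₀#) , balanced , char

  extremal⇒star : length 𝓕 ≡ M → ∃[ Fo ] Star Fo
  extremal⇒star e = [ (λ lt → ⊥-elim (<-irrefl (trans F# e) lt)) , (λ (T₀ , T₀# , star) → FullStar.found e T₀ T₀# star) ]′ (dichotomy F F! F⊆ F-tint)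

  star⇒extremal : ∃[ Fo ] Star Fo → length 𝓕 ≡ M
  star⇒extremal (Fo , forest , len , (k , almost) , char) = trans (sym F#) (trans (full-star F F! F⊆ X star full) NX)
    where
    X = toSet Fo
    fc = forest-comp forest
    Bs = proj₁ fc
    cp : Comp X Bs 0
    cp = proj₂ fc
    star : ∀ A → A ∈ F → X ⊑ A
    star A mA = let (T , mT , eq) = ∈-map⁻ toSet mA in
      subst (X ⊑_) (sym eq) (⊆E⇒⊑ {Fo} {T} (Equivalence.from (char T (spanning mT)) (lose mT (≡⇒same {T} {T} refl))))
    full : ∀ A → A ∈ 𝒯 → X ⊑ A → A ∈ F
    full A mA le =
      let (U , mU , same) = find (Equivalence.to (char (edges A) (tree⇒spanning (𝒯⇒ mA))) (⊑⇒⊆E {Fo} {edges A} (subst (X ⊑_) (sym (toSet-edges A)) le))) in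
      subst (_∈ F) (trans (sym (same⇒≡ {edges A} {U} same)) (toSet-edges A)) (∈-map⁺ toSet mU)
    each : ∀ B → B ∈ Bs → ∣ B ∣ ≡ k ⊎ ∣ B ∣ ≡ suc k
    each B mB = let (v , hv) = point B (Comp.ne cp B mB) in almost v ∣ B ∣ (block-compSize (proj₁ (proj₁ forest)) cp mB hv)
    X# : ∣ X ∣ ≡ t
    X# = trans (toSet-size (proj₂ (proj₁ forest))) len
    NX : N X ≡ M
    NX = go k each
      where
      go : ∀ k → (∀ B → B ∈ Bs → ∣ B ∣ ≡ k ⊎ ∣ B ∣ ≡ suc k) → N X ≡ M
      go (suc k) h = balanced⇒full cp X# (suc k) (s≤s z≤n) h
      -- The given k may be 0. Blocks are nonempty, so all of them then have size 1.
      go zero h = balanced⇒full cp X# 1 (s≤s z≤n) (λ B mB → [ (λ z → ⊥-elim (<-irrefl (sym z) (Comp.ne cp B mB))) , inj₁ ]′ (h B mB))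

abstract
  -- The constant 16^16 is sealed so that type checking does not compute with it.
  factorial-growth : ∃[ C ] (32 ≤ C × (∀ x → 16 ^ x ≤ C * x !))
  factorial-growth = 16 ^ 16 , ≤ᵇ⇒≤ 32 (16 ^ 16) tt , λ x → pow≤fact 16 x (s≤s z≤n)

theorem1 : ∃[ n₀ ] ((n t : ℕ) → n₀ ≤ n → 2 ≤ t → t ≤ n ∸ 2 →
    (c : ℕ) → IsMaxProduct n (n ∸ t) c →
    (F : List (List (Edge n))) → TreeFamily F → TIntersecting t F →
    (length F ≤ c * n ^ (n ∸ 2 ∸ t))
    × ((length F ≡ c * n ^ (n ∸ 2 ∸ t)) ⇔
    (∃[ Fo ] (Forest Fo × length Fo ≡ t × AlmostEqualComponents Fo
    × ((T : List (Edge n)) → SpanningTree T → (Fo ⊆E T) ⇔ Any (SameEdges T) F)))))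
theorem1 = threshold C , λ n t n≥ t≥2 t≤ c mx 𝓕 fam tint →
    let open Families C (≤-trans (s≤s z≤n) C≥32) hC n t (≤-trans (≤ᵇ⇒≤ 29 32 tt) (≤-trans C≥32 (≤-trans (C≤threshold C) n≥))) (parameters C n C≥32 n≥) t≥2 t≤ c mx 𝓕 fam tint
    in bound , mk⇔ extremal⇒star star⇒extremal
  where
  C = proj₁ factorial-growth
  C≥32 = proj₁ (proj₂ factorial-growth)
  hC = proj₂ (proj₂ factorial-growth)
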